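{- Let $n\ge2$. Then: (i) A basis of orthogonal idempotents of $\mathcal{W}_n$ is given by $\frac12(I^+_{k,n}+I^-_{k,n})$ for $1\le k\le n$, $k\equiv n\pmod 2$, and $\frac12(J^+_{l,n}+J^-_{l,n}-I^+_{l,n}-I^-_{l,n})$ for $0\le l\le n-4$, $l\equiv n\pmod2$. Their images under $\Gamma$ are respectively $\sum_{\lambda\vdash n,\ \ell_o(\lambda)=k,\ \ell_e(\lambda)=0}\frac{1}{z_\lambda}p_\lambda$ and $\sum_{\lambda\vdash n,\ \ell_o(\lambda)=l,\ \ell_e(\lambda)>0\text{ even}}\frac1{z_\lambda}p_\lambda$. (ii) A basis of orthogonal idempotents of $\mathcal{W}^\circ_n$ is given by $I^+_{k,n}$ for $1\le k\le n$, $k\equiv n\pmod2$, and $\frac12(J^+_{l,n}-I^+_{l,n})$ for $0\le l\le n-2$, $l\equiv n\pmod 2$. Their images under $\Gamma$ are respectively $\sum_{\lambda\vdash n,\ \ell_o(\lambda)=k,\ \ell_e(\lambda)=0}\frac1{z_\lambda}p_\lambda$ and $\sum_{\lambda\vdash n,\ \ell_o(\lambda)=l,\ \ell_e(\lambda)>0}\frac1{z_\lambda}p_\lambda$. (iii) A basis of orthogonal idempotents of $\mathcal{C}_n$ is given by $\frac12(I^+_{k,n}+I^-_{k,n})$ for $1\le k\le n$, $k\equiv n\pmod2$; $\frac12(J^+_{l,n}+J^-_{l,n}-I^+_{l,n}-I^-_{l,n})$ for $0\le l\le n-4$, $l\equiv n\pmod2$; and $\frac12(J^+_{m,n}-J^-_{m,n})$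 for $0\le m\le n-2$, $m\equiv n\pmod2$. Their images under $\Gamma$ are respectively $\sum_{\lambda\vdash n,\ \ell_o(\lambda)=k,\ \ell_e(\lambda)=0}\frac1{z_\lambda}p_\lambda$, $\sum_{\lambda\vdash n,\ \ell_o(\lambda)=l,\ \ell_e(\lambda)\text{ even}}\frac1{z_\lambda}p_\lambda$, and $\sum_{\lambda\vdash n,\ \ell_o(\lambda)=m,\ \ell_e(\lambda)>0\text{ odd}}\frac1{z_\lambda}p_\lambda$. (iv) A basis of orthogonal idempotents of $\mathcal{P}_n$ is given by $I^-_{k,n}$ for $1\le k\le n$, $k\equiv n\pmod2$, with images $\sum_{\lambda\vdash n,\ \ell_o(\lambda)=k,\ \ell_e(\lambda)=0}\frac1{z_\lambda}p_\lambda$ under $\Gamma$. (v) A basis of orthogonal idempotents of $\mathcal{P}^\circ_n$ is given by $J^+_{k,n}$ for $0\le k\le n$, $k\equiv n\pmod 2$, with images $\sum_{\lambda\vdash n,\ \ell_o(\lambda)=k}\frac1{z_\lambda}p_\lambda$ under $\Gamma$.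
   Context: Noncommutative symmetric functions: $\mathbf{Sym}=\bigoplus_n\mathbf{Sym}_n$ over $\mathbb{Q}$ with ribbon basis $R_I$ ($I$ compositions of $n$; a composition $(i_1,\dots,i_r)$ has descent set $\{i_1,\dots,i_1+\dots+i_{r-1}\}$), $R_\emptyset=1$. $\mathbf{Sym}_n$ is identified with the descent algebra $\mathcal{D}_n\subseteq\mathbb{Q}[\mathfrak{S}_n]$ via $R_I\mapsto\sum\{\sigma:\mathrm{Des}(\sigma)=\text{descent set of }I\}$; the internal product is that of $\mathbb{Q}[\mathfrak{S}_n]$ (with $(\alpha\beta)(i)=\alpha(\beta(i))$) in each degree and zero across degrees. External product: $R_{(i_1,\dots,i_r)}\star R_{(j_1,\dots,j_s)}=R_{(i_1,\dots,i_r,j_1,\dots,j_s)}+R_{(i_1,\dots,i_{r-1},i_r+j_1,j_2,\dots,j_s)}$; both products extend to the completion $\widehat{\mathbf{Sym}}$ of formal sums of homogeneous elements. For $F$ with zero degree-$0$ part, $\log_\star(1+F)=\sum_{m\ge1}\frac{(-1)^{m-1}}{m}F^{\star m}$, $\exp_\star F=\sum_{m\ge0}\frac1{m!}F^{\star m}$, and $(1+F)^{\star c}=\exp_\star(c\log_\star(1+F))$ for $c\in\mathbb{Q}$. Let $V_1^+=\sum_{i\ge0}R_{(i)}$, $V_1^-=\sum_{i\ge0}R_{(1^i)}$, $V_2^+=V_1^+\star V_1^-$, $V_2^-=V_1^-\star V_1^+$. Define $I_1^-=\frac12\log_\star V_2^-$, $I_1^+=\frac12\log_\star V_2^+$, $I_k^\pm=\frac1{k!}(I_1^\pm)^{\star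 k}$ (with $I_0^\pm=1$), $J_0^+=V_1^+\star(V_2^-)^{\star(-1/2)}$, $J_0^-=V_1^-\star(V_2^+)^{\star(-1/2)}$, $J_k^+=J_0^+\star I_k^-$, $J_k^-=J_0^-\star I_k^+$; subscripts $k,n$ denote degree-$n$ components. Run algebras: for $\sigma\in\mathfrak{S}_n$, an alternating run is a maximal monotone sequence of consecutive entries of $\sigma(1),\dots,\sigma(n)$, a left run the same for $\sigma(0)=0,\sigma(1),\dots,\sigma(n)$; $W_k^+$ (resp. $W_k^-$) is the sum of $\sigma$ with $k$ runs and first run ascending (resp. descending), $W_k=W_k^++W_k^-$, $W_k^\circ$ is the sum of $\sigma$ with $k$ left runs. $\mathcal{W}_n=\mathrm{span}\{W_k\}$, $\mathcal{W}_n^\circ=\mathrm{span}\{W^\circ_k\}$, $\mathcal{C}_n=\mathrm{span}\{W_{2k},W^+_{2k-1},W^-_{2k-1}\}$, $\mathcal{P}_n$ (resp. $\mathcal{P}_n^\circ$) is spanned by the sums of permutations in $\mathfrak{S}_n$ with a fixed number of peaks (resp. left peaks), where a peak is $i\in[2,n-1]$ with $\sigma(i-1)<\sigma(i)>\sigma(i+1)$ and a left peak is $i\in[1,n-1]$ with the same condition, $\sigma(0)=0$. Symmetric functions: $p_\lambda$ power sums, $h_J$ complete homogeneous, $z_\lambda=\prod_r r^{m_r}m_r!$ with $m_r$ the multiplicity of $r$ in $\lambda$; $\ell_o(\lambda)$ and $\ell_e(\lambda)$ are the numbers of odd and even parts of $\lambda$. $\Gamma:\mathbf{Sym}\to Sym$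 is the linear map $R_I\mapsto r_I=\sum_{J\preccurlyeq I}(-1)^{\ell(I)-\ell(J)}h_J$ (the ribbon skew Schur function), where $J\preccurlyeq I$ means the descent set of $J$ is contained in that of $I$; it is a homomorphism for the internal product (Kronecker product on $Sym_n$) and the external product (ordinary product).
   Formalization: In (ii) the second family is taken as J⁺_{l,n} − I⁺_{l,n} without the factor ½ (with ½ it is not idempotent, e.g. n=2, l=0); in (iii) the second image is summed over ℓ_e(λ)>0 even, as in (i), since "ℓ_e(λ) even" would wrongly include ℓ_e(λ)=0. -}

module Defs where

-- Concrete, computable model of everything in Theorem 5.3.
--  * Elements of Sym_d (ribbon basis) are formal sums  List (ℚ × composition);
--    compositions are lists of positive naturals.
--  * Elements of the completion are "series": degree d ↦ formal sum in Sym_d.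
--  * Q[S_n]: formal sums List (ℚ × permutation), a permutation of [n] being its
--    one-line notation [σ(1),…,σ(n)] (values 1..n).  Equality ≈ compares the
--    coefficient of every word.
--  * Sym_n (commutative) is modelled inside the formal power series ring
--    ℚ[[x_1,…,x_n]] (coefficient functions on exponent vectors), which is
--    faithful in degree n.

open import Data.Nat as ℕ using (ℕ; zero; suc; _∸_; _≡ᵇ_; _<ᵇ_; _≤ᵇ_; _!; _%_)
open import Data.Nat.Properties using (_≟_)
open import Data.Bool using (Bool; true; false; if_then_else_; _∧_; _∨_; not)
open import Data.List using (List; []; _∷_; _++_; map; concatMap; concat; length;
  replicate; upTo; filterᵇ; foldr; zipWith; lookup; drop)
open import Data.List.Properties using (≡-dec)
open import Data.List.Relation.Unary.All using (All)
open import Data.Product using (_×_; _,_; ∃)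
open import Data.Fin using (Fin)
open import Data.Vec as V using (Vec)
open import Data.Integer using (+_)
open import Data.Rational as Q using (ℚ; 0ℚ; 1ℚ; ½)
open import Relation.Binary.PropositionalEquality using (_≡_; _≢_)
open import Relation.Nullary.Decidable using (⌊_⌋)

-- 1/m (only ever used for m ≥ 1)
recip : ℕ → ℚ
recip zero    = 0ℚ
recip (suc k) = (+ 1) Q./ suc k

negOnePow : ℕ → ℚ
negOnePow zero    = 1ℚ
negOnePow (suc m) = Q.- negOnePow m

sumℚ : List ℚ → ℚ
sumℚ = foldr Q._+_ 0ℚ

from1 : ℕ → List ℕ
from1 m = map suc (upTo m)

Comp : Set
Comp = List ℕ

FSum : Set
FSum = List (ℚ × Comp)

scaleF : ℚ → FSum → FSum
scaleF c = map (λ { (a , I) → (c Q.* a , I) })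

negF : FSum → FSum
negF = scaleF (Q.- 1ℚ)

mergeLast : Comp → ℕ → Comp → Comp
mergeLast []            j js = j ∷ js
mergeLast (i ∷ [])      j js = (i ℕ.+ j) ∷ js
mergeLast (i ∷ i' ∷ is) j js = i ∷ mergeLast (i' ∷ is) j js

extR : Comp → Comp → FSum
extR []      J        = (1ℚ , J) ∷ []
extR (i ∷ I) []       = (1ℚ , i ∷ I) ∷ []
extR (i ∷ I) (j ∷ js) = (1ℚ , (i ∷ I) ++ (j ∷ js)) ∷ (1ℚ , mergeLast (i ∷ I) j js) ∷ []

mulF : FSum → FSum → FSum
mulF x y = concatMap (λ { (a , I) → concatMap (λ { (b , J) → scaleF (a Q.* b) (extR I J) }) y }) x

-- elements of the completion: degree ↦ homogeneous component
Ser : Set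
Ser = ℕ → FSum

oneS : Ser
oneS zero    = (1ℚ , []) ∷ []
oneS (suc _) = []

scaleS : ℚ → Ser → Ser
scaleS c F d = scaleF c (F d)

mulS : Ser → Ser → Ser
mulS F G d = concatMap (λ a → mulF (F a) (G (d ∸ a))) (upTo (suc d))

powS : Ser → ℕ → Ser
powS F zero    = oneS
powS F (suc m) = mulS F (powS F m)

-- log_⋆(1+F) for F with zero degree-0 part: in degree d only m ≤ d contribute
log1p : Ser → Ser
log1p F d = concatMap (λ m → scaleF (negOnePow (m ∸ 1) Q.* recip m) (powS F m d)) (from1 d)

-- exp_⋆ F for F with zero degree-0 part
expS : Ser → Ser
expS F d = concatMap (λ m → scaleF (recip (m !)) (powS F m d)) (upTo (suc d))

minusOne : Ser → Ser
minusOne G zero    = G zero ++ ((Q.- 1ℚ) , []) ∷ []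
minusOne G (suc d) = G (suc d)

logS : Ser → Ser
logS G = log1p (minusOne G)

powRat : Ser → ℚ → Ser
powRat G c = expS (scaleS c (logS G))

V1p : Ser
V1p zero    = (1ℚ , []) ∷ []
V1p (suc i) = (1ℚ , suc i ∷ []) ∷ []

V1m : Ser
V1m i = (1ℚ , replicate i 1) ∷ []

V2p V2m : Ser
V2p = mulS V1p V1m
V2m = mulS V1m V1p

I1p I1m : Ser
I1p = scaleS ½ (logS V2p)
I1m = scaleS ½ (logS V2m)

Ip Im : ℕ → Ser
Ip k = scaleS (recip (k !)) (powS I1p k)
Im k = scaleS (recip (k !)) (powS I1m k)

J0p J0m : Ser
J0p = mulS V1p (powRat V2m (Q.- ½))
J0m = mulS V1m (powRat V2p (Q.- ½))

Jp Jm : ℕ → Ser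
Jp k = mulS J0p (Im k)
Jm k = mulS J0m (Ip k)

Perm : Set
Perm = List ℕ   -- one-line notation

GA : Set
GA = List (ℚ × Perm)

elemᵇ : ℕ → List ℕ → Bool
elemᵇ x []       = false
elemᵇ x (y ∷ ys) = (x ≡ᵇ y) ∨ elemᵇ x ys

distinct : List ℕ → Bool
distinct []       = true
distinct (x ∷ xs) = not (elemᵇ x xs) ∧ distinct xs

words : ℕ → List ℕ → List (List ℕ)
words zero    A = [] ∷ []
words (suc l) A = concatMap (λ a → map (a ∷_) (words l A)) A

perms : ℕ → List Perm
perms n = filterᵇ distinct (words n (from1 n))

-- α(i), 1-based
at : List ℕ → ℕ → ℕ
at []       _             = 0
at (x ∷ xs) zero          = 0
at (x ∷ xs) (suc zero)    = x
at (x ∷ xs) (suc (suc k)) = at xs (suc k)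

compose : Perm → Perm → Perm
compose α β = map (at α) β

mulGA : GA → GA → GA
mulGA x y = concatMap (λ { (a , α) → map (λ { (b , β) → (a Q.* b , compose α β) }) y }) x

scaleGA : ℚ → GA → GA
scaleGA c = map (λ { (a , σ) → (c Q.* a , σ) })

eqPerm : Perm → Perm → Bool
eqPerm σ τ = ⌊ ≡-dec _≟_ σ τ ⌋

coeffGA : GA → Perm → ℚ
coeffGA x σ = sumℚ (map (λ { (a , τ) → if eqPerm τ σ then a else 0ℚ }) x)

infix 4 _≈_
_≈_ : GA → GA → Set
x ≈ y = ∀ σ → coeffGA x σ ≡ coeffGA y σ

desL : ℕ → List ℕ → List ℕ
desL i (a ∷ b ∷ r) = if b <ᵇ a then i ∷ desL (suc i) (b ∷ r) else desL (suc i) (b ∷ r)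
desL i _           = []

desPerm : Perm → List ℕ
desPerm = desL 1

compDesAcc : ℕ → Comp → List ℕ
compDesAcc acc []          = []
compDesAcc acc (i ∷ [])    = []
compDesAcc acc (i ∷ j ∷ r) = (acc ℕ.+ i) ∷ compDesAcc (acc ℕ.+ i) (j ∷ r)

compDes : Comp → List ℕ
compDes = compDesAcc 0

-- identification Sym_n → descent algebra ⊆ Q[S_n]
ι : ℕ → FSum → GA
ι n x = concatMap (λ { (c , I) → map (λ σ → (c , σ))
          (filterᵇ (λ σ → ⌊ ≡-dec _≟_ (desPerm σ) (compDes I) ⌋) (perms n)) }) x

changes : List ℕ → ℕ
changes (a ∷ b ∷ c ∷ r) =
  (if ((a <ᵇ b) ∧ (c <ᵇ b)) ∨ ((b <ᵇ a) ∧ (b <ᵇ c)) then 1 else 0) ℕ.+ changes (b ∷ c ∷ r)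
changes _ = 0

-- number of alternating runs (maximal monotone factors) of a sequence of length ≥ 2
runs : List ℕ → ℕ
runs l = suc (changes l)

firstAsc : List ℕ → Bool
firstAsc (a ∷ b ∷ _) = a <ᵇ b
firstAsc _           = false

peaks : List ℕ → ℕ
peaks (a ∷ b ∷ c ∷ r) = (if (a <ᵇ b) ∧ (c <ᵇ b) then 1 else 0) ℕ.+ peaks (b ∷ c ∷ r)
peaks _ = 0

sumPerms : ℕ → (Perm → Bool) → GA
sumPerms n P = map (λ σ → (1ℚ , σ)) (filterᵇ P (perms n))

Wp Wm W Wc Pk Pc : ℕ → ℕ → GA
Wp n k = sumPerms n (λ σ → (runs σ ≡ᵇ k) ∧ firstAsc σ)
Wm n k = sumPerms n (λ σ → (runs σ ≡ᵇ k) ∧ not (firstAsc σ))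
W  n k = Wp n k ++ Wm n k
Wc n k = sumPerms n (λ σ → runs (0 ∷ σ) ≡ᵇ k)
Pk n k = sumPerms n (λ σ → peaks σ ≡ᵇ k)
Pc n k = sumPerms n (λ σ → peaks (0 ∷ σ) ≡ᵇ k)     -- left peaks, i ∈ [1,n-1], σ(0)=0

-- spanning families (k ranging over 0..n covers all nonzero generators)
gensW gensWc gensC gensP gensPc : ℕ → List GA
gensW  n = map (W n)  (upTo (suc n))
gensWc n = map (Wc n) (upTo (suc n))
gensC  n = concatMap (λ j → if j % 2 ≡ᵇ 0 then W n j ∷ [] else Wp n j ∷ Wm n j ∷ []) (upTo (suc n))
gensP  n = map (Pk n) (upTo (suc n))
gensPc n = map (Pc n) (upTo (suc n))

lincomb : List ℚ → List GA → GA
lincomb cs gs = concat (zipWith scaleGA cs gs)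

InSpan : List GA → GA → Set
InSpan gs x = ∃ λ (cs : List ℚ) → length cs ≡ length gs × x ≈ lincomb cs gs

LinIndep : List GA → Set
LinIndep es = ∀ (cs : List ℚ) → length cs ≡ length es → lincomb cs es ≈ [] → All (_≡ 0ℚ) cs

OrthIdemBasis : List GA → List GA → Set
OrthIdemBasis gs es =
    All (InSpan gs) es
  × All (InSpan es) gs
  × LinIndep es
  × (∀ (i : Fin (length es)) → mulGA (lookup es i) (lookup es i) ≈ lookup es i)
  × (∀ (i j : Fin (length es)) → i ≢ j → mulGA (lookup es i) (lookup es j) ≈ [])

Poly : ℕ → Set
Poly m = Vec ℕ m → ℚ

infix 4 _≈P_
_≈P_ : ∀ {m} → Poly m → Poly m → Set
f ≈P g = ∀ v → f v ≡ g v

vsum : ∀ {m} → Vec ℕ m → ℕ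
vsum = V.foldr _ ℕ._+_ 0

below : ∀ {m} → Vec ℕ m → List (Vec ℕ m)
below V.[]       = V.[] ∷ []
below (a V.∷ vs) = concatMap (λ b → map (b V.∷_) (below vs)) (upTo (suc a))

pzero : ∀ {m} → Poly m
pzero _ = 0ℚ

pone : ∀ {m} → Poly m
pone v = if vsum v ≡ᵇ 0 then 1ℚ else 0ℚ

padd : ∀ {m} → Poly m → Poly m → Poly m
padd f g v = f v Q.+ g v

pscale : ∀ {m} → ℚ → Poly m → Poly m
pscale c f v = c Q.* f v

pmul : ∀ {m} → Poly m → Poly m → Poly m
pmul f g v = sumℚ (map (λ u → f u Q.* g (V.zipWith _∸_ v u)) (below v))

psum : ∀ {m} → List (Poly m) → Poly m
psum = foldr padd pzero

hk : ∀ {m} → ℕ → Poly m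
hk k v = if vsum v ≡ᵇ k then 1ℚ else 0ℚ

nonzeros : ∀ {m} → Vec ℕ m → ℕ
nonzeros = V.foldr _ (λ a r → if a ≡ᵇ 0 then r else suc r) 0

-- power sum p_k = Σ_i x_i^k  (k ≥ 1)
pk : ∀ {m} → ℕ → Poly m
pk k v = if (vsum v ≡ᵇ k) ∧ (nonzeros v ≡ᵇ 1) then 1ℚ else 0ℚ

hJ : ∀ {m} → List ℕ → Poly m
hJ J = foldr (λ j r → pmul (hk j) r) pone J

pλ : ∀ {m} → List ℕ → Poly m
pλ λs = foldr (λ j r → pmul (pk j) r) pone λs

coarsen : Comp → List Comp
coarsen []          = [] ∷ []
coarsen (a ∷ [])    = (a ∷ []) ∷ []
coarsen (a ∷ b ∷ r) = concatMap (λ { [] → []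
                                   ; (c ∷ cs) → (a ∷ c ∷ cs) ∷ ((a ℕ.+ c) ∷ cs) ∷ [] })
                                (coarsen (b ∷ r))

ΓR : ∀ {m} → Comp → Poly m
ΓR I = psum (map (λ J → pscale (negOnePow (length I ∸ length J)) (hJ J)) (coarsen I))

Γ : (n : ℕ) → FSum → Poly n
Γ n x = psum (map (λ { (c , I) → pscale c (ΓR I) }) x)

-- partitions of n with parts ≤ mx (fuel f ≥ n)
partsF : ℕ → ℕ → ℕ → List (List ℕ)
partsF _       zero    _  = [] ∷ []
partsF zero    (suc _) _  = []
partsF (suc f) n       mx =
  concatMap (λ k → map (k ∷_) (partsF f (n ∸ k) k)) (filterᵇ (λ k → (k ≤ᵇ mx) ∧ (k ≤ᵇ n)) (from1 n))

partitions : ℕ → List (List ℕ)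
partitions n = partsF n n n

count : ℕ → List ℕ → ℕ
count r = foldr (λ a c → if a ≡ᵇ r then suc c else c) 0

zλ : List ℕ → ℕ
zλ λs = foldr (λ r acc → (r ℕ.^ count r λs) ℕ.* (count r λs !) ℕ.* acc) 1 (from1 (foldr ℕ._+_ 0 λs))

ℓo ℓe : List ℕ → ℕ
ℓo λs = foldr (λ a c → if a % 2 ≡ᵇ 1 then suc c else c) 0 λs
ℓe λs = foldr (λ a c → if a % 2 ≡ᵇ 0 then suc c else c) 0 λs

target : (n : ℕ) → (List ℕ → Bool) → Poly n
target n cond = psum (map (λ λs → pscale (recip (zλ λs)) (pλ λs)) (filterᵇ cond (partitions n)))

eA eB eC eD eE : ℕ → ℕ → FSum
eA n k = scaleF ½ (Ip k n ++ Im k n)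
eB n l = scaleF ½ (Jp l n ++ Jm l n ++ negF (Ip l n ++ Im l n))
eC n m = scaleF ½ (Jp m n ++ negF (Jm m n))
-- J⁺_{l,n} − I⁺_{l,n}   (the statement prints a factor ½ here)
eD n l = Jp l n ++ negF (Ip l n)
eE n k = Jp k n

par : ℕ → ℕ → Bool
par k n = k % 2 ≡ᵇ n % 2

rngK : ℕ → List ℕ
rngK n = filterᵇ (λ k → (1 ≤ᵇ k) ∧ par k n) (upTo (suc n))

-- 0 ≤ l ≤ n - d, l ≡ n   (empty if n < d)
rngUpTo : ℕ → ℕ → List ℕ
rngUpTo d n = filterᵇ (λ l → ((l ℕ.+ d) ≤ᵇ n) ∧ par l n) (upTo (suc n))

fam : ℕ → (ℕ → ℕ → FSum) → List ℕ → List GA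
fam n e ks = map (λ k → ι n (e n k)) ks

{-# OPTIONS --safe #-}
module Submission where

-- For a word A in the signs +, − let V_A be the external product of the corresponding series V₁^±, and let
-- V_m^s be V_A for the alternating word A of length m starting with s.  Since (V₂^∓)^{t/2} is a polynomial in t
-- in each degree, Σ_k m^k I_k^s = V_m^s for even m and Σ_k m^k J_k^s = V_m^s for odd m.
--
-- Right multiplication by V_B in ℚ[S_n] distributes the letters of a word over the blocks of B, reverses the
-- negative blocks and concatenates.  This operator is a morphism for the unshuffle coproduct, whence
-- V_A * V_B = V_{A ⊙ B}, where A ⊙ B substitutes A, reversed and with opposite signs under −, for the letters of B.
-- For alternating words this reads V_a^s * V_b^t = V_{ab}^u, with u = s for even a and u = st for odd a, and
-- comparing coefficients of a^k b^l gives I^s_k * X_l = δ_{kl} I^s_k, J^s_k * I^t_l = δ_{kl} I^{st}_k and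
-- J^s_k * J^t_l = δ_{kl} J^{st}_k; idempotence and orthogonality follow.
--
-- The coefficient of σ in V_m^s depends only on the number c of changes in the sequence of ascents and descents of σ,
-- completed by the first and last sign of the alternating word; it vanishes for m ≤ c and is 2^c for m = c + 1.
-- This triangularity expresses the run and peak sums through the V_m^s, and conversely.  The degree sign θ satisfies
-- V₁^+ ⋆ θ V₁^- = 1, which turns t into −t and kills the components with k ≢ n modulo 2.
--
-- Under Γ the series V₁^± become exp (Σ_r (±1)^{r-1} p_r / r); the sums of a_λ p_λ / z_λ are the solutions of
-- D Z = (Σ_r a_r p_r) Z for the Euler derivation D, and interpolating in m again gives the images.  Evaluated at
-- (n, 0, …, 0) they give the coefficient of the identity permutation as a non-empty sum of 1 / z_λ > 0,
-- so the idempotents are non-zero, hence independent.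

open import Defs
open import Data.Nat using (ℕ; zero; suc; _≤_; _<_; _+_; _*_; _%_; _∸_; _!; z≤n; s≤s; s≤s⁻¹)
open import Data.Nat using (_≡ᵇ_; _<ᵇ_; _≤ᵇ_)
import Data.Nat as ℕ
import Data.Nat.Properties as ℕ
import Data.Nat.DivMod as ℕ
open import Data.List using (List; []; _∷_; _++_; map; concatMap; length; replicate; upTo; applyUpTo; filterᵇ; foldr; zipWith; lookup; reverse)
open import Data.List using () renaming (_++_ to _++ᴸ_)
import Data.List.Properties as L
open import Data.List.Relation.Unary.All using (All; []; _∷_)
import Data.List.Relation.Unary.All as All
import Data.List.Relation.Unary.All.Properties as All
open import Data.List.Relation.Unary.Any using (here; there)
open import Data.List.Membership.Propositional using (_∈_)
import Data.List.Membership.Propositional.Properties as Mem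
open import Data.List.Relation.Unary.AllPairs using (AllPairs; []; _∷_)
import Data.List.Relation.Unary.AllPairs.Properties as AllPairs
open import Data.List.Relation.Binary.Sublist.Propositional using (_⊆_; []; _∷_; _∷ʳ_)
import Data.List.Relation.Binary.Sublist.Propositional.Properties as Sublist
open import Data.Vec using (Vec; []; _∷_)
import Data.Vec as Vec
open import Data.Bool using (Bool; true; false; if_then_else_; not; T)
open import Data.Bool using (_∧_; _∨_)
import Data.Bool.Properties as Bool
open import Data.Product using (Σ; _,_; proj₁; proj₂)
open import Data.Product using (_×_)
open import Data.Sum using (_⊎_; inj₁; inj₂)
open import Data.Empty using (⊥; ⊥-elim)
open import Data.Unit using (⊤; tt)
open import Data.Fin using (Fin)
import Data.Fin as Fin
import Data.Integer as ℤ
import Data.Integer.Properties as ℤ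
open import Data.Rational using (ℚ; 0ℚ; 1ℚ; ½) renaming (_+_ to _⊕_; _*_ to _⊗_; -_ to ⊝_)
import Data.Rational as ℚ
import Data.Rational.Properties as ℚ
import Data.Rational.Unnormalised as ℚᵘ
import Data.Rational.Unnormalised.Properties as ℚᵘ
open import Data.Rational.Solver using (module +-*-Solver)
open +-*-Solver using (solve; con; _:+_; _:*_; :-_; _:=_)
open import Function using (_∘_; id)
open import Relation.Binary.Definitions using (tri<; tri≈; tri>)
open import Relation.Nullary using (yes; no; Dec)
open import Relation.Nullary.Decidable using (⌊_⌋)
open import Relation.Binary.PropositionalEquality using (_≢_; refl; sym; trans; cong; cong₂; subst; module ≡-Reasoning)
open import Relation.Binary.PropositionalEquality using (_≡_)
open ≡-Reasoning

-- The logarithms and square roots in the definition of I_k and J_k have no manageable coefficients;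
-- what can be computed are the values of their generating polynomials at integers. Products,
-- parity, dependence on run statistics and images are therefore checked on integer powers and
-- pulled back by `interpolate`. The external product is not commutative, so an exponential cannot
-- simply be differentiated. The laws of (1 + t)^c are proved for series in one variable, by a
-- differential equation, and carried over by the substitution homomorphism `φ`. Words, exponent
-- vectors and natural numbers are three coalgebras; one construction of convolution algebras serves
-- Sym, the symmetric functions and the series in t. Coalgebra laws are required only under
-- summation against test functions, so the order of splittings is irrelevant; products in ℚ[S_n]
-- are likewise met through pairings. For fixed k the elements I^+, I^-, J^+, J^- multiply by a
-- table independent of k. The coordinates `coef` of a family in these four elements decide
-- idempotence, orthogonality and the shape of the image.

-- Rational arithmetic and finite sums.

nat : ℕ → ℚ
nat zero    = 0ℚ
nat (suc n) = 1ℚ ⊕ nat n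

𝟙 : Bool → ℚ
𝟙 true  = 1ℚ
𝟙 false = 0ℚ

0⊗ : ∀ x → 0ℚ ⊗ x ≡ 0ℚ
0⊗ = ℚ.*-zeroˡ

⊗0 : ∀ x → x ⊗ 0ℚ ≡ 0ℚ
⊗0 = ℚ.*-zeroʳ

1⊗ : ∀ x → 1ℚ ⊗ x ≡ x
1⊗ = ℚ.*-identityˡ

⊗1 : ∀ x → x ⊗ 1ℚ ≡ x
⊗1 = ℚ.*-identityʳ

0⊕ : ∀ x → 0ℚ ⊕ x ≡ x
0⊕ = ℚ.+-identityˡ

⊕0 : ∀ x → x ⊕ 0ℚ ≡ x
⊕0 = ℚ.+-identityʳ

nat-+ : ∀ m n → nat (m + n) ≡ nat m ⊕ nat n
nat-+ zero    n = sym (0⊕ _)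
nat-+ (suc m) n = trans (cong (1ℚ ⊕_) (nat-+ m n)) (sym (ℚ.+-assoc 1ℚ (nat m) (nat n)))

nat-* : ∀ m n → nat (m * n) ≡ nat m ⊗ nat n
nat-* zero    n = sym (0⊗ (nat n))
nat-* (suc m) n = trans (nat-+ n (m * n)) (trans (cong (nat n ⊕_) (nat-* m n))
  (solve 2 (λ a b → b :+ a :* b := (con 1ℚ :+ a) :* b) refl (nat m) (nat n)))

-- Unnormalised fractions avoid the gcd hidden in `recip`; `recip-nat` is verified there and then
-- lifted to ℚ.
nat≡/1 : ∀ n → ℚ.toℚᵘ (nat n) ℚᵘ.≃ ℚᵘ.mkℚᵘ (ℤ.+ n) 0
nat≡/1 zero    = ℚᵘ.≃-refl
nat≡/1 (suc n) = ℚᵘ.≃-trans (ℚ.toℚᵘ-homo-+ 1ℚ (nat n))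
  (ℚᵘ.≃-trans (ℚᵘ.+-congʳ (ℚ.toℚᵘ 1ℚ) (nat≡/1 n)) (ℚᵘ.*≡*
    (trans (ℤ.*-identityʳ _) (trans (cong (ℤ._+_ (ℤ.+ 1)) (ℤ.*-identityʳ (ℤ.+ n))) (sym (ℤ.*-identityʳ (ℤ.+ suc n)))))))

recip-nat : ∀ k → recip (suc k) ⊗ nat (suc k) ≡ 1ℚ
recip-nat k = ℚ.toℚᵘ-injective (ℚᵘ.≃-trans (ℚ.toℚᵘ-homo-* (recip (suc k)) (nat (suc k)))
  (ℚᵘ.≃-trans (ℚᵘ.*-cong (ℚ.toℚᵘ-fromℚᵘ (ℚᵘ.mkℚᵘ (ℤ.+ 1) k)) (nat≡/1 (suc k))) (ℚᵘ.*≡* (trans (ℤ.*-identityʳ _) (trans (ℤ.*-identityˡ (ℤ.+ suc k))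
    (sym (trans (ℤ.*-identityˡ _) (ℤ.*-identityʳ (ℤ.+ suc k)))))))))

nat-suc≢0 : ∀ k → nat (suc k) ≢ 0ℚ
nat-suc≢0 k eq with trans (sym (recip-nat k)) (trans (cong (recip (suc k) ⊗_) eq) (⊗0 (recip (suc k))))
... | ()

nat-cancel : ∀ k {x y} → nat (suc k) ⊗ x ≡ nat (suc k) ⊗ y → x ≡ y
nat-cancel k {x} {y} eq = trans (sym (undo x)) (trans (cong (recip (suc k) ⊗_) eq) (undo y))
  where
  undo : ∀ z → recip (suc k) ⊗ (nat (suc k) ⊗ z) ≡ z
  undo z = trans (sym (ℚ.*-assoc (recip (suc k)) (nat (suc k)) z))
    (trans (cong (_⊗ z) (recip-nat k)) (1⊗ z))

∑ : {A : Set} → List A → (A → ℚ) → ℚ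
∑ []       f = 0ℚ
∑ (x ∷ xs) f = f x ⊕ ∑ xs f

Σ< : ℕ → (ℕ → ℚ) → ℚ
Σ< zero    f = 0ℚ
Σ< (suc n) f = f 0 ⊕ Σ< n (f ∘ suc)

⊕-interchange : ∀ a b c d → (a ⊕ b) ⊕ (c ⊕ d) ≡ (a ⊕ c) ⊕ (b ⊕ d)
⊕-interchange = solve 4 (λ a b c d → (a :+ b) :+ (c :+ d) := (a :+ c) :+ (b :+ d)) refl

⊗-interchange : ∀ a b c d → (a ⊗ b) ⊗ (c ⊗ d) ≡ (a ⊗ c) ⊗ (b ⊗ d)
⊗-interchange = solve 4 (λ a b c d → (a :* b) :* (c :* d) := (a :* c) :* (b :* d)) refl

⊗-swap : ∀ a b c → a ⊗ (b ⊗ c) ≡ b ⊗ (a ⊗ c)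
⊗-swap = solve 3 (λ a b c → a :* (b :* c) := b :* (a :* c)) refl

module _ {A : Set} where

  ∑-cong : ∀ (xs : List A) {f g : A → ℚ} → (∀ x → f x ≡ g x) → ∑ xs f ≡ ∑ xs g
  ∑-cong []       eq = refl
  ∑-cong (x ∷ xs) eq = cong₂ _⊕_ (eq x) (∑-cong xs eq)

  ∑-cong-All : ∀ {xs : List A} {f g : A → ℚ} → All (λ x → f x ≡ g x) xs → ∑ xs f ≡ ∑ xs g
  ∑-cong-All []         = refl
  ∑-cong-All (eq ∷ eqs) = cong₂ _⊕_ eq (∑-cong-All eqs)

  ∑-0 : ∀ (xs : List A) → ∑ xs (λ _ → 0ℚ) ≡ 0ℚ
  ∑-0 []       = refl
  ∑-0 (x ∷ xs) = trans (0⊕ _) (∑-0 xs)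

  ∑-zero : ∀ (xs : List A) {f : A → ℚ} → (∀ x → f x ≡ 0ℚ) → ∑ xs f ≡ 0ℚ
  ∑-zero xs eq = trans (∑-cong xs eq) (∑-0 xs)

  ∑-zero-All : ∀ {xs : List A} {f : A → ℚ} → All (λ x → f x ≡ 0ℚ) xs → ∑ xs f ≡ 0ℚ
  ∑-zero-All {xs} eqs = trans (∑-cong-All eqs) (∑-0 xs)

  ∑-++ : ∀ (xs ys : List A) f → ∑ (xs ++ ys) f ≡ ∑ xs f ⊕ ∑ ys f
  ∑-++ []       ys f = sym (0⊕ _)
  ∑-++ (x ∷ xs) ys f = trans (cong (f x ⊕_) (∑-++ xs ys f)) (sym (ℚ.+-assoc (f x) _ _))

  ∑-⊕ : ∀ (xs : List A) f g → ∑ xs (λ x → f x ⊕ g x) ≡ ∑ xs f ⊕ ∑ xs g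
  ∑-⊕ []       f g = refl
  ∑-⊕ (x ∷ xs) f g = trans (cong (f x ⊕ g x ⊕_) (∑-⊕ xs f g)) (⊕-interchange (f x) (g x) _ _)

  ∑-*ˡ : ∀ (xs : List A) c f → ∑ xs (λ x → c ⊗ f x) ≡ c ⊗ ∑ xs f
  ∑-*ˡ []       c f = sym (⊗0 c)
  ∑-*ˡ (x ∷ xs) c f = trans (cong (c ⊗ f x ⊕_) (∑-*ˡ xs c f)) (sym (ℚ.*-distribˡ-+ c _ _))

  ∑-*ʳ : ∀ (xs : List A) c f → ∑ xs (λ x → f x ⊗ c) ≡ ∑ xs f ⊗ c
  ∑-*ʳ xs c f = trans (∑-cong xs (λ x → ℚ.*-comm (f x) c)) (trans (∑-*ˡ xs c f) (ℚ.*-comm c _))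

  sumℚ-map : ∀ (f : A → ℚ) xs → sumℚ (map f xs) ≡ ∑ xs f
  sumℚ-map f []       = refl
  sumℚ-map f (x ∷ xs) = cong (f x ⊕_) (sumℚ-map f xs)

  ∑-filter : ∀ (p : A → Bool) xs f → ∑ (filterᵇ p xs) f ≡ ∑ xs (λ x → 𝟙 (p x) ⊗ f x)
  ∑-filter p []       f = refl
  ∑-filter p (x ∷ xs) f with p x
  ... | true  = cong₂ _⊕_ (sym (1⊗ (f x))) (∑-filter p xs f)
  ... | false = trans (∑-filter p xs f) (sym (trans (cong (_⊕ _) (0⊗ (f x))) (0⊕ _)))

module _ {A B : Set} where

  ∑-map : ∀ (h : A → B) xs f → ∑ (map h xs) f ≡ ∑ xs (f ∘ h)
  ∑-map h []       f = refl
  ∑-map h (x ∷ xs) f = cong (f (h x) ⊕_) (∑-map h xs f)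

  ∑-concatMap : ∀ (k : A → List B) xs f → ∑ (concatMap k xs) f ≡ ∑ xs (λ x → ∑ (k x) f)
  ∑-concatMap k []       f = refl
  ∑-concatMap k (x ∷ xs) f = trans (∑-++ (k x) (concatMap k xs) f) (cong (∑ (k x) f ⊕_) (∑-concatMap k xs f))

  ∑-swap : ∀ (xs : List A) (ys : List B) (f : A → B → ℚ) → ∑ xs (λ x → ∑ ys (f x)) ≡ ∑ ys (λ y → ∑ xs (λ x → f x y))
  ∑-swap []       ys f = sym (∑-0 ys)
  ∑-swap (x ∷ xs) ys f = trans (cong (∑ ys (f x) ⊕_) (∑-swap xs ys f)) (sym (∑-⊕ ys (f x) _))

∑-applyUpTo : ∀ {A : Set} (h : ℕ → A) n f → ∑ (applyUpTo h n) f ≡ Σ< n (f ∘ h)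
∑-applyUpTo h zero    f = refl
∑-applyUpTo h (suc n) f = cong (f (h 0) ⊕_) (∑-applyUpTo (h ∘ suc) n f)

∑-upTo : ∀ n f → ∑ (upTo n) f ≡ Σ< n f
∑-upTo n f = ∑-applyUpTo id n f

Σ<-cong< : ∀ n {f g} → (∀ i → i < n → f i ≡ g i) → Σ< n f ≡ Σ< n g
Σ<-cong< zero    eq = refl
Σ<-cong< (suc n) eq = cong₂ _⊕_ (eq 0 (s≤s z≤n)) (Σ<-cong< n (λ i i<n → eq (suc i) (s≤s i<n)))

Σ<-cong : ∀ n {f g} → (∀ i → f i ≡ g i) → Σ< n f ≡ Σ< n g
Σ<-cong n eq = Σ<-cong< n (λ i _ → eq i)

Σ<-0 : ∀ n → Σ< n (λ _ → 0ℚ) ≡ 0ℚ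
Σ<-0 zero    = refl
Σ<-0 (suc n) = trans (0⊕ _) (Σ<-0 n)

Σ<-zero< : ∀ n {f} → (∀ i → i < n → f i ≡ 0ℚ) → Σ< n f ≡ 0ℚ
Σ<-zero< n eq = trans (Σ<-cong< n eq) (Σ<-0 n)

Σ<-⊕ : ∀ n f g → Σ< n (λ i → f i ⊕ g i) ≡ Σ< n f ⊕ Σ< n g
Σ<-⊕ zero    f g = refl
Σ<-⊕ (suc n) f g = trans (cong (f 0 ⊕ g 0 ⊕_) (Σ<-⊕ n (f ∘ suc) (g ∘ suc))) (⊕-interchange (f 0) (g 0) _ _)

Σ<-*ˡ : ∀ n c f → Σ< n (λ i → c ⊗ f i) ≡ c ⊗ Σ< n f
Σ<-*ˡ zero    c f = sym (⊗0 c)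
Σ<-*ˡ (suc n) c f = trans (cong (c ⊗ f 0 ⊕_) (Σ<-*ˡ n c (f ∘ suc))) (sym (ℚ.*-distribˡ-+ c _ _))

Σ<-*ʳ : ∀ n c f → Σ< n (λ i → f i ⊗ c) ≡ Σ< n f ⊗ c
Σ<-*ʳ n c f = trans (Σ<-cong n (λ x → ℚ.*-comm (f x) c)) (trans (Σ<-*ˡ n c f) (ℚ.*-comm c _))

Σ<-∑ : ∀ {A : Set} n (xs : List A) (f : ℕ → A → ℚ) → Σ< n (λ i → ∑ xs (f i)) ≡ ∑ xs (λ x → Σ< n (λ i → f i x))
Σ<-∑ zero    xs f = sym (∑-0 xs)
Σ<-∑ (suc n) xs f = trans (cong (∑ xs (f 0) ⊕_) (Σ<-∑ n xs (f ∘ suc))) (sym (∑-⊕ xs (f 0) (λ x → Σ< n (λ i → f (suc i) x))))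

Σ<-swap : ∀ m n (f : ℕ → ℕ → ℚ) → Σ< m (λ i → Σ< n (f i)) ≡ Σ< n (λ j → Σ< m (λ i → f i j))
Σ<-swap zero    n f = sym (Σ<-0 n)
Σ<-swap (suc m) n f = trans (cong (Σ< n (f 0) ⊕_) (Σ<-swap m n (f ∘ suc))) (sym (Σ<-⊕ n (f 0) (λ j → Σ< m (λ i → f (suc i) j))))

Σ<-last : ∀ n f → Σ< (suc n) f ≡ Σ< n f ⊕ f n
Σ<-last zero    f = ℚ.+-comm (f 0) 0ℚ
Σ<-last (suc n) f = trans (cong (f 0 ⊕_) (Σ<-last n (f ∘ suc))) (sym (ℚ.+-assoc (f 0) _ _))

-- Makes sums comparable whose bound depends on a degree: the bound can be raised past the last
-- non-zero term.
Σ<-extend : ∀ n m {f} → n ≤ m → (∀ i → n ≤ i → f i ≡ 0ℚ) → Σ< n f ≡ Σ< m f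
Σ<-extend zero    m       z≤n       eq = sym (Σ<-zero< m (λ i _ → eq i z≤n))
Σ<-extend (suc n) (suc m) {f} (s≤s n≤m) eq = cong (f 0 ⊕_) (Σ<-extend n m n≤m (λ i n≤i → eq (suc i) (s≤s n≤i)))

Σ<-single : ∀ n k {f} → k < n → (∀ i → i ≢ k → f i ≡ 0ℚ) → Σ< n f ≡ f k
Σ<-single (suc n) zero    {f} _         eq = trans (cong (f 0 ⊕_) (Σ<-zero< n (λ i _ → eq (suc i) λ ()))) (⊕0 _)
Σ<-single (suc n) (suc k) {f} (s≤s k<n) eq =
  trans (cong₂ _⊕_ (eq 0 λ ()) (Σ<-single n k k<n (λ i i≢k → eq (suc i) (i≢k ∘ ℕ.suc-injective)))) (0⊕ _)

pow₁ : ℚ → ℕ → ℚ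
pow₁ c zero    = 1ℚ
pow₁ c (suc k) = c ⊗ pow₁ c k

negOnePow-+ : ∀ m n → negOnePow (m + n) ≡ negOnePow m ⊗ negOnePow n
negOnePow-+ zero    n = sym (1⊗ (negOnePow n))
negOnePow-+ (suc m) n = trans (cong ⊝_ (negOnePow-+ m n))
  (ℚ.neg-distribˡ-* (negOnePow m) (negOnePow n))

negOnePow-sq : ∀ m → negOnePow m ⊗ negOnePow m ≡ 1ℚ
negOnePow-sq zero    = refl
negOnePow-sq (suc m) = trans (solve 1 (λ x → (:- x) :* (:- x) := x :* x) refl (negOnePow m)) (negOnePow-sq m)

-- Convolution algebras

∑₂ : {A B : Set} → List (A × B) → (A → B → ℚ) → ℚ
∑₂ xs F = ∑ xs (λ p → F (proj₁ p) (proj₂ p))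

∑₂-cong : ∀ {A B : Set} (xs : List (A × B)) {F G : A → B → ℚ} → (∀ a b → F a b ≡ G a b) → ∑₂ xs F ≡ ∑₂ xs G
∑₂-cong xs eq = ∑-cong xs (λ p → eq (proj₁ p) (proj₂ p))

-- A connected graded coalgebra with a distinguished basis Pt; the convolution
-- algebra of functions Pt → ℚ is the completion of its graded dual.
record Coalg : Set₁ where
  field
    Pt         : Set
    deg        : Pt → ℕ
    splits     : Pt → List (Pt × Pt)
    deg-splits : ∀ p → All (λ qr → deg (proj₁ qr) + deg (proj₂ qr) ≡ deg p) (splits p)
    coassoc    : ∀ p (F : Pt → Pt → Pt → ℚ) →
      ∑₂ (splits p) (λ q r → ∑₂ (splits q) (λ s t → F s t r)) ≡
      ∑₂ (splits p) (λ q r → ∑₂ (splits r) (λ s t → F q s t))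
    counitˡ    : ∀ p (F : Pt → ℚ) → ∑₂ (splits p) (λ q r → 𝟙 (deg q ≡ᵇ 0) ⊗ F r) ≡ F p
    counitʳ    : ∀ p (F : Pt → ℚ) → ∑₂ (splits p) (λ q r → F q ⊗ 𝟙 (deg r ≡ᵇ 0)) ≡ F p

module Conv (C : Coalg) where
  open Coalg C public

  Fun : Set
  Fun = Pt → ℚ

  infix 4 _≐_
  _≐_ : Fun → Fun → Set
  f ≐ g = ∀ p → f p ≡ g p

  ≐-sym : ∀ {f g} → f ≐ g → g ≐ f
  ≐-sym eq p = sym (eq p)

  ≐-trans : ∀ {f g h} → f ≐ g → g ≐ h → f ≐ h
  ≐-trans eq eq′ p = trans (eq p) (eq′ p)

  infixl 7 _⋆_
  infixr 8 _·_
  infixl 6 _⊞_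

  _⋆_ : Fun → Fun → Fun
  (f ⋆ g) p = ∑₂ (splits p) (λ q r → f q ⊗ g r)

  one : Fun
  one p = 𝟙 (deg p ≡ᵇ 0)

  _⊞_ : Fun → Fun → Fun
  (f ⊞ g) p = f p ⊕ g p

  _·_ : ℚ → Fun → Fun
  (c · f) p = c ⊗ f p

  ⋆-cong : ∀ {f f′ g g′} → f ≐ f′ → g ≐ g′ → f ⋆ g ≐ f′ ⋆ g′
  ⋆-cong eq eq′ p = ∑-cong (splits p) (λ qr → cong₂ _⊗_ (eq (proj₁ qr)) (eq′ (proj₂ qr)))

  ⋆-congˡ : ∀ f {g g′} → g ≐ g′ → f ⋆ g ≐ f ⋆ g′
  ⋆-congˡ f eq = ⋆-cong {f} {f} (λ _ → refl) eq

  ⋆-congʳ : ∀ g {f f′} → f ≐ f′ → f ⋆ g ≐ f′ ⋆ g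
  ⋆-congʳ g eq = ⋆-cong {g = g} {g} eq (λ _ → refl)

  ⋆-assoc : ∀ f g h → (f ⋆ g) ⋆ h ≐ f ⋆ (g ⋆ h)
  ⋆-assoc f g h p = begin
    ∑₂ (splits p) (λ q r → ∑₂ (splits q) (λ s t → f s ⊗ g t) ⊗ h r)
      ≡⟨ ∑₂-cong (splits p) (λ q r → sym (∑-*ʳ (splits q) (h r) (λ st → f (proj₁ st) ⊗ g (proj₂ st)))) ⟩
    ∑₂ (splits p) (λ q r → ∑₂ (splits q) (λ s t → (f s ⊗ g t) ⊗ h r))
      ≡⟨ coassoc p (λ s t r → (f s ⊗ g t) ⊗ h r) ⟩
    ∑₂ (splits p) (λ q r → ∑₂ (splits r) (λ s t → (f q ⊗ g s) ⊗ h t))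
      ≡⟨ ∑₂-cong (splits p) (λ q r → trans
           (∑₂-cong (splits r) (λ s t → ℚ.*-assoc (f q) (g s) (h t)))
           (∑-*ˡ (splits r) (f q) (λ st → g (proj₁ st) ⊗ h (proj₂ st)))) ⟩
    ∑₂ (splits p) (λ q r → f q ⊗ ∑₂ (splits r) (λ s t → g s ⊗ h t)) ∎

  one⋆ : ∀ f → one ⋆ f ≐ f
  one⋆ f p = counitˡ p f

  ⋆one : ∀ f → f ⋆ one ≐ f
  ⋆one f p = counitʳ p f

  ⋆-⊞ʳ : ∀ f g h → (f ⊞ g) ⋆ h ≐ f ⋆ h ⊞ g ⋆ h
  ⋆-⊞ʳ f g h p = trans (∑₂-cong (splits p) (λ q r → ℚ.*-distribʳ-+ (h r) (f q) (g q)))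
    (∑-⊕ (splits p) (λ qr → f (proj₁ qr) ⊗ h (proj₂ qr)) (λ qr → g (proj₁ qr) ⊗ h (proj₂ qr)))

  ⋆-⊞ˡ : ∀ f g h → f ⋆ (g ⊞ h) ≐ f ⋆ g ⊞ f ⋆ h
  ⋆-⊞ˡ f g h p = trans (∑₂-cong (splits p) (λ q r → ℚ.*-distribˡ-+ (f q) (g r) (h r)))
    (∑-⊕ (splits p) (λ qr → f (proj₁ qr) ⊗ g (proj₂ qr)) (λ qr → f (proj₁ qr) ⊗ h (proj₂ qr)))

  ⋆-·ʳ : ∀ c f g → (c · f) ⋆ g ≐ c · (f ⋆ g)
  ⋆-·ʳ c f g p = trans (∑₂-cong (splits p) (λ q r → ℚ.*-assoc c (f q) (g r)))
    (∑-*ˡ (splits p) c (λ qr → f (proj₁ qr) ⊗ g (proj₂ qr)))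

  ⋆-·ˡ : ∀ c f g → f ⋆ (c · g) ≐ c · (f ⋆ g)
  ⋆-·ˡ c f g p = trans (∑₂-cong (splits p) (λ q r → ⊗-swap (f q) c (g r)))
    (∑-*ˡ (splits p) c (λ qr → f (proj₁ qr) ⊗ g (proj₂ qr)))

  Σf : ℕ → (ℕ → Fun) → Fun
  Σf N fs p = Σ< N (λ i → fs i p)

  ⋆-Σʳ : ∀ N fs g → Σf N fs ⋆ g ≐ Σf N (λ i → fs i ⋆ g)
  ⋆-Σʳ N fs g p = trans (∑₂-cong (splits p) (λ q r → sym (Σ<-*ʳ N (g r) (λ i → fs i q))))
    (sym (Σ<-∑ N (splits p) (λ i qr → fs i (proj₁ qr) ⊗ g (proj₂ qr))))

  ⋆-Σˡ : ∀ N f gs → f ⋆ Σf N gs ≐ Σf N (λ i → f ⋆ gs i)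
  ⋆-Σˡ N f gs p = trans (∑₂-cong (splits p) (λ q r → sym (Σ<-*ˡ N (f q) (λ i → gs i r))))
    (sym (Σ<-∑ N (splits p) (λ i qr → f (proj₁ qr) ⊗ gs i (proj₂ qr))))

  -- Both halves of a splitting of p have degree at most `deg p`. This allows a series to be
  -- replaced by a truncation that is only correct up to that degree.
  ⋆-cong-deg : ∀ {f f′ g g′} p → (∀ q → deg q ≤ deg p → f q ≡ f′ q) →
               (∀ q → deg q ≤ deg p → g q ≡ g′ q) → (f ⋆ g) p ≡ (f′ ⋆ g′) p
  ⋆-cong-deg p eq eq′ = ∑-cong-All (All.map
    (λ {qr} e → cong₂ _⊗_ (eq (proj₁ qr) (ℕ.≤-trans (ℕ.m≤m+n _ _) (ℕ.≤-reflexive e)))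
                          (eq′ (proj₂ qr) (ℕ.≤-trans (ℕ.m≤n+m _ (deg (proj₁ qr))) (ℕ.≤-reflexive e))))
    (deg-splits p))

  Vanish₀ : Fun → Set
  Vanish₀ f = ∀ p → deg p ≡ 0 → f p ≡ 0ℚ

  -- A factor f without constant term forces the other half of the splitting into strictly smaller
  -- degree. All recursions on the degree rest on this.
  ⋆-local : ∀ {f g g′} → Vanish₀ f → ∀ p → (∀ q → deg q < deg p → g q ≡ g′ q) → (f ⋆ g) p ≡ (f ⋆ g′) p
  ⋆-local {f} {g} {g′} f₀ p eq = ∑-cong-All (All.map (λ {qr} e → step (proj₁ qr) (proj₂ qr) e) (deg-splits p))
    where
    step : ∀ q r → deg q + deg r ≡ deg p → f q ⊗ g r ≡ f q ⊗ g′ r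
    step q r e with deg q in eqd
    ... | zero  = trans (cong (_⊗ g r) (f₀ q eqd)) (trans (0⊗ (g r)) (sym (trans (cong (_⊗ g′ r) (f₀ q eqd)) (0⊗ (g′ r)))))
    ... | suc d = cong (f q ⊗_) (eq r (subst (suc (deg r) ≤_) e (s≤s (ℕ.m≤n+m _ d))))

  pow : Fun → ℕ → Fun
  pow f zero    = one
  pow f (suc k) = f ⋆ pow f k

  pow-cong : ∀ {f g} → f ≐ g → ∀ k → pow f k ≐ pow g k
  pow-cong eq zero    = λ _ → refl
  pow-cong eq (suc k) = ⋆-cong eq (pow-cong eq k)

  pow-vanish : ∀ {f} → Vanish₀ f → ∀ k p → deg p < k → pow f k p ≡ 0ℚ
  pow-vanish {f} f₀ (suc k) p lt = trans
    (⋆-local {f} {pow f k} {λ _ → 0ℚ} f₀ p (λ q q<p → pow-vanish f₀ k q (ℕ.<-≤-trans q<p (s≤s⁻¹ lt))))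
    (∑-zero (splits p) (λ qr → ⊗0 (f (proj₁ qr))))

  pow-· : ∀ c f k → pow (c · f) k ≐ pow₁ c k · pow f k
  pow-· c f zero    p = sym (1⊗ (one p))
  pow-· c f (suc k) p = begin
    ((c · f) ⋆ pow (c · f) k) p             ≡⟨ ⋆-congˡ (c · f) (pow-· c f k) p ⟩
    ((c · f) ⋆ (pow₁ c k · pow f k)) p      ≡⟨ ⋆-·ˡ (pow₁ c k) (c · f) (pow f k) p ⟩
    pow₁ c k ⊗ ((c · f) ⋆ pow f k) p        ≡⟨ cong (pow₁ c k ⊗_) (⋆-·ʳ c f (pow f k) p) ⟩
    pow₁ c k ⊗ (c ⊗ (f ⋆ pow f k) p)        ≡⟨ sym (ℚ.*-assoc (pow₁ c k) c _) ⟩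
    (pow₁ c k ⊗ c) ⊗ (f ⋆ pow f k) p        ≡⟨ cong (_⊗ (f ⋆ pow f k) p) (ℚ.*-comm (pow₁ c k) c) ⟩
    (c ⊗ pow₁ c k) ⊗ (f ⋆ pow f k) p ∎

  D : Fun → Fun
  D f p = nat (deg p) ⊗ f p

  D-⋆ : ∀ f g → D (f ⋆ g) ≐ D f ⋆ g ⊞ f ⋆ D g
  D-⋆ f g p = trans (sym (∑-*ˡ (splits p) (nat (deg p)) (λ qr → f (proj₁ qr) ⊗ g (proj₂ qr))))
    (trans (∑-cong-All (All.map (λ {qr} e → step (proj₁ qr) (proj₂ qr) e) (deg-splits p)))
      (∑-⊕ (splits p) (λ qr → D f (proj₁ qr) ⊗ g (proj₂ qr)) (λ qr → f (proj₁ qr) ⊗ D g (proj₂ qr))))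
    where
    step : ∀ q r → deg q + deg r ≡ deg p →
           nat (deg p) ⊗ (f q ⊗ g r) ≡ (nat (deg q) ⊗ f q) ⊗ g r ⊕ f q ⊗ (nat (deg r) ⊗ g r)
    step q r e = trans (cong (_⊗ (f q ⊗ g r)) (trans (cong nat (sym e)) (nat-+ (deg q) (deg r))))
      (solve 4 (λ a b x y → (a :+ b) :* (x :* y) := (a :* x) :* y :+ x :* (b :* y)) refl
        (nat (deg q)) (nat (deg r)) (f q) (g r))

  D-Vanish₀ : ∀ f → Vanish₀ (D f)
  D-Vanish₀ f p eq = trans (cong (λ z → nat z ⊗ f p) eq) (0⊗ (f p))

  -- In degree d > 0 the equation expresses d X through values of X in lower degree, because G has
  -- no constant term; dividing by d determines X from its constant term.
  ode-unique : ∀ {G X Y} → Vanish₀ G → D X ≐ G ⋆ X → D Y ≐ G ⋆ Y →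
               (∀ p → deg p ≡ 0 → X p ≡ Y p) → X ≐ Y
  ode-unique {G} {X} {Y} G₀ DX DY eq₀ p = go (suc (deg p)) p (ℕ.n<1+n _)
    where
    go : ∀ n p → deg p < n → X p ≡ Y p
    go (suc n) p lt with deg p in eqd
    ... | zero  = eq₀ p eqd
    ... | suc d = nat-cancel d (begin
      nat (suc d) ⊗ X p   ≡⟨ cong (λ z → nat z ⊗ X p) (sym eqd) ⟩
      D X p               ≡⟨ DX p ⟩
      (G ⋆ X) p           ≡⟨ ⋆-local G₀ p (λ q q<p → go n q (ℕ.<-≤-trans q<p (subst (_≤ n) (sym eqd) (s≤s⁻¹ lt)))) ⟩
      (G ⋆ Y) p           ≡⟨ sym (DY p) ⟩
      D Y p               ≡⟨ cong (λ z → nat z ⊗ Y p) eqd ⟩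
      nat (suc d) ⊗ Y p ∎)

  θ : Fun → Fun
  θ f p = negOnePow (deg p) ⊗ f p

  θ-⋆ : ∀ f g → θ (f ⋆ g) ≐ θ f ⋆ θ g
  θ-⋆ f g p = trans (sym (∑-*ˡ (splits p) (negOnePow (deg p)) (λ qr → f (proj₁ qr) ⊗ g (proj₂ qr))))
    (∑-cong-All (All.map (λ {qr} e → step (proj₁ qr) (proj₂ qr) e) (deg-splits p)))
    where
    step : ∀ q r → deg q + deg r ≡ deg p →
           negOnePow (deg p) ⊗ (f q ⊗ g r) ≡ (negOnePow (deg q) ⊗ f q) ⊗ (negOnePow (deg r) ⊗ g r)
    step q r e = trans (cong (_⊗ (f q ⊗ g r)) (trans (cong negOnePow (sym e)) (negOnePow-+ (deg q) (deg r))))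
      (⊗-interchange (negOnePow (deg q)) (negOnePow (deg r)) (f q) (g r))

  θ-one : θ one ≐ one
  θ-one p with deg p in eqd
  ... | zero  = refl
  ... | suc d = ⊗0 (negOnePow (suc d))

  θθ : ∀ f → θ (θ f) ≐ f
  θθ f p = trans (sym (ℚ.*-assoc (negOnePow (deg p)) (negOnePow (deg p)) (f p)))
    (trans (cong (_⊗ f p) (negOnePow-sq (deg p))) (1⊗ (f p)))

  module Commutative (⋆-comm : ∀ f g → f ⋆ g ≐ g ⋆ f) where

    -- Commutativity is needed to bring every factor D f to the front. For words this fails, so
    -- differential equations are used only for series in one variable and for symmetric functions.
    D-pow : ∀ f k → D (pow f (suc k)) ≐ nat (suc k) · (D f ⋆ pow f k)
    D-pow f zero p = begin
      D (f ⋆ one) p               ≡⟨ cong (nat (deg p) ⊗_) (⋆one f p) ⟩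
      D f p                       ≡⟨ sym (⋆one (D f) p) ⟩
      (D f ⋆ one) p               ≡⟨ sym (1⊗ _) ⟩
      1ℚ ⊗ (D f ⋆ one) p ∎
    D-pow f (suc k) p = begin
      D (f ⋆ pow f (suc k)) p
        ≡⟨ D-⋆ f (pow f (suc k)) p ⟩
      (D f ⋆ pow f (suc k)) p ⊕ (f ⋆ D (pow f (suc k))) p
        ≡⟨ cong (X ⊕_) (trans (⋆-congˡ f (D-pow f k) p) (⋆-·ˡ (nat (suc k)) f (D f ⋆ pow f k) p)) ⟩
      X ⊕ nat (suc k) ⊗ (f ⋆ (D f ⋆ pow f k)) p
        ≡⟨ cong (λ z → X ⊕ nat (suc k) ⊗ z) (trans (sym (⋆-assoc f (D f) (pow f k) p))
             (trans (⋆-congʳ (pow f k) (⋆-comm f (D f)) p) (⋆-assoc (D f) f (pow f k) p))) ⟩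
      X ⊕ nat (suc k) ⊗ X
        ≡⟨ solve 2 (λ x n → x :+ n :* x := (con 1ℚ :+ n) :* x) refl X (nat (suc k)) ⟩
      nat (suc (suc k)) ⊗ X ∎
      where
      X : ℚ
      X = (D f ⋆ pow f (suc k)) p

    -- Logarithmic derivatives add; commutativity moves H past X.
    ode-⋆ : ∀ {G H X Y} → D X ≐ G ⋆ X → D Y ≐ H ⋆ Y → D (X ⋆ Y) ≐ (G ⊞ H) ⋆ (X ⋆ Y)
    ode-⋆ {G} {H} {X} {Y} DX DY p = begin
      D (X ⋆ Y) p                                ≡⟨ D-⋆ X Y p ⟩
      (D X ⋆ Y) p ⊕ (X ⋆ D Y) p                  ≡⟨ cong₂ _⊕_ (⋆-congʳ Y DX p) (⋆-congˡ X DY p) ⟩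
      ((G ⋆ X) ⋆ Y) p ⊕ (X ⋆ (H ⋆ Y)) p          ≡⟨ cong₂ _⊕_ (⋆-assoc G X Y p) (trans (sym (⋆-assoc X H Y p))
                                                      (trans (⋆-congʳ Y (⋆-comm X H) p) (⋆-assoc H X Y p))) ⟩
      (G ⋆ (X ⋆ Y)) p ⊕ (H ⋆ (X ⋆ Y)) p          ≡⟨ sym (⋆-⊞ʳ G H (X ⋆ Y) p) ⟩
      ((G ⊞ H) ⋆ (X ⋆ Y)) p ∎

recip-nat-inv : ∀ n → n ≢ 0 → recip n ⊗ nat n ≡ 1ℚ
recip-nat-inv zero    n≢0 = ⊥-elim (n≢0 refl)
recip-nat-inv (suc n) _   = recip-nat n

recip-unique : ∀ n x → n ≢ 0 → x ⊗ nat n ≡ 1ℚ → x ≡ recip n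
recip-unique n x n≢0 eq = begin
  x                          ≡⟨ sym (⊗1 x) ⟩
  x ⊗ 1ℚ                     ≡⟨ cong (x ⊗_) (sym (recip-nat-inv n n≢0)) ⟩
  x ⊗ (recip n ⊗ nat n)      ≡⟨ solve 3 (λ x r m → x :* (r :* m) := r :* (x :* m)) refl x (recip n) (nat n) ⟩
  recip n ⊗ (x ⊗ nat n)      ≡⟨ cong (recip n ⊗_) eq ⟩
  recip n ⊗ 1ℚ               ≡⟨ ⊗1 (recip n) ⟩
  recip n ∎

recip-* : ∀ a b → recip (a * b) ≡ recip a ⊗ recip b
recip-* zero      b         = sym (0⊗ (recip b))
recip-* a@(suc _) zero      = trans (cong recip (ℕ.*-zeroʳ a)) (sym (⊗0 (recip a)))
recip-* a@(suc x) b@(suc y) = sym (recip-unique (a * b) (recip a ⊗ recip b) (λ ()) (begin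
  (recip a ⊗ recip b) ⊗ nat (a * b)        ≡⟨ cong ((recip a ⊗ recip b) ⊗_) (nat-* a b) ⟩
  (recip a ⊗ recip b) ⊗ (nat a ⊗ nat b)    ≡⟨ ⊗-interchange (recip a) (recip b) (nat a) (nat b) ⟩
  (recip a ⊗ nat a) ⊗ (recip b ⊗ nat b)    ≡⟨ cong₂ _⊗_ (recip-nat x) (recip-nat y) ⟩
  1ℚ ∎))

recip-!-suc : ∀ m → recip (suc m !) ⊗ nat (suc m) ≡ recip (m !)
recip-!-suc m = begin
  recip (suc m * m !) ⊗ nat (suc m)                ≡⟨ cong (_⊗ nat (suc m)) (recip-* (suc m) (m !)) ⟩
  (recip (suc m) ⊗ recip (m !)) ⊗ nat (suc m)      ≡⟨ solve 3 (λ a b c → (a :* b) :* c := (a :* c) :* b) refl (recip (suc m)) (recip (m !)) (nat (suc m)) ⟩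
  (recip (suc m) ⊗ nat (suc m)) ⊗ recip (m !)      ≡⟨ cong (_⊗ recip (m !)) (recip-nat m) ⟩
  1ℚ ⊗ recip (m !)                                 ≡⟨ 1⊗ (recip (m !)) ⟩
  recip (m !) ∎

-- Power series in one variable and the binomial series.

splitsℕ : ℕ → List (ℕ × ℕ)
splitsℕ zero    = (0 , 0) ∷ []
splitsℕ (suc n) = (0 , suc n) ∷ map (λ p → suc (proj₁ p) , proj₂ p) (splitsℕ n)

Δℕ : ℕ → (ℕ → ℕ → ℚ) → ℚ
Δℕ n = ∑₂ (splitsℕ n)

Δℕ-suc : ∀ n G → Δℕ (suc n) G ≡ G 0 (suc n) ⊕ Δℕ n (λ a b → G (suc a) b)
Δℕ-suc n G = cong (G 0 (suc n) ⊕_) (∑-map (λ p → suc (proj₁ p) , proj₂ p) (splitsℕ n) (λ p → G (proj₁ p) (proj₂ p)))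

Δℕ-cong : ∀ n {G H : ℕ → ℕ → ℚ} → (∀ a b → G a b ≡ H a b) → Δℕ n G ≡ Δℕ n H
Δℕ-cong n = ∑₂-cong (splitsℕ n)

Δℕ-sucʳ : ∀ n G → Δℕ (suc n) G ≡ Δℕ n (λ a b → G a (suc b)) ⊕ G (suc n) 0
Δℕ-sucʳ zero    G = trans (cong (G 0 1 ⊕_) (⊕0 (G 1 0))) (cong (_⊕ G 1 0) (sym (⊕0 (G 0 1))))
Δℕ-sucʳ (suc n) G = begin
  Δℕ (suc (suc n)) G
    ≡⟨ Δℕ-suc (suc n) G ⟩
  G 0 (suc (suc n)) ⊕ Δℕ (suc n) (λ a b → G (suc a) b)
    ≡⟨ cong (G 0 (suc (suc n)) ⊕_) (Δℕ-sucʳ n (λ a b → G (suc a) b)) ⟩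
  G 0 (suc (suc n)) ⊕ (Δℕ n (λ a b → G (suc a) (suc b)) ⊕ G (suc (suc n)) 0)
    ≡⟨ sym (ℚ.+-assoc (G 0 (suc (suc n))) _ _) ⟩
  (G 0 (suc (suc n)) ⊕ Δℕ n (λ a b → G (suc a) (suc b))) ⊕ G (suc (suc n)) 0
    ≡⟨ cong (_⊕ G (suc (suc n)) 0) (sym (Δℕ-suc n (λ a b → G a (suc b)))) ⟩
  Δℕ (suc n) (λ a b → G a (suc b)) ⊕ G (suc (suc n)) 0 ∎

Δℕ-comm : ∀ n G → Δℕ n G ≡ Δℕ n (λ a b → G b a)
Δℕ-comm zero    G = refl
Δℕ-comm (suc n) G = begin
  Δℕ (suc n) G                                        ≡⟨ Δℕ-suc n G ⟩
  G 0 (suc n) ⊕ Δℕ n (λ a b → G (suc a) b)            ≡⟨ cong (G 0 (suc n) ⊕_) (Δℕ-comm n (λ a b → G (suc a) b)) ⟩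
  G 0 (suc n) ⊕ Δℕ n (λ a b → G (suc b) a)            ≡⟨ ℚ.+-comm (G 0 (suc n)) _ ⟩
  Δℕ n (λ a b → G (suc b) a) ⊕ G 0 (suc n)            ≡⟨ sym (Δℕ-sucʳ n (λ a b → G b a)) ⟩
  Δℕ (suc n) (λ a b → G b a) ∎

Δℕ-⊕ : ∀ n (G H : ℕ → ℕ → ℚ) → Δℕ n (λ a b → G a b ⊕ H a b) ≡ Δℕ n G ⊕ Δℕ n H
Δℕ-⊕ n G H = ∑-⊕ (splitsℕ n) (λ p → G (proj₁ p) (proj₂ p)) (λ p → H (proj₁ p) (proj₂ p))

Δℕ-coassoc : ∀ n (F : ℕ → ℕ → ℕ → ℚ) →
  Δℕ n (λ q r → Δℕ q (λ s t → F s t r)) ≡ Δℕ n (λ q r → Δℕ r (λ s t → F q s t))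
Δℕ-coassoc zero    F = refl
Δℕ-coassoc (suc n) F = begin
  Δℕ (suc n) (λ q r → Δℕ q (λ s t → F s t r))
    ≡⟨ Δℕ-suc n (λ q r → Δℕ q (λ s t → F s t r)) ⟩
  (F 0 0 (suc n) ⊕ 0ℚ) ⊕ Δℕ n (λ q r → Δℕ (suc q) (λ s t → F s t r))
    ≡⟨ cong₂ _⊕_ (⊕0 (F 0 0 (suc n))) (trans (Δℕ-cong n (λ q r → Δℕ-suc q (λ s t → F s t r)))
         (Δℕ-⊕ n (λ q r → F 0 (suc q) r) (λ q r → Δℕ q (λ s t → F (suc s) t r)))) ⟩
  F 0 0 (suc n) ⊕ (Δℕ n (λ q r → F 0 (suc q) r) ⊕ Δℕ n (λ q r → Δℕ q (λ s t → F (suc s) t r)))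
    ≡⟨ sym (ℚ.+-assoc (F 0 0 (suc n)) _ _) ⟩
  (F 0 0 (suc n) ⊕ Δℕ n (λ q r → F 0 (suc q) r)) ⊕ Δℕ n (λ q r → Δℕ q (λ s t → F (suc s) t r))
    ≡⟨ cong₂ _⊕_ (sym (Δℕ-suc n (F 0))) (Δℕ-coassoc n (λ s t r → F (suc s) t r)) ⟩
  Δℕ (suc n) (F 0) ⊕ Δℕ n (λ q r → Δℕ r (λ s t → F (suc q) s t))
    ≡⟨ sym (Δℕ-suc n (λ q r → Δℕ r (λ s t → F q s t))) ⟩
  Δℕ (suc n) (λ q r → Δℕ r (λ s t → F q s t)) ∎

Δℕ-counitˡ : ∀ n (F : ℕ → ℚ) → Δℕ n (λ q r → 𝟙 (q ≡ᵇ 0) ⊗ F r) ≡ F n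
Δℕ-counitˡ zero    F = trans (⊕0 (1ℚ ⊗ F 0)) (1⊗ (F 0))
Δℕ-counitˡ (suc n) F = trans (Δℕ-suc n (λ q r → 𝟙 (q ≡ᵇ 0) ⊗ F r))
  (trans (cong₂ _⊕_ (1⊗ (F (suc n))) (∑-zero (splitsℕ n) (λ p → 0⊗ (F (proj₂ p))))) (⊕0 (F (suc n))))

Δℕ-counitʳ : ∀ n (F : ℕ → ℚ) → Δℕ n (λ q r → F q ⊗ 𝟙 (r ≡ᵇ 0)) ≡ F n
Δℕ-counitʳ n F = trans (Δℕ-comm n (λ q r → F q ⊗ 𝟙 (r ≡ᵇ 0)))
  (trans (Δℕ-cong n (λ q r → ℚ.*-comm (F r) (𝟙 (q ≡ᵇ 0)))) (Δℕ-counitˡ n F))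

deg-splitsℕ : ∀ n → All (λ p → proj₁ p + proj₂ p ≡ n) (splitsℕ n)
deg-splitsℕ zero    = refl ∷ []
deg-splitsℕ (suc n) = refl ∷ All.map⁺ (All.map (cong suc) (deg-splitsℕ n))

natC : Coalg
natC = record
  { Pt = ℕ ; deg = id ; splits = splitsℕ ; deg-splits = deg-splitsℕ
  ; coassoc = Δℕ-coassoc ; counitˡ = Δℕ-counitˡ ; counitʳ = Δℕ-counitʳ }

module U = Conv natC

U-comm : ∀ f g → f U.⋆ g U.≐ g U.⋆ f
U-comm f g n = trans (Δℕ-comm n (λ a b → f a ⊗ g b)) (Δℕ-cong n (λ a b → ℚ.*-comm (f b) (g a)))

module UC = U.Commutative U-comm

⋆-suc : ∀ (f g : ℕ → ℚ) n → (f U.⋆ g) (suc n) ≡ f 0 ⊗ g (suc n) ⊕ ((f ∘ suc) U.⋆ g) n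
⋆-suc f g n = Δℕ-suc n (λ a b → f a ⊗ g b)

-- The indeterminate t of the ring of power series `ℕ → ℚ`.
X : ℕ → ℚ
X n = 𝟙 (n ≡ᵇ 1)

X⋆-suc : ∀ g n → (X U.⋆ g) (suc n) ≡ g n
X⋆-suc g n = trans (⋆-suc X g n) (trans (cong (_⊕ (U.one U.⋆ g) n) (0⊗ (g (suc n))))
  (trans (0⊕ ((U.one U.⋆ g) n)) (U.one⋆ g n)))

-- The coefficients of log (1 + t), in the form used by `log1p`; the convention `recip 0 = 0ℚ`
-- supplies the vanishing constant term.
Lg : ℕ → ℚ
Lg m = negOnePow (m ∸ 1) ⊗ recip m

Lg₀ : U.Vanish₀ Lg
Lg₀ .0 refl = refl

-- The Euler derivative of log (1 + t) is t / (1 + t).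
DLg-suc : ∀ k → U.D Lg (suc k) ≡ negOnePow k
DLg-suc k = trans (solve 3 (λ n s r → n :* (s :* r) := (r :* n) :* s) refl (nat (suc k)) (negOnePow k) (recip (suc k)))
  (trans (cong (_⊗ negOnePow k) (recip-nat k)) (1⊗ (negOnePow k)))

-- The coefficient of x^m in exp (c x).
κ : ℚ → ℕ → ℚ
κ c m = pow₁ c m ⊗ recip (m !)

κ-suc : ∀ c m → κ c (suc m) ⊗ nat (suc m) ≡ c ⊗ κ c m
κ-suc c m = trans (solve 4 (λ c p r n → ((c :* p) :* r) :* n := c :* (p :* (r :* n))) refl c (pow₁ c m) (recip (suc m !)) (nat (suc m)))
  (cong (λ z → c ⊗ (pow₁ c m ⊗ z)) (recip-!-suc m))

-- The coefficients of (1 + t)^c = exp (c log (1 + t)).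
E : ℚ → ℕ → ℚ
E c n = Σ< (suc n) (λ m → κ c m ⊗ U.pow Lg m n)

E-extend : ∀ c n N → n < N → E c n ≡ Σ< N (λ m → κ c m ⊗ U.pow Lg m n)
E-extend c n N lt = Σ<-extend (suc n) N lt (λ m n<m → trans (cong (κ c m ⊗_) (U.pow-vanish Lg₀ m n n<m)) (⊗0 (κ c m)))

-- Differentiating the summand with index m + 1 gives c D(log) times the summand with index m. The
-- sum over m < n that remains in degree n is long enough, because D(log) has no constant term.
E-ode : ∀ c → U.D (E c) U.≐ (c U.· U.D Lg) U.⋆ E c
E-ode c n = begin
  nat n ⊗ E c n
    ≡⟨ sym (Σ<-*ˡ (suc n) (nat n) (λ m → κ c m ⊗ U.pow Lg m n)) ⟩
  nat n ⊗ (κ c 0 ⊗ U.one n) ⊕ Σ< n (λ m → nat n ⊗ (κ c (suc m) ⊗ U.pow Lg (suc m) n))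
    ≡⟨ cong₂ _⊕_ (const n) (Σ<-cong n (λ m → step m)) ⟩
  0ℚ ⊕ Σ< n (λ m → c ⊗ (U.D Lg U.⋆ (κ c m U.· U.pow Lg m)) n)
    ≡⟨ 0⊕ _ ⟩
  Σ< n (λ m → c ⊗ (U.D Lg U.⋆ (κ c m U.· U.pow Lg m)) n)
    ≡⟨ Σ<-*ˡ n c (λ m → (U.D Lg U.⋆ (κ c m U.· U.pow Lg m)) n) ⟩
  c ⊗ Σ< n (λ m → (U.D Lg U.⋆ (κ c m U.· U.pow Lg m)) n)
    ≡⟨ cong (c ⊗_) (sym (U.⋆-Σˡ n (U.D Lg) (λ m → κ c m U.· U.pow Lg m) n)) ⟩
  c ⊗ (U.D Lg U.⋆ U.Σf n (λ m → κ c m U.· U.pow Lg m)) n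
    ≡⟨ cong (c ⊗_) (U.⋆-local (U.D-Vanish₀ Lg) n (λ q q<n → sym (E-extend c q n q<n))) ⟩
  c ⊗ (U.D Lg U.⋆ E c) n
    ≡⟨ sym (U.⋆-·ʳ c (U.D Lg) (E c) n) ⟩
  ((c U.· U.D Lg) U.⋆ E c) n ∎
  where
  const : ∀ n → nat n ⊗ (κ c 0 ⊗ U.one n) ≡ 0ℚ
  const zero    = 0⊗ (κ c 0 ⊗ 1ℚ)
  const (suc n) = trans (cong (nat (suc n) ⊗_) (⊗0 (κ c 0))) (⊗0 (nat (suc n)))
  step : ∀ m → nat n ⊗ (κ c (suc m) ⊗ U.pow Lg (suc m) n) ≡ c ⊗ (U.D Lg U.⋆ (κ c m U.· U.pow Lg m)) n
  step m = begin
    nat n ⊗ (κ c (suc m) ⊗ U.pow Lg (suc m) n)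
      ≡⟨ ⊗-swap (nat n) (κ c (suc m)) (U.pow Lg (suc m) n) ⟩
    κ c (suc m) ⊗ U.D (U.pow Lg (suc m)) n
      ≡⟨ cong (κ c (suc m) ⊗_) (UC.D-pow Lg m n) ⟩
    κ c (suc m) ⊗ (nat (suc m) ⊗ (U.D Lg U.⋆ U.pow Lg m) n)
      ≡⟨ sym (ℚ.*-assoc (κ c (suc m)) (nat (suc m)) _) ⟩
    (κ c (suc m) ⊗ nat (suc m)) ⊗ (U.D Lg U.⋆ U.pow Lg m) n
      ≡⟨ cong (_⊗ (U.D Lg U.⋆ U.pow Lg m) n) (κ-suc c m) ⟩
    (c ⊗ κ c m) ⊗ (U.D Lg U.⋆ U.pow Lg m) n
      ≡⟨ ℚ.*-assoc c (κ c m) _ ⟩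
    c ⊗ (κ c m ⊗ (U.D Lg U.⋆ U.pow Lg m) n)
      ≡⟨ cong (c ⊗_) (sym (U.⋆-·ˡ (κ c m) (U.D Lg) (U.pow Lg m) n)) ⟩
    c ⊗ (U.D Lg U.⋆ (κ c m U.· U.pow Lg m)) n ∎

cDLg₀ : ∀ c → U.Vanish₀ (c U.· U.D Lg)
cDLg₀ c n eq = trans (cong (c ⊗_) (U.D-Vanish₀ Lg n eq)) (⊗0 c)

-- Both sides have logarithmic derivative (c + d) t / (1 + t) and constant term 1.
E-⋆ : ∀ c d → E c U.⋆ E d U.≐ E (c ⊕ d)
E-⋆ c d = U.ode-unique {G = (c U.· U.D Lg) U.⊞ (d U.· U.D Lg)}
  (λ n eq → trans (cong₂ _⊕_ (cDLg₀ c n eq) (cDLg₀ d n eq)) refl)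
  (UC.ode-⋆ {c U.· U.D Lg} {d U.· U.D Lg} {E c} {E d} (E-ode c) (E-ode d))
  (λ n → trans (E-ode (c ⊕ d) n) (U.⋆-congʳ (E (c ⊕ d)) (λ m → ℚ.*-distribʳ-+ (U.D Lg m) c d) n))
  (λ { .0 refl → refl })

1+X : ℕ → ℚ
1+X = U.one U.⊞ X

-- 1 + t solves the equation of `E 1ℚ`, since t / (1 + t) times 1 + t is t: from degree 2 on, two
-- consecutive alternating coefficients cancel.
E-1 : E 1ℚ U.≐ 1+X
E-1 = U.ode-unique (cDLg₀ 1ℚ) (E-ode 1ℚ) ode (λ { .0 refl → refl })
  where
  A : ℕ → ℚ
  A = 1ℚ U.· U.D Lg
  split : ∀ n → (A U.⋆ 1+X) n ≡ A n ⊕ (X U.⋆ A) n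
  split n = trans (U.⋆-⊞ˡ A U.one X n) (cong₂ _⊕_ (U.⋆one A n) (U-comm A X n))
  ode : U.D 1+X U.≐ A U.⋆ 1+X
  ode zero          = refl
  ode (suc zero)    = sym (trans (split 1) (trans (cong (A 1 ⊕_) (X⋆-suc A 0)) refl))
  ode (suc (suc n)) = trans (⊗0 (nat (suc (suc n)))) (sym (begin
    (A U.⋆ 1+X) (suc (suc n))               ≡⟨ split (suc (suc n)) ⟩
    A (suc (suc n)) ⊕ (X U.⋆ A) (suc (suc n)) ≡⟨ cong (A (suc (suc n)) ⊕_) (X⋆-suc A (suc n)) ⟩
    A (suc (suc n)) ⊕ A (suc n)             ≡⟨ cong₂ _⊕_ (A-suc (suc n)) (A-suc n) ⟩
    negOnePow (suc n) ⊕ negOnePow n         ≡⟨ ℚ.+-inverseˡ (negOnePow n) ⟩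
    0ℚ ∎))
    where
    A-suc : ∀ k → A (suc k) ≡ negOnePow k
    A-suc k = trans (1⊗ (U.D Lg (suc k))) (DLg-suc k)

E-0 : E 0ℚ U.≐ U.one
E-0 = U.ode-unique (cDLg₀ 0ℚ) (E-ode 0ℚ)
  (λ n → trans (const n) (sym (trans (U.⋆-·ʳ 0ℚ (U.D Lg) U.one n) (0⊗ ((U.D Lg U.⋆ U.one) n))))) (λ { .0 refl → refl })
  where
  const : ∀ n → nat n ⊗ U.one n ≡ 0ℚ
  const zero    = refl
  const (suc n) = ⊗0 (nat (suc n))

-- Substitution of an element without constant term into a power series.

module Subst (C : Coalg) (F : Coalg.Pt C → ℚ) (F₀ : Conv.Vanish₀ C F) where
  open Conv C

  trunc : ℕ → (ℕ → ℚ) → Fun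
  trunc N a = Σf N (λ j → a j · pow F j)

  φ : (ℕ → ℚ) → Fun
  φ a p = trunc (suc (deg p)) a p

  φ-extend : ∀ a N p → deg p < N → φ a p ≡ trunc N a p
  φ-extend a N p lt = Σ<-extend (suc (deg p)) N lt
    (λ j p<j → trans (cong (a j ⊗_) (pow-vanish F₀ j p p<j)) (⊗0 (a j)))

  trunc-cong : ∀ N {a b} → (∀ j → a j ≡ b j) → trunc N a ≐ trunc N b
  trunc-cong N eq p = Σ<-cong N (λ j → cong (_⊗ pow F j p) (eq j))

  φ-cong : ∀ {a b} → (∀ j → a j ≡ b j) → φ a ≐ φ b
  φ-cong eq p = trunc-cong (suc (deg p)) eq p

  trunc-⊞ : ∀ N a b → trunc N (a U.⊞ b) ≐ trunc N a ⊞ trunc N b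
  trunc-⊞ N a b p = trans (Σ<-cong N (λ j → ℚ.*-distribʳ-+ (pow F j p) (a j) (b j)))
    (Σ<-⊕ N (λ j → a j ⊗ pow F j p) (λ j → b j ⊗ pow F j p))

  trunc-· : ∀ N c a → trunc N (c U.· a) ≐ c · trunc N a
  trunc-· N c a p = trans (Σ<-cong N (λ j → ℚ.*-assoc c (a j) (pow F j p))) (Σ<-*ˡ N c (λ j → a j ⊗ pow F j p))

  horner : ∀ N a → trunc (suc N) a ≐ a 0 · one ⊞ F ⋆ trunc N (a ∘ suc)
  horner N a p = cong (a 0 ⊗ one p ⊕_) (sym (trans (⋆-Σˡ N F (λ j → a (suc j) · pow F j) p)
    (Σ<-cong N (λ j → ⋆-·ˡ (a (suc j)) F (pow F j) p))))

  -- Induction on N by Horner's scheme. After the constant term of a is split off, the rest carries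
  -- a factor F, hence only degrees below `deg p` are met and truncation at N instead of N + 1 is
  -- enough there.
  trunc-⋆ : ∀ N a b p → deg p < N → (trunc N a ⋆ trunc N b) p ≡ trunc N (a U.⋆ b) p
  trunc-⋆ (suc N) a b p (s≤s p≤N) = begin
    (trunc (suc N) a ⋆ trunc (suc N) b) p
      ≡⟨ ⋆-congʳ (trunc (suc N) b) (horner N a) p ⟩
    ((a 0 · one ⊞ F ⋆ trunc N (a ∘ suc)) ⋆ trunc (suc N) b) p
      ≡⟨ ⋆-⊞ʳ (a 0 · one) (F ⋆ trunc N (a ∘ suc)) (trunc (suc N) b) p ⟩
    ((a 0 · one) ⋆ trunc (suc N) b) p ⊕ ((F ⋆ trunc N (a ∘ suc)) ⋆ trunc (suc N) b) p
      ≡⟨ cong₂ _⊕_ left right ⟩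
    (a 0 ⊗ (b 0 ⊗ one p) ⊕ (F ⋆ (a 0 · trunc N (b ∘ suc))) p) ⊕ (F ⋆ trunc N ((a ∘ suc) U.⋆ b)) p
      ≡⟨ ℚ.+-assoc (a 0 ⊗ (b 0 ⊗ one p)) _ _ ⟩
    a 0 ⊗ (b 0 ⊗ one p) ⊕ ((F ⋆ (a 0 · trunc N (b ∘ suc))) p ⊕ (F ⋆ trunc N ((a ∘ suc) U.⋆ b)) p)
      ≡⟨ cong₂ _⊕_ head tail ⟩
    (a U.⋆ b) 0 ⊗ one p ⊕ (F ⋆ trunc N ((a U.⋆ b) ∘ suc)) p
      ≡⟨ sym (horner N (a U.⋆ b) p) ⟩
    trunc (suc N) (a U.⋆ b) p ∎
    where
    left : ((a 0 · one) ⋆ trunc (suc N) b) p ≡ a 0 ⊗ (b 0 ⊗ one p) ⊕ (F ⋆ (a 0 · trunc N (b ∘ suc))) p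
    left = trans (⋆-·ʳ (a 0) one (trunc (suc N) b) p) (trans (cong (a 0 ⊗_) (trans (one⋆ (trunc (suc N) b) p) (horner N b p)))
      (trans (ℚ.*-distribˡ-+ (a 0) (b 0 ⊗ one p) _)
        (cong (a 0 ⊗ (b 0 ⊗ one p) ⊕_) (sym (⋆-·ˡ (a 0) F (trunc N (b ∘ suc)) p)))))
    right : ((F ⋆ trunc N (a ∘ suc)) ⋆ trunc (suc N) b) p ≡ (F ⋆ trunc N ((a ∘ suc) U.⋆ b)) p
    right = trans (⋆-assoc F (trunc N (a ∘ suc)) (trunc (suc N) b) p) (⋆-local F₀ p (λ q q<p →
      trans (⋆-cong-deg {trunc N (a ∘ suc)} {trunc N (a ∘ suc)} q (λ _ _ → refl) (λ r r≤q → trans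
              (sym (φ-extend b (suc N) r (s≤s (ℕ.≤-trans r≤q (ℕ.≤-trans (ℕ.<⇒≤ q<p) p≤N)))))
              (φ-extend b N r (ℕ.≤-<-trans r≤q (ℕ.<-≤-trans q<p p≤N)))))
        (trunc-⋆ N (a ∘ suc) b q (ℕ.<-≤-trans q<p p≤N))))
    head : a 0 ⊗ (b 0 ⊗ one p) ≡ (a U.⋆ b) 0 ⊗ one p
    head = trans (sym (ℚ.*-assoc (a 0) (b 0) (one p))) (cong (_⊗ one p) (sym (⊕0 (a 0 ⊗ b 0))))
    tail : (F ⋆ (a 0 · trunc N (b ∘ suc))) p ⊕ (F ⋆ trunc N ((a ∘ suc) U.⋆ b)) p ≡ (F ⋆ trunc N ((a U.⋆ b) ∘ suc)) p
    tail = trans (sym (⋆-⊞ˡ F (a 0 · trunc N (b ∘ suc)) (trunc N ((a ∘ suc) U.⋆ b)) p)) (⋆-congˡ F (λ q →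
      trans (cong (_⊕ trunc N ((a ∘ suc) U.⋆ b) q) (sym (trunc-· N (a 0) (b ∘ suc) q)))
        (trans (sym (trunc-⊞ N (a 0 U.· (b ∘ suc)) ((a ∘ suc) U.⋆ b) q))
          (trunc-cong N (λ j → sym (⋆-suc a b j)) q))) p)

  -- Substitution is an algebra homomorphism. Powers of one element commute with each other, so
  -- identities of the commutative ring of series in t hold in any convolution algebra.
  φ-⋆ : ∀ a b → φ a ⋆ φ b ≐ φ (a U.⋆ b)
  φ-⋆ a b p = trans
    (⋆-cong-deg p (λ q q≤p → φ-extend a (suc (deg p)) q (s≤s q≤p)) (λ q q≤p → φ-extend b (suc (deg p)) q (s≤s q≤p)))
    (trunc-⋆ (suc (deg p)) a b p (ℕ.n<1+n _))

  φ-one : φ U.one ≐ one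
  φ-one p = trans (Σ<-single (suc (deg p)) 0 {λ j → U.one j ⊗ pow F j p} (s≤s z≤n) (λ { zero i≢0 → ⊥-elim (i≢0 refl) ; (suc i) _ → 0⊗ (pow F (suc i) p) }))
    (1⊗ (one p))

  φ-pow : ∀ a k → pow (φ a) k ≐ φ (U.pow a k)
  φ-pow a zero    = ≐-sym φ-one
  φ-pow a (suc k) = ≐-trans (⋆-congˡ (φ a) (φ-pow a k)) (φ-⋆ a (U.pow a k))

  φ-1+X : φ 1+X ≐ one ⊞ F
  φ-1+X p = begin
    trunc (suc (deg p)) 1+X p                 ≡⟨ φ-extend 1+X (suc (suc (deg p))) p (ℕ.m<n⇒m<1+n (ℕ.n<1+n _)) ⟩
    trunc (suc (suc (deg p))) 1+X p           ≡⟨ cong₂ (λ x y → x ⊕ (y ⊕ Σ< (deg p) (λ i → 0ℚ ⊗ pow F (suc (suc i)) p))) (1⊗ (one p)) (1⊗ ((F ⋆ one) p)) ⟩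
    one p ⊕ ((F ⋆ one) p ⊕ Σ< (deg p) (λ i → 0ℚ ⊗ pow F (suc (suc i)) p))
      ≡⟨ cong (one p ⊕_) (trans (cong₂ _⊕_ (⋆one F p) (Σ<-zero< (deg p) (λ i _ → 0⊗ (pow F (suc (suc i)) p)))) (⊕0 (F p))) ⟩
    one p ⊕ F p ∎

  -- For integral exponents the binomial series is the iterated product; this ties rational powers
  -- to the computable words V_A.
  pow-1+ : ∀ m → pow (one ⊞ F) m ≐ φ (E (nat m))
  pow-1+ zero    p = trans (sym (φ-one p)) (φ-cong (λ j → sym (E-0 j)) p)
  pow-1+ (suc m) p = trans (⋆-cong (λ q → trans (sym (φ-1+X q)) (φ-cong (λ j → sym (E-1 j)) q)) (pow-1+ m) p)
    (trans (φ-⋆ (E 1ℚ) (E (nat m)) p) (φ-cong (E-⋆ 1ℚ (nat m)) p))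

  φE-⋆ : ∀ c d → φ (E c) ⋆ φ (E d) ≐ φ (E (c ⊕ d))
  φE-⋆ c d p = trans (φ-⋆ (E c) (E d) p) (φ-cong (E-⋆ c d) p)

  -- The power (1 + F)^c is a polynomial in c in each degree.
  φE-expand : ∀ c p → φ (E c) p ≡ Σ< (suc (deg p)) (λ m → κ c m ⊗ φ (U.pow Lg m) p)
  φE-expand c p = begin
    Σ< N (λ j → E c j ⊗ pow F j p)
      ≡⟨ Σ<-cong< N (λ j j<N → trans (cong (_⊗ pow F j p) (E-extend c j N j<N))
           (sym (Σ<-*ʳ N (pow F j p) (λ m → κ c m ⊗ U.pow Lg m j)))) ⟩
    Σ< N (λ j → Σ< N (λ m → (κ c m ⊗ U.pow Lg m j) ⊗ pow F j p))
      ≡⟨ Σ<-swap N N (λ j m → (κ c m ⊗ U.pow Lg m j) ⊗ pow F j p) ⟩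
    Σ< N (λ m → Σ< N (λ j → (κ c m ⊗ U.pow Lg m j) ⊗ pow F j p))
      ≡⟨ Σ<-cong N (λ m → trans (Σ<-cong N (λ j → ℚ.*-assoc (κ c m) (U.pow Lg m j) (pow F j p)))
           (Σ<-*ˡ N (κ c m) (λ j → U.pow Lg m j ⊗ pow F j p))) ⟩
    Σ< N (λ m → κ c m ⊗ φ (U.pow Lg m) p) ∎
    where
    N : ℕ
    N = suc (deg p)

-- Interpolation

evalL : List ℚ → ℚ → ℚ
evalL []       t = 0ℚ
evalL (x ∷ xs) t = x ⊕ t ⊗ evalL xs t

-- The quotient by t - r, by synthetic division: its coefficients are the intermediate values of
-- Horner's scheme at r.
quoL : List ℚ → ℚ → List ℚ
quoL []            r = []
quoL (x ∷ [])      r = []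
quoL (x ∷ y ∷ xs)  r = evalL (y ∷ xs) r ∷ quoL (y ∷ xs) r

quoL-spec : ∀ xs r t → evalL xs t ≡ evalL xs r ⊕ (t ⊕ ⊝ r) ⊗ evalL (quoL xs r) t
quoL-spec []       r t = sym (trans (0⊕ ((t ⊕ ⊝ r) ⊗ 0ℚ)) (⊗0 (t ⊕ ⊝ r)))
quoL-spec (x ∷ []) r t = solve 3 (λ x r t → x :+ t :* con 0ℚ := (x :+ r :* con 0ℚ) :+ (t :+ :- r) :* con 0ℚ) refl x r t
quoL-spec (x ∷ y ∷ xs) r t = trans (cong (λ z → x ⊕ t ⊗ z) (quoL-spec (y ∷ xs) r t))
  (solve 5 (λ x r t e q → x :+ t :* (e :+ (t :+ :- r) :* q) := (x :+ r :* e) :+ (t :+ :- r) :* (e :+ t :* q)) refl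
    x r t (evalL (y ∷ xs) r) (evalL (quoL (y ∷ xs) r) t))

length-quoL : ∀ x xs r → length (quoL (x ∷ xs) r) ≡ length xs
length-quoL x []       r = refl
length-quoL x (y ∷ xs) r = cong suc (length-quoL y xs r)

⊕⊗0 : ∀ {x} r {z} → z ≡ 0ℚ → x ⊕ r ⊗ z ≡ 0ℚ → x ≡ 0ℚ
⊕⊗0 {x} r eqz eq = trans (sym (trans (cong (x ⊕_) (trans (cong (r ⊗_) eqz) (⊗0 r))) (⊕0 x))) eq

-- The coefficients of the quotient are the Horner values of the tails at r. When they and the
-- remainder vanish, each coefficient is a difference of vanishing terms.
quoL-zero : ∀ x xs r → evalL (x ∷ xs) r ≡ 0ℚ → All (_≡ 0ℚ) (quoL (x ∷ xs) r) → All (_≡ 0ℚ) (x ∷ xs)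
quoL-zero x []       r eq []         = ⊕⊗0 r refl eq ∷ []
quoL-zero x (y ∷ xs) r eq (eq′ ∷ qs) = ⊕⊗0 r eq′ eq ∷ quoL-zero y xs r eq′ qs

⊗-cancel-0 : ∀ a b → a ≢ 0ℚ → a ⊗ b ≡ 0ℚ → b ≡ 0ℚ
⊗-cancel-0 a b a≢0 eq = begin
  b                    ≡⟨ sym (1⊗ b) ⟩
  1ℚ ⊗ b               ≡⟨ cong (_⊗ b) (sym (ℚ.*-inverseˡ a {{nz}})) ⟩
  (1/a ⊗ a) ⊗ b        ≡⟨ ℚ.*-assoc 1/a a b ⟩
  1/a ⊗ (a ⊗ b)        ≡⟨ cong (1/a ⊗_) eq ⟩
  1/a ⊗ 0ℚ             ≡⟨ ⊗0 1/a ⟩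
  0ℚ ∎
  where
  nz : ℚ.NonZero a
  nz = ℚ.≢-nonZero a≢0
  1/a : ℚ
  1/a = ℚ.1/_ a {{nz}}

-- Divide by t - r 0. The remaining points are roots of the quotient, which is shorter by one; an
-- infinite injective family of roots spares any count of them.
roots⇒zero : ∀ N xs → length xs ≡ N → (r : ℕ → ℚ) → (∀ i j → r i ≡ r j → i ≡ j) →
             (∀ m → evalL xs (r m) ≡ 0ℚ) → All (_≡ 0ℚ) xs
roots⇒zero zero    []       _   r inj ev = []
roots⇒zero (suc N) (x ∷ xs) len r inj ev = quoL-zero x xs (r 0) (ev 0)
  (roots⇒zero N (quoL (x ∷ xs) (r 0)) (trans (length-quoL x xs (r 0)) (ℕ.suc-injective len)) (r ∘ suc)
    (λ i j eq → ℕ.suc-injective (inj (suc i) (suc j) eq))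
    (λ m → ⊗-cancel-0 (r (suc m) ⊕ ⊝ r 0) _ (λ eq → ℕ.1+n≢0 (inj (suc m) 0 (diff (r (suc m)) (r 0) eq)))
      (trans (sym (trans (cong (_⊕ Q m) (ev 0)) (0⊕ (Q m))))
        (trans (sym (quoL-spec (x ∷ xs) (r 0) (r (suc m)))) (ev (suc m))))))
  where
  Q : ℕ → ℚ
  Q m = (r (suc m) ⊕ ⊝ r 0) ⊗ evalL (quoL (x ∷ xs) (r 0)) (r (suc m))
  diff : ∀ a b → a ⊕ ⊝ b ≡ 0ℚ → a ≡ b
  diff a b eq = trans (solve 2 (λ a b → a := (a :+ :- b) :+ b) refl a b) (trans (cong (_⊕ b) eq) (0⊕ b))

Σ<-evalL : ∀ N x t → Σ< N (λ k → pow₁ t k ⊗ x k) ≡ evalL (applyUpTo x N) t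
Σ<-evalL zero    x t = refl
Σ<-evalL (suc N) x t = cong₂ _⊕_ (1⊗ (x 0)) (trans (Σ<-cong N (λ k → ℚ.*-assoc t (pow₁ t k) (x (suc k))))
  (trans (Σ<-*ˡ N t (λ k → pow₁ t k ⊗ x (suc k))) (cong (t ⊗_) (Σ<-evalL N (x ∘ suc) t))))

-- Coefficients are recovered from values at infinitely many points. The points will be the even or
-- the odd numbers, where the generating polynomials of I_k or J_k are products of the series V₁^±.
interpolate : ∀ N (x y : ℕ → ℚ) (r : ℕ → ℚ) → (∀ i j → r i ≡ r j → i ≡ j) →
              (∀ m → Σ< N (λ k → pow₁ (r m) k ⊗ x k) ≡ Σ< N (λ k → pow₁ (r m) k ⊗ y k)) →
              ∀ k → k < N → x k ≡ y k
interpolate N x y r inj eq k k<N = trans (solve 2 (λ a b → a := (a :+ :- b) :+ b) refl (x k) (y k))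
  (trans (cong (_⊕ y k) (All.applyUpTo⁻ d N (roots⇒zero N (applyUpTo d N) (L.length-applyUpTo d N) r inj ev) k<N)) (0⊕ (y k)))
  where
  d : ℕ → ℚ
  d k = x k ⊕ ⊝ y k
  ev : ∀ m → evalL (applyUpTo d N) (r m) ≡ 0ℚ
  ev m = begin
    evalL (applyUpTo d N) (r m)
      ≡⟨ sym (Σ<-evalL N d (r m)) ⟩
    Σ< N (λ k → pow₁ (r m) k ⊗ (x k ⊕ ⊝ y k))
      ≡⟨ Σ<-cong N (λ k → solve 3 (λ p a b → p :* (a :+ :- b) := p :* a :+ (:- (con 1ℚ)) :* (p :* b)) refl (pow₁ (r m) k) (x k) (y k)) ⟩
    Σ< N (λ k → pow₁ (r m) k ⊗ x k ⊕ (⊝ 1ℚ) ⊗ (pow₁ (r m) k ⊗ y k))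
      ≡⟨ Σ<-⊕ N (λ k → pow₁ (r m) k ⊗ x k) (λ k → (⊝ 1ℚ) ⊗ (pow₁ (r m) k ⊗ y k)) ⟩
    Sx ⊕ Σ< N (λ k → (⊝ 1ℚ) ⊗ (pow₁ (r m) k ⊗ y k))
      ≡⟨ cong₂ _⊕_ (eq m) (Σ<-*ˡ N (⊝ 1ℚ) (λ k → pow₁ (r m) k ⊗ y k)) ⟩
    Sy ⊕ (⊝ 1ℚ) ⊗ Sy
      ≡⟨ solve 1 (λ s → s :+ (:- (con 1ℚ)) :* s := con 0ℚ) refl Sy ⟩
    0ℚ ∎
    where
    Sx Sy : ℚ
    Sx = Σ< N (λ k → pow₁ (r m) k ⊗ x k)
    Sy = Σ< N (λ k → pow₁ (r m) k ⊗ y k)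

nat-injective : ∀ i j → nat i ≡ nat j → i ≡ j
nat-injective zero    zero    eq = refl
nat-injective zero    (suc j) eq = ⊥-elim (nat-suc≢0 j (sym eq))
nat-injective (suc i) zero    eq = ⊥-elim (nat-suc≢0 i eq)
nat-injective (suc i) (suc j) eq = cong suc (nat-injective i j (trans (lem (nat i)) (trans (cong (⊝ 1ℚ ⊕_) eq) (sym (lem (nat j))))))
  where
  lem : ∀ x → x ≡ ⊝ 1ℚ ⊕ (1ℚ ⊕ x)
  lem = solve 1 (λ x → x := (:- (con 1ℚ)) :+ (con 1ℚ :+ x)) refl

double : ℕ → ℕ
double zero    = zero
double (suc m) = suc (suc (double m))

double-injective : ∀ i j → double i ≡ double j → i ≡ j
double-injective zero    zero    eq = refl
double-injective (suc i) (suc j) eq = cong suc (double-injective i j (ℕ.suc-injective (ℕ.suc-injective eq)))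

even-inj : ∀ i j → nat (double i) ≡ nat (double j) → i ≡ j
even-inj i j eq = double-injective i j (nat-injective (double i) (double j) eq)

odd-inj : ∀ i j → nat (suc (double i)) ≡ nat (suc (double j)) → i ≡ j
odd-inj i j eq = double-injective i j (ℕ.suc-injective (nat-injective (suc (double i)) (suc (double j)) eq))

nat-double-½ : ∀ m → nat (double m) ⊗ ½ ≡ nat m
nat-double-½ zero    = refl
nat-double-½ (suc m) = trans (lem (nat (double m))) (cong (1ℚ ⊕_) (nat-double-½ m))
  where
  lem : ∀ x → (1ℚ ⊕ (1ℚ ⊕ x)) ⊗ ½ ≡ 1ℚ ⊕ x ⊗ ½
  lem = solve 1 (λ x → (con 1ℚ :+ (con 1ℚ :+ x)) :* con ½ := con 1ℚ :+ x :* con ½) refl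

pow₁-⊗ : ∀ a b k → pow₁ (a ⊗ b) k ≡ pow₁ a k ⊗ pow₁ b k
pow₁-⊗ a b zero    = refl
pow₁-⊗ a b (suc k) = trans (cong ((a ⊗ b) ⊗_) (pow₁-⊗ a b k)) (⊗-interchange a b (pow₁ a k) (pow₁ b k))

pow₁-neg : ∀ t k → pow₁ (⊝ t) k ≡ negOnePow k ⊗ pow₁ t k
pow₁-neg t zero    = refl
pow₁-neg t (suc k) = trans (cong (⊝ t ⊗_) (pow₁-neg t k))
  (solve 3 (λ t n p → (:- t) :* (n :* p) := (:- n) :* (t :* p)) refl t (negOnePow k) (pow₁ t k))

-- Realisations of the external algebra

csum : Comp → ℕ
csum = foldr _+_ 0

-- Formal sums may contain arbitrary lists. A realisation is only asked to respect products of
-- compositions with positive parts and to vanish off their degree, so both conditions are carried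
-- along.
Valid : ℕ → Comp → Set
Valid d I = All (1 ≤_) I × csum I ≡ d

ValidF : ℕ → FSum → Set
ValidF d = All (λ cI → Valid d (proj₂ cI))

ValidS : Ser → Set
ValidS F = ∀ d → ValidF d (F d)

valid-scaleF : ∀ {d} c {x} → ValidF d x → ValidF d (scaleF c x)
valid-scaleF c v = All.map⁺ v

valid-concatMap : ∀ {A : Set} {d} (k : A → FSum) {xs} → All (λ a → ValidF d (k a)) xs → ValidF d (concatMap k xs)
valid-concatMap k v = All.concat⁺ (All.map⁺ v)

csum-++ : ∀ I J → csum (I ++ J) ≡ csum I + csum J
csum-++ []      J = refl
csum-++ (i ∷ I) J = trans (cong (i +_) (csum-++ I J)) (sym (ℕ.+-assoc i (csum I) (csum J)))

valid-merge : ∀ i I j js → All (1 ≤_) (i ∷ I) → All (1 ≤_) (j ∷ js) →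
              Valid (csum (i ∷ I) + csum (j ∷ js)) (mergeLast (i ∷ I) j js)
valid-merge i []       j js (pi ∷ _)   (pj ∷ pjs) = (ℕ.≤-trans pi (ℕ.m≤m+n i j) ∷ pjs) ,
  trans (ℕ.+-assoc i j (csum js)) (cong (_+ (j + csum js)) (sym (ℕ.+-identityʳ i)))
valid-merge i (i′ ∷ I) j js (pi ∷ pis) pj with valid-merge i′ I j js pis pj
... | ps , eq = (pi ∷ ps) , trans (cong (λ z → i + z) eq) (sym (ℕ.+-assoc i (i′ + csum I) (j + csum js)))

valid-extR : ∀ {a b} I J → Valid a I → Valid b J → ValidF (a + b) (extR I J)
valid-extR []      J       (_ , refl)  vJ          = vJ ∷ []
valid-extR (i ∷ I) []      (pI , refl) (_ , refl)  = (pI , sym (ℕ.+-identityʳ _)) ∷ []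
valid-extR (i ∷ I) (j ∷ J) (pI , refl) (pJ , refl) =
  (All.++⁺ pI pJ , csum-++ (i ∷ I) (j ∷ J)) ∷ valid-merge i I j J pI pJ ∷ []

valid-mulF : ∀ {a b x y} → ValidF a x → ValidF b y → ValidF (a + b) (mulF x y)
valid-mulF vx vy = valid-concatMap _ (All.map (λ {cI} vI →
  valid-concatMap _ (All.map (λ {cJ} vJ → valid-scaleF (proj₁ cI ⊗ proj₁ cJ) (valid-extR (proj₂ cI) (proj₂ cJ) vI vJ)) vy)) vx)

valid-mulS : ∀ {F G} → ValidS F → ValidS G → ValidS (mulS F G)
valid-mulS {F} {G} vF vG d = valid-concatMap _ (All.applyUpTo⁺₁ id (suc d) (λ {a} a<d →
  subst (λ z → ValidF z (mulF (F a) (G (d ∸ a)))) (ℕ.m+[n∸m]≡n (s≤s⁻¹ a<d)) (valid-mulF (vF a) (vG (d ∸ a)))))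

valid-oneS : ValidS oneS
valid-oneS zero    = ([] , refl) ∷ []
valid-oneS (suc d) = []

valid-powS : ∀ {F} → ValidS F → ∀ m → ValidS (powS F m)
valid-powS vF zero    = valid-oneS
valid-powS vF (suc m) = valid-mulS vF (valid-powS vF m)

valid-minusOne : ∀ {G} → ValidS G → ValidS (minusOne G)
valid-minusOne vG zero    = All.++⁺ (vG zero) (([] , refl) ∷ [])
valid-minusOne vG (suc d) = vG (suc d)

valid-log1p : ∀ {F} → ValidS F → ValidS (log1p F)
valid-log1p {F} vF d = valid-concatMap (λ m → scaleF (negOnePow (m ∸ 1) ⊗ recip m) (powS F m d)) (All.universal (λ m → valid-scaleF (negOnePow (m ∸ 1) ⊗ recip m) (valid-powS vF m d)) (from1 d))

valid-expS : ∀ {F} → ValidS F → ValidS (expS F)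
valid-expS {F} vF d = valid-concatMap (λ m → scaleF (recip (m !)) (powS F m d)) (All.universal (λ m → valid-scaleF (recip (m !)) (valid-powS vF m d)) (upTo (suc d)))

valid-scaleS : ∀ c {F} → ValidS F → ValidS (scaleS c F)
valid-scaleS c vF d = valid-scaleF c (vF d)

valid-V1p : ValidS V1p
valid-V1p zero    = ([] , refl) ∷ []
valid-V1p (suc i) = ((s≤s z≤n ∷ []) , ℕ.+-identityʳ (suc i)) ∷ []

csum-ones : ∀ i → csum (replicate i 1) ≡ i
csum-ones zero    = refl
csum-ones (suc i) = cong suc (csum-ones i)

valid-V1m : ValidS V1m
valid-V1m i = (All.replicate⁺ i (s≤s z≤n) , csum-ones i) ∷ []

-- The sign true stands for + and false for −.
V₁ : Bool → Ser
V₁ true  = V1p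
V₁ false = V1m

V₂ : Bool → Ser
V₂ true  = V2p
V₂ false = V2m

Is Js : Bool → ℕ → Ser
Is true  = Ip
Is false = Im
Js true  = Jp
Js false = Jm

valid-V₁ : ∀ s → ValidS (V₁ s)
valid-V₁ true  = valid-V1p
valid-V₁ false = valid-V1m

valid-V₂ : ∀ s → ValidS (V₂ s)
valid-V₂ true  = valid-mulS valid-V1p valid-V1m
valid-V₂ false = valid-mulS valid-V1m valid-V1p

valid-logS : ∀ {G} → ValidS G → ValidS (logS G)
valid-logS vG = valid-log1p (valid-minusOne vG)

-- I_k and J_k with the underlying series as parameters, so that both signs are treated by one
-- argument.
Iof : Ser → ℕ → Ser
Iof G k = scaleS (recip (k !)) (powS (scaleS ½ (logS G)) k)

Jof : Ser → Ser → ℕ → Ser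
Jof V G k = mulS (mulS V (powRat G (⊝ ½))) (Iof G k)

Is≡Iof : ∀ s k → Is s k ≡ Iof (V₂ s) k
Is≡Iof true  k = refl
Is≡Iof false k = refl

Js≡Jof : ∀ s k → Js s k ≡ Jof (V₁ s) (V₂ (not s)) k
Js≡Jof true  k = refl
Js≡Jof false k = refl

valid-Iof : ∀ {G} → ValidS G → ∀ k → ValidS (Iof G k)
valid-Iof vG k = valid-scaleS (recip (k !)) (valid-powS (valid-scaleS ½ (valid-logS vG)) k)

valid-powRat : ∀ {G} → ValidS G → ∀ c → ValidS (powRat G c)
valid-powRat vG c = valid-expS (valid-scaleS c (valid-logS vG))

valid-Jof : ∀ {V G} → ValidS V → ValidS G → ∀ k → ValidS (Jof V G k)
valid-Jof vV vG k = valid-mulS (valid-mulS vV (valid-powRat vG (⊝ ½))) (valid-Iof vG k)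

valid-Is : ∀ s k → ValidS (Is s k)
valid-Is true  k = valid-Iof (valid-V₂ true) k
valid-Is false k = valid-Iof (valid-V₂ false) k

valid-Js : ∀ s k → ValidS (Js s k)
valid-Js true  k = valid-Jof (valid-V₁ true) (valid-V₂ false) k
valid-Js false k = valid-Jof (valid-V₁ false) (valid-V₂ true) k

Δℕ-Σ< : ∀ d H → Σ< (suc d) (λ a → H a (d ∸ a)) ≡ Δℕ d H
Δℕ-Σ< zero    H = refl
Δℕ-Σ< (suc d) H = trans (cong (H 0 (suc d) ⊕_) (Δℕ-Σ< d (λ a c → H (suc a) c))) (sym (Δℕ-suc d H))

Δℕ-single : ∀ x y H → (∀ a c → a ≢ x → H a c ≡ 0ℚ) → Δℕ (x + y) H ≡ H x y
Δℕ-single zero    zero    H z = ⊕0 (H 0 0)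
Δℕ-single zero    (suc y) H z = trans (Δℕ-suc y H)
  (trans (cong (H 0 (suc y) ⊕_) (∑-zero (splitsℕ y) (λ p → z (suc (proj₁ p)) (proj₂ p) λ ()))) (⊕0 (H 0 (suc y))))
Δℕ-single (suc x) y       H z = trans (Δℕ-suc (x + y) H)
  (trans (cong₂ _⊕_ (z 0 (suc (x + y)) λ ()) (Δℕ-single x y (λ a c → H (suc a) c) (λ a c a≢x → z (suc a) c (a≢x ∘ ℕ.suc-injective))))
    (0⊕ (H (suc x) y)))

-- A graded realisation of the external algebra: b I is the image of the ribbon R_I.
record Interp : Set₁ where
  field
    coalg : Coalg
  open Conv coalg
  field
    b      : Comp → Fun
    b-[]   : b [] ≐ one
    b-step : ∀ i j r → b (suc i ∷ []) ⋆ b (suc j ∷ r) ≐ b (suc i ∷ suc j ∷ r) ⊞ b ((suc i + suc j) ∷ r)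
    b-deg  : ∀ {d} I → Valid d I → ∀ p → deg p ≢ d → b I p ≡ 0ℚ

module Realisation (K : Interp) where
  open Interp K public
  open Conv coalg public

  ev : FSum → Fun
  ev x p = ∑₂ x (λ c I → c ⊗ b I p)

  -- At p only the component of degree `deg p` is evaluated; by `ev-deg` any other component
  -- vanishes there.
  evS : Ser → Fun
  evS F p = ev (F (deg p)) p

  ev-scaleF : ∀ c x p → ev (scaleF c x) p ≡ c ⊗ ev x p
  ev-scaleF c []            p = sym (⊗0 c)
  ev-scaleF c ((a , I) ∷ x) p = trans (cong₂ _⊕_ (ℚ.*-assoc c a (b I p)) (ev-scaleF c x p))
    (sym (ℚ.*-distribˡ-+ c (a ⊗ b I p) (ev x p)))

  ev-++ : ∀ x y p → ev (x ++ y) p ≡ ev x p ⊕ ev y p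
  ev-++ x y p = ∑-++ x y (λ cI → proj₁ cI ⊗ b (proj₂ cI) p)

  ev-concatMap : ∀ {A : Set} (k : A → FSum) xs p → ev (concatMap k xs) p ≡ ∑ xs (λ a → ev (k a) p)
  ev-concatMap k xs p = ∑-concatMap k xs (λ cI → proj₁ cI ⊗ b (proj₂ cI) p)

  ev-deg : ∀ {d} x → ValidF d x → ∀ p → deg p ≢ d → ev x p ≡ 0ℚ
  ev-deg x v p neq = ∑-zero-All (All.map (λ {cI} vI → trans (cong (proj₁ cI ⊗_) (b-deg (proj₂ cI) vI p neq)) (⊗0 (proj₁ cI))) v)

  mergeLast-head : ∀ i i′ is j js → 1 ≤ i′ → Σ ℕ λ h → Σ Comp λ t →
    mergeLast (i′ ∷ is) j js ≡ suc h ∷ t × mergeLast ((i + i′) ∷ is) j js ≡ (i + suc h) ∷ t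
  mergeLast-head i (suc i′) []       j js _ = i′ + j , js , refl , cong (_∷ js) (ℕ.+-assoc i (suc i′) j)
  mergeLast-head i (suc i′) (x ∷ is) j js _ = i′ , mergeLast (x ∷ is) j js , refl , refl

  -- A realisation postulates products only for a left factor with one part. For more parts, R_(i)
  -- times R_(i′,...) is the sum of R_A and a ribbon with one part fewer; multiply by R_J,
  -- reassociate, and subtract the equation known for the shorter ribbon.
  b-merge : ∀ i is j js → All (1 ≤_) (i ∷ is) → 1 ≤ j →
            b (i ∷ is) ⋆ b (j ∷ js) ≐ b ((i ∷ is) ++ (j ∷ js)) ⊞ b (mergeLast (i ∷ is) j js)
  b-merge zero    _             _       _  (() ∷ _)         _
  b-merge (suc i) []            (suc j) js _                _  = b-step i j js
  b-merge (suc i) (suc i′ ∷ is) (suc j) js (pi ∷ pi′ ∷ pis) pj p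
    with mergeLast-head (suc i) (suc i′) is (suc j) js (s≤s z≤n)
  ... | h , t , eq₁ , eq₂ = cancel {(b A ⋆ b J) p} {(b B′ ⋆ b J) p} {b P p} {b (B′ ++ J) p} {b R p} {b S p} sum₁ (b-merge (suc i + suc i′) is (suc j) js (s≤s z≤n ∷ pis) pj p)
    where
    A B′ P R S : Comp
    A = suc i ∷ suc i′ ∷ is
    B′ = (suc i + suc i′) ∷ is
    J : Comp
    J = suc j ∷ js
    P = A ++ J
    R = mergeLast A (suc j) js
    S = mergeLast B′ (suc j) js
    cancel : ∀ {x y u v w z : ℚ} → x ⊕ y ≡ (u ⊕ v) ⊕ (w ⊕ z) → y ≡ v ⊕ z → x ≡ u ⊕ w
    cancel {x} {y} {u} {v} {w} {z} e₁ e₂ = begin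
      x                                        ≡⟨ solve 2 (λ x y → x := (x :+ y) :+ :- y) refl x y ⟩
      (x ⊕ y) ⊕ ⊝ y                            ≡⟨ cong₂ (λ a c → a ⊕ ⊝ c) e₁ e₂ ⟩
      ((u ⊕ v) ⊕ (w ⊕ z)) ⊕ ⊝ (v ⊕ z)          ≡⟨ solve 4 (λ u v w z → ((u :+ v) :+ (w :+ z)) :+ :- (v :+ z) := u :+ w) refl u v w z ⟩
      u ⊕ w ∎
    hd : b (suc i ∷ []) ⋆ b (suc h ∷ t) ≐ b R ⊞ b S
    hd q = trans (b-step i h t q) (cong₂ _⊕_ (cong (λ z → b (suc i ∷ z) q) (sym eq₁)) (cong (λ z → b z q) (sym eq₂)))
    sum₁ : (b A ⋆ b J) p ⊕ (b B′ ⋆ b J) p ≡ (b P p ⊕ b (B′ ++ J) p) ⊕ (b R p ⊕ b S p)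
    sum₁ = begin
      (b A ⋆ b J) p ⊕ (b B′ ⋆ b J) p
        ≡⟨ sym (⋆-⊞ʳ (b A) (b B′) (b J) p) ⟩
      ((b A ⊞ b B′) ⋆ b J) p
        ≡⟨ ⋆-congʳ (b J) (≐-sym (b-step i i′ is)) p ⟩
      ((b (suc i ∷ []) ⋆ b (suc i′ ∷ is)) ⋆ b J) p
        ≡⟨ ⋆-assoc (b (suc i ∷ [])) (b (suc i′ ∷ is)) (b J) p ⟩
      (b (suc i ∷ []) ⋆ (b (suc i′ ∷ is) ⋆ b J)) p
        ≡⟨ ⋆-congˡ (b (suc i ∷ [])) (≐-trans (b-merge (suc i′) is (suc j) js (pi′ ∷ pis) pj)
             (λ q → cong (λ z → b ((suc i′ ∷ is) ++ J) q ⊕ b z q) eq₁)) p ⟩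
      (b (suc i ∷ []) ⋆ (b ((suc i′ ∷ is) ++ J) ⊞ b (suc h ∷ t))) p
        ≡⟨ ⋆-⊞ˡ (b (suc i ∷ [])) (b ((suc i′ ∷ is) ++ J)) (b (suc h ∷ t)) p ⟩
      (b (suc i ∷ []) ⋆ b ((suc i′ ∷ is) ++ J)) p ⊕ (b (suc i ∷ []) ⋆ b (suc h ∷ t)) p
        ≡⟨ cong₂ _⊕_ (b-step i i′ (is ++ J) p) (hd p) ⟩
      (b P p ⊕ b (B′ ++ J) p) ⊕ (b R p ⊕ b S p) ∎

  ev-extR : ∀ {a c} I J → Valid a I → Valid c J → b I ⋆ b J ≐ ev (extR I J)
  ev-extR []      J       vI vJ p = begin
    (b [] ⋆ b J) p        ≡⟨ ⋆-congʳ (b J) b-[] p ⟩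
    (one ⋆ b J) p         ≡⟨ one⋆ (b J) p ⟩
    b J p                 ≡⟨ sym (trans (⊕0 (1ℚ ⊗ b J p)) (1⊗ (b J p))) ⟩
    1ℚ ⊗ b J p ⊕ 0ℚ ∎
  ev-extR (i ∷ I) []      vI vJ p = begin
    (b (i ∷ I) ⋆ b []) p  ≡⟨ ⋆-congˡ (b (i ∷ I)) b-[] p ⟩
    (b (i ∷ I) ⋆ one) p   ≡⟨ ⋆one (b (i ∷ I)) p ⟩
    b (i ∷ I) p           ≡⟨ sym (trans (⊕0 (1ℚ ⊗ b (i ∷ I) p)) (1⊗ (b (i ∷ I) p))) ⟩
    1ℚ ⊗ b (i ∷ I) p ⊕ 0ℚ ∎
  ev-extR (i ∷ I) (j ∷ J) (pI , _) (pj ∷ _ , _) p = trans (b-merge i I j J pI pj p)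
    (cong₂ _⊕_ (sym (1⊗ (b (i ∷ I ++ j ∷ J) p)))
      (sym (trans (⊕0 (1ℚ ⊗ b (mergeLast (i ∷ I) j J) p)) (1⊗ (b (mergeLast (i ∷ I) j J) p)))))

  ev-mulF : ∀ {a c} x y → ValidF a x → ValidF c y → ev (mulF x y) ≐ ev x ⋆ ev y
  ev-mulF []            y []        vy p = sym (∑-zero (splits p) (λ qr → 0⊗ (ev y (proj₂ qr))))
  ev-mulF ((a , I) ∷ x) y (vI ∷ vx) vy p = begin
    ev (mulF ((a , I) ∷ x) y) p
      ≡⟨ ev-++ (concatMap _ y) (mulF x y) p ⟩
    ev (concatMap _ y) p ⊕ ev (mulF x y) p
      ≡⟨ cong₂ _⊕_ (inner y vy) (ev-mulF x y vx vy p) ⟩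
    ((a · b I) ⋆ ev y) p ⊕ (ev x ⋆ ev y) p
      ≡⟨ sym (⋆-⊞ʳ (a · b I) (ev x) (ev y) p) ⟩
    (ev ((a , I) ∷ x) ⋆ ev y) p ∎
    where
    inner : ∀ {c} y → ValidF c y → ev (concatMap (λ { (c , J) → scaleF (a ⊗ c) (extR I J) }) y) p ≡ ((a · b I) ⋆ ev y) p
    inner []            []        = sym (∑-zero (splits p) (λ qr → ⊗0 (a ⊗ b I (proj₁ qr))))
    inner ((c , J) ∷ y) (vJ ∷ vy) = begin
      ev (scaleF (a ⊗ c) (extR I J) ++ concatMap _ y) p
        ≡⟨ ev-++ (scaleF (a ⊗ c) (extR I J)) (concatMap _ y) p ⟩
      ev (scaleF (a ⊗ c) (extR I J)) p ⊕ ev (concatMap _ y) p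
        ≡⟨ cong₂ _⊕_ (trans (ev-scaleF (a ⊗ c) (extR I J) p) (trans (cong ((a ⊗ c) ⊗_) (sym (ev-extR I J vI vJ p)))
             (sym (trans (⋆-·ʳ a (b I) (c · b J) p) (trans (cong (a ⊗_) (⋆-·ˡ c (b I) (b J) p)) (sym (ℚ.*-assoc a c ((b I ⋆ b J) p))))))))
             (inner y vy) ⟩
      ((a · b I) ⋆ (c · b J)) p ⊕ ((a · b I) ⋆ ev y) p
        ≡⟨ sym (⋆-⊞ˡ (a · b I) (c · b J) (ev y) p) ⟩
      ((a · b I) ⋆ ev ((c , J) ∷ y)) p ∎

  -- A splitting (q, r) receives a contribution only from a = deg q, so the convolution of graded
  -- families may be sorted by the degree of the left factor.
  ⋆-graded : ∀ (f g : ℕ → Fun) → (∀ a q → deg q ≢ a → f a q ≡ 0ℚ) →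
             ∀ p → ((λ q → f (deg q) q) ⋆ (λ r → g (deg r) r)) p ≡ Δℕ (deg p) (λ a c → (f a ⋆ g c) p)
  ⋆-graded f g f₀ p = begin
    ∑₂ (splits p) (λ q r → f (deg q) q ⊗ g (deg r) r)
      ≡⟨ ∑-cong-All (All.map (λ {qr} e → sym (trans (cong (λ z → Δℕ z (λ a c → f a (proj₁ qr) ⊗ g c (proj₂ qr))) (sym e))
           (Δℕ-single (deg (proj₁ qr)) (deg (proj₂ qr)) (λ a c → f a (proj₁ qr) ⊗ g c (proj₂ qr))
             (λ a c a≢ → trans (cong (_⊗ g c (proj₂ qr)) (f₀ a (proj₁ qr) (a≢ ∘ sym))) (0⊗ (g c (proj₂ qr))))))) (deg-splits p)) ⟩
    ∑₂ (splits p) (λ q r → Δℕ (deg p) (λ a c → f a q ⊗ g c r))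
      ≡⟨ ∑-swap (splits p) (splitsℕ (deg p)) (λ qr ac → f (proj₁ ac) (proj₁ qr) ⊗ g (proj₂ ac) (proj₂ qr)) ⟩
    Δℕ (deg p) (λ a c → (f a ⋆ g c) p) ∎

  evS-mulS : ∀ {F G} → ValidS F → ValidS G → evS (mulS F G) ≐ evS F ⋆ evS G
  evS-mulS {F} {G} vF vG p = begin
    ev (concatMap (λ a → mulF (F a) (G (deg p ∸ a))) (upTo (suc (deg p)))) p
      ≡⟨ ev-concatMap (λ a → mulF (F a) (G (deg p ∸ a))) (upTo (suc (deg p))) p ⟩
    ∑ (upTo (suc (deg p))) (λ a → ev (mulF (F a) (G (deg p ∸ a))) p)
      ≡⟨ ∑-upTo (suc (deg p)) (λ a → ev (mulF (F a) (G (deg p ∸ a))) p) ⟩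
    Σ< (suc (deg p)) (λ a → ev (mulF (F a) (G (deg p ∸ a))) p)
      ≡⟨ Δℕ-Σ< (deg p) (λ a c → ev (mulF (F a) (G c)) p) ⟩
    Δℕ (deg p) (λ a c → ev (mulF (F a) (G c)) p)
      ≡⟨ Δℕ-cong (deg p) (λ a c → ev-mulF (F a) (G c) (vF a) (vG c) p) ⟩
    Δℕ (deg p) (λ a c → (ev (F a) ⋆ ev (G c)) p)
      ≡⟨ sym (⋆-graded (λ a → ev (F a)) (λ c → ev (G c)) (λ a q → ev-deg (F a) (vF a) q) p) ⟩
    (evS F ⋆ evS G) p ∎

  evS-oneS : evS oneS ≐ one
  evS-oneS p with deg p in eqd
  ... | zero  = trans (⊕0 (1ℚ ⊗ b [] p)) (trans (1⊗ (b [] p)) (trans (b-[] p) (cong (λ z → 𝟙 (z ≡ᵇ 0)) eqd)))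
  ... | suc d = refl

  evS-powS : ∀ {F} → ValidS F → ∀ m → evS (powS F m) ≐ pow (evS F) m
  evS-powS vF zero    = evS-oneS
  evS-powS {F} vF (suc m) = ≐-trans (evS-mulS vF (valid-powS vF m)) (⋆-congˡ (evS F) (evS-powS vF m))

  evS-scaleS : ∀ c F → evS (scaleS c F) ≐ c · evS F
  evS-scaleS c F p = ev-scaleF c (F (deg p)) p

  evS-minusOne : ∀ G → one ⊞ evS (minusOne G) ≐ evS G
  evS-minusOne G p with deg p in eqd
  ... | suc d = 0⊕ (ev (G (suc d)) p)
  ... | zero  = begin
    1ℚ ⊕ ev (G 0 ++ (⊝ 1ℚ , []) ∷ []) p          ≡⟨ cong (1ℚ ⊕_) (ev-++ (G 0) ((⊝ 1ℚ , []) ∷ []) p) ⟩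
    1ℚ ⊕ (ev (G 0) p ⊕ (⊝ 1ℚ ⊗ b [] p ⊕ 0ℚ))     ≡⟨ cong (λ z → 1ℚ ⊕ (ev (G 0) p ⊕ (⊝ 1ℚ ⊗ z ⊕ 0ℚ))) (trans (b-[] p) (cong (λ z → 𝟙 (z ≡ᵇ 0)) eqd)) ⟩
    1ℚ ⊕ (ev (G 0) p ⊕ (⊝ 1ℚ ⊗ 1ℚ ⊕ 0ℚ))         ≡⟨ solve 1 (λ x → con 1ℚ :+ (x :+ (:- (con 1ℚ) :* con 1ℚ :+ con 0ℚ)) := x) refl (ev (G 0) p) ⟩
    ev (G 0) p ∎

  v : Bool → Fun
  v s = evS (V₁ s)

  evS-V₂ : ∀ s → evS (V₂ s) ≐ v s ⋆ v (not s)
  evS-V₂ true  = evS-mulS valid-V1p valid-V1m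
  evS-V₂ false = evS-mulS valid-V1m valid-V1p

  v-at-0 : ∀ s p → deg p ≡ 0 → v s p ≡ 1ℚ
  v-at-0 true  p d0 = trans (cong (λ z → ev (V1p z) p) d0)
    (trans (⊕0 (1ℚ ⊗ b [] p)) (trans (1⊗ (b [] p)) (trans (b-[] p) (cong (λ z → 𝟙 (z ≡ᵇ 0)) d0))))
  v-at-0 false p d0 = trans (cong (λ z → ev (V1m z) p) d0)
    (trans (⊕0 (1ℚ ⊗ b [] p)) (trans (1⊗ (b [] p)) (trans (b-[] p) (cong (λ z → 𝟙 (z ≡ᵇ 0)) d0))))

  ⋆-at-0≡1 : ∀ f g → (∀ p → deg p ≡ 0 → f p ≡ 1ℚ) → (∀ p → deg p ≡ 0 → g p ≡ 1ℚ) → ∀ p → deg p ≡ 0 → (f ⋆ g) p ≡ 1ℚ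
  ⋆-at-0≡1 f g f1 g1 p d0 = trans (⋆-cong-deg {f} {one} {g} {one} p (λ q le → near q f f1 le) (λ q le → near q g g1 le))
    (trans (one⋆ one p) (cong (λ z → 𝟙 (z ≡ᵇ 0)) d0))
    where
    near : ∀ q (h : Fun) → (∀ p → deg p ≡ 0 → h p ≡ 1ℚ) → deg q ≤ deg p → h q ≡ one q
    near q h h1 le = trans (h1 q dq) (sym (cong (λ z → 𝟙 (z ≡ᵇ 0)) dq))
      where
      dq : deg q ≡ 0
      dq = ℕ.n≤0⇒n≡0 (subst (deg q ≤_) d0 le)

  module OfSer (G : Ser) (vG : ValidS G) (G1 : ∀ p → deg p ≡ 0 → evS G p ≡ 1ℚ) where

    F : Fun
    F = evS (minusOne G)

    F₀ : Vanish₀ F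
    F₀ p d0 = trans (solve 2 (λ o f → f := (o :+ f) :+ :- o) refl (one p) (F p))
      (trans (cong₂ (λ x y → x ⊕ ⊝ y) (trans (evS-minusOne G p) (G1 p d0)) (cong (λ z → 𝟙 (z ≡ᵇ 0)) d0)) refl)

    open Subst coalg F F₀ public

    evS-logS : evS (logS G) ≐ φ Lg
    evS-logS p = begin
      ev (concatMap (λ m → scaleF (Lg m) (powS (minusOne G) m (deg p))) (from1 (deg p))) p
        ≡⟨ ev-concatMap (λ m → scaleF (Lg m) (powS (minusOne G) m (deg p))) (from1 (deg p)) p ⟩
      ∑ (from1 (deg p)) (λ m → ev (scaleF (Lg m) (powS (minusOne G) m (deg p))) p)
        ≡⟨ ∑-cong (from1 (deg p)) (λ m → trans (ev-scaleF (Lg m) (powS (minusOne G) m (deg p)) p)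
             (cong (Lg m ⊗_) (evS-powS (valid-minusOne vG) m p))) ⟩
      ∑ (from1 (deg p)) (λ m → Lg m ⊗ pow F m p)
        ≡⟨ trans (∑-map suc (upTo (deg p)) (λ m → Lg m ⊗ pow F m p)) (∑-upTo (deg p) (λ m → Lg (suc m) ⊗ pow F (suc m) p)) ⟩
      Σ< (deg p) (λ m → Lg (suc m) ⊗ pow F (suc m) p)
        -- `log1p` starts at m = 1 and `φ` at 0; the extra term carries the coefficient `Lg 0`,
        -- which is zero.
        ≡⟨ sym (trans (cong (_⊕ Σ< (deg p) (λ m → Lg (suc m) ⊗ pow F (suc m) p)) (0⊗ (one p))) (0⊕ _)) ⟩
      φ Lg p ∎

    evS-cLog : ∀ c m → pow (evS (scaleS c (logS G))) m ≐ pow₁ c m · φ (U.pow Lg m)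
    evS-cLog c m p = begin
      pow (evS (scaleS c (logS G))) m p  ≡⟨ pow-cong (λ q → trans (evS-scaleS c (logS G) q) (cong (c ⊗_) (evS-logS q))) m p ⟩
      pow (c · φ Lg) m p                 ≡⟨ pow-· c (φ Lg) m p ⟩
      pow₁ c m ⊗ pow (φ Lg) m p          ≡⟨ cong (pow₁ c m ⊗_) (φ-pow Lg m p) ⟩
      pow₁ c m ⊗ φ (U.pow Lg m) p ∎

    evS-powRat : ∀ c → evS (powRat G c) ≐ φ (E c)
    evS-powRat c p = begin
      ev (concatMap (λ m → scaleF (recip (m !)) (powS cL m (deg p))) (upTo (suc (deg p)))) p
        ≡⟨ ev-concatMap (λ m → scaleF (recip (m !)) (powS cL m (deg p))) (upTo (suc (deg p))) p ⟩
      ∑ (upTo (suc (deg p))) (λ m → ev (scaleF (recip (m !)) (powS cL m (deg p))) p)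
        ≡⟨ ∑-upTo (suc (deg p)) (λ m → ev (scaleF (recip (m !)) (powS cL m (deg p))) p) ⟩
      Σ< (suc (deg p)) (λ m → ev (scaleF (recip (m !)) (powS cL m (deg p))) p)
        ≡⟨ Σ<-cong (suc (deg p)) (λ m → term m) ⟩
      Σ< (suc (deg p)) (λ m → κ c m ⊗ φ (U.pow Lg m) p)
        ≡⟨ sym (φE-expand c p) ⟩
      φ (E c) p ∎
      where
      cL : Ser
      cL = scaleS c (logS G)
      term : ∀ m → ev (scaleF (recip (m !)) (powS cL m (deg p))) p ≡ κ c m ⊗ φ (U.pow Lg m) p
      term m = begin
        ev (scaleF (recip (m !)) (powS cL m (deg p))) p   ≡⟨ ev-scaleF (recip (m !)) (powS cL m (deg p)) p ⟩
        recip (m !) ⊗ evS (powS cL m) p                    ≡⟨ cong (recip (m !) ⊗_) (trans (evS-powS (valid-scaleS c (valid-logS vG)) m p) (evS-cLog c m p)) ⟩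
        recip (m !) ⊗ (pow₁ c m ⊗ φ (U.pow Lg m) p)        ≡⟨ solve 3 (λ r q f → r :* (q :* f) := (q :* r) :* f) refl (recip (m !)) (pow₁ c m) (φ (U.pow Lg m) p) ⟩
        κ c m ⊗ φ (U.pow Lg m) p ∎

    evS-Iof : ∀ k → evS (Iof G k) ≐ κ ½ k · φ (U.pow Lg k)
    evS-Iof k p = begin
      evS (Iof G k) p                                  ≡⟨ evS-scaleS (recip (k !)) (powS (scaleS ½ (logS G)) k) p ⟩
      recip (k !) ⊗ evS (powS (scaleS ½ (logS G)) k) p ≡⟨ cong (recip (k !) ⊗_) (trans (evS-powS (valid-scaleS ½ (valid-logS vG)) k p) (evS-cLog ½ k p)) ⟩
      recip (k !) ⊗ (pow₁ ½ k ⊗ φ (U.pow Lg k) p)      ≡⟨ solve 3 (λ r q f → r :* (q :* f) := (q :* r) :* f) refl (recip (k !)) (pow₁ ½ k) (φ (U.pow Lg k) p) ⟩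
      κ ½ k ⊗ φ (U.pow Lg k) p ∎

    evS-Iof-deg : ∀ k p → deg p < k → evS (Iof G k) p ≡ 0ℚ
    evS-Iof-deg k p lt = trans (evS-Iof k p) (trans (cong (κ ½ k ⊗_) (trans (sym (φ-pow Lg k p)) (pow-vanish φLg₀ k p lt))) (⊗0 (κ ½ k)))
      where
      φLg₀ : Vanish₀ (φ Lg)
      φLg₀ q d0 = trans (cong (λ z → trunc (suc z) Lg q) d0) (trans (cong (_⊕ 0ℚ) (0⊗ (one q))) refl)

    -- exp ((t/2) log G) = G^(t/2), since I_k is (½ log G)^k / k!.
    I-expand : ∀ t p → Σ< (suc (deg p)) (λ k → pow₁ t k ⊗ evS (Iof G k) p) ≡ φ (E (t ⊗ ½)) p
    I-expand t p = trans (Σ<-cong (suc (deg p)) (λ k → trans (cong (pow₁ t k ⊗_) (evS-Iof k p)) (lem k))) (sym (φE-expand (t ⊗ ½) p))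
      where
      lem : ∀ k → pow₁ t k ⊗ (κ ½ k ⊗ φ (U.pow Lg k) p) ≡ κ (t ⊗ ½) k ⊗ φ (U.pow Lg k) p
      lem k = trans (solve 4 (λ a q r f → a :* ((q :* r) :* f) := ((a :* q) :* r) :* f) refl (pow₁ t k) (pow₁ ½ k) (recip (k !)) (φ (U.pow Lg k) p))
        (cong (λ z → (z ⊗ recip (k !)) ⊗ φ (U.pow Lg k) p) (sym (pow₁-⊗ t ½ k)))

    I-expand≤ : ∀ t N p → deg p < N → Σ< N (λ k → pow₁ t k ⊗ evS (Iof G k) p) ≡ φ (E (t ⊗ ½)) p
    I-expand≤ t N p lt = trans (sym (Σ<-extend (suc (deg p)) N lt
      (λ k p<k → trans (cong (pow₁ t k ⊗_) (evS-Iof-deg k p p<k)) (⊗0 (pow₁ t k))))) (I-expand t p)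

    -- The factor G^(-½) in J_0 shifts the exponent: the generating polynomial of the J_k is V ⋆
    -- G^((t-1)/2).
    J-expand : ∀ V → ValidS V → ∀ t p →
      Σ< (suc (deg p)) (λ k → pow₁ t k ⊗ evS (Jof V G k) p) ≡ (evS V ⋆ φ (E (⊝ ½ ⊕ t ⊗ ½))) p
    J-expand V vV t p = begin
      Σ< N (λ k → pow₁ t k ⊗ evS (Jof V G k) p)
        ≡⟨ Σ<-cong N (λ k → trans (cong (pow₁ t k ⊗_) (trans (evS-mulS vJ₀ (valid-Iof vG k) p) (⋆-congʳ (evS (Iof G k)) J₀≐ p)))
             (sym (⋆-·ˡ (pow₁ t k) J₀ (evS (Iof G k)) p))) ⟩
      Σ< N (λ k → (J₀ ⋆ (pow₁ t k · evS (Iof G k))) p)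
        ≡⟨ sym (⋆-Σˡ N J₀ (λ k → pow₁ t k · evS (Iof G k)) p) ⟩
      (J₀ ⋆ Σf N (λ k → pow₁ t k · evS (Iof G k))) p
        ≡⟨ ⋆-cong-deg {J₀} {J₀} p (λ _ _ → refl) (λ q q≤p → I-expand≤ t N q (s≤s q≤p)) ⟩
      (J₀ ⋆ φ (E (t ⊗ ½))) p
        ≡⟨ ⋆-assoc (evS V) (φ (E (⊝ ½))) (φ (E (t ⊗ ½))) p ⟩
      (evS V ⋆ (φ (E (⊝ ½)) ⋆ φ (E (t ⊗ ½)))) p
        ≡⟨ ⋆-congˡ (evS V) (φE-⋆ (⊝ ½) (t ⊗ ½)) p ⟩
      (evS V ⋆ φ (E (⊝ ½ ⊕ t ⊗ ½))) p ∎
      where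
      N : ℕ
      N = suc (deg p)
      J₀ : Fun
      J₀ = evS V ⋆ φ (E (⊝ ½))
      vJ₀ : ValidS (mulS V (powRat G (⊝ ½)))
      vJ₀ = valid-mulS vV (valid-powRat vG (⊝ ½))
      J₀≐ : evS (mulS V (powRat G (⊝ ½))) ≐ J₀
      J₀≐ q = trans (evS-mulS vV (valid-powRat vG (⊝ ½)) q) (⋆-congˡ (evS V) (evS-powRat (⊝ ½)) q)

    pow-G : ∀ m → pow (evS G) m ≐ φ (E (nat m))
    pow-G m p = trans (pow-cong (≐-sym (evS-minusOne G)) m p) (pow-1+ m p)

module Signed (K : Interp) where
  open Realisation K public

  V : Bool → Fun
  V s = v s ⋆ v (not s)

  V₂-at-0 : ∀ s p → deg p ≡ 0 → evS (V₂ s) p ≡ 1ℚ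
  V₂-at-0 s p d0 = trans (evS-V₂ s p) (⋆-at-0≡1 (v s) (v (not s)) (v-at-0 s) (v-at-0 (not s)) p d0)

  module S (s : Bool) = OfSer (V₂ s) (valid-V₂ s) (V₂-at-0 s)

  I J : Bool → ℕ → Fun
  I s k = evS (Is s k)
  J s k = evS (Js s k)

  I≐ : ∀ s k → I s k ≐ evS (Iof (V₂ s) k)
  I≐ s k p = cong (λ F → evS F p) (Is≡Iof s k)

  J≐ : ∀ s k → J s k ≐ evS (Jof (V₁ s) (V₂ (not s)) k)
  J≐ s k p = cong (λ F → evS F p) (Js≡Jof s k)

  I-deg : ∀ s k p → deg p < k → I s k p ≡ 0ℚ
  I-deg s k p lt = trans (I≐ s k p) (S.evS-Iof-deg s k p lt)

  I-gen : ∀ s t p → Σ< (suc (deg p)) (λ k → pow₁ t k ⊗ I s k p) ≡ S.φ s (E (t ⊗ ½)) p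
  I-gen s t p = trans (Σ<-cong (suc (deg p)) (λ k → cong (pow₁ t k ⊗_) (I≐ s k p))) (S.I-expand s t p)

  J-gen : ∀ s t p → Σ< (suc (deg p)) (λ k → pow₁ t k ⊗ J s k p) ≡ (v s ⋆ S.φ (not s) (E (⊝ ½ ⊕ t ⊗ ½))) p
  J-gen s t p = trans (Σ<-cong (suc (deg p)) (λ k → cong (pow₁ t k ⊗_) (J≐ s k p)))
    (S.J-expand (not s) (V₁ s) (valid-V₁ s) t p)

  Vʳ : ∀ s → evS (V₂ (not s)) ≐ v (not s) ⋆ v s
  Vʳ true  = evS-V₂ false
  Vʳ false = evS-V₂ true

  I-even : ∀ s m p → Σ< (suc (deg p)) (λ k → pow₁ (nat (double m)) k ⊗ I s k p) ≡ pow (V s) m p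
  I-even s m p = begin
    Σ< (suc (deg p)) (λ k → pow₁ (nat (double m)) k ⊗ I s k p)  ≡⟨ I-gen s (nat (double m)) p ⟩
    S.φ s (E (nat (double m) ⊗ ½)) p                            ≡⟨ cong (λ z → S.φ s (E z) p) (nat-double-½ m) ⟩
    S.φ s (E (nat m)) p                                         ≡⟨ sym (S.pow-G s m p) ⟩
    pow (evS (V₂ s)) m p                                        ≡⟨ pow-cong (evS-V₂ s) m p ⟩
    pow (V s) m p ∎

  odd-½ : ∀ m → ⊝ ½ ⊕ nat (suc (double m)) ⊗ ½ ≡ nat m
  odd-½ m = trans (lem (nat (double m))) (nat-double-½ m)
    where
    lem : ∀ x → ⊝ ½ ⊕ (1ℚ ⊕ x) ⊗ ½ ≡ x ⊗ ½
    lem = solve 1 (λ x → (:- (con ½)) :+ (con 1ℚ :+ x) :* con ½ := x :* con ½) refl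

  J-odd : ∀ s m p → Σ< (suc (deg p)) (λ k → pow₁ (nat (suc (double m))) k ⊗ J s k p) ≡ (v s ⋆ pow (v (not s) ⋆ v s) m) p
  J-odd s m p = begin
    Σ< (suc (deg p)) (λ k → pow₁ (nat (suc (double m))) k ⊗ J s k p)   ≡⟨ J-gen s (nat (suc (double m))) p ⟩
    (v s ⋆ S.φ (not s) (E (⊝ ½ ⊕ nat (suc (double m)) ⊗ ½))) p         ≡⟨ cong (λ z → (v s ⋆ S.φ (not s) (E z)) p) (odd-½ m) ⟩
    (v s ⋆ S.φ (not s) (E (nat m))) p                                  ≡⟨ ⋆-congˡ (v s) (λ q → trans (sym (S.pow-G (not s) m q)) (pow-cong (Vʳ s) m q)) p ⟩
    (v s ⋆ pow (v (not s) ⋆ v s) m) p ∎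

  ev-single : ∀ I p → ev ((1ℚ , I) ∷ []) p ≡ b I p
  ev-single I p = trans (⊕0 (1ℚ ⊗ b I p)) (1⊗ (b I p))

  -- A row times a column is a sum of two hooks. With alternating signs consecutive products share a
  -- hook and the sum telescopes to the one with the longest leg.
  hook-sum : ∀ i d p → Δℕ d (λ a c → (ev (V1p (suc i + a)) ⋆ (negOnePow c · ev (V1m c))) p) ≡
             negOnePow d ⊗ b (suc i ∷ replicate d 1) p
  hook-sum i zero p = begin
    (ev (V1p (suc i + 0)) ⋆ (1ℚ · ev (V1m 0))) p ⊕ 0ℚ    ≡⟨ ⊕0 ((ev (V1p (suc i + 0)) ⋆ (1ℚ · ev (V1m 0))) p) ⟩
    (ev (V1p (suc i + 0)) ⋆ (1ℚ · ev (V1m 0))) p         ≡⟨ ⋆-·ˡ 1ℚ (ev (V1p (suc i + 0))) (ev (V1m 0)) p ⟩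
    1ℚ ⊗ (ev (V1p (suc i + 0)) ⋆ ev (V1m 0)) p           ≡⟨ cong (1ℚ ⊗_) (⋆-cong (λ q → trans (cong (λ z → ev (V1p z) q) (ℕ.+-identityʳ (suc i))) (ev-single (suc i ∷ []) q))
                                                              (λ q → trans (ev-single [] q) (b-[] q)) p) ⟩
    1ℚ ⊗ (b (suc i ∷ []) ⋆ one) p                        ≡⟨ cong (1ℚ ⊗_) (⋆one (b (suc i ∷ [])) p) ⟩
    1ℚ ⊗ b (suc i ∷ []) p ∎
  hook-sum i (suc d) p = begin
    Δℕ (suc d) (λ a c → (ev (V1p (suc i + a)) ⋆ (negOnePow c · ev (V1m c))) p)
      ≡⟨ Δℕ-suc d (λ a c → (ev (V1p (suc i + a)) ⋆ (negOnePow c · ev (V1m c))) p) ⟩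
    (ev (V1p (suc i + 0)) ⋆ (ν · ev (V1m (suc d)))) p ⊕ Δℕ d (λ a c → (ev (V1p (suc i + suc a)) ⋆ (negOnePow c · ev (V1m c))) p)
      ≡⟨ cong₂ _⊕_ first (trans (Δℕ-cong d (λ a c → cong (λ z → (ev (V1p z) ⋆ (negOnePow c · ev (V1m c))) p) (ℕ.+-suc (suc i) a))) (hook-sum (suc i) d p)) ⟩
    ν ⊗ (b (suc i ∷ 1 ∷ replicate d 1) p ⊕ y) ⊕ negOnePow d ⊗ y
      ≡⟨ solve 3 (λ n x y → (:- n) :* (x :+ y) :+ n :* y := (:- n) :* x) refl (negOnePow d) (b (suc i ∷ 1 ∷ replicate d 1) p) y ⟩
    ν ⊗ b (suc i ∷ 1 ∷ replicate d 1) p ∎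
    where
    ν y : ℚ
    ν = negOnePow (suc d)
    y = b (suc (suc i) ∷ replicate d 1) p
    first : (ev (V1p (suc i + 0)) ⋆ (ν · ev (V1m (suc d)))) p ≡ ν ⊗ (b (suc i ∷ 1 ∷ replicate d 1) p ⊕ y)
    first = trans (⋆-·ˡ ν (ev (V1p (suc i + 0))) (ev (V1m (suc d))) p) (cong (ν ⊗_) (trans
      (⋆-cong (λ q → trans (cong (λ z → ev (V1p z) q) (ℕ.+-identityʳ (suc i))) (ev-single (suc i ∷ []) q)) (ev-single (replicate (suc d) 1)) p)
      (trans (b-step i 0 (replicate d 1) p) (cong (λ z → b (suc i ∷ 1 ∷ replicate d 1) p ⊕ b (z ∷ replicate d 1) p) (ℕ.+-comm (suc i) 1)))))

  -- The noncommutative form of the relation between complete and elementary functions: in positive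
  -- degree the product with empty row cancels the hook left by `hook-sum`.
  inv⁺ : v true ⋆ θ (v false) ≐ one
  inv⁺ p = trans (⋆-graded (λ a → ev (V1p a)) (λ c → negOnePow c · ev (V1m c)) (λ a q → ev-deg (V1p a) (valid-V1p a) q) p) go
    where
    go : Δℕ (deg p) (λ a c → (ev (V1p a) ⋆ (negOnePow c · ev (V1m c))) p) ≡ one p
    go with deg p in eqd
    ... | zero  = trans (⊕0 ((ev (V1p 0) ⋆ (1ℚ · ev (V1m 0))) p))
      (trans (⋆-cong (λ q → trans (ev-single [] q) (b-[] q)) (λ q → trans (1⊗ (ev (V1m 0) q)) (trans (ev-single [] q) (b-[] q))) p)
        (trans (one⋆ one p) (cong (λ z → 𝟙 (z ≡ᵇ 0)) eqd)))
    ... | suc d = begin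
      Δℕ (suc d) (λ a c → (ev (V1p a) ⋆ (negOnePow c · ev (V1m c))) p)
        ≡⟨ Δℕ-suc d (λ a c → (ev (V1p a) ⋆ (negOnePow c · ev (V1m c))) p) ⟩
      (ev (V1p 0) ⋆ (negOnePow (suc d) · ev (V1m (suc d)))) p ⊕ Δℕ d (λ a c → (ev (V1p (suc a)) ⋆ (negOnePow c · ev (V1m c))) p)
        ≡⟨ cong₂ _⊕_ (trans (⋆-congʳ (negOnePow (suc d) · ev (V1m (suc d))) (λ q → trans (ev-single [] q) (b-[] q)) p)
             (trans (one⋆ (negOnePow (suc d) · ev (V1m (suc d))) p) (cong (negOnePow (suc d) ⊗_) (ev-single (replicate (suc d) 1) p)))) (hook-sum 0 d p) ⟩
      ⊝ negOnePow d ⊗ y ⊕ negOnePow d ⊗ y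
        ≡⟨ solve 2 (λ n y → (:- n) :* y :+ n :* y := con 0ℚ) refl (negOnePow d) y ⟩
      0ℚ ∎
      where
      y : ℚ
      y = b (replicate (suc d) 1) p

  -- Y is 1 + F with F free of constant term, so the binomial series with exponent -1 is an inverse
  -- of Y; a left inverse A of Y must coincide with it.
  invʳ⇒invˡ : ∀ A Y → (∀ p → deg p ≡ 0 → Y p ≡ 1ℚ) → A ⋆ Y ≐ one → Y ⋆ A ≐ one
  invʳ⇒invˡ A Y Y1 AY = ≐-trans (⋆-congˡ Y A≐) YY′
    where
    F : Fun
    F p = Y p ⊕ ⊝ one p
    F₀ : Vanish₀ F
    F₀ p d0 = cong₂ (λ x y → x ⊕ ⊝ y) (Y1 p d0) (cong (λ z → 𝟙 (z ≡ᵇ 0)) d0)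
    open Subst coalg F F₀
    Y′ : Fun
    Y′ = φ (E (⊝ 1ℚ))
    Y≐ : Y ≐ φ (E 1ℚ)
    Y≐ p = trans (solve 2 (λ o y → y := o :+ (y :+ :- o)) refl (one p) (Y p)) (trans (sym (φ-1+X p)) (φ-cong (λ j → sym (E-1 j)) p))
    YY′ : Y ⋆ Y′ ≐ one
    YY′ p = trans (⋆-congʳ Y′ Y≐ p) (trans (φE-⋆ 1ℚ (⊝ 1ℚ) p) (trans (φ-cong E-0 p) (φ-one p)))
    A≐ : A ≐ Y′
    A≐ p = trans (sym (⋆one A p)) (trans (⋆-congˡ A (≐-sym YY′) p) (trans (sym (⋆-assoc A Y Y′ p))
      (trans (⋆-congʳ Y′ AY p) (one⋆ Y′ p))))

  θ-at-0 : ∀ f → (∀ p → deg p ≡ 0 → f p ≡ 1ℚ) → ∀ p → deg p ≡ 0 → θ f p ≡ 1ℚ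
  θ-at-0 f f1 p d0 = cong₂ (λ x y → negOnePow x ⊗ y) d0 (f1 p d0)

  θ-cong : ∀ {f g} → f ≐ g → θ f ≐ θ g
  θ-cong eq p = cong (negOnePow (deg p) ⊗_) (eq p)

  θ-inverse : ∀ s → v s ⋆ θ (v (not s)) ≐ one
  θ-inverse true    = inv⁺
  θ-inverse false p = begin
    (v false ⋆ θ (v true)) p           ≡⟨ ⋆-congʳ (θ (v true)) (≐-sym (θθ (v false))) p ⟩
    (θ (θ (v false)) ⋆ θ (v true)) p   ≡⟨ sym (θ-⋆ (θ (v false)) (v true) p) ⟩
    θ (θ (v false) ⋆ v true) p         ≡⟨ θ-cong (invʳ⇒invˡ (v true) (θ (v false)) (θ-at-0 (v false) (v-at-0 false)) inv⁺) p ⟩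
    θ one p                            ≡⟨ θ-one p ⟩
    one p ∎

  θ-inverseˡ : ∀ s → θ (v s) ⋆ v (not s) ≐ one
  θ-inverseˡ s p = begin
    (θ (v s) ⋆ v (not s)) p             ≡⟨ ⋆-congˡ (θ (v s)) (≐-sym (θθ (v (not s)))) p ⟩
    (θ (v s) ⋆ θ (θ (v (not s)))) p     ≡⟨ sym (θ-⋆ (v s) (θ (v (not s))) p) ⟩
    θ (v s ⋆ θ (v (not s))) p           ≡⟨ θ-cong (θ-inverse s) p ⟩
    θ one p                             ≡⟨ θ-one p ⟩
    one p ∎

  θ-inverse′ : ∀ s → v (not s) ⋆ θ (v s) ≐ one
  θ-inverse′ true  = θ-inverse false
  θ-inverse′ false = θ-inverse true

  cancel-mid : ∀ A B C D → B ⋆ C ≐ one → (A ⋆ B) ⋆ (C ⋆ D) ≐ A ⋆ D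
  cancel-mid A B C D BC p = begin
    ((A ⋆ B) ⋆ (C ⋆ D)) p   ≡⟨ ⋆-assoc A B (C ⋆ D) p ⟩
    (A ⋆ (B ⋆ (C ⋆ D))) p   ≡⟨ ⋆-congˡ A (λ q → trans (sym (⋆-assoc B C D q)) (trans (⋆-congʳ D BC q) (one⋆ D q))) p ⟩
    (A ⋆ D) p ∎

  V-θ : ∀ s → V s ⋆ θ (V s) ≐ one
  V-θ s p = trans (⋆-congˡ (V s) (θ-⋆ (v s) (v (not s))) p)
    (trans (cancel-mid (v s) (v (not s)) (θ (v s)) (θ (v (not s))) (θ-inverse′ s) p) (θ-inverse s p))

  φ1 : ∀ s → V s ≐ S.φ s (E 1ℚ)
  φ1 s p = trans (sym (evS-V₂ s p)) (trans (sym (⋆one (evS (V₂ s)) p)) (S.pow-G s 1 p))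

  φ-inv : ∀ s → S.φ s (E (⊝ 1ℚ)) ⋆ V s ≐ one
  φ-inv s p = trans (⋆-congˡ (S.φ s (E (⊝ 1ℚ))) (φ1 s) p) (trans (S.φE-⋆ s (⊝ 1ℚ) 1ℚ p) (trans (S.φ-cong s E-0 p) (S.φ-one s p)))

  θV : ∀ s → θ (V s) ≐ S.φ s (E (⊝ 1ℚ))
  θV s p = begin
    θ (V s) p                                   ≡⟨ sym (one⋆ (θ (V s)) p) ⟩
    (one ⋆ θ (V s)) p                           ≡⟨ ⋆-congʳ (θ (V s)) (≐-sym (φ-inv s)) p ⟩
    ((S.φ s (E (⊝ 1ℚ)) ⋆ V s) ⋆ θ (V s)) p      ≡⟨ ⋆-assoc (S.φ s (E (⊝ 1ℚ))) (V s) (θ (V s)) p ⟩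
    (S.φ s (E (⊝ 1ℚ)) ⋆ (V s ⋆ θ (V s))) p      ≡⟨ ⋆-congˡ (S.φ s (E (⊝ 1ℚ))) (V-θ s) p ⟩
    (S.φ s (E (⊝ 1ℚ)) ⋆ one) p                  ≡⟨ ⋆one (S.φ s (E (⊝ 1ℚ))) p ⟩
    S.φ s (E (⊝ 1ℚ)) p ∎

  neg-nat-suc : ∀ m → ⊝ 1ℚ ⊕ ⊝ nat m ≡ ⊝ nat (suc m)
  neg-nat-suc m = solve 1 (λ x → (:- (con 1ℚ)) :+ :- x := :- (con 1ℚ :+ x)) refl (nat m)

  θ-pow : ∀ s m → θ (pow (V s) m) ≐ S.φ s (E (⊝ nat m))
  θ-pow s zero    p = trans (θ-one p) (trans (sym (S.φ-one s p)) (S.φ-cong s (λ j → sym (E-0 j)) p))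
  θ-pow s (suc m) p = trans (θ-⋆ (V s) (pow (V s) m) p) (trans (⋆-cong (θV s) (θ-pow s m) p)
    (trans (S.φE-⋆ s (⊝ 1ℚ) (⊝ nat m) p) (cong (λ z → S.φ s (E z) p) (neg-nat-suc m))))

  sign-lemma : ∀ p (x : ℕ → ℚ) t → negOnePow (deg p) ⊗ Σ< (suc (deg p)) (λ k → pow₁ t k ⊗ x k) ≡
               Σ< (suc (deg p)) (λ k → pow₁ (⊝ t) k ⊗ x k) →
               Σ< (suc (deg p)) (λ k → pow₁ t k ⊗ (negOnePow (deg p) ⊗ x k)) ≡
               Σ< (suc (deg p)) (λ k → pow₁ t k ⊗ (negOnePow k ⊗ x k))
  sign-lemma p x t eq = trans (Σ<-cong (suc (deg p)) (λ k → ⊗-swap (pow₁ t k) (negOnePow (deg p)) (x k)))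
    (trans (Σ<-*ˡ (suc (deg p)) (negOnePow (deg p)) (λ k → pow₁ t k ⊗ x k)) (trans eq (Σ<-cong (suc (deg p)) (λ k →
      trans (cong (_⊗ x k) (pow₁-neg t k)) (solve 3 (λ n q x → (n :* q) :* x := q :* (n :* x)) refl (negOnePow k) (pow₁ t k) (x k))))))

  sign-vanish : ∀ {x} ν → ν ⊗ ν ≡ 1ℚ → ν ⊗ x ≡ ⊝ ν ⊗ x → x ≡ 0ℚ
  sign-vanish {x} ν sq eq = begin
    x                           ≡⟨ sym (1⊗ x) ⟩
    1ℚ ⊗ x                      ≡⟨ cong (_⊗ x) (sym sq) ⟩
    (ν ⊗ ν) ⊗ x                 ≡⟨ solve 2 (λ n x → (n :* n) :* x := (con ½ :* n) :* (n :* x :+ n :* x)) refl ν x ⟩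
    (½ ⊗ ν) ⊗ (ν ⊗ x ⊕ ν ⊗ x)   ≡⟨ cong (λ z → (½ ⊗ ν) ⊗ (z ⊕ ν ⊗ x)) eq ⟩
    (½ ⊗ ν) ⊗ (⊝ ν ⊗ x ⊕ ν ⊗ x) ≡⟨ solve 2 (λ n x → (con ½ :* n) :* ((:- n) :* x :+ n :* x) := con 0ℚ) refl ν x ⟩
    0ℚ ∎

  I-parity : ∀ s k p → k ≤ deg p → negOnePow k ≡ ⊝ negOnePow (deg p) → I s k p ≡ 0ℚ
  I-parity s k p k≤ opp = sign-vanish (negOnePow (deg p)) (negOnePow-sq (deg p))
    (trans (interpolate (suc (deg p)) (λ k → negOnePow (deg p) ⊗ I s k p) (λ k → negOnePow k ⊗ I s k p) (λ m → nat (double m)) even-inj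
      (λ m → sign-lemma p (λ k → I s k p) (nat (double m)) (begin
        negOnePow (deg p) ⊗ Σ< (suc (deg p)) (λ k → pow₁ (nat (double m)) k ⊗ I s k p)
          ≡⟨ cong (negOnePow (deg p) ⊗_) (I-even s m p) ⟩
        θ (pow (V s) m) p
          ≡⟨ θ-pow s m p ⟩
        S.φ s (E (⊝ nat m)) p
          ≡⟨ cong (λ z → S.φ s (E z) p) (trans (cong ⊝_ (sym (nat-double-½ m))) (ℚ.neg-distribˡ-* (nat (double m)) ½)) ⟩
        S.φ s (E (⊝ nat (double m) ⊗ ½)) p
          ≡⟨ sym (I-gen s (⊝ nat (double m)) p) ⟩
        Σ< (suc (deg p)) (λ k → pow₁ (⊝ nat (double m)) k ⊗ I s k p) ∎)) k (s≤s k≤))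
      (cong (_⊗ I s k p) opp))

  V-not : ∀ s → V (not s) ≐ v (not s) ⋆ v s
  V-not true  _ = refl
  V-not false _ = refl

  θv : ∀ s → θ (v s) ≐ v s ⋆ S.φ (not s) (E (⊝ 1ℚ))
  θv s p = begin
    θ (v s) p                                             ≡⟨ sym (⋆one (θ (v s)) p) ⟩
    (θ (v s) ⋆ one) p                                     ≡⟨ ⋆-congˡ (θ (v s)) (≐-sym VΦ) p ⟩
    (θ (v s) ⋆ ((v (not s) ⋆ v s) ⋆ Φ)) p                 ≡⟨ ⋆-congˡ (θ (v s)) (⋆-assoc (v (not s)) (v s) Φ) p ⟩
    (θ (v s) ⋆ (v (not s) ⋆ (v s ⋆ Φ))) p                 ≡⟨ sym (⋆-assoc (θ (v s)) (v (not s)) (v s ⋆ Φ) p) ⟩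
    ((θ (v s) ⋆ v (not s)) ⋆ (v s ⋆ Φ)) p                 ≡⟨ ⋆-congʳ (v s ⋆ Φ) (θ-inverseˡ s) p ⟩
    (one ⋆ (v s ⋆ Φ)) p                                   ≡⟨ one⋆ (v s ⋆ Φ) p ⟩
    (v s ⋆ Φ) p ∎
    where
    Φ : Fun
    Φ = S.φ (not s) (E (⊝ 1ℚ))
    VΦ : (v (not s) ⋆ v s) ⋆ Φ ≐ one
    VΦ q = trans (⋆-congʳ Φ (≐-trans (≐-sym (V-not s)) (φ1 (not s))) q)
      (trans (S.φE-⋆ (not s) 1ℚ (⊝ 1ℚ) q) (trans (S.φ-cong (not s) E-0 q) (S.φ-one (not s) q)))

  -- By `θv` the sign θ turns the exponent (t - 1)/2 into -1 - (t - 1)/2 = (-t - 1)/2, which is the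
  -- exponent belonging to -t.
  J-parity : ∀ s k p → k ≤ deg p → negOnePow k ≡ ⊝ negOnePow (deg p) → J s k p ≡ 0ℚ
  J-parity s k p k≤ opp = sign-vanish (negOnePow (deg p)) (negOnePow-sq (deg p))
    (trans (interpolate (suc (deg p)) (λ k → negOnePow (deg p) ⊗ J s k p) (λ k → negOnePow k ⊗ J s k p) (λ m → nat (suc (double m))) odd-inj
      (λ m → sign-lemma p (λ k → J s k p) (nat (suc (double m))) (begin
        negOnePow (deg p) ⊗ Σ< (suc (deg p)) (λ k → pow₁ (nat (suc (double m))) k ⊗ J s k p)
          ≡⟨ cong (negOnePow (deg p) ⊗_) (J-odd s m p) ⟩
        θ (v s ⋆ pow (v (not s) ⋆ v s) m) p
          ≡⟨ θ-⋆ (v s) (pow (v (not s) ⋆ v s) m) p ⟩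
        (θ (v s) ⋆ θ (pow (v (not s) ⋆ v s) m)) p
          ≡⟨ ⋆-cong (θv s) (≐-trans (θ-cong (pow-cong (≐-sym (V-not s)) m)) (θ-pow (not s) m)) p ⟩
        ((v s ⋆ S.φ (not s) (E (⊝ 1ℚ))) ⋆ S.φ (not s) (E (⊝ nat m))) p
          ≡⟨ ⋆-assoc (v s) (S.φ (not s) (E (⊝ 1ℚ))) (S.φ (not s) (E (⊝ nat m))) p ⟩
        (v s ⋆ (S.φ (not s) (E (⊝ 1ℚ)) ⋆ S.φ (not s) (E (⊝ nat m)))) p
          ≡⟨ ⋆-congˡ (v s) (S.φE-⋆ (not s) (⊝ 1ℚ) (⊝ nat m)) p ⟩
        (v s ⋆ S.φ (not s) (E (⊝ 1ℚ ⊕ ⊝ nat m))) p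
          ≡⟨ cong (λ z → (v s ⋆ S.φ (not s) (E z)) p) (trans (cong (λ z → ⊝ 1ℚ ⊕ ⊝ z) (sym (nat-double-½ m))) (lem (nat (double m)))) ⟩
        (v s ⋆ S.φ (not s) (E (⊝ ½ ⊕ ⊝ nat (suc (double m)) ⊗ ½))) p
          ≡⟨ sym (J-gen s (⊝ nat (suc (double m))) p) ⟩
        Σ< (suc (deg p)) (λ k → pow₁ (⊝ nat (suc (double m))) k ⊗ J s k p) ∎)) k (s≤s k≤))
      (cong (_⊗ J s k p) opp))
    where
    lem : ∀ x → ⊝ 1ℚ ⊕ ⊝ (x ⊗ ½) ≡ ⊝ ½ ⊕ ⊝ (1ℚ ⊕ x) ⊗ ½
    lem = solve 1 (λ x → (:- (con 1ℚ)) :+ :- (x :* con ½) := (:- (con ½)) :+ (:- (con 1ℚ :+ x)) :* con ½) refl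

-- Words and descents

-- Deconcatenation. Convolution of functions of descent shapes is then the external product: a word
-- is cut and nothing is asked of the two letters at the cut.
splitsL : List ℕ → List (List ℕ × List ℕ)
splitsL []      = ([] , []) ∷ []
splitsL (x ∷ w) = ([] , x ∷ w) ∷ map (λ p → x ∷ proj₁ p , proj₂ p) (splitsL w)

ΔL : List ℕ → (List ℕ → List ℕ → ℚ) → ℚ
ΔL w = ∑₂ (splitsL w)

ΔL-∷ : ∀ x w G → ΔL (x ∷ w) G ≡ G [] (x ∷ w) ⊕ ΔL w (λ q r → G (x ∷ q) r)
ΔL-∷ x w G = cong (G [] (x ∷ w) ⊕_) (∑-map (λ p → x ∷ proj₁ p , proj₂ p) (splitsL w) (λ p → G (proj₁ p) (proj₂ p)))

ΔL-cong : ∀ w {G H : List ℕ → List ℕ → ℚ} → (∀ q r → G q r ≡ H q r) → ΔL w G ≡ ΔL w H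
ΔL-cong w = ∑₂-cong (splitsL w)

ΔL-⊕ : ∀ w (G H : List ℕ → List ℕ → ℚ) → ΔL w (λ q r → G q r ⊕ H q r) ≡ ΔL w G ⊕ ΔL w H
ΔL-⊕ w G H = ∑-⊕ (splitsL w) (λ p → G (proj₁ p) (proj₂ p)) (λ p → H (proj₁ p) (proj₂ p))

ΔL-coassoc : ∀ w (F : List ℕ → List ℕ → List ℕ → ℚ) →
  ΔL w (λ q r → ΔL q (λ s t → F s t r)) ≡ ΔL w (λ q r → ΔL r (λ s t → F q s t))
ΔL-coassoc []      F = refl
ΔL-coassoc (x ∷ w) F = begin
  ΔL (x ∷ w) (λ q r → ΔL q (λ s t → F s t r))
    ≡⟨ ΔL-∷ x w (λ q r → ΔL q (λ s t → F s t r)) ⟩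
  (F [] [] (x ∷ w) ⊕ 0ℚ) ⊕ ΔL w (λ q r → ΔL (x ∷ q) (λ s t → F s t r))
    ≡⟨ cong₂ _⊕_ (⊕0 (F [] [] (x ∷ w))) (trans (ΔL-cong w (λ q r → ΔL-∷ x q (λ s t → F s t r)))
         (ΔL-⊕ w (λ q r → F [] (x ∷ q) r) (λ q r → ΔL q (λ s t → F (x ∷ s) t r)))) ⟩
  F [] [] (x ∷ w) ⊕ (ΔL w (λ q r → F [] (x ∷ q) r) ⊕ ΔL w (λ q r → ΔL q (λ s t → F (x ∷ s) t r)))
    ≡⟨ sym (ℚ.+-assoc (F [] [] (x ∷ w)) _ _) ⟩
  (F [] [] (x ∷ w) ⊕ ΔL w (λ q r → F [] (x ∷ q) r)) ⊕ ΔL w (λ q r → ΔL q (λ s t → F (x ∷ s) t r))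
    ≡⟨ cong₂ _⊕_ (sym (ΔL-∷ x w (F []))) (ΔL-coassoc w (λ s t r → F (x ∷ s) t r)) ⟩
  ΔL (x ∷ w) (F []) ⊕ ΔL w (λ q r → ΔL r (λ s t → F (x ∷ q) s t))
    ≡⟨ sym (ΔL-∷ x w (λ q r → ΔL r (λ s t → F q s t))) ⟩
  ΔL (x ∷ w) (λ q r → ΔL r (λ s t → F q s t)) ∎

ΔL-counitˡ : ∀ w (F : List ℕ → ℚ) → ΔL w (λ q r → 𝟙 (length q ≡ᵇ 0) ⊗ F r) ≡ F w
ΔL-counitˡ []      F = trans (⊕0 (1ℚ ⊗ F [])) (1⊗ (F []))
ΔL-counitˡ (x ∷ w) F = trans (ΔL-∷ x w (λ q r → 𝟙 (length q ≡ᵇ 0) ⊗ F r))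
  (trans (cong₂ _⊕_ (1⊗ (F (x ∷ w))) (∑-zero (splitsL w) (λ p → 0⊗ (F (proj₂ p))))) (⊕0 (F (x ∷ w))))

ΔL-counitʳ : ∀ w (F : List ℕ → ℚ) → ΔL w (λ q r → F q ⊗ 𝟙 (length r ≡ᵇ 0)) ≡ F w
ΔL-counitʳ []      F = trans (⊕0 (F [] ⊗ 1ℚ)) (⊗1 (F []))
ΔL-counitʳ (x ∷ w) F = trans (ΔL-∷ x w (λ q r → F q ⊗ 𝟙 (length r ≡ᵇ 0)))
  (trans (cong₂ _⊕_ (⊗0 (F [])) (ΔL-counitʳ w (F ∘ (x ∷_)))) (0⊕ (F (x ∷ w))))

deg-splitsL : ∀ w → All (λ p → length (proj₁ p) + length (proj₂ p) ≡ length w) (splitsL w)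
deg-splitsL []      = refl ∷ []
deg-splitsL (x ∷ w) = refl ∷ All.map⁺ (All.map (cong suc) (deg-splitsL w))

splitsL-++ : ∀ w → All (λ p → proj₁ p ++ proj₂ p ≡ w) (splitsL w)
splitsL-++ []      = refl ∷ []
splitsL-++ (x ∷ w) = refl ∷ All.map⁺ (All.map (cong (x ∷_)) (splitsL-++ w))

wordC : Coalg
wordC = record
  { Pt = List ℕ ; deg = length ; splits = splitsL ; deg-splits = deg-splitsL
  ; coassoc = ΔL-coassoc ; counitˡ = ΔL-counitˡ ; counitʳ = ΔL-counitʳ }

-- hasShape x i I w: after the letter x, the word w continues the current
-- ascending run by i letters and then has ascending runs of lengths I.
hasShape : ℕ → ℕ → Comp → List ℕ → Bool
hasShape x zero    []          []      = true
hasShape x zero    []          (y ∷ w) = false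
hasShape x zero    (j ∷ I)     []      = false
hasShape x zero    (zero ∷ I)  (y ∷ w) = false
hasShape x zero    (suc j ∷ I) (y ∷ w) = (y <ᵇ x) ∧ hasShape y j I w
hasShape x (suc i) I           []      = false
hasShape x (suc i) I           (y ∷ w) = not (y <ᵇ x) ∧ hasShape y i I w

-- Equal neighbours count as an ascent, as in `desL`. Words with repeated letters are thus covered
-- without a separate case.
isRibbon : Comp → List ℕ → Bool
isRibbon []          []      = true
isRibbon []          (x ∷ w) = false
isRibbon (zero ∷ I)  w       = false
isRibbon (suc i ∷ I) []      = false
isRibbon (suc i ∷ I) (x ∷ w) = hasShape x i I w

∧-true : ∀ a {b} → a ∧ b ≡ true → b ≡ true
∧-true true eq = eq

hasShape-length : ∀ x i I w → hasShape x i I w ≡ true → length w ≡ i + csum I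
hasShape-length x zero    []          []      eq = refl
hasShape-length x zero    (suc j ∷ I) (y ∷ w) eq = cong suc (hasShape-length y j I w (∧-true (y <ᵇ x) eq))
hasShape-length x (suc i) I           (y ∷ w) eq = cong suc (hasShape-length y i I w (∧-true (not (y <ᵇ x)) eq))

isRibbon-length : ∀ I w → isRibbon I w ≡ true → length w ≡ csum I
isRibbon-length []          []      eq = refl
isRibbon-length (suc i ∷ I) (x ∷ w) eq = cong suc (hasShape-length x i I w eq)

𝟙-∧ : ∀ a b → 𝟙 (a ∧ b) ≡ 𝟙 a ⊗ 𝟙 b
𝟙-∧ true  b = sym (1⊗ (𝟙 b))
𝟙-∧ false b = sym (0⊗ (𝟙 b))

-- The length of the first run fixes the cut. The letters next to it form a descent, which keeps the
-- two runs apart, or an ascent, which fuses them.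
hasShape-step : ∀ x i j r w → ΔL w (λ q s → 𝟙 (hasShape x i [] q) ⊗ 𝟙 (isRibbon (suc j ∷ r) s)) ≡
                𝟙 (hasShape x i (suc j ∷ r) w) ⊕ 𝟙 (hasShape x (i + suc j) r w)
hasShape-step x zero    j r [] = refl
hasShape-step x (suc i) j r [] = refl
hasShape-step x zero    j r (y ∷ w) = begin
  ΔL (y ∷ w) (λ q s → 𝟙 (hasShape x 0 [] q) ⊗ 𝟙 (isRibbon (suc j ∷ r) s))
    ≡⟨ ΔL-∷ y w (λ q s → 𝟙 (hasShape x 0 [] q) ⊗ 𝟙 (isRibbon (suc j ∷ r) s)) ⟩
  1ℚ ⊗ z ⊕ ΔL w (λ q s → 0ℚ ⊗ 𝟙 (isRibbon (suc j ∷ r) s))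
    ≡⟨ cong₂ _⊕_ (1⊗ z) (∑-zero (splitsL w) (λ p → 0⊗ (𝟙 (isRibbon (suc j ∷ r) (proj₂ p))))) ⟩
  z ⊕ 0ℚ
    ≡⟨ ⊕0 z ⟩
  z
    ≡⟨ either (y <ᵇ x) ⟩
  𝟙 ((y <ᵇ x) ∧ hasShape y j r w) ⊕ 𝟙 (not (y <ᵇ x) ∧ hasShape y j r w) ∎
  where
  z : ℚ
  z = 𝟙 (hasShape y j r w)
  either : ∀ a → z ≡ 𝟙 (a ∧ hasShape y j r w) ⊕ 𝟙 (not a ∧ hasShape y j r w)
  either true  = sym (⊕0 z)
  either false = sym (0⊕ z)
hasShape-step x (suc i) j r (y ∷ w) = begin
  ΔL (y ∷ w) (λ q s → 𝟙 (hasShape x (suc i) [] q) ⊗ 𝟙 (isRibbon (suc j ∷ r) s))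
    ≡⟨ ΔL-∷ y w (λ q s → 𝟙 (hasShape x (suc i) [] q) ⊗ 𝟙 (isRibbon (suc j ∷ r) s)) ⟩
  0ℚ ⊗ 𝟙 (hasShape y j r w) ⊕ ΔL w (λ q s → 𝟙 (a ∧ hasShape y i [] q) ⊗ 𝟙 (isRibbon (suc j ∷ r) s))
    ≡⟨ cong₂ _⊕_ (0⊗ (𝟙 (hasShape y j r w))) (ΔL-cong w (λ q s → trans (cong (_⊗ 𝟙 (isRibbon (suc j ∷ r) s)) (𝟙-∧ a (hasShape y i [] q)))
         (ℚ.*-assoc (𝟙 a) (𝟙 (hasShape y i [] q)) (𝟙 (isRibbon (suc j ∷ r) s))))) ⟩
  0ℚ ⊕ ΔL w (λ q s → 𝟙 a ⊗ (𝟙 (hasShape y i [] q) ⊗ 𝟙 (isRibbon (suc j ∷ r) s)))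
    ≡⟨ trans (0⊕ _) (∑-*ˡ (splitsL w) (𝟙 a) (λ p → 𝟙 (hasShape y i [] (proj₁ p)) ⊗ 𝟙 (isRibbon (suc j ∷ r) (proj₂ p)))) ⟩
  𝟙 a ⊗ ΔL w (λ q s → 𝟙 (hasShape y i [] q) ⊗ 𝟙 (isRibbon (suc j ∷ r) s))
    ≡⟨ cong (𝟙 a ⊗_) (hasShape-step y i j r w) ⟩
  𝟙 a ⊗ (𝟙 (hasShape y i (suc j ∷ r) w) ⊕ 𝟙 (hasShape y (i + suc j) r w))
    ≡⟨ ℚ.*-distribˡ-+ (𝟙 a) (𝟙 (hasShape y i (suc j ∷ r) w)) (𝟙 (hasShape y (i + suc j) r w)) ⟩
  𝟙 a ⊗ 𝟙 (hasShape y i (suc j ∷ r) w) ⊕ 𝟙 a ⊗ 𝟙 (hasShape y (i + suc j) r w)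
    ≡⟨ cong₂ _⊕_ (sym (𝟙-∧ a (hasShape y i (suc j ∷ r) w))) (sym (𝟙-∧ a (hasShape y (i + suc j) r w))) ⟩
  𝟙 (a ∧ hasShape y i (suc j ∷ r) w) ⊕ 𝟙 (a ∧ hasShape y (i + suc j) r w) ∎
  where
  a : Bool
  a = not (y <ᵇ x)

isRibbon-step : ∀ i j r w → ΔL w (λ q s → 𝟙 (isRibbon (suc i ∷ []) q) ⊗ 𝟙 (isRibbon (suc j ∷ r) s)) ≡
                𝟙 (isRibbon (suc i ∷ suc j ∷ r) w) ⊕ 𝟙 (isRibbon ((suc i + suc j) ∷ r) w)
isRibbon-step i j r []      = refl
isRibbon-step i j r (x ∷ w) = trans (ΔL-∷ x w (λ q s → 𝟙 (isRibbon (suc i ∷ []) q) ⊗ 𝟙 (isRibbon (suc j ∷ r) s)))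
  (trans (cong (_⊕ ΔL w (λ q s → 𝟙 (hasShape x i [] q) ⊗ 𝟙 (isRibbon (suc j ∷ r) s))) (0⊗ (𝟙 (hasShape x j r w))))
    (trans (0⊕ _) (hasShape-step x i j r w)))

isRibbon-deg : ∀ {d} I → Valid d I → ∀ w → length w ≢ d → 𝟙 (isRibbon I w) ≡ 0ℚ
isRibbon-deg I (_ , refl) w neq with isRibbon I w in eq
... | true  = ⊥-elim (neq (isRibbon-length I w eq))
... | false = refl

isRibbon-[] : ∀ w → 𝟙 (isRibbon [] w) ≡ 𝟙 (length w ≡ᵇ 0)
isRibbon-[] []      = refl
isRibbon-[] (x ∷ w) = refl

wordI : Interp
wordI = record
  { coalg = wordC ; b = λ I w → 𝟙 (isRibbon I w) ; b-[] = isRibbon-[]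
  ; b-step = isRibbon-step ; b-deg = isRibbon-deg }

module NC = Signed wordI

desL-head : ∀ k x w {h t} → desL k (x ∷ w) ≡ h ∷ t → k ≤ h
desL-head k x (y ∷ w) eq with y <ᵇ x
... | true  = ℕ.≤-reflexive (L.∷-injectiveˡ eq)
... | false = ℕ.≤-trans (ℕ.n≤1+n k) (desL-head (suc k) y w eq)

compDes-shift : ∀ acc i I → compDesAcc acc (suc i ∷ I) ≡ compDesAcc (suc acc) (i ∷ I)
compDes-shift acc i []      = refl
compDes-shift acc i (j ∷ I) = cong (λ z → z ∷ compDesAcc z (j ∷ I)) (ℕ.+-suc acc i)

compDes-head : ∀ acc i I h t → compDesAcc acc (suc i ∷ I) ≡ h ∷ t → acc < h
compDes-head acc i (j ∷ I) .(acc + suc i) _ refl = ℕ.m<m+n acc (s≤s z≤n)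

bool-ext : ∀ {a b : Bool} → (a ≡ true → b ≡ true) → (b ≡ true → a ≡ true) → a ≡ b
bool-ext {true}  {true}  f g = refl
bool-ext {true}  {false} f g = sym (f refl)
bool-ext {false} {true}  f g = g refl
bool-ext {false} {false} f g = refl

⌊⌋-true : ∀ {P : Set} (d : Dec P) → ⌊ d ⌋ ≡ true → P
⌊⌋-true (yes p) _ = p

true-⌊⌋ : ∀ {P : Set} (d : Dec P) → P → ⌊ d ⌋ ≡ true
true-⌊⌋ (yes _) p = refl
true-⌊⌋ (no ¬p) p = ⊥-elim (¬p p)

shape⇒des : ∀ acc x i I w → All (1 ≤_) I → hasShape x i I w ≡ true → desL (suc acc) (x ∷ w) ≡ compDesAcc acc (suc i ∷ I)
shape⇒des acc x zero    []          []      pos eq = refl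
shape⇒des acc x zero    (suc j ∷ I) (y ∷ w) (_ ∷ pos) eq with y <ᵇ x
... | true  = trans (cong (suc acc ∷_) (shape⇒des (suc acc) y j I w pos eq)) (cong (λ z → z ∷ compDesAcc z (suc j ∷ I)) (ℕ.+-comm 1 acc))
shape⇒des acc x (suc i) I           (y ∷ w) pos eq with y <ᵇ x
... | false = trans (shape⇒des (suc acc) y i I w pos eq) (sym (compDes-shift acc (suc i) I))

des⇒shape : ∀ acc x i I w → All (1 ≤_) I → length w ≡ i + csum I → desL (suc acc) (x ∷ w) ≡ compDesAcc acc (suc i ∷ I) → hasShape x i I w ≡ true
des⇒shape acc x zero    []          []      pos len eq = refl
des⇒shape acc x zero    (suc j ∷ I) (y ∷ w) (_ ∷ pos) len eq with y <ᵇ x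
... | true  = des⇒shape (suc acc) y j I w pos (ℕ.suc-injective len)
  (trans (L.∷-injectiveʳ eq) (cong (λ z → compDesAcc z (suc j ∷ I)) (ℕ.+-comm acc 1)))
... | false = ⊥-elim (ℕ.<-irrefl (ℕ.+-comm 1 acc) (desL-head (suc (suc acc)) y w eq))
des⇒shape acc x (suc i) I           (y ∷ w) pos len eq with y <ᵇ x
... | true  = ⊥-elim (ℕ.<-irrefl refl (compDes-head (suc acc) i I _ _ (trans (sym (compDes-shift acc (suc i) I)) (sym eq))))
... | false = des⇒shape (suc acc) y i I w pos (ℕ.suc-injective len) (trans eq (compDes-shift acc (suc i) I))
des⇒shape acc x zero    (zero ∷ I)  w       (() ∷ _) len eq

-- Identifies the comparison of descent lists in `ι` with the shape test. Descents determine a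
-- composition only together with its weight, hence the hypothesis on the length of w.
descent-ribbon : ∀ I w → Valid (length w) I → ⌊ L.≡-dec ℕ._≟_ (desPerm w) (compDes I) ⌋ ≡ isRibbon I w
descent-ribbon []          []      (pos , len) = refl
descent-ribbon (suc i ∷ I) (x ∷ w) (_ ∷ pos , len) = bool-ext
  (λ e → des⇒shape 0 x i I w pos (sym (ℕ.suc-injective len)) (⌊⌋-true (L.≡-dec ℕ._≟_ (desPerm (x ∷ w)) (compDes (suc i ∷ I))) e))
  (λ e → true-⌊⌋ (L.≡-dec ℕ._≟_ (desPerm (x ∷ w)) (compDes (suc i ∷ I))) (shape⇒des 0 x i I w pos e))
descent-ribbon (zero ∷ I)  w       (() ∷ _ , _)

step : Bool → ℕ → ℕ → Bool
step true  x y = not (y <ᵇ x)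
step false x y = y <ᵇ x

mono : Bool → List ℕ → Bool
mono s []          = true
mono s (x ∷ [])    = true
mono s (x ∷ y ∷ w) = step s x y ∧ mono s (y ∷ w)

fs : Bool → List ℕ → ℚ
fs s w = 𝟙 (mono s w)

v≐fs : ∀ s → NC.v s NC.≐ fs s
v≐fs true  []      = refl
v≐fs false []      = refl
v≐fs true  (x ∷ w) = trans (NC.ev-single (suc (length w) ∷ []) (x ∷ w)) (cong 𝟙 (go x w))
  where
  go : ∀ x w → hasShape x (length w) [] w ≡ mono true (x ∷ w)
  go x []      = refl
  go x (y ∷ w) = cong (not (y <ᵇ x) ∧_) (go y w)
v≐fs false (x ∷ w) = trans (NC.ev-single (replicate (suc (length w)) 1) (x ∷ w)) (cong 𝟙 (go x w))
  where
  go : ∀ x w → hasShape x 0 (replicate (length w) 1) w ≡ mono false (x ∷ w)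
  go x []      = refl
  go x (y ∷ w) = cong ((y <ᵇ x) ∧_) (go y w)

-- Products in the group algebra

Word : Set
Word = List ℕ

-- The unshuffle coproduct, as a summation functional.
ΔU : Word → (Word → Word → ℚ) → ℚ
ΔU []      G = G [] []
ΔU (x ∷ w) G = ΔU w (λ a b → G (x ∷ a) b) ⊕ ΔU w (λ a b → G a (x ∷ b))

-- The subword relation is kept because monotonicity of w must be passed on to both parts, see
-- `increasing-⊆`.
ΔU-cong-⊆ : ∀ w {G H : Word → Word → ℚ} → (∀ a b → a ⊆ w → b ⊆ w → G a b ≡ H a b) → ΔU w G ≡ ΔU w H
ΔU-cong-⊆ []      eq = eq [] [] [] []
ΔU-cong-⊆ (x ∷ w) eq = cong₂ _⊕_
  (ΔU-cong-⊆ w (λ a b pa pb → eq (x ∷ a) b (refl ∷ pa) (x ∷ʳ pb)))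
  (ΔU-cong-⊆ w (λ a b pa pb → eq a (x ∷ b) (x ∷ʳ pa) (refl ∷ pb)))

ΔU-cong : ∀ w {G H : Word → Word → ℚ} → (∀ a b → G a b ≡ H a b) → ΔU w G ≡ ΔU w H
ΔU-cong w eq = ΔU-cong-⊆ w (λ a b _ _ → eq a b)

ΔU-⊕ : ∀ w (G H : Word → Word → ℚ) → ΔU w (λ a b → G a b ⊕ H a b) ≡ ΔU w G ⊕ ΔU w H
ΔU-⊕ []      G H = refl
ΔU-⊕ (x ∷ w) G H = trans (cong₂ _⊕_ (ΔU-⊕ w (λ a b → G (x ∷ a) b) (λ a b → H (x ∷ a) b)) (ΔU-⊕ w (λ a b → G a (x ∷ b)) (λ a b → H a (x ∷ b))))
  (⊕-interchange (ΔU w (λ a b → G (x ∷ a) b)) _ _ _)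

ΔU-0 : ∀ w → ΔU w (λ _ _ → 0ℚ) ≡ 0ℚ
ΔU-0 []      = refl
ΔU-0 (x ∷ w) = trans (cong₂ _⊕_ (ΔU-0 w) (ΔU-0 w)) refl

ΔU-unitˡ : ∀ w (H : Word → Word → ℚ) → (∀ x a b → H (x ∷ a) b ≡ 0ℚ) → ΔU w H ≡ H [] w
ΔU-unitˡ []      H z = refl
ΔU-unitˡ (x ∷ w) H z = trans (cong₂ _⊕_ (trans (ΔU-cong w (z x)) (ΔU-0 w)) (ΔU-unitˡ w (λ a b → H a (x ∷ b)) (λ y a b → z y a (x ∷ b)))) (0⊕ (H [] (x ∷ w)))

ΔU-comm : ∀ w G → ΔU w G ≡ ΔU w (λ a b → G b a)
ΔU-comm []      G = refl
ΔU-comm (x ∷ w) G = trans (cong₂ _⊕_ (ΔU-comm w (λ a b → G (x ∷ a) b)) (ΔU-comm w (λ a b → G a (x ∷ b))))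
  (ℚ.+-comm (ΔU w (λ a b → G (x ∷ b) a)) _)

ΔU-coassoc : ∀ w (G : Word → Word → Word → ℚ) →
  ΔU w (λ p c → ΔU p (λ a b → G a b c)) ≡ ΔU w (λ a q → ΔU q (λ b c → G a b c))
ΔU-coassoc []      G = refl
ΔU-coassoc (x ∷ w) G = begin
  ΔU w (λ p c → ΔU p (λ a b → G (x ∷ a) b c) ⊕ ΔU p (λ a b → G a (x ∷ b) c)) ⊕ ΔU w (λ p c → ΔU p (λ a b → G a b (x ∷ c)))
    ≡⟨ cong₂ _⊕_ (trans (ΔU-⊕ w (λ p c → ΔU p (λ a b → G (x ∷ a) b c)) (λ p c → ΔU p (λ a b → G a (x ∷ b) c)))
         (cong₂ _⊕_ (ΔU-coassoc w (λ a b c → G (x ∷ a) b c)) (ΔU-coassoc w (λ a b c → G a (x ∷ b) c)))) (ΔU-coassoc w (λ a b c → G a b (x ∷ c))) ⟩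
  (ΔU w (λ a q → ΔU q (λ b c → G (x ∷ a) b c)) ⊕ ΔU w (λ a q → ΔU q (λ b c → G a (x ∷ b) c))) ⊕ ΔU w (λ a q → ΔU q (λ b c → G a b (x ∷ c)))
    ≡⟨ ℚ.+-assoc (ΔU w (λ a q → ΔU q (λ b c → G (x ∷ a) b c))) _ _ ⟩
  ΔU w (λ a q → ΔU q (λ b c → G (x ∷ a) b c)) ⊕ (ΔU w (λ a q → ΔU q (λ b c → G a (x ∷ b) c)) ⊕ ΔU w (λ a q → ΔU q (λ b c → G a b (x ∷ c))))
    ≡⟨ cong (ΔU w (λ a q → ΔU q (λ b c → G (x ∷ a) b c)) ⊕_) (sym (ΔU-⊕ w (λ a q → ΔU q (λ b c → G a (x ∷ b) c)) (λ a q → ΔU q (λ b c → G a b (x ∷ c))))) ⟩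
  ΔU w (λ a q → ΔU q (λ b c → G (x ∷ a) b c)) ⊕ ΔU w (λ a q → ΔU q (λ b c → G a (x ∷ b) c) ⊕ ΔU q (λ b c → G a b (x ∷ c))) ∎

-- The unshuffle coproduct is cocommutative: distributing letters over four places does not depend
-- on how the places are paired.
ΔU-interchange : ∀ w (G : Word → Word → Word → Word → ℚ) →
  ΔU w (λ p q → ΔU p (λ a b → ΔU q (λ c d → G a b c d))) ≡ ΔU w (λ p q → ΔU p (λ a c → ΔU q (λ b d → G a b c d)))
ΔU-interchange []      G = refl
ΔU-interchange (x ∷ w) G = begin
  ΔU w (λ p q → ΔU p (λ a b → ΔU q (λ c d → G (x ∷ a) b c d)) ⊕ ΔU p (λ a b → ΔU q (λ c d → G a (x ∷ b) c d)))
    ⊕ ΔU w (λ p q → ΔU p (λ a b → ΔU q (λ c d → G a b (x ∷ c) d) ⊕ ΔU q (λ c d → G a b c (x ∷ d))))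
    ≡⟨ cong₂ _⊕_ (ΔU-⊕ w _ _) (trans (ΔU-cong w (λ p q → ΔU-⊕ p _ _)) (ΔU-⊕ w _ _)) ⟩
  (L₁ ⊕ L₂) ⊕ (L₃ ⊕ L₄)
    ≡⟨ cong₂ _⊕_ (cong₂ _⊕_ (ΔU-interchange w (λ a b c d → G (x ∷ a) b c d)) (ΔU-interchange w (λ a b c d → G a (x ∷ b) c d)))
                 (cong₂ _⊕_ (ΔU-interchange w (λ a b c d → G a b (x ∷ c) d)) (ΔU-interchange w (λ a b c d → G a b c (x ∷ d)))) ⟩
  (R₁ ⊕ R₂) ⊕ (R₃ ⊕ R₄)
    ≡⟨ ⊕-interchange R₁ R₂ R₃ R₄ ⟩
  (R₁ ⊕ R₃) ⊕ (R₂ ⊕ R₄)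
    ≡⟨ sym (cong₂ _⊕_ (ΔU-⊕ w _ _) (trans (ΔU-cong w (λ p q → ΔU-⊕ p _ _)) (ΔU-⊕ w _ _))) ⟩
  ΔU w (λ p q → ΔU p (λ a c → ΔU q (λ b d → G (x ∷ a) b c d)) ⊕ ΔU p (λ a c → ΔU q (λ b d → G a b (x ∷ c) d)))
    ⊕ ΔU w (λ p q → ΔU p (λ a c → ΔU q (λ b d → G a (x ∷ b) c d) ⊕ ΔU q (λ b d → G a b c (x ∷ d)))) ∎
  where
  L₁ L₂ L₃ L₄ R₁ R₂ R₃ R₄ : ℚ
  L₁ = ΔU w (λ p q → ΔU p (λ a b → ΔU q (λ c d → G (x ∷ a) b c d)))
  L₂ = ΔU w (λ p q → ΔU p (λ a b → ΔU q (λ c d → G a (x ∷ b) c d)))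
  L₃ = ΔU w (λ p q → ΔU p (λ a b → ΔU q (λ c d → G a b (x ∷ c) d)))
  L₄ = ΔU w (λ p q → ΔU p (λ a b → ΔU q (λ c d → G a b c (x ∷ d))))
  R₁ = ΔU w (λ p q → ΔU p (λ a c → ΔU q (λ b d → G (x ∷ a) b c d)))
  R₂ = ΔU w (λ p q → ΔU p (λ a c → ΔU q (λ b d → G a (x ∷ b) c d)))
  R₃ = ΔU w (λ p q → ΔU p (λ a c → ΔU q (λ b d → G a b (x ∷ c) d)))
  R₄ = ΔU w (λ p q → ΔU p (λ a c → ΔU q (λ b d → G a b c (x ∷ d))))

ΔU-++ : ∀ u z F → ΔU (u ++ z) F ≡ ΔU u (λ a b → ΔU z (λ c d → F (a ++ c) (b ++ d)))
ΔU-++ []      z F = refl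
ΔU-++ (x ∷ u) z F = cong₂ _⊕_ (ΔU-++ u z (λ a b → F (x ∷ a) b)) (ΔU-++ u z (λ a b → F a (x ∷ b)))

ΔU-reverse : ∀ p F → ΔU (reverse p) F ≡ ΔU p (λ a b → F (reverse a) (reverse b))
ΔU-reverse []      F = refl
ΔU-reverse (x ∷ p) F = begin
  ΔU (reverse (x ∷ p)) F
    ≡⟨ cong (λ z → ΔU z F) (L.unfold-reverse x p) ⟩
  ΔU (reverse p ++ x ∷ []) F
    ≡⟨ ΔU-++ (reverse p) (x ∷ []) F ⟩
  ΔU (reverse p) (λ a b → F (a ++ x ∷ []) (b ++ []) ⊕ F (a ++ []) (b ++ x ∷ []))
    ≡⟨ ΔU-reverse p (λ a b → F (a ++ x ∷ []) (b ++ []) ⊕ F (a ++ []) (b ++ x ∷ [])) ⟩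
  ΔU p (λ a b → F (reverse a ++ x ∷ []) (reverse b ++ []) ⊕ F (reverse a ++ []) (reverse b ++ x ∷ []))
    ≡⟨ ΔU-cong p (λ a b → cong₂ _⊕_ (cong₂ F (sym (L.unfold-reverse x a)) (L.++-identityʳ (reverse b)))
                                     (cong₂ F (L.++-identityʳ (reverse a)) (sym (L.unfold-reverse x b)))) ⟩
  ΔU p (λ a b → F (reverse (x ∷ a)) (reverse b) ⊕ F (reverse a) (reverse (x ∷ b)))
    ≡⟨ ΔU-⊕ p (λ a b → F (reverse (x ∷ a)) (reverse b)) (λ a b → F (reverse a) (reverse (x ∷ b))) ⟩
  ΔU (x ∷ p) (λ a b → F (reverse a) (reverse b)) ∎

ΔU-map : ∀ (f : ℕ → ℕ) w G → ΔU (map f w) G ≡ ΔU w (λ a b → G (map f a) (map f b))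
ΔU-map f []      G = refl
ΔU-map f (x ∷ w) G = cong₂ _⊕_ (ΔU-map f w (λ a b → G (f x ∷ a) b)) (ΔU-map f w (λ a b → G a (f x ∷ b)))

sgn : Bool → Word → Word
sgn true  w = w
sgn false w = reverse w

ΔU-sgn : ∀ s p F → ΔU (sgn s p) F ≡ ΔU p (λ a b → F (sgn s a) (sgn s b))
ΔU-sgn true  p F = refl
ΔU-sgn false p F = ΔU-reverse p F

sgn-map : ∀ s (f : ℕ → ℕ) w → map f (sgn s w) ≡ sgn s (map f w)
sgn-map true  f w = refl
sgn-map false f w = L.reverse-map f w

-- Right multiplication by V_A, acting on functions of words.
T∗ : List Bool → (Word → ℚ) → Word → ℚ
T∗ []      g []      = g []
T∗ []      g (x ∷ w) = 0ℚ
T∗ (s ∷ A) g w       = ΔU w (λ a b → T∗ A (λ z → g (sgn s a ++ z)) b)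

T-cong : ∀ A {g h : Word → ℚ} → (∀ z → g z ≡ h z) → ∀ w → T∗ A g w ≡ T∗ A h w
T-cong []      eq []      = eq []
T-cong []      eq (x ∷ w) = refl
T-cong (s ∷ A) eq w       = ΔU-cong w (λ a b → T-cong A (λ z → eq (sgn s a ++ z)) b)

T-⊕ : ∀ A (g h : Word → ℚ) w → T∗ A (λ z → g z ⊕ h z) w ≡ T∗ A g w ⊕ T∗ A h w
T-⊕ []      g h []      = refl
T-⊕ []      g h (x ∷ w) = refl
T-⊕ (s ∷ A) g h w       = trans (ΔU-cong w (λ a b → T-⊕ A (λ z → g (sgn s a ++ z)) (λ z → h (sgn s a ++ z)) b)) (ΔU-⊕ w _ _)

T-0 : ∀ A w → T∗ A (λ _ → 0ℚ) w ≡ 0ℚ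
T-0 []      []      = refl
T-0 []      (x ∷ w) = refl
T-0 (s ∷ A) w       = trans (ΔU-cong w (λ a b → T-0 A b)) (ΔU-0 w)

T-swap-ΔU : ∀ A u (F : Word → Word → Word → ℚ) w → T∗ A (λ z → ΔU u (F z)) w ≡ ΔU u (λ a b → T∗ A (λ z → F z a b) w)
T-swap-ΔU A []      F w = refl
T-swap-ΔU A (x ∷ u) F w = trans (T-⊕ A (λ z → ΔU u (λ a b → F z (x ∷ a) b)) (λ z → ΔU u (λ a b → F z a (x ∷ b))) w)
  (cong₂ _⊕_ (T-swap-ΔU A u (λ z a b → F z (x ∷ a) b) w) (T-swap-ΔU A u (λ z a b → F z a (x ∷ b)) w))

T-++ : ∀ A B g w → T∗ (A ++ B) g w ≡ ΔU w (λ a b → T∗ A (λ x → T∗ B (λ z → g (x ++ z)) b) a)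
T-++ []      B g w = sym (ΔU-unitˡ w (λ a b → T∗ [] (λ x → T∗ B (λ z → g (x ++ z)) b) a) (λ _ _ _ → refl))
T-++ (s ∷ A) B g w = begin
  ΔU w (λ p q → T∗ (A ++ B) (λ z → g (sgn s p ++ z)) q)
    ≡⟨ ΔU-cong w (λ p q → T-++ A B (λ z → g (sgn s p ++ z)) q) ⟩
  ΔU w (λ p q → ΔU q (λ a b → T∗ A (λ x → T∗ B (λ z → g (sgn s p ++ (x ++ z))) b) a))
    ≡⟨ sym (ΔU-coassoc w (λ p a b → T∗ A (λ x → T∗ B (λ z → g (sgn s p ++ (x ++ z))) b) a)) ⟩
  ΔU w (λ u b → ΔU u (λ p a → T∗ A (λ x → T∗ B (λ z → g (sgn s p ++ (x ++ z))) b) a))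
    ≡⟨ ΔU-cong w (λ u b → ΔU-cong u (λ p a → T-cong A (λ x → T-cong B (λ z → cong g (sym (L.++-assoc (sgn s p) x z))) b) a)) ⟩
  ΔU w (λ u b → ΔU u (λ p a → T∗ A (λ x → T∗ B (λ z → g ((sgn s p ++ x) ++ z)) b) a)) ∎

T-[_] : ∀ s h b → T∗ (s ∷ []) h b ≡ h (sgn s b)
T-[ s ] h b = trans (ΔU-comm b (λ p q → T∗ [] (λ z → h (sgn s p ++ z)) q))
  (trans (ΔU-unitˡ b (λ q p → T∗ [] (λ z → h (sgn s p ++ z)) q) (λ _ _ _ → refl)) (cong h (L.++-identityʳ (sgn s b))))

flipA : List Bool → List Bool
flipA A = map not (reverse A)

reverse-sgn : ∀ s p → reverse (sgn s p) ≡ sgn (not s) p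
reverse-sgn true  p = refl
reverse-sgn false p = L.reverse-involutive p

-- Reversing a concatenation reverses the order of the blocks and the orientation of each block.
T-flip : ∀ A g w → T∗ (flipA A) g w ≡ T∗ A (λ z → g (reverse z)) w
T-flip []      g []      = refl
T-flip []      g (x ∷ w) = refl
T-flip (s ∷ A) g w = begin
  T∗ (map not (reverse (s ∷ A))) g w
    ≡⟨ cong (λ z → T∗ z g w) (trans (cong (map not) (L.unfold-reverse s A)) (L.map-++ not (reverse A) (s ∷ []))) ⟩
  T∗ (flipA A ++ not s ∷ []) g w
    ≡⟨ T-++ (flipA A) (not s ∷ []) g w ⟩
  ΔU w (λ a b → T∗ (flipA A) (λ x → T∗ (not s ∷ []) (λ z → g (x ++ z)) b) a)
    ≡⟨ ΔU-cong w (λ a b → trans (T-cong (flipA A) (λ x → T-[ not s ] (λ z → g (x ++ z)) b) a) (T-flip A (λ x → g (x ++ sgn (not s) b)) a)) ⟩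
  ΔU w (λ a b → T∗ A (λ x → g (reverse x ++ sgn (not s) b)) a)
    ≡⟨ ΔU-comm w (λ a b → T∗ A (λ x → g (reverse x ++ sgn (not s) b)) a) ⟩
  ΔU w (λ p q → T∗ A (λ x → g (reverse x ++ sgn (not s) p)) q)
    ≡⟨ ΔU-cong w (λ p q → T-cong A (λ x → cong g (sym (trans (L.reverse-++ (sgn s p) x) (cong (reverse x ++_) (reverse-sgn s p))))) q) ⟩
  ΔU w (λ p q → T∗ A (λ x → g (reverse (sgn s p ++ x))) q) ∎

-- Unshuffling is compatible with concatenation and with reversal of a block. Hence splitting the
-- output amounts to splitting the input and rearranging either half; `ΔU-interchange` exchanges the
-- two distributions of letters.
T-ΔU : ∀ A F w → T∗ A (λ z → ΔU z F) w ≡ ΔU w (λ a b → T∗ A (λ x → T∗ A (λ y → F x y) b) a)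
T-ΔU []      F []      = refl
T-ΔU []      F (x ∷ w) = sym (trans (cong₂ _⊕_ (ΔU-0 w) (trans (ΔU-unitˡ w (λ a b → T∗ [] (λ z → T∗ [] (F z) (x ∷ b)) a) (λ _ _ _ → refl)) refl)) refl)
T-ΔU (s ∷ A) F w = begin
  ΔU w (λ p q → T∗ A (λ z → ΔU (sgn s p ++ z) F) q)
    ≡⟨ ΔU-cong w (λ p q → T-cong A (λ z → trans (ΔU-++ (sgn s p) z F) (ΔU-sgn s p (λ a b → ΔU z (λ c d → F (a ++ c) (b ++ d))))) q) ⟩
  ΔU w (λ p q → T∗ A (λ z → ΔU p (λ a b → ΔU z (λ c d → F (sgn s a ++ c) (sgn s b ++ d)))) q)
    ≡⟨ ΔU-cong w (λ p q → T-swap-ΔU A p (λ z a b → ΔU z (λ c d → F (sgn s a ++ c) (sgn s b ++ d))) q) ⟩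
  ΔU w (λ p q → ΔU p (λ a b → T∗ A (λ z → ΔU z (λ c d → F (sgn s a ++ c) (sgn s b ++ d))) q))
    ≡⟨ ΔU-cong w (λ p q → ΔU-cong p (λ a b → T-ΔU A (λ c d → F (sgn s a ++ c) (sgn s b ++ d)) q)) ⟩
  ΔU w (λ p q → ΔU p (λ a b → ΔU q (λ c d → T∗ A (λ x → T∗ A (λ y → F (sgn s a ++ x) (sgn s b ++ y)) d) c)))
    ≡⟨ ΔU-interchange w (λ a b c d → T∗ A (λ x → T∗ A (λ y → F (sgn s a ++ x) (sgn s b ++ y)) d) c) ⟩
  ΔU w (λ p q → ΔU p (λ a c → ΔU q (λ b d → T∗ A (λ x → T∗ A (λ y → F (sgn s a ++ x) (sgn s b ++ y)) d) c)))
    ≡⟨ ΔU-cong w (λ p q → ΔU-cong p (λ a c → sym (T-swap-ΔU A q (λ x b d → T∗ A (λ y → F (sgn s a ++ x) (sgn s b ++ y)) d) c))) ⟩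
  ΔU w (λ p q → ΔU p (λ a c → T∗ A (λ x → ΔU q (λ b d → T∗ A (λ y → F (sgn s a ++ x) (sgn s b ++ y)) d)) c)) ∎

T-at-[] : ∀ A g → T∗ A g [] ≡ g []
T-at-[] []          g = refl
T-at-[] (true ∷ A)  g = T-at-[] A g
T-at-[] (false ∷ A) g = T-at-[] A g

sgn-∷ : ∀ s x a z → sgn s (x ∷ a) ++ z ≢ []
sgn-∷ true  x a z ()
sgn-∷ false x a z eq with reverse a | trans (sym (L.++-assoc (reverse a) (x ∷ []) z)) (trans (cong (_++ z) (sym (L.unfold-reverse x a))) eq)
... | []    | ()
... | _ ∷ _ | ()

++-≢[] : ∀ (u z : Word) → z ≢ [] → u ++ z ≢ []
++-≢[] []      z z≢ eq = z≢ eq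

T-nonempty : ∀ A g → (∀ z → z ≢ [] → g z ≡ 0ℚ) → ∀ x w → T∗ A g (x ∷ w) ≡ 0ℚ
T-nonempty []      g z₀ x w = refl
T-nonempty (s ∷ A) g z₀ x w = trans (cong₂ _⊕_
  (trans (ΔU-cong w (λ a b → trans (T-cong A (λ z → z₀ (sgn s (x ∷ a) ++ z) (sgn-∷ s x a z)) b) (T-0 A b))) (ΔU-0 w))
  (trans (ΔU-cong w (λ a b → T-nonempty A (λ z → g (sgn s a ++ z)) (λ z z≢ → z₀ (sgn s a ++ z) (++-≢[] (sgn s a) z z≢)) x b)) (ΔU-0 w))) refl

act : Bool → List Bool → List Bool
act true  A = A
act false A = flipA A

infixl 7 _⊙_
_⊙_ : List Bool → List Bool → List Bool
A ⊙ []      = []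
A ⊙ (b ∷ B) = act b A ++ A ⊙ B

T-act : ∀ b A g w → T∗ (act b A) g w ≡ T∗ A (λ z → g (sgn b z)) w
T-act true  A g w = refl
T-act false A g w = T-flip A g w

-- Induction on B. By `T-ΔU` the first block of B and the remaining blocks act on separately
-- rearranged words, and a sign of B outside a rearrangement by A is absorbed into `act b A`.
T-⊙ : ∀ A B g w → T∗ A (T∗ B g) w ≡ T∗ (A ⊙ B) g w
T-⊙ A []      g []      = T-at-[] A (T∗ [] g)
T-⊙ A []      g (x ∷ w) = T-nonempty A (T∗ [] g) (λ { [] z≢ → ⊥-elim (z≢ refl) ; (_ ∷ _) _ → refl }) x w
T-⊙ A (b ∷ B) g w = begin
  T∗ A (λ z → ΔU z (λ x y → T∗ B (λ u → g (sgn b x ++ u)) y)) w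
    ≡⟨ T-ΔU A (λ x y → T∗ B (λ u → g (sgn b x ++ u)) y) w ⟩
  ΔU w (λ p q → T∗ A (λ x → T∗ A (λ y → T∗ B (λ u → g (sgn b x ++ u)) y) q) p)
    ≡⟨ ΔU-cong w (λ p q → T-cong A (λ x → T-⊙ A B (λ u → g (sgn b x ++ u)) q) p) ⟩
  ΔU w (λ p q → T∗ A (λ x → T∗ (A ⊙ B) (λ u → g (sgn b x ++ u)) q) p)
    ≡⟨ ΔU-cong w (λ p q → sym (T-act b A (λ x → T∗ (A ⊙ B) (λ u → g (x ++ u)) q) p)) ⟩
  ΔU w (λ p q → T∗ (act b A) (λ x → T∗ (A ⊙ B) (λ u → g (x ++ u)) q) p)
    ≡⟨ sym (T-++ (act b A) (A ⊙ B) g w) ⟩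
  T∗ (act b A ++ A ⊙ B) g w ∎

T-map : ∀ A (f : ℕ → ℕ) g w → T∗ A g (map f w) ≡ T∗ A (λ z → g (map f z)) w
T-map []      f g []      = refl
T-map []      f g (x ∷ w) = refl
T-map (s ∷ A) f g w = trans (ΔU-map f w (λ a b → T∗ A (λ z → g (sgn s a ++ z)) b))
  (ΔU-cong w (λ a b → trans (T-map A f (λ z → g (sgn s (map f a) ++ z)) b)
    (T-cong A (λ z → cong g (sym (trans (L.map-++ f (sgn s a) z) (cong (_++ map f z) (sgn-map s f a))))) b)))

ins : ℕ → Word → (Word → ℚ) → ℚ
ins x []      g = g (x ∷ [])
ins x (y ∷ σ) g = g (x ∷ y ∷ σ) ⊕ ins x σ (λ τ → g (y ∷ τ))

-- The sum of g over all arrangements of the letters, built by insertion of the first letter. For an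
-- increasing word that letter is the smallest, which makes monotone arrangements easy to follow.
arr : Word → (Word → ℚ) → ℚ
arr []      g = g []
arr (x ∷ w) g = arr w (λ σ → ins x σ g)

ins-cong-All : ∀ {P : ℕ → Set} {x} σ {g h : Word → ℚ} → P x → All P σ →
               (∀ τ → All P τ → length τ ≡ suc (length σ) → g τ ≡ h τ) → ins x σ g ≡ ins x σ h
ins-cong-All []      px pσ       eq = eq _ (px ∷ []) refl
ins-cong-All (y ∷ σ) px (py ∷ pσ) eq = cong₂ _⊕_ (eq _ (px ∷ py ∷ pσ) refl)
  (ins-cong-All σ px pσ (λ τ pτ len → eq (y ∷ τ) (py ∷ pτ) (cong suc len)))

arr-cong-All : ∀ {P : ℕ → Set} w {g h : Word → ℚ} → All P w →
               (∀ σ → All P σ → length σ ≡ length w → g σ ≡ h σ) → arr w g ≡ arr w h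
arr-cong-All []      pw        eq = eq [] [] refl
arr-cong-All (x ∷ w) (px ∷ pw) eq = arr-cong-All w pw (λ σ pσ len → ins-cong-All σ px pσ
  (λ τ pτ lenτ → eq τ pτ (trans lenτ (cong suc len))))

ins-cong : ∀ x σ {g h : Word → ℚ} → (∀ τ → g τ ≡ h τ) → ins x σ g ≡ ins x σ h
ins-cong x []      eq = eq _
ins-cong x (y ∷ σ) eq = cong₂ _⊕_ (eq _) (ins-cong x σ (λ τ → eq (y ∷ τ)))

arr-cong : ∀ w {g h : Word → ℚ} → (∀ σ → g σ ≡ h σ) → arr w g ≡ arr w h
arr-cong []      eq = eq []
arr-cong (x ∷ w) eq = arr-cong w (λ σ → ins-cong x σ eq)

ins-⊕ : ∀ x σ (g h : Word → ℚ) → ins x σ (λ τ → g τ ⊕ h τ) ≡ ins x σ g ⊕ ins x σ h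
ins-⊕ x []      g h = refl
ins-⊕ x (y ∷ σ) g h = trans (cong (g (x ∷ y ∷ σ) ⊕ h (x ∷ y ∷ σ) ⊕_) (ins-⊕ x σ (λ τ → g (y ∷ τ)) (λ τ → h (y ∷ τ))))
  (⊕-interchange (g (x ∷ y ∷ σ)) (h (x ∷ y ∷ σ)) _ _)

arr-⊕ : ∀ w (g h : Word → ℚ) → arr w (λ σ → g σ ⊕ h σ) ≡ arr w g ⊕ arr w h
arr-⊕ []      g h = refl
arr-⊕ (x ∷ w) g h = trans (arr-cong w (λ σ → ins-⊕ x σ g h)) (arr-⊕ w _ _)

ins-*ˡ : ∀ x σ c (g : Word → ℚ) → ins x σ (λ τ → c ⊗ g τ) ≡ c ⊗ ins x σ g
ins-*ˡ x []      c g = refl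
ins-*ˡ x (y ∷ σ) c g = trans (cong (c ⊗ g (x ∷ y ∷ σ) ⊕_) (ins-*ˡ x σ c (λ τ → g (y ∷ τ)))) (sym (ℚ.*-distribˡ-+ c _ _))

arr-*ˡ : ∀ w c (g : Word → ℚ) → arr w (λ σ → c ⊗ g σ) ≡ c ⊗ arr w g
arr-*ˡ []      c g = refl
arr-*ˡ (x ∷ w) c g = trans (arr-cong w (λ σ → ins-*ˡ x σ c g)) (arr-*ˡ w c _)

arr-0 : ∀ w → arr w (λ _ → 0ℚ) ≡ 0ℚ
arr-0 w = trans (arr-cong w (λ _ → sym (0⊗ 0ℚ))) (trans (arr-*ˡ w 0ℚ (λ _ → 0ℚ)) (0⊗ (arr w (λ _ → 0ℚ))))

ins-0 : ∀ x σ → ins x σ (λ _ → 0ℚ) ≡ 0ℚ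
ins-0 x σ = trans (ins-cong x σ (λ _ → sym (0⊗ 0ℚ))) (trans (ins-*ˡ x σ 0ℚ (λ _ → 0ℚ)) (0⊗ (ins x σ (λ _ → 0ℚ))))

ins-swap-arr : ∀ x σ w (F : Word → Word → ℚ) → arr w (λ ρ → ins x σ (λ τ → F τ ρ)) ≡ ins x σ (λ τ → arr w (F τ))
ins-swap-arr x []      w F = refl
ins-swap-arr x (y ∷ σ) w F = trans (arr-⊕ w (λ ρ → F (x ∷ y ∷ σ) ρ) (λ ρ → ins x σ (λ τ → F (y ∷ τ) ρ)))
  (cong (arr w (F (x ∷ y ∷ σ)) ⊕_) (ins-swap-arr x σ w (λ τ → F (y ∷ τ))))

ins-ΔL : ∀ x σ (F : Word → Word → ℚ) → ins x σ (λ τ → ΔL τ F) ≡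
         ΔL σ (λ a b → ins x a (λ τ → F τ b) ⊕ ins x b (λ τ → F a τ))
ins-ΔL x []      F = solve 2 (λ a b → a :+ (b :+ con 0ℚ) := (b :+ a) :+ con 0ℚ) refl (F [] (x ∷ [])) (F (x ∷ []) [])
ins-ΔL x (y ∷ σ) F = begin
  ΔL (x ∷ y ∷ σ) F ⊕ ins x σ (λ τ → ΔL (y ∷ τ) F)
    ≡⟨ cong₂ _⊕_ (trans (ΔL-∷ x (y ∷ σ) F) (cong (F [] (x ∷ y ∷ σ) ⊕_) (ΔL-∷ y σ (λ q r → F (x ∷ q) r))))
                 (trans (ins-cong x σ (λ τ → ΔL-∷ y τ F)) (ins-⊕ x σ (λ τ → F [] (y ∷ τ)) (λ τ → ΔL τ (λ q r → F (y ∷ q) r)))) ⟩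
  (F [] (x ∷ y ∷ σ) ⊕ (F (x ∷ []) (y ∷ σ) ⊕ B)) ⊕ (A ⊕ ins x σ (λ τ → ΔL τ (λ q r → F (y ∷ q) r)))
    ≡⟨ cong (λ z → (F [] (x ∷ y ∷ σ) ⊕ (F (x ∷ []) (y ∷ σ) ⊕ B)) ⊕ (A ⊕ z)) (ins-ΔL x σ (λ q r → F (y ∷ q) r)) ⟩
  (F [] (x ∷ y ∷ σ) ⊕ (F (x ∷ []) (y ∷ σ) ⊕ B)) ⊕ (A ⊕ ΔL σ (λ a b → ins x a (λ τ → F (y ∷ τ) b) ⊕ ins x b (λ τ → F (y ∷ a) τ)))
    ≡⟨ cong (λ z → (F [] (x ∷ y ∷ σ) ⊕ (F (x ∷ []) (y ∷ σ) ⊕ B)) ⊕ (A ⊕ z)) (ΔL-⊕ σ (λ a b → ins x a (λ τ → F (y ∷ τ) b)) (λ a b → ins x b (λ τ → F (y ∷ a) τ))) ⟩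
  (F [] (x ∷ y ∷ σ) ⊕ (F (x ∷ []) (y ∷ σ) ⊕ B)) ⊕ (A ⊕ (C ⊕ D))
    ≡⟨ solve 6 (λ f g a b c d → (f :+ (g :+ b)) :+ (a :+ (c :+ d)) := (g :+ (f :+ a)) :+ ((b :+ c) :+ d)) refl
         (F [] (x ∷ y ∷ σ)) (F (x ∷ []) (y ∷ σ)) A B C D ⟩
  (F (x ∷ []) (y ∷ σ) ⊕ (F [] (x ∷ y ∷ σ) ⊕ A)) ⊕ ((B ⊕ C) ⊕ D)
    ≡⟨ cong (H [] (y ∷ σ) ⊕_) (sym (trans (ΔL-⊕ σ (λ a b → F (x ∷ y ∷ a) b ⊕ ins x a (λ τ → F (y ∷ τ) b)) (λ a b → ins x b (λ τ → F (y ∷ a) τ)))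
         (cong (_⊕ D) (ΔL-⊕ σ (λ a b → F (x ∷ y ∷ a) b) (λ a b → ins x a (λ τ → F (y ∷ τ) b)))))) ⟩
  H [] (y ∷ σ) ⊕ ΔL σ (λ a b → H (y ∷ a) b)
    ≡⟨ sym (ΔL-∷ y σ H) ⟩
  ΔL (y ∷ σ) H ∎
  where
  H : Word → Word → ℚ
  H a b = ins x a (λ τ → F τ b) ⊕ ins x b (λ τ → F a τ)
  A B C D : ℚ
  A = ins x σ (λ τ → F [] (y ∷ τ))
  B = ΔL σ (λ q r → F (x ∷ y ∷ q) r)
  C = ΔL σ (λ a b → ins x a (λ τ → F (y ∷ τ) b))
  D = ΔL σ (λ a b → ins x b (λ τ → F (y ∷ a) τ))

-- Arranging and then cutting is the same as first choosing which letters go left and then arranging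
-- both sides. This turns the external product into unshuffling.
arr-ΔL : ∀ w (F : Word → Word → ℚ) → arr w (λ σ → ΔL σ F) ≡ ΔU w (λ a b → arr a (λ σ → arr b (λ ρ → F σ ρ)))
arr-ΔL []      F = ⊕0 (F [] [])
arr-ΔL (x ∷ w) F = begin
  arr w (λ σ → ins x σ (λ τ → ΔL τ F))
    ≡⟨ arr-cong w (λ σ → ins-ΔL x σ F) ⟩
  arr w (λ σ → ΔL σ (λ a b → ins x a (λ τ → F τ b) ⊕ ins x b (λ τ → F a τ)))
    ≡⟨ arr-ΔL w (λ a b → ins x a (λ τ → F τ b) ⊕ ins x b (λ τ → F a τ)) ⟩
  ΔU w (λ a b → arr a (λ σ → arr b (λ ρ → ins x σ (λ τ → F τ ρ) ⊕ ins x ρ (λ τ → F σ τ))))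
    ≡⟨ ΔU-cong w (λ a b → trans (arr-cong a (λ σ → arr-⊕ b (λ ρ → ins x σ (λ τ → F τ ρ)) (λ ρ → ins x ρ (λ τ → F σ τ))))
         (trans (arr-⊕ a (λ σ → arr b (λ ρ → ins x σ (λ τ → F τ ρ))) (λ σ → arr b (λ ρ → ins x ρ (λ τ → F σ τ))))
           (cong (_⊕ arr a (λ σ → arr b (λ ρ → ins x ρ (λ τ → F σ τ)))) (arr-cong a (λ σ → ins-swap-arr x σ b F))))) ⟩
  ΔU w (λ a b → arr (x ∷ a) (λ σ → arr b (F σ)) ⊕ arr a (λ σ → arr (x ∷ b) (F σ)))
    ≡⟨ ΔU-⊕ w (λ a b → arr (x ∷ a) (λ σ → arr b (F σ))) (λ a b → arr a (λ σ → arr (x ∷ b) (F σ))) ⟩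
  ΔU (x ∷ w) (λ a b → arr a (λ σ → arr b (F σ))) ∎

<ᵇ-true : ∀ {x y} → x < y → (x <ᵇ y) ≡ true
<ᵇ-true {x} {y} lt with x <ᵇ y | ℕ.<⇒<ᵇ lt
... | true | _ = refl

<ᵇ-false : ∀ {x y} → x ≤ y → (y <ᵇ x) ≡ false
<ᵇ-false {x} {y} le with y <ᵇ x in eq
... | false = refl
... | true  = ⊥-elim (ℕ.<⇒≱ (ℕ.<ᵇ⇒< y x (subst T (sym eq) tt)) le)

fs-⊗ : ∀ s y z τ k → fs s (y ∷ z ∷ τ) ⊗ k ≡ fs s (z ∷ τ) ⊗ (𝟙 (step s y z) ⊗ k)
fs-⊗ s y z τ k = trans (cong (_⊗ k) (𝟙-∧ (step s y z) (mono s (z ∷ τ))))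
  (solve 3 (λ a b c → (a :* b) :* c := b :* (a :* c)) refl (𝟙 (step s y z)) (fs s (z ∷ τ)) k)

-- A letter x inserted anywhere behind the larger y has a larger left neighbour, so no ascending
-- word arises.
ins-asc-0 : ∀ x y σ (k : Word → ℚ) → x < y → All (x <_) σ → ins x σ (λ τ → fs true (y ∷ τ) ⊗ k τ) ≡ 0ℚ
ins-asc-0 x y []      k x<y _         = trans (cong (λ z → 𝟙 (not z ∧ true) ⊗ k (x ∷ [])) (<ᵇ-true x<y)) (0⊗ (k (x ∷ [])))
ins-asc-0 x y (z ∷ σ) k x<y (x<z ∷ pσ) = trans (cong₂ _⊕_
  (trans (cong (λ b → 𝟙 (not b ∧ mono true (x ∷ z ∷ σ)) ⊗ k (x ∷ z ∷ σ)) (<ᵇ-true x<y)) (0⊗ (k (x ∷ z ∷ σ))))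
  (trans (ins-cong x σ (λ τ → fs-⊗ true y z τ (k (z ∷ τ)))) (ins-asc-0 x z σ (λ τ → 𝟙 (step true y z) ⊗ k (z ∷ τ)) x<z pσ))) refl

ins-asc : ∀ x σ (h : Word → ℚ) → All (x <_) σ → ins x σ (λ τ → fs true τ ⊗ h τ) ≡ fs true σ ⊗ h (x ∷ σ)
ins-asc x []      h _          = refl
ins-asc x (y ∷ σ) h (x<y ∷ pσ) = trans (cong₂ _⊕_
  (cong (λ b → 𝟙 (not b ∧ mono true (y ∷ σ)) ⊗ h (x ∷ y ∷ σ)) (<ᵇ-false (ℕ.<⇒≤ x<y)))
  (ins-asc-0 x y σ (λ τ → h (y ∷ τ)) x<y pσ)) (⊕0 (fs true (y ∷ σ) ⊗ h (x ∷ y ∷ σ)))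

ins-desc-∷ : ∀ x y σ (k : Word → ℚ) → x < y → All (x <_) σ →
             ins x σ (λ τ → fs false (y ∷ τ) ⊗ k τ) ≡ fs false (y ∷ σ) ⊗ k (σ ++ x ∷ [])
ins-desc-∷ x y []      k x<y _          = cong (λ b → 𝟙 (b ∧ true) ⊗ k (x ∷ [])) (<ᵇ-true x<y)
ins-desc-∷ x y (z ∷ σ) k x<y (x<z ∷ pσ) = begin
  𝟙 ((x <ᵇ y) ∧ ((z <ᵇ x) ∧ mono false (z ∷ σ))) ⊗ k (x ∷ z ∷ σ) ⊕ ins x σ (λ τ → fs false (y ∷ z ∷ τ) ⊗ k (z ∷ τ))
    ≡⟨ cong₂ _⊕_ (trans (cong₂ (λ a b → 𝟙 (a ∧ (b ∧ mono false (z ∷ σ))) ⊗ k (x ∷ z ∷ σ)) (<ᵇ-true x<y) (<ᵇ-false (ℕ.<⇒≤ x<z))) (0⊗ (k (x ∷ z ∷ σ))))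
         (trans (ins-cong x σ (λ τ → fs-⊗ false y z τ (k (z ∷ τ)))) (ins-desc-∷ x z σ (λ τ → 𝟙 (step false y z) ⊗ k (z ∷ τ)) x<z pσ)) ⟩
  0ℚ ⊕ fs false (z ∷ σ) ⊗ (𝟙 (step false y z) ⊗ k (z ∷ σ ++ x ∷ []))
    ≡⟨ trans (0⊕ _) (sym (fs-⊗ false y z σ (k (z ∷ σ ++ x ∷ [])))) ⟩
  fs false (y ∷ z ∷ σ) ⊗ k (z ∷ σ ++ x ∷ []) ∎

ins-desc : ∀ x σ (h : Word → ℚ) → All (x <_) σ → ins x σ (λ τ → fs false τ ⊗ h τ) ≡ fs false σ ⊗ h (σ ++ x ∷ [])
ins-desc x []      h _          = refl
ins-desc x (y ∷ σ) h (x<y ∷ pσ) = trans (cong₂ _⊕_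
  (trans (cong (λ b → 𝟙 (b ∧ mono false (y ∷ σ)) ⊗ h (x ∷ y ∷ σ)) (<ᵇ-false (ℕ.<⇒≤ x<y))) (0⊗ (h (x ∷ y ∷ σ))))
  (ins-desc-∷ x y σ (λ τ → h (y ∷ τ)) x<y pσ)) (0⊕ (fs false (y ∷ σ) ⊗ h (y ∷ σ ++ x ∷ [])))

Increasing : Word → Set
Increasing = AllPairs _<_

-- Exactly one arrangement of distinct letters is monotone in the given direction. The smallest
-- letter must go to the front for ascents and to the end for descents.
arr-mono : ∀ s w (h : Word → ℚ) → Increasing w → arr w (λ σ → fs s σ ⊗ h σ) ≡ h (sgn s w)
arr-mono true  []      h _          = 1⊗ (h [])
arr-mono false []      h _          = 1⊗ (h [])
arr-mono true  (x ∷ w) h (px ∷ inc) = trans (arr-cong-All w px (λ σ pσ _ → ins-asc x σ h pσ)) (arr-mono true w (λ σ → h (x ∷ σ)) inc)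
arr-mono false (x ∷ w) h (px ∷ inc) = trans (arr-cong-All w px (λ σ pσ _ → ins-desc x σ h pσ))
  (trans (arr-mono false w (λ σ → h (σ ++ x ∷ [])) inc) (cong h (sym (L.unfold-reverse x w))))

increasing-⊆ : ∀ {a w} → a ⊆ w → Increasing w → Increasing a
increasing-⊆ []         []         = []
increasing-⊆ (_ ∷ʳ sub) (_ ∷ inc)  = increasing-⊆ sub inc
increasing-⊆ (refl ∷ sub) (p ∷ inc) = Sublist.All-resp-⊆ sub p ∷ increasing-⊆ sub inc

-- The coefficient of a word in V_A: the number of ways to cut it into consecutive blocks, possibly
-- empty, with the monotonicity prescribed by A.
VA : List Bool → Word → ℚ
VA []      = NC.one
VA (s ∷ A) = fs s NC.⋆ VA A

arr-one : ∀ w (g : Word → ℚ) → arr w (λ σ → NC.one σ ⊗ g σ) ≡ T∗ [] g w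
arr-one []      g = 1⊗ (g [])
arr-one (x ∷ w) g = trans (arr-cong w (λ σ → trans (nz σ g) refl)) (arr-0 w)
  where
  nz : ∀ σ (g : Word → ℚ) → ins x σ (λ τ → NC.one τ ⊗ g τ) ≡ 0ℚ
  nz []      g = 0⊗ (g (x ∷ []))
  nz (y ∷ σ) g = trans (cong₂ _⊕_ (0⊗ (g (x ∷ y ∷ σ))) (trans (ins-cong x σ (λ τ → 0⊗ (g (y ∷ τ)))) (ins-0 x σ))) refl

-- The link between the two pictures: summing over permutations weighted by V_A is the block
-- operator `T∗ A`. Each block contributes its unique monotone arrangement.
arr-VA : ∀ A (g : Word → ℚ) w → Increasing w → arr w (λ σ → VA A σ ⊗ g σ) ≡ T∗ A g w
arr-VA []      g w inc = arr-one w g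
arr-VA (s ∷ A) g w inc = begin
  arr w (λ σ → ΔL σ (λ a b → fs s a ⊗ VA A b) ⊗ g σ)
    ≡⟨ arr-cong w (λ σ → trans (sym (∑-*ʳ (splitsL σ) (g σ) (λ ab → fs s (proj₁ ab) ⊗ VA A (proj₂ ab))))
         (∑-cong-All (All.map (λ {ab} e → trans (cong (λ z → (fs s (proj₁ ab) ⊗ VA A (proj₂ ab)) ⊗ g z) (sym e))
           (ℚ.*-assoc (fs s (proj₁ ab)) (VA A (proj₂ ab)) (g (proj₁ ab ++ proj₂ ab)))) (splitsL-++ σ)))) ⟩
  arr w (λ σ → ΔL σ (λ a b → fs s a ⊗ (VA A b ⊗ g (a ++ b))))
    ≡⟨ arr-ΔL w (λ a b → fs s a ⊗ (VA A b ⊗ g (a ++ b))) ⟩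
  ΔU w (λ a b → arr a (λ σ → arr b (λ ρ → fs s σ ⊗ (VA A ρ ⊗ g (σ ++ ρ)))))
    ≡⟨ ΔU-cong-⊆ w (λ a b pa pb → trans
         (arr-cong a (λ σ → trans (arr-*ˡ b (fs s σ) (λ ρ → VA A ρ ⊗ g (σ ++ ρ))) (cong (fs s σ ⊗_) (arr-VA A (λ ρ → g (σ ++ ρ)) b (increasing-⊆ pb inc)))))
         (arr-mono s a (λ σ → T∗ A (λ ρ → g (σ ++ ρ)) b) (increasing-⊆ pa inc))) ⟩
  ΔU w (λ a b → T∗ A (λ z → g (sgn s a ++ z)) b) ∎

sel : Word → (ℕ → Word → ℚ) → ℚ
sel []      H = 0ℚ
sel (x ∷ w) H = H x w ⊕ sel w (λ y v → H y (x ∷ v))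

-- Enumeration by choosing the first letter, as `words` does; `arrS≡arr` compares it with
-- enumeration by insertion.
arrS : ℕ → Word → (Word → ℚ) → ℚ
arrS zero    w g = g []
arrS (suc l) w g = sel w (λ y v → arrS l v (λ σ → g (y ∷ σ)))

sel-cong : ∀ w {H K : ℕ → Word → ℚ} → (∀ y v → suc (length v) ≡ length w → H y v ≡ K y v) → sel w H ≡ sel w K
sel-cong []      eq = refl
sel-cong (x ∷ w) eq = cong₂ _⊕_ (eq x w refl) (sel-cong w (λ y v len → eq y (x ∷ v) (cong suc len)))

sel-⊕ : ∀ w (H K : ℕ → Word → ℚ) → sel w (λ y v → H y v ⊕ K y v) ≡ sel w H ⊕ sel w K
sel-⊕ []      H K = refl
sel-⊕ (x ∷ w) H K = trans (cong (H x w ⊕ K x w ⊕_) (sel-⊕ w (λ y v → H y (x ∷ v)) (λ y v → K y (x ∷ v)))) (⊕-interchange (H x w) (K x w) _ _)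

arrS-⊕ : ∀ l w (g h : Word → ℚ) → arrS l w (λ σ → g σ ⊕ h σ) ≡ arrS l w g ⊕ arrS l w h
arrS-⊕ zero    w g h = refl
arrS-⊕ (suc l) w g h = trans (sel-cong w (λ y v _ → arrS-⊕ l v (λ σ → g (y ∷ σ)) (λ σ → h (y ∷ σ)))) (sel-⊕ w _ _)

arrS-ins : ∀ l x w g → length w ≡ l → arrS (suc l) (x ∷ w) g ≡ arrS l w (λ σ → ins x σ g)
arrS-ins zero    x []      g _   = ⊕0 (g (x ∷ []))
arrS-ins (suc l) x w       g len = begin
  arrS (suc l) w (λ σ → g (x ∷ σ)) ⊕ sel w (λ y v → arrS (suc l) (x ∷ v) (λ σ → g (y ∷ σ)))
    ≡⟨ cong (arrS (suc l) w (λ σ → g (x ∷ σ)) ⊕_) (sel-cong w (λ y v lv → arrS-ins l x v (λ σ → g (y ∷ σ)) (ℕ.suc-injective (trans lv len)))) ⟩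
  sel w (λ y v → arrS l v (λ σ → g (x ∷ y ∷ σ))) ⊕ sel w (λ y v → arrS l v (λ σ → ins x σ (λ τ → g (y ∷ τ))))
    ≡⟨ sym (sel-⊕ w (λ y v → arrS l v (λ σ → g (x ∷ y ∷ σ))) (λ y v → arrS l v (λ σ → ins x σ (λ τ → g (y ∷ τ))))) ⟩
  sel w (λ y v → arrS l v (λ σ → g (x ∷ y ∷ σ)) ⊕ arrS l v (λ σ → ins x σ (λ τ → g (y ∷ τ))))
    ≡⟨ sel-cong w (λ y v _ → sym (arrS-⊕ l v (λ σ → g (x ∷ y ∷ σ)) (λ σ → ins x σ (λ τ → g (y ∷ τ))))) ⟩
  sel w (λ y v → arrS l v (λ σ → ins x (y ∷ σ) g)) ∎

arrS≡arr : ∀ w g → arrS (length w) w g ≡ arr w g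
arrS≡arr []      g = refl
arrS≡arr (x ∷ w) g = trans (arrS-ins (length w) x w g refl) (arrS≡arr w (λ σ → ins x σ g))

remove : ℕ → Word → Word
remove a = filterᵇ (λ y → not (a ≡ᵇ y))

sel-remove : ∀ w (K : ℕ → Word → ℚ) → Increasing w → ∑ w (λ a → K a (remove a w)) ≡ sel w K
sel-remove []      K _          = refl
sel-remove (x ∷ w) K (px ∷ inc) = cong₂ _⊕_ (cong (K x) (trans same (removeAll px)))
  (trans (∑-cong-All (All.map (λ {y} x<y → cong (K y) (keep y (≡ᵇ-false (ℕ.>⇒≢ x<y)))) px)) (sel-remove w (λ y v → K y (x ∷ v)) inc))
  where
  ≡ᵇ-false : ∀ {a c} → a ≢ c → (a ≡ᵇ c) ≡ false
  ≡ᵇ-false {a} {c} neq with a ≡ᵇ c in eq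
  ... | false = refl
  ... | true  = ⊥-elim (neq (ℕ.≡ᵇ⇒≡ a c (subst T (sym eq) tt)))
  ≡ᵇ-refl : ∀ a → (a ≡ᵇ a) ≡ true
  ≡ᵇ-refl zero    = refl
  ≡ᵇ-refl (suc a) = ≡ᵇ-refl a
  same : remove x (x ∷ w) ≡ remove x w
  same rewrite ≡ᵇ-refl x = refl
  removeAll : ∀ {u} → All (x <_) u → remove x u ≡ u
  removeAll {[]}    []         = refl
  removeAll {y ∷ u} (x<y ∷ pu) rewrite ≡ᵇ-false (ℕ.<⇒≢ x<y) = cong (y ∷_) (removeAll pu)
  keep : ∀ y → (y ≡ᵇ x) ≡ false → remove y (x ∷ w) ≡ x ∷ remove y w
  keep y eq rewrite eq = refl

words-avoid : ∀ a l A (f : Word → ℚ) → ∑ (words l A) (λ σ → 𝟙 (not (elemᵇ a σ)) ⊗ f σ) ≡ ∑ (words l (remove a A)) f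
words-avoid a zero    A f = cong (_⊕ 0ℚ) (1⊗ (f []))
words-avoid a (suc l) A f = begin
  ∑ (concatMap (λ c → map (c ∷_) (words l A)) A) (λ σ → 𝟙 (not (elemᵇ a σ)) ⊗ f σ)
    ≡⟨ trans (∑-concatMap (λ c → map (c ∷_) (words l A)) A _) (∑-cong A (λ c → ∑-map (c ∷_) (words l A) _)) ⟩
  ∑ A (λ c → ∑ (words l A) (λ σ → 𝟙 (not ((a ≡ᵇ c) ∨ elemᵇ a σ)) ⊗ f (c ∷ σ)))
    ≡⟨ ∑-cong A (λ c → trans (∑-cong (words l A) (λ σ → factor (a ≡ᵇ c) (elemᵇ a σ) (f (c ∷ σ))))
         (trans (∑-*ˡ (words l A) (𝟙 (not (a ≡ᵇ c))) (λ σ → 𝟙 (not (elemᵇ a σ)) ⊗ f (c ∷ σ)))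
           (cong (𝟙 (not (a ≡ᵇ c)) ⊗_) (words-avoid a l A (λ σ → f (c ∷ σ)))))) ⟩
  ∑ A (λ c → 𝟙 (not (a ≡ᵇ c)) ⊗ ∑ (words l (remove a A)) (λ σ → f (c ∷ σ)))
    ≡⟨ sym (∑-filter (λ c → not (a ≡ᵇ c)) A (λ c → ∑ (words l (remove a A)) (λ σ → f (c ∷ σ)))) ⟩
  ∑ (remove a A) (λ c → ∑ (words l (remove a A)) (λ σ → f (c ∷ σ)))
    ≡⟨ sym (trans (∑-concatMap (λ c → map (c ∷_) (words l (remove a A))) (remove a A) f) (∑-cong (remove a A) (λ c → ∑-map (c ∷_) (words l (remove a A)) f))) ⟩
  ∑ (concatMap (λ c → map (c ∷_) (words l (remove a A))) (remove a A)) f ∎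
  where
  factor : ∀ p q k → 𝟙 (not (p ∨ q)) ⊗ k ≡ 𝟙 (not p) ⊗ (𝟙 (not q) ⊗ k)
  factor true  q k = trans (0⊗ k) (sym (0⊗ (𝟙 (not q) ⊗ k)))
  factor false q k = sym (1⊗ (𝟙 (not q) ⊗ k))

words-arrS : ∀ l A (g : Word → ℚ) → Increasing A → ∑ (words l A) (λ σ → 𝟙 (distinct σ) ⊗ g σ) ≡ arrS l A g
words-arrS zero    A g inc = trans (⊕0 (1ℚ ⊗ g [])) (1⊗ (g []))
words-arrS (suc l) A g inc = begin
  ∑ (concatMap (λ c → map (c ∷_) (words l A)) A) (λ σ → 𝟙 (distinct σ) ⊗ g σ)
    ≡⟨ trans (∑-concatMap (λ c → map (c ∷_) (words l A)) A _) (∑-cong A (λ c → ∑-map (c ∷_) (words l A) _)) ⟩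
  ∑ A (λ c → ∑ (words l A) (λ σ → 𝟙 (not (elemᵇ c σ) ∧ distinct σ) ⊗ g (c ∷ σ)))
    ≡⟨ ∑-cong A (λ c → trans (∑-cong (words l A) (λ σ → trans (cong (_⊗ g (c ∷ σ)) (𝟙-∧ (not (elemᵇ c σ)) (distinct σ)))
         (ℚ.*-assoc (𝟙 (not (elemᵇ c σ))) (𝟙 (distinct σ)) (g (c ∷ σ))))) (words-avoid c l A (λ σ → 𝟙 (distinct σ) ⊗ g (c ∷ σ)))) ⟩
  ∑ A (λ c → ∑ (words l (remove c A)) (λ σ → 𝟙 (distinct σ) ⊗ g (c ∷ σ)))
    ≡⟨ ∑-cong A (λ c → words-arrS l (remove c A) (λ σ → g (c ∷ σ)) (AllPairs.filter⁺ _ inc)) ⟩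
  ∑ A (λ c → arrS l (remove c A) (λ σ → g (c ∷ σ)))
    ≡⟨ sel-remove A (λ c v → arrS l v (λ σ → g (c ∷ σ))) inc ⟩
  arrS (suc l) A g ∎

from1≡ : ∀ n → from1 n ≡ applyUpTo suc n
from1≡ n = L.map-upTo suc n

from1-length : ∀ n → length (from1 n) ≡ n
from1-length n = trans (cong length (from1≡ n)) (L.length-applyUpTo suc n)

from1-inc : ∀ n → Increasing (from1 n)
from1-inc n = subst Increasing (sym (from1≡ n)) (AllPairs.applyUpTo⁺₁ suc n (λ i<j _ → s≤s i<j))

perms-arr : ∀ n g → ∑ (perms n) g ≡ arr (from1 n) g
perms-arr n g = begin
  ∑ (filterᵇ distinct (words n (from1 n))) g                        ≡⟨ ∑-filter distinct (words n (from1 n)) g ⟩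
  ∑ (words n (from1 n)) (λ σ → 𝟙 (distinct σ) ⊗ g σ)                ≡⟨ words-arrS n (from1 n) g (from1-inc n) ⟩
  arrS n (from1 n) g                                                ≡⟨ cong (λ l → arrS l (from1 n) g) (sym (from1-length n)) ⟩
  arrS (length (from1 n)) (from1 n) g                               ≡⟨ arrS≡arr (from1 n) g ⟩
  arr (from1 n) g ∎

at-suc : ∀ α → applyUpTo (at α ∘ suc) (length α) ≡ α
at-suc []      = refl
at-suc (x ∷ α) = cong (x ∷_) (at-suc α)

map-at : ∀ α n → length α ≡ n → map (at α) (from1 n) ≡ α
map-at α .(length α) refl = trans (cong (map (at α)) (from1≡ (length α))) (trans (L.map-applyUpTo suc (at α) (length α)) (at-suc α))

-- `compose α β` relabels the letters of β through α, and `T∗ B` commutes with relabelling. The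
-- inner sum is therefore `T∗ B g` at the word α, and the outer one composes the two operators.
VA-product : ∀ n A B (g : Word → ℚ) →
  ∑ (perms n) (λ α → VA A α ⊗ ∑ (perms n) (λ β → VA B β ⊗ g (compose α β))) ≡ ∑ (perms n) (λ π → VA (A ⊙ B) π ⊗ g π)
VA-product n A B g = begin
  ∑ (perms n) (λ α → VA A α ⊗ ∑ (perms n) (λ β → VA B β ⊗ g (compose α β)))
    ≡⟨ perms-arr n _ ⟩
  arr (from1 n) (λ α → VA A α ⊗ ∑ (perms n) (λ β → VA B β ⊗ g (compose α β)))
    ≡⟨ arr-cong-All (from1 n) (All.universal (λ _ → tt) (from1 n)) (λ α _ len → cong (VA A α ⊗_) (inner α (trans len (from1-length n)))) ⟩
  arr (from1 n) (λ α → VA A α ⊗ T∗ B g α)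
    ≡⟨ arr-VA A (T∗ B g) (from1 n) (from1-inc n) ⟩
  T∗ A (T∗ B g) (from1 n)
    ≡⟨ T-⊙ A B g (from1 n) ⟩
  T∗ (A ⊙ B) g (from1 n)
    ≡⟨ sym (arr-VA (A ⊙ B) g (from1 n) (from1-inc n)) ⟩
  arr (from1 n) (λ π → VA (A ⊙ B) π ⊗ g π)
    ≡⟨ sym (perms-arr n _) ⟩
  ∑ (perms n) (λ π → VA (A ⊙ B) π ⊗ g π) ∎
  where
  inner : ∀ α → length α ≡ n → ∑ (perms n) (λ β → VA B β ⊗ g (compose α β)) ≡ T∗ B g α
  inner α len = begin
    ∑ (perms n) (λ β → VA B β ⊗ g (map (at α) β))          ≡⟨ perms-arr n _ ⟩
    arr (from1 n) (λ β → VA B β ⊗ g (map (at α) β))        ≡⟨ arr-VA B (λ β → g (map (at α) β)) (from1 n) (from1-inc n) ⟩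
    T∗ B (λ β → g (map (at α) β)) (from1 n)                ≡⟨ sym (T-map B (at α) g (from1 n)) ⟩
    T∗ B g (map (at α) (from1 n))                          ≡⟨ cong (T∗ B g) (map-at α n len) ⟩
    T∗ B g α ∎

-- Alternating words and the products of I and J.

alt : Bool → ℕ → List Bool
alt s zero    = []
alt s (suc m) = s ∷ alt (not s) m

alt-double : ∀ s i → alt s (double (suc i)) ≡ s ∷ not s ∷ alt s (double i)
alt-double true  i = refl
alt-double false i = refl

alt-++-even : ∀ s i c → alt s (double i) ++ alt s c ≡ alt s (double i + c)
alt-++-even s     zero    c = refl
alt-++-even true  (suc i) c = cong (λ z → true ∷ false ∷ z) (alt-++-even true i c)
alt-++-even false (suc i) c = cong (λ z → false ∷ true ∷ z) (alt-++-even false i c)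

alt-++-odd : ∀ s i c → alt s (suc (double i)) ++ alt (not s) c ≡ alt s (suc (double i) + c)
alt-++-odd s i c = cong (s ∷_) (alt-++-even (not s) i c)

flipA-∷ : ∀ s A → flipA (s ∷ A) ≡ flipA A ++ not s ∷ []
flipA-∷ s A = trans (cong (map not) (L.unfold-reverse s A)) (L.map-++ not (reverse A) (s ∷ []))

-- An even alternating word ends in the sign opposite to its first, so reversal exchanges the signs
-- and negation restores them; for odd length only the negation is felt.
flipA-even : ∀ s i → flipA (alt s (double i)) ≡ alt s (double i)
flipA-even s zero    = refl
flipA-even s (suc i) = begin
  flipA (alt s (double (suc i)))                              ≡⟨ cong flipA (alt-double s i) ⟩
  flipA (s ∷ not s ∷ alt s (double i))                        ≡⟨ trans (flipA-∷ s (not s ∷ alt s (double i))) (cong (_++ not s ∷ []) (flipA-∷ (not s) (alt s (double i)))) ⟩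
  (flipA (alt s (double i)) ++ not (not s) ∷ []) ++ not s ∷ [] ≡⟨ L.++-assoc (flipA (alt s (double i))) (not (not s) ∷ []) (not s ∷ []) ⟩
  flipA (alt s (double i)) ++ not (not s) ∷ not s ∷ []        ≡⟨ cong₂ (λ x y → x ++ y ∷ not s ∷ []) (flipA-even s i) (Bool.not-involutive s) ⟩
  alt s (double i) ++ alt s 2                                 ≡⟨ alt-++-even s i 2 ⟩
  alt s (double i + 2)                                        ≡⟨ cong (alt s) (ℕ.+-comm (double i) 2) ⟩
  alt s (double (suc i)) ∎

flipA-odd : ∀ s i → flipA (alt s (suc (double i))) ≡ alt (not s) (suc (double i))
flipA-odd s i = begin
  flipA (s ∷ alt (not s) (double i))             ≡⟨ flipA-∷ s (alt (not s) (double i)) ⟩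
  flipA (alt (not s) (double i)) ++ not s ∷ []   ≡⟨ cong (_++ not s ∷ []) (flipA-even (not s) i) ⟩
  alt (not s) (double i) ++ alt (not s) 1        ≡⟨ alt-++-even (not s) i 1 ⟩
  alt (not s) (double i + 1)                     ≡⟨ cong (alt (not s)) (ℕ.+-comm (double i) 1) ⟩
  alt (not s) (suc (double i)) ∎

-- The Boolean p records the parity of the number of blocks: true for odd.
num : Bool → ℕ → ℕ
num true  m = suc (double m)
num false m = double m

infixl 7 _·ₛ_
_·ₛ_ : Bool → Bool → Bool
s ·ₛ true  = s
s ·ₛ false = not s

sgnMul : Bool → Bool → Bool → Bool
sgnMul true  s t = s ·ₛ t
sgnMul false s t = s

·ₛ-not : ∀ s t → s ·ₛ not t ≡ not (s ·ₛ t)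
·ₛ-not s     true  = refl
·ₛ-not true  false = refl
·ₛ-not false false = refl

act-even : ∀ t s i → act t (alt s (double i)) ≡ alt s (double i)
act-even true  s i = refl
act-even false s i = flipA-even s i

act-odd : ∀ t s i → act t (alt s (suc (double i))) ≡ alt (s ·ₛ t) (suc (double i))
act-odd true  s i = refl
act-odd false s i = flipA-odd s i

-- Even blocks are all equal, odd blocks alternate in their first sign along with t. In both cases
-- each block starts with the sign opposite to the end of the one before, so the concatenation
-- alternates.
alt-⊙ : ∀ p s i t c → alt s (num p i) ⊙ alt t c ≡ alt (sgnMul p s t) (c * num p i)
alt-⊙ p     s i t zero    = refl
alt-⊙ false s i t (suc c) = trans (cong₂ _++_ (act-even t s i) (alt-⊙ false s i (not t) c)) (alt-++-even s i (c * double i))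
alt-⊙ true  s i t (suc c) = trans (cong₂ _++_ (act-odd t s i) (trans (alt-⊙ true s i (not t) c) (cong (λ z → alt z (c * suc (double i))) (·ₛ-not s t))))
  (alt-++-odd (s ·ₛ t) i (c * suc (double i)))

double-+ : ∀ i j → double i + double j ≡ double (i + j)
double-+ zero    j = refl
double-+ (suc i) j = cong (suc ∘ suc) (double-+ i j)

num-* : ∀ p q i j → Σ ℕ λ m → num q j * num p i ≡ num (p ∧ q) m
num-* false q i j = num q j * i , dbl (num q j)
  where
  dbl : ∀ c → c * double i ≡ double (c * i)
  dbl zero    = refl
  dbl (suc c) = trans (cong (double i +_) (dbl c)) (double-+ i (c * i))
num-* true false i j = j * suc (double i) , dbl j
  where
  dbl : ∀ j → double j * suc (double i) ≡ double (j * suc (double i))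
  dbl zero    = refl
  dbl (suc j) = trans (sym (ℕ.+-assoc (suc (double i)) (suc (double i)) (double j * suc (double i))))
    (trans (cong₂ _+_ (two (suc (double i))) (dbl j)) (double-+ (suc (double i)) (j * suc (double i))))
    where
    two : ∀ x → x + x ≡ double x
    two zero    = refl
    two (suc x) = cong suc (trans (ℕ.+-suc x x) (cong suc (two x)))
num-* true true i j = i + double j * i + j , cong suc (begin
  double i + double j * suc (double i)               ≡⟨ cong (double i +_) (ℕ.*-suc (double j) (double i)) ⟩
  double i + (double j + double j * double i)        ≡⟨ cong (λ z → double i + (double j + z)) (dbl (double j)) ⟩
  double i + (double j + double (double j * i))      ≡⟨ cong (double i +_) (ℕ.+-comm (double j) (double (double j * i))) ⟩
  double i + (double (double j * i) + double j)      ≡⟨ sym (ℕ.+-assoc (double i) (double (double j * i)) (double j)) ⟩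
  double i + double (double j * i) + double j        ≡⟨ cong (_+ double j) (double-+ i (double j * i)) ⟩
  double (i + double j * i) + double j               ≡⟨ double-+ (i + double j * i) j ⟩
  double (i + double j * i + j) ∎)
  where
  dbl : ∀ c → c * double i ≡ double (c * i)
  dbl zero    = refl
  dbl (suc c) = trans (cong (double i +_) (dbl c)) (double-+ i (c * i))

num-inj : ∀ p i j → nat (num p i) ≡ nat (num p j) → i ≡ j
num-inj true  = odd-inj
num-inj false = even-inj

-- Odd numbers of blocks are interpolated by J, even numbers by I.
el : Bool → Bool → ℕ → Word → ℚ
el true  = NC.J
el false = NC.I

pow-VA : ∀ s m → NC.pow (NC.V s) m NC.≐ VA (alt s (double m))
pow-VA s zero    w = refl
pow-VA s (suc m) w = begin
  (NC.V s NC.⋆ NC.pow (NC.V s) m) w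
    ≡⟨ NC.⋆-cong (NC.⋆-cong (v≐fs s) (v≐fs (not s))) (pow-VA s m) w ⟩
  ((fs s NC.⋆ fs (not s)) NC.⋆ VA (alt s (double m))) w
    ≡⟨ NC.⋆-assoc (fs s) (fs (not s)) (VA (alt s (double m))) w ⟩
  VA (s ∷ not s ∷ alt s (double m)) w
    ≡⟨ cong (λ A → VA A w) (sym (alt-double s m)) ⟩
  VA (alt s (double (suc m))) w ∎

el-gen : ∀ p s m w → Σ< (suc (length w)) (λ k → pow₁ (nat (num p m)) k ⊗ el p s k w) ≡ VA (alt s (num p m)) w
el-gen false s m w = trans (NC.I-even s m w) (pow-VA s m w)
el-gen true  s m w = trans (NC.J-odd s m w) (NC.⋆-cong (v≐fs s)
  (λ q → trans (NC.pow-cong (≐V s) m q) (pow-VA (not s) m q)) w)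
  where
  ≐V : ∀ s → NC.v (not s) NC.⋆ NC.v s NC.≐ NC.V (not s)
  ≐V s q = sym (NC.V-not s q)

perms-length : ∀ n → All (λ σ → length σ ≡ n) (perms n)
perms-length n = All.filter⁺ _ (words-length n (from1 n))
  where
  words-length : ∀ l A → All (λ σ → length σ ≡ l) (words l A)
  words-length zero    A = refl ∷ []
  words-length (suc l) A = All.concat⁺ (All.map⁺ (All.universal (λ a → All.map⁺ (All.map (cong suc) (words-length l A))) A))

∑ₚ : ℕ → (Word → ℚ) → (Word → ℚ) → ℚ
∑ₚ n f g = ∑ (perms n) (λ π → f π ⊗ g π)

∑ₚ-cong : ∀ n {f f′ : Word → ℚ} (g : Word → ℚ) → All (λ σ → f σ ≡ f′ σ) (perms n) → ∑ₚ n f g ≡ ∑ₚ n f′ g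
∑ₚ-cong n g eqs = ∑-cong-All (All.map (λ {σ} e → cong (_⊗ g σ) e) eqs)

∑ₚ-Σ : ∀ n N (c : ℕ → ℚ) (e : ℕ → Word → ℚ) g → ∑ₚ n (λ π → Σ< N (λ k → c k ⊗ e k π)) g ≡ Σ< N (λ k → c k ⊗ ∑ₚ n (e k) g)
∑ₚ-Σ n N c e g = begin
  ∑ (perms n) (λ π → Σ< N (λ k → c k ⊗ e k π) ⊗ g π)
    ≡⟨ ∑-cong (perms n) (λ π → sym (Σ<-*ʳ N (g π) (λ k → c k ⊗ e k π))) ⟩
  ∑ (perms n) (λ π → Σ< N (λ k → (c k ⊗ e k π) ⊗ g π))
    ≡⟨ sym (Σ<-∑ N (perms n) (λ k π → (c k ⊗ e k π) ⊗ g π)) ⟩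
  Σ< N (λ k → ∑ (perms n) (λ π → (c k ⊗ e k π) ⊗ g π))
    ≡⟨ Σ<-cong N (λ k → trans (∑-cong (perms n) (λ π → ℚ.*-assoc (c k) (e k π) (g π))) (∑-*ˡ (perms n) (c k) (λ π → e k π ⊗ g π))) ⟩
  Σ< N (λ k → c k ⊗ ∑ₚ n (e k) g) ∎

-- ⟨ f * h , g ⟩ for the product of ℚ[S_n], f and h being coefficient functions.
prodₚ : ℕ → (Word → ℚ) → (Word → ℚ) → (Word → ℚ) → ℚ
prodₚ n f h g = ∑ₚ n f (λ α → ∑ₚ n h (λ β → g (compose α β)))

el-expand : ∀ n p s m → All (λ σ → VA (alt s (num p m)) σ ≡ Σ< (suc n) (λ k → pow₁ (nat (num p m)) k ⊗ el p s k σ)) (perms n)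
el-expand n p s m = All.map (λ {σ} len → trans (sym (el-gen p s m σ)) (cong (λ l → Σ< (suc l) (λ k → pow₁ (nat (num p m)) k ⊗ el p s k σ)) len)) (perms-length n)

δ : ℕ → ℕ → ℚ
δ k l = 𝟙 (k ≡ᵇ l)

δ-≢ : ∀ k l → k ≢ l → δ k l ≡ 0ℚ
δ-≢ zero    zero    neq = ⊥-elim (neq refl)
δ-≢ zero    (suc l) neq = refl
δ-≢ (suc k) zero    neq = refl
δ-≢ (suc k) (suc l) neq = δ-≢ k l (neq ∘ cong suc)

δ-refl : ∀ k → δ k k ≡ 1ℚ
δ-refl zero    = refl
δ-refl (suc k) = δ-refl k

-- With b blocks on the right fixed, interpolation in the number a of left blocks extracts the
-- coefficient of a^k from V_{ab}, namely b^k times that of V. A second interpolation, in b, leaves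
-- only l = k.
el-product : ∀ n p s q t k l g → k ≤ n → l ≤ n →
  prodₚ n (el p s k) (el q t l) g ≡ δ l k ⊗ ∑ₚ n (el (p ∧ q) (sgnMul p s t) k) g
el-product n p s q t k l g k≤n l≤n = interpolate N
  (λ l → prodₚ n (el p s k) (el q t l) g) (λ l → δ l k ⊗ Y k) (λ j → nat (num q j)) (num-inj q)
  (λ j → trans (fixed j) (sym (trans (Σ<-single N k {λ l → pow₁ (nat (num q j)) l ⊗ (δ l k ⊗ Y k)} (s≤s k≤n)
     (λ i i≢k → trans (cong (λ z → pow₁ (nat (num q j)) i ⊗ (z ⊗ Y k)) (δ-≢ i k i≢k))
       (trans (cong (pow₁ (nat (num q j)) i ⊗_) (0⊗ (Y k))) (⊗0 (pow₁ (nat (num q j)) i)))))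
     (cong (pow₁ (nat (num q j)) k ⊗_) (trans (cong (_⊗ Y k) (δ-refl k)) (1⊗ (Y k))))))) l (s≤s l≤n)
  where
  N : ℕ
  N = suc n
  Y : ℕ → ℚ
  Y k = ∑ₚ n (el (p ∧ q) (sgnMul p s t) k) g
  Vq : ℕ → Word → ℚ
  Vq j = VA (alt t (num q j))
  x : ℕ → ℕ → ℚ
  x j k = prodₚ n (el p s k) (Vq j) g
  full : ∀ i j → prodₚ n (VA (alt s (num p i))) (Vq j) g ≡ Σ< N (λ k → pow₁ (nat (num p i)) k ⊗ (pow₁ (nat (num q j)) k ⊗ Y k))
  full i j with num-* p q i j
  ... | m , eq = begin
    prodₚ n (VA (alt s (num p i))) (Vq j) g
      ≡⟨ VA-product n (alt s (num p i)) (alt t (num q j)) g ⟩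
    ∑ₚ n (VA (alt s (num p i) ⊙ alt t (num q j))) g
      ≡⟨ cong (λ A → ∑ₚ n (VA A) g) (trans (alt-⊙ p s i t (num q j)) (cong (alt (sgnMul p s t)) eq)) ⟩
    ∑ₚ n (VA (alt (sgnMul p s t) (num (p ∧ q) m))) g
      ≡⟨ ∑ₚ-cong n g (el-expand n (p ∧ q) (sgnMul p s t) m) ⟩
    ∑ₚ n (λ π → Σ< N (λ k → pow₁ (nat (num (p ∧ q) m)) k ⊗ el (p ∧ q) (sgnMul p s t) k π)) g
      ≡⟨ ∑ₚ-Σ n N (pow₁ (nat (num (p ∧ q) m))) (el (p ∧ q) (sgnMul p s t)) g ⟩
    Σ< N (λ k → pow₁ (nat (num (p ∧ q) m)) k ⊗ Y k)
      ≡⟨ Σ<-cong N (λ k → trans (cong (λ z → pow₁ z k ⊗ Y k) (trans (cong nat (sym eq)) (trans (nat-* (num q j) (num p i)) (ℚ.*-comm (nat (num q j)) (nat (num p i))))))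
           (trans (cong (_⊗ Y k) (pow₁-⊗ (nat (num p i)) (nat (num q j)) k)) (ℚ.*-assoc (pow₁ (nat (num p i)) k) (pow₁ (nat (num q j)) k) (Y k)))) ⟩
    Σ< N (λ k → pow₁ (nat (num p i)) k ⊗ (pow₁ (nat (num q j)) k ⊗ Y k)) ∎
  expand₁ : ∀ i j → prodₚ n (VA (alt s (num p i))) (Vq j) g ≡ Σ< N (λ k → pow₁ (nat (num p i)) k ⊗ x j k)
  expand₁ i j = trans (∑ₚ-cong n (λ α → ∑ₚ n (Vq j) (λ β → g (compose α β))) (el-expand n p s i))
    (∑ₚ-Σ n N (pow₁ (nat (num p i))) (el p s) (λ α → ∑ₚ n (Vq j) (λ β → g (compose α β))))
  x≡ : ∀ j → x j k ≡ pow₁ (nat (num q j)) k ⊗ Y k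
  x≡ j = interpolate N (x j) (λ k → pow₁ (nat (num q j)) k ⊗ Y k) (λ i → nat (num p i)) (num-inj p)
    (λ i → trans (sym (expand₁ i j)) (full i j)) k (s≤s k≤n)
  fixed : ∀ j → Σ< N (λ l → pow₁ (nat (num q j)) l ⊗ prodₚ n (el p s k) (el q t l) g) ≡ pow₁ (nat (num q j)) k ⊗ Y k
  fixed j = trans (sym (begin
    x j k
      ≡⟨ ∑-cong (perms n) (λ α → cong (el p s k α ⊗_) (trans (∑ₚ-cong n (λ β → g (compose α β)) (el-expand n q t j))
           (∑ₚ-Σ n N (pow₁ (nat (num q j))) (el q t) (λ β → g (compose α β))))) ⟩
    ∑ (perms n) (λ α → el p s k α ⊗ Σ< N (λ l → pow₁ (nat (num q j)) l ⊗ ∑ₚ n (el q t l) (λ β → g (compose α β))))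
      ≡⟨ ∑-cong (perms n) (λ α → trans (sym (Σ<-*ˡ N (el p s k α) (λ l → pow₁ (nat (num q j)) l ⊗ ∑ₚ n (el q t l) (λ β → g (compose α β)))))
           (Σ<-cong N (λ l → ⊗-swap (el p s k α) (pow₁ (nat (num q j)) l) (∑ₚ n (el q t l) (λ β → g (compose α β)))))) ⟩
    ∑ (perms n) (λ α → Σ< N (λ l → pow₁ (nat (num q j)) l ⊗ (el p s k α ⊗ ∑ₚ n (el q t l) (λ β → g (compose α β)))))
      ≡⟨ sym (Σ<-∑ N (perms n) (λ l α → pow₁ (nat (num q j)) l ⊗ (el p s k α ⊗ ∑ₚ n (el q t l) (λ β → g (compose α β))))) ⟩
    Σ< N (λ l → ∑ (perms n) (λ α → pow₁ (nat (num q j)) l ⊗ (el p s k α ⊗ ∑ₚ n (el q t l) (λ β → g (compose α β)))))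
      ≡⟨ Σ<-cong N (λ l → ∑-*ˡ (perms n) (pow₁ (nat (num q j)) l) (λ α → el p s k α ⊗ ∑ₚ n (el q t l) (λ β → g (compose α β)))) ⟩
    Σ< N (λ l → pow₁ (nat (num q j)) l ⊗ prodₚ n (el p s k) (el q t l) g) ∎)) (x≡ j)

-- Pairing of the group algebra with functions on words.

⟪_,_⟫ : GA → (Word → ℚ) → ℚ
⟪ z , g ⟫ = ∑₂ z (λ a σ → a ⊗ g σ)

at-perm : Perm → Word → ℚ
at-perm σ τ = 𝟙 (eqPerm τ σ)

coeffGA-pair : ∀ z σ → coeffGA z σ ≡ ⟪ z , at-perm σ ⟫
coeffGA-pair []            σ = refl
coeffGA-pair ((a , τ) ∷ z) σ = cong₂ _⊕_ (ite (eqPerm τ σ)) (coeffGA-pair z σ)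
  where
  ite : ∀ b → (if b then a else 0ℚ) ≡ a ⊗ 𝟙 b
  ite true  = sym (⊗1 a)
  ite false = sym (⊗0 a)

pair-++ : ∀ x y g → ⟪ x ++ y , g ⟫ ≡ ⟪ x , g ⟫ ⊕ ⟪ y , g ⟫
pair-++ x y g = ∑-++ x y (λ aσ → proj₁ aσ ⊗ g (proj₂ aσ))

pair-scale : ∀ c x g → ⟪ scaleGA c x , g ⟫ ≡ c ⊗ ⟪ x , g ⟫
pair-scale c []            g = sym (⊗0 c)
pair-scale c ((a , σ) ∷ x) g = trans (cong₂ _⊕_ (ℚ.*-assoc c a (g σ)) (pair-scale c x g)) (sym (ℚ.*-distribˡ-+ c (a ⊗ g σ) ⟪ x , g ⟫))

pair-mulGA : ∀ x y g → ⟪ mulGA x y , g ⟫ ≡ ⟪ x , (λ α → ⟪ y , (λ β → g (compose α β)) ⟫) ⟫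
pair-mulGA []            y g = refl
pair-mulGA ((a , α) ∷ x) y g = trans (pair-++ (map _ y) (mulGA x y) g) (cong₂ _⊕_ (row y) (pair-mulGA x y g))
  where
  row : ∀ y → ⟪ map (λ { (c , β) → (a ⊗ c , compose α β) }) y , g ⟫ ≡ a ⊗ ⟪ y , (λ β → g (compose α β)) ⟫
  row []            = sym (⊗0 a)
  row ((c , β) ∷ y) = trans (cong₂ _⊕_ (ℚ.*-assoc a c (g (compose α β))) (row y)) (sym (ℚ.*-distribˡ-+ a (c ⊗ g (compose α β)) _))

pair-const : ∀ c (σs : List Perm) g → ⟪ map (λ σ → (c , σ)) σs , g ⟫ ≡ c ⊗ ∑ σs g
pair-const c σs g = trans (∑-map (λ σ → (c , σ)) σs (λ aσ → proj₁ aσ ⊗ g (proj₂ aσ))) (∑-*ˡ σs c g)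

-- f is the coefficient function of x; only its values on permutations of n matter. Testing against
-- all g makes products iterated sums.
Rep : ℕ → GA → (Word → ℚ) → Set
Rep n x f = ∀ g → ⟪ x , g ⟫ ≡ ∑ₚ n f g

Rep-sumPerms : ∀ n P → Rep n (sumPerms n P) (λ σ → 𝟙 (P σ))
Rep-sumPerms n P g = trans (pair-const 1ℚ (filterᵇ P (perms n)) g) (trans (1⊗ _) (∑-filter P (perms n) g))

Rep-ι : ∀ n x → ValidF n x → Rep n (ι n x) (NC.ev x)
Rep-ι n []            v        g = sym (∑-zero (perms n) (λ σ → 0⊗ (g σ)))
Rep-ι n ((c , I) ∷ x) (vI ∷ v) g = begin
  ⟪ map (λ σ → (c , σ)) (filterᵇ (λ σ → ⌊ L.≡-dec ℕ._≟_ (desPerm σ) (compDes I) ⌋) (perms n)) ++ ι n x , g ⟫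
    ≡⟨ pair-++ (map (λ σ → (c , σ)) (filterᵇ (λ σ → ⌊ L.≡-dec ℕ._≟_ (desPerm σ) (compDes I) ⌋) (perms n))) (ι n x) g ⟩
  ⟪ map (λ σ → (c , σ)) (filterᵇ (λ σ → ⌊ L.≡-dec ℕ._≟_ (desPerm σ) (compDes I) ⌋) (perms n)) , g ⟫ ⊕ ⟪ ι n x , g ⟫
    ≡⟨ cong₂ _⊕_ head (Rep-ι n x v g) ⟩
  ∑ (perms n) (λ σ → (c ⊗ 𝟙 (isRibbon I σ)) ⊗ g σ) ⊕ ∑ₚ n (NC.ev x) g
    ≡⟨ sym (∑-⊕ (perms n) (λ σ → (c ⊗ 𝟙 (isRibbon I σ)) ⊗ g σ) (λ σ → NC.ev x σ ⊗ g σ)) ⟩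
  ∑ (perms n) (λ σ → (c ⊗ 𝟙 (isRibbon I σ)) ⊗ g σ ⊕ NC.ev x σ ⊗ g σ)
    ≡⟨ ∑-cong (perms n) (λ σ → sym (ℚ.*-distribʳ-+ (g σ) (c ⊗ 𝟙 (isRibbon I σ)) (NC.ev x σ))) ⟩
  ∑ₚ n (NC.ev ((c , I) ∷ x)) g ∎
  where
  head : ⟪ map (λ σ → (c , σ)) (filterᵇ (λ σ → ⌊ L.≡-dec ℕ._≟_ (desPerm σ) (compDes I) ⌋) (perms n)) , g ⟫ ≡
         ∑ (perms n) (λ σ → (c ⊗ 𝟙 (isRibbon I σ)) ⊗ g σ)
  head = begin
    ⟪ map (λ σ → (c , σ)) (filterᵇ (λ σ → ⌊ L.≡-dec ℕ._≟_ (desPerm σ) (compDes I) ⌋) (perms n)) , g ⟫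
      ≡⟨ pair-const c (filterᵇ (λ σ → ⌊ L.≡-dec ℕ._≟_ (desPerm σ) (compDes I) ⌋) (perms n)) g ⟩
    c ⊗ ∑ (filterᵇ (λ σ → ⌊ L.≡-dec ℕ._≟_ (desPerm σ) (compDes I) ⌋) (perms n)) g
      ≡⟨ cong (c ⊗_) (∑-filter (λ σ → ⌊ L.≡-dec ℕ._≟_ (desPerm σ) (compDes I) ⌋) (perms n) g) ⟩
    c ⊗ ∑ (perms n) (λ σ → 𝟙 ⌊ L.≡-dec ℕ._≟_ (desPerm σ) (compDes I) ⌋ ⊗ g σ)
      ≡⟨ sym (∑-*ˡ (perms n) c (λ σ → 𝟙 ⌊ L.≡-dec ℕ._≟_ (desPerm σ) (compDes I) ⌋ ⊗ g σ)) ⟩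
    ∑ (perms n) (λ σ → c ⊗ (𝟙 ⌊ L.≡-dec ℕ._≟_ (desPerm σ) (compDes I) ⌋ ⊗ g σ))
      ≡⟨ ∑-cong-All (All.map (λ {σ} len → trans (cong (λ b → c ⊗ (𝟙 b ⊗ g σ)) (descent-ribbon I σ (subst (λ z → Valid z I) (sym len) vI)))
           (sym (ℚ.*-assoc c (𝟙 (isRibbon I σ)) (g σ)))) (perms-length n)) ⟩
    ∑ (perms n) (λ σ → (c ⊗ 𝟙 (isRibbon I σ)) ⊗ g σ) ∎

Rep-cong : ∀ {n x f f′} → Rep n x f → All (λ σ → f σ ≡ f′ σ) (perms n) → Rep n x f′
Rep-cong {n} r eqs g = trans (r g) (∑ₚ-cong n g eqs)

Rep⇒≈ : ∀ {n x y f} → Rep n x f → Rep n y f → x ≈ y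
Rep⇒≈ {n} {x} {y} rx ry σ = trans (coeffGA-pair x σ) (trans (rx (at-perm σ)) (sym (trans (coeffGA-pair y σ) (ry (at-perm σ)))))

Rep-mulGA : ∀ {n x y f h} → Rep n x f → Rep n y h → ∀ g → ⟪ mulGA x y , g ⟫ ≡ prodₚ n f h g
Rep-mulGA {n} {x} {y} {f} rx ry g = trans (pair-mulGA x y g) (trans (rx (λ α → ⟪ y , (λ β → g (compose α β)) ⟫))
  (∑-cong (perms n) (λ α → cong (f α ⊗_) (ry (λ β → g (compose α β))))))

IsPerm : ℕ → Word → Set
IsPerm n σ = length σ ≡ n × All (_∈ from1 n) σ × distinct σ ≡ true

perms-IsPerm : ∀ n → All (IsPerm n) (perms n)
perms-IsPerm n = All.zipWith (λ { (len , mem , d) → len , mem , d })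
  (perms-length n , All.zipWith id (All.filter⁺ _ (words-mem n (from1 n)) , All.map T⇒≡ (All.all-filter _ (words n (from1 n)))))
  where
  words-mem : ∀ l A → All (All (_∈ A)) (words l A)
  words-mem zero    A = [] ∷ []
  words-mem (suc l) A = All.concat⁺ (All.map⁺ (All.tabulate (λ a∈ → All.map⁺ (All.map (a∈ ∷_) (words-mem l A)))))
  T⇒≡ : ∀ {b} → T b → b ≡ true
  T⇒≡ {true} _ = refl

∧-trueˡ : ∀ a {b} → a ∧ b ≡ true → a ≡ true
∧-trueˡ true _ = refl

eqPerm-∷ : ∀ a ρ c π → eqPerm (a ∷ ρ) (c ∷ π) ≡ (a ≡ᵇ c) ∧ eqPerm ρ π
eqPerm-∷ a ρ c π = bool-ext to from
  where
  to : eqPerm (a ∷ ρ) (c ∷ π) ≡ true → (a ≡ᵇ c) ∧ eqPerm ρ π ≡ true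
  to e with ⌊⌋-true (L.≡-dec ℕ._≟_ (a ∷ ρ) (c ∷ π)) e
  ... | refl = cong₂ _∧_ (T⇒true (ℕ.≡⇒≡ᵇ a a refl)) (true-⌊⌋ (L.≡-dec ℕ._≟_ ρ ρ) refl)
    where
    T⇒true : ∀ {b} → T b → b ≡ true
    T⇒true {true} _ = refl
  from : (a ≡ᵇ c) ∧ eqPerm ρ π ≡ true → eqPerm (a ∷ ρ) (c ∷ π) ≡ true
  from e = true-⌊⌋ (L.≡-dec ℕ._≟_ (a ∷ ρ) (c ∷ π))
    (cong₂ _∷_ (ℕ.≡ᵇ⇒≡ a c (subst T (sym (∧-trueˡ (a ≡ᵇ c) e)) tt)) (⌊⌋-true (L.≡-dec ℕ._≟_ ρ π) (∧-true (a ≡ᵇ c) e)))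

∑-δ : ∀ A c → Increasing A → c ∈ A → ∑ A (λ a → δ a c) ≡ 1ℚ
∑-δ (x ∷ A) .x (px ∷ inc) (here refl) = trans (cong₂ _⊕_ (δ-refl x) (∑-zero-All (All.map (λ {y} x<y → δ-≢ y x (ℕ.>⇒≢ x<y)) px))) refl
∑-δ (x ∷ A) c  (px ∷ inc) (there c∈)  = trans (cong₂ _⊕_ (δ-≢ x c (ℕ.<⇒≢ (All.lookup px c∈))) (∑-δ A c inc c∈)) refl

count-words : ∀ l A π → Increasing A → length π ≡ l → All (_∈ A) π → ∑ (words l A) (at-perm π) ≡ 1ℚ
count-words zero    A []      inc len mem        = refl
count-words (suc l) A (c ∷ π) inc len (c∈ ∷ mem) = begin
  ∑ (concatMap (λ a → map (a ∷_) (words l A)) A) (at-perm (c ∷ π))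
    ≡⟨ trans (∑-concatMap (λ a → map (a ∷_) (words l A)) A (at-perm (c ∷ π))) (∑-cong A (λ a → ∑-map (a ∷_) (words l A) (at-perm (c ∷ π)))) ⟩
  ∑ A (λ a → ∑ (words l A) (λ ρ → 𝟙 (eqPerm (a ∷ ρ) (c ∷ π))))
    ≡⟨ ∑-cong A (λ a → trans (∑-cong (words l A) (λ ρ → trans (cong 𝟙 (eqPerm-∷ a ρ c π)) (𝟙-∧ (a ≡ᵇ c) (eqPerm ρ π))))
         (trans (∑-*ˡ (words l A) (δ a c) (at-perm π)) (trans (cong (δ a c ⊗_) (count-words l A π inc (ℕ.suc-injective len) mem)) (⊗1 (δ a c))))) ⟩
  ∑ A (λ a → δ a c)
    ≡⟨ ∑-δ A c inc c∈ ⟩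
  1ℚ ∎

-- `perms n` lists every permutation exactly once, so the indicator of π reads off a single value.
∑ₚ-at : ∀ n f π → IsPerm n π → ∑ₚ n f (at-perm π) ≡ f π
∑ₚ-at n f π (len , mem , d) = begin
  ∑ (perms n) (λ ρ → f ρ ⊗ 𝟙 (eqPerm ρ π))
    ≡⟨ ∑-cong (perms n) (λ ρ → replace ρ) ⟩
  ∑ (perms n) (λ ρ → f π ⊗ 𝟙 (eqPerm ρ π))
    ≡⟨ ∑-*ˡ (perms n) (f π) (at-perm π) ⟩
  f π ⊗ ∑ (perms n) (at-perm π)
    ≡⟨ cong (f π ⊗_) (trans (∑-filter distinct (words n (from1 n)) (at-perm π)) (trans (∑-cong (words n (from1 n)) absorb)
         (count-words n (from1 n) π (from1-inc n) len mem))) ⟩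
  f π ⊗ 1ℚ
    ≡⟨ ⊗1 (f π) ⟩
  f π ∎
  where
  replace : ∀ ρ → f ρ ⊗ 𝟙 (eqPerm ρ π) ≡ f π ⊗ 𝟙 (eqPerm ρ π)
  replace ρ with L.≡-dec ℕ._≟_ ρ π
  ... | yes refl = refl
  ... | no  _    = trans (⊗0 (f ρ)) (sym (⊗0 (f π)))
  absorb : ∀ ρ → 𝟙 (distinct ρ) ⊗ 𝟙 (eqPerm ρ π) ≡ 𝟙 (eqPerm ρ π)
  absorb ρ with L.≡-dec ℕ._≟_ ρ π
  ... | yes refl = trans (cong (λ b → 𝟙 b ⊗ 1ℚ) d) refl
  ... | no  _    = ⊗0 (𝟙 (distinct ρ))

increasing⇒distinct : ∀ w → Increasing w → distinct w ≡ true
increasing⇒distinct []      _          = refl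
increasing⇒distinct (x ∷ w) (px ∷ inc) = cong₂ (λ a c → not a ∧ c) (notElem w px) (increasing⇒distinct w inc)
  where
  notElem : ∀ w → All (x <_) w → elemᵇ x w ≡ false
  notElem []      []         = refl
  notElem (y ∷ w) (x<y ∷ pw) with x ≡ᵇ y in eq
  ... | false = notElem w pw
  ... | true  = ⊥-elim (ℕ.<⇒≢ x<y (ℕ.≡ᵇ⇒≡ x y (subst T (sym eq) tt)))

id-IsPerm : ∀ n → IsPerm n (from1 n)
id-IsPerm n = from1-length n , All.tabulate id , increasing⇒distinct (from1 n) (from1-inc n)

-- Combinations of I and J of either sign.

L₄ : (Bool → Bool → ℚ) → (Bool → Bool → ℚ) → ℚ
L₄ c y = (c false true ⊗ y false true ⊕ c false false ⊗ y false false) ⊕ (c true true ⊗ y true true ⊕ c true false ⊗ y true false)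

L₄-cong : ∀ c {y z : Bool → Bool → ℚ} → (∀ p s → y p s ≡ z p s) → L₄ c y ≡ L₄ c z
L₄-cong c eq = cong₂ _⊕_ (cong₂ _⊕_ (cong (c false true ⊗_) (eq false true)) (cong (c false false ⊗_) (eq false false)))
  (cong₂ _⊕_ (cong (c true true ⊗_) (eq true true)) (cong (c true false ⊗_) (eq true false)))

L₄-congˡ : ∀ {c d : Bool → Bool → ℚ} y → (∀ p s → c p s ≡ d p s) → L₄ c y ≡ L₄ d y
L₄-congˡ y eq = cong₂ _⊕_ (cong₂ _⊕_ (cong (_⊗ y false true) (eq false true)) (cong (_⊗ y false false) (eq false false)))
  (cong₂ _⊕_ (cong (_⊗ y true true) (eq true true)) (cong (_⊗ y true false) (eq true false)))

L₄-0 : ∀ y → L₄ (λ _ _ → 0ℚ) y ≡ 0ℚ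
L₄-0 y = trans (cong₂ _⊕_ (cong₂ _⊕_ (0⊗ (y false true)) (0⊗ (y false false))) (cong₂ _⊕_ (0⊗ (y true true)) (0⊗ (y true false)))) refl

comb : (Bool → Bool → ℚ) → ℕ → Word → ℚ
comb c k w = L₄ c (λ p s → el p s k w)

∑-L₄ : ∀ {A : Set} (xs : List A) c (y : A → Bool → Bool → ℚ) → ∑ xs (λ x → L₄ c (y x)) ≡ L₄ c (λ p s → ∑ xs (λ x → y x p s))
∑-L₄ []       c y = sym (trans (cong₂ _⊕_ (cong₂ _⊕_ (⊗0 (c false true)) (⊗0 (c false false))) (cong₂ _⊕_ (⊗0 (c true true)) (⊗0 (c true false)))) refl)
∑-L₄ (x ∷ xs) c y = trans (cong (L₄ c (y x) ⊕_) (∑-L₄ xs c y))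
  (solve 12 (λ a b c d p q r s p′ q′ r′ s′ →
    ((a :* p :+ b :* q) :+ (c :* r :+ d :* s)) :+ ((a :* p′ :+ b :* q′) :+ (c :* r′ :+ d :* s′)) :=
    (a :* (p :+ p′) :+ b :* (q :+ q′)) :+ (c :* (r :+ r′) :+ d :* (s :+ s′))) refl
    (c false true) (c false false) (c true true) (c true false)
    (y x false true) (y x false false) (y x true true) (y x true false)
    (∑ xs (λ x → y x false true)) (∑ xs (λ x → y x false false)) (∑ xs (λ x → y x true true)) (∑ xs (λ x → y x true false)))

L₄-*ʳ : ∀ c y z → L₄ c y ⊗ z ≡ L₄ c (λ p s → y p s ⊗ z)
L₄-*ʳ c y z = solve 9 (λ a b c d p q r s z → ((a :* p :+ b :* q) :+ (c :* r :+ d :* s)) :* z :=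
    (a :* (p :* z) :+ b :* (q :* z)) :+ (c :* (r :* z) :+ d :* (s :* z))) refl
    (c false true) (c false false) (c true true) (c true false) (y false true) (y false false) (y true true) (y true false) z

L₄-*ˡ : ∀ c y z → z ⊗ L₄ c y ≡ L₄ c (λ p s → z ⊗ y p s)
L₄-*ˡ c y z = solve 9 (λ a b c d p q r s z → z :* ((a :* p :+ b :* q) :+ (c :* r :+ d :* s)) :=
    (a :* (z :* p) :+ b :* (z :* q)) :+ (c :* (z :* r) :+ d :* (z :* s))) refl
    (c false true) (c false false) (c true true) (c true false) (y false true) (y false false) (y true true) (y true false) z

infixl 7 _∗_
-- Structure constants for a common index k: I^s X = I^s for every X among the four, J^s I^t =
-- I^{st} and J^s J^t = J^{st}.
_∗_ : (Bool → Bool → ℚ) → (Bool → Bool → ℚ) → Bool → Bool → ℚ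
(c ∗ d) true  s = c true s ⊗ d true true ⊕ c true (not s) ⊗ d true false
(c ∗ d) false s = c false s ⊗ ((d false true ⊕ d false false) ⊕ (d true true ⊕ d true false))
  ⊕ (c true true ⊗ d false s ⊕ c true false ⊗ d false (not s))

L₄-∗ : ∀ c d (y : Bool → Bool → ℚ) → L₄ c (λ p s → L₄ d (λ q t → y (p ∧ q) (sgnMul p s t))) ≡ L₄ (c ∗ d) y
L₄-∗ c d y = solve 12 (λ a b c d a′ b′ c′ d′ p q r s →
    (a :* ((a′ :* p :+ b′ :* p) :+ (c′ :* p :+ d′ :* p)) :+ b :* ((a′ :* q :+ b′ :* q) :+ (c′ :* q :+ d′ :* q)))
    :+ (c :* ((a′ :* p :+ b′ :* q) :+ (c′ :* r :+ d′ :* s)) :+ d :* ((a′ :* q :+ b′ :* p) :+ (c′ :* s :+ d′ :* r))) :=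
    ((a :* ((a′ :+ b′) :+ (c′ :+ d′)) :+ (c :* a′ :+ d :* b′)) :* p :+ (b :* ((a′ :+ b′) :+ (c′ :+ d′)) :+ (c :* b′ :+ d :* a′)) :* q)
    :+ ((c :* c′ :+ d :* d′) :* r :+ (d :* c′ :+ c :* d′) :* s)) refl
    (c false true) (c false false) (c true true) (c true false)
    (d false true) (d false false) (d true true) (d true false)
    (y false true) (y false false) (y true true) (y true false)

-- One tag for each of the families `eA` to `eE`, and `tP`, `tM` for I^+ and I^-. A tag fixes an
-- element of the four-dimensional algebra and a condition on the number of even parts.
data Tag : Set where
  tA tB tC tD tE tP tM : Tag

elF : Tag → ℕ → ℕ → FSum
elF tA n k = eA n k
elF tB n k = eB n k
elF tC n k = eC n k
elF tD n k = eD n k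
elF tE n k = eE n k
elF tP n k = Ip k n
elF tM n k = Im k n

coef : Tag → Bool → Bool → ℚ
coef tA false _     = ½
coef tA true  _     = 0ℚ
coef tB false _     = ⊝ ½
coef tB true  _     = ½
coef tC false _     = 0ℚ
coef tC true  true  = ½
coef tC true  false = ⊝ ½
coef tD false true  = ⊝ 1ℚ
coef tD true  true  = 1ℚ
coef tD _     false = 0ℚ
coef tE true  true  = 1ℚ
coef tE _     _     = 0ℚ
coef tP false true  = 1ℚ
coef tP _     _     = 0ℚ
coef tM false false = 1ℚ
coef tM _     _     = 0ℚ

bool² : {P : Bool → Bool → Set} → P false true → P false false → P true true → P true false → ∀ p s → P p s
bool² a b c d false true  = a
bool² a b c d false false = b
bool² a b c d true  true  = c
bool² a b c d true  false = d

-- A computation in the table of `_∗_`. For `tD`, both J^+ I^+ and I^+ J^+ equal I^+, so the square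
-- of J^+ - I^+ is J^+ - I^+ itself: its coefficients are 1 and -1, and a factor ½ would destroy
-- idempotence.
coef-idem : ∀ t p s → (coef t ∗ coef t) p s ≡ coef t p s
coef-idem tA = bool² refl refl refl refl
coef-idem tB = bool² refl refl refl refl
coef-idem tC = bool² refl refl refl refl
coef-idem tD = bool² refl refl refl refl
coef-idem tE = bool² refl refl refl refl
coef-idem tP = bool² refl refl refl refl
coef-idem tM = bool² refl refl refl refl

Annihilate : Tag → Tag → Set
Annihilate t u = (∀ p s → (coef t ∗ coef u) p s ≡ 0ℚ) × (∀ p s → (coef u ∗ coef t) p s ≡ 0ℚ)

A⊥B : Annihilate tA tB
A⊥B = bool² refl refl refl refl , bool² refl refl refl refl

A⊥C : Annihilate tA tC
A⊥C = bool² refl refl refl refl , bool² refl refl refl refl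

B⊥C : Annihilate tB tC
B⊥C = bool² refl refl refl refl , bool² refl refl refl refl

P⊥D : Annihilate tP tD
P⊥D = bool² refl refl refl refl , bool² refl refl refl refl

valid-elF : ∀ t n k → ValidF n (elF t n k)
valid-elF tA n k = valid-scaleF ½ (All.++⁺ (valid-Is true k n) (valid-Is false k n))
valid-elF tB n k = valid-scaleF ½ (All.++⁺ (valid-Js true k n) (All.++⁺ (valid-Js false k n)
  (valid-scaleF (⊝ 1ℚ) (All.++⁺ (valid-Is true k n) (valid-Is false k n)))))
valid-elF tC n k = valid-scaleF ½ (All.++⁺ (valid-Js true k n) (valid-scaleF (⊝ 1ℚ) (valid-Js false k n)))
valid-elF tD n k = All.++⁺ (valid-Js true k n) (valid-scaleF (⊝ 1ℚ) (valid-Is true k n))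
valid-elF tE n k = valid-Js true k n
valid-elF tP n k = valid-Is true k n
valid-elF tM n k = valid-Is false k n

module EvComb (K : Interp) where
  open Signed K

  elK : Bool → Bool → ℕ → Fun
  elK true  = J
  elK false = I

  ev-elF : ∀ t k p → ev (elF t (deg p) k) p ≡ L₄ (coef t) (λ q s → elK q s k p)
  ev-elF tA k p = trans (ev-scaleF ½ (Ip k n ++ Im k n) p) (trans (cong (½ ⊗_) (ev-++ (Ip k n) (Im k n) p))
    (solve 4 (λ a b c d → con ½ :* (a :+ b) := (con ½ :* a :+ con ½ :* b) :+ (con 0ℚ :* c :+ con 0ℚ :* d)) refl (I true k p) (I false k p) (J true k p) (J false k p)))
    where
    n : ℕ
    n = deg p
  ev-elF tB k p = trans (ev-scaleF ½ (Jp k n ++ Jm k n ++ negF (Ip k n ++ Im k n)) p) (trans (cong (½ ⊗_) (trans (ev-++ (Jp k n) (Jm k n ++ negF (Ip k n ++ Im k n)) p)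
    (cong (J true k p ⊕_) (trans (ev-++ (Jm k n) (negF (Ip k n ++ Im k n)) p) (cong (J false k p ⊕_)
      (trans (ev-scaleF (⊝ 1ℚ) (Ip k n ++ Im k n) p) (cong (⊝ 1ℚ ⊗_) (ev-++ (Ip k n) (Im k n) p))))))))
    (solve 4 (λ a b c d → con ½ :* (c :+ (d :+ :- con 1ℚ :* (a :+ b))) := (:- con ½ :* a :+ :- con ½ :* b) :+ (con ½ :* c :+ con ½ :* d)) refl (I true k p) (I false k p) (J true k p) (J false k p)))
    where
    n : ℕ
    n = deg p
  ev-elF tC k p = trans (ev-scaleF ½ (Jp k n ++ negF (Jm k n)) p) (trans (cong (½ ⊗_) (trans (ev-++ (Jp k n) (negF (Jm k n)) p)
    (cong (J true k p ⊕_) (ev-scaleF (⊝ 1ℚ) (Jm k n) p))))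
    (solve 4 (λ a b c d → con ½ :* (c :+ :- con 1ℚ :* d) := (con 0ℚ :* a :+ con 0ℚ :* b) :+ (con ½ :* c :+ :- con ½ :* d)) refl (I true k p) (I false k p) (J true k p) (J false k p)))
    where
    n : ℕ
    n = deg p
  ev-elF tD k p = trans (ev-++ (Jp k n) (negF (Ip k n)) p) (trans (cong (J true k p ⊕_) (ev-scaleF (⊝ 1ℚ) (Ip k n) p))
    (solve 4 (λ a b c d → c :+ :- con 1ℚ :* a := (:- con 1ℚ :* a :+ con 0ℚ :* b) :+ (con 1ℚ :* c :+ con 0ℚ :* d)) refl (I true k p) (I false k p) (J true k p) (J false k p)))
    where
    n : ℕ
    n = deg p
  ev-elF tE k p = solve 4 (λ a b c d → c := (con 0ℚ :* a :+ con 0ℚ :* b) :+ (con 1ℚ :* c :+ con 0ℚ :* d)) refl (I true k p) (I false k p) (J true k p) (J false k p)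
  ev-elF tP k p = solve 4 (λ a b c d → a := (con 1ℚ :* a :+ con 0ℚ :* b) :+ (con 0ℚ :* c :+ con 0ℚ :* d)) refl (I true k p) (I false k p) (J true k p) (J false k p)
  ev-elF tM k p = solve 4 (λ a b c d → b := (con 0ℚ :* a :+ con 1ℚ :* b) :+ (con 0ℚ :* c :+ con 0ℚ :* d)) refl (I true k p) (I false k p) (J true k p) (J false k p)

Entry : Set
Entry = Tag × ℕ

fun : Entry → Word → ℚ
fun (t , k) = comb (coef t) k

elt : ℕ → Entry → GA
elt n (t , k) = ι n (elF t n k)

ev-fun : ∀ t k w → NC.ev (elF t (length w) k) w ≡ fun (t , k) w
ev-fun t k w = trans (EvComb.ev-elF wordI t k w) (L₄-cong (coef t) {λ q s → EvComb.elK wordI q s k w} {λ q s → el q s k w} (λ { true s → refl ; false s → refl }))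

Rep-elt : ∀ n e → Rep n (elt n e) (fun e)
Rep-elt n (t , k) = Rep-cong {n} {elt n (t , k)} {NC.ev (elF t n k)} {fun (t , k)} (Rep-ι n (elF t n k) (valid-elF t n k))
  (All.map (λ {σ} len → trans (cong (λ z → NC.ev (elF t z k) σ) (sym len)) (ev-fun t k σ)) (perms-length n))

∑ₚ-comb : ∀ n c (e : Bool → Bool → Word → ℚ) g → ∑ₚ n (λ σ → L₄ c (λ p s → e p s σ)) g ≡ L₄ c (λ p s → ∑ₚ n (e p s) g)
∑ₚ-comb n c e g = trans (∑-cong (perms n) (λ σ → L₄-*ʳ c (λ p s → e p s σ) (g σ))) (∑-L₄ (perms n) c (λ σ p s → e p s σ ⊗ g σ))

prodₚ-combʳ : ∀ n f c (e : Bool → Bool → Word → ℚ) g → prodₚ n f (λ σ → L₄ c (λ p s → e p s σ)) g ≡ L₄ c (λ p s → prodₚ n f (e p s) g)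
prodₚ-combʳ n f c e g = trans (∑-cong (perms n) (λ α → trans (cong (f α ⊗_) (∑ₚ-comb n c e (λ β → g (compose α β))))
  (L₄-*ˡ c (λ p s → ∑ₚ n (e p s) (λ β → g (compose α β))) (f α))))
  (∑-L₄ (perms n) c (λ α p s → f α ⊗ ∑ₚ n (e p s) (λ β → g (compose α β))))

comb-product : ∀ n c d k l g → k ≤ n → l ≤ n → prodₚ n (comb c k) (comb d l) g ≡ δ l k ⊗ ∑ₚ n (comb (c ∗ d) k) g
comb-product n c d k l g k≤n l≤n = begin
  prodₚ n (comb c k) (comb d l) g
    ≡⟨ ∑ₚ-comb n c (λ p s → el p s k) (λ α → ∑ₚ n (comb d l) (λ β → g (compose α β))) ⟩
  L₄ c (λ p s → prodₚ n (el p s k) (comb d l) g)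
    ≡⟨ L₄-cong c (λ p s → prodₚ-combʳ n (el p s k) d (λ q t → el q t l) g) ⟩
  L₄ c (λ p s → L₄ d (λ q t → prodₚ n (el p s k) (el q t l) g))
    ≡⟨ L₄-cong c (λ p s → L₄-cong d (λ q t → el-product n p s q t k l g k≤n l≤n)) ⟩
  L₄ c (λ p s → L₄ d (λ q t → δ l k ⊗ ∑ₚ n (el (p ∧ q) (sgnMul p s t) k) g))
    ≡⟨ L₄-∗ c d (λ p s → δ l k ⊗ ∑ₚ n (el p s k) g) ⟩
  L₄ (c ∗ d) (λ p s → δ l k ⊗ ∑ₚ n (el p s k) g)
    ≡⟨ sym (L₄-*ˡ (c ∗ d) (λ p s → ∑ₚ n (el p s k) g) (δ l k)) ⟩
  δ l k ⊗ L₄ (c ∗ d) (λ p s → ∑ₚ n (el p s k) g)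
    ≡⟨ cong (δ l k ⊗_) (sym (∑ₚ-comb n (c ∗ d) (λ p s → el p s k) g)) ⟩
  δ l k ⊗ ∑ₚ n (comb (c ∗ d) k) g ∎

fun-idem : ∀ n t k g → k ≤ n → prodₚ n (fun (t , k)) (fun (t , k)) g ≡ ∑ₚ n (fun (t , k)) g
fun-idem n t k g k≤n = trans (comb-product n (coef t) (coef t) k k g k≤n k≤n) (trans (cong (_⊗ ∑ₚ n (comb (coef t ∗ coef t) k) g) (δ-refl k))
  (trans (1⊗ (∑ₚ n (comb (coef t ∗ coef t) k) g)) (∑-cong (perms n) (λ σ → cong (_⊗ g σ) (L₄-congˡ (λ p s → el p s k σ) (coef-idem t))))))

Orthogonal : ℕ → Entry → Entry → Set
Orthogonal n e e′ = ∀ g → prodₚ n (fun e) (fun e′) g ≡ 0ℚ × prodₚ n (fun e′) (fun e) g ≡ 0ℚ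

orth-≢ : ∀ n t u k l → k ≤ n → l ≤ n → k ≢ l → Orthogonal n (t , k) (u , l)
orth-≢ n t u k l k≤n l≤n neq g = zero′ t u k l k≤n l≤n neq , zero′ u t l k l≤n k≤n (neq ∘ sym)
  where
  zero′ : ∀ t u k l → k ≤ n → l ≤ n → k ≢ l → prodₚ n (fun (t , k)) (fun (u , l)) g ≡ 0ℚ
  zero′ t u k l k≤n l≤n neq = trans (comb-product n (coef t) (coef u) k l g k≤n l≤n)
    (trans (cong (_⊗ ∑ₚ n (comb (coef t ∗ coef u) k) g) (δ-≢ l k (neq ∘ sym))) (0⊗ (∑ₚ n (comb (coef t ∗ coef u) k) g)))

orth-tag : ∀ n t u k l → k ≤ n → l ≤ n → Annihilate t u → Orthogonal n (t , k) (u , l)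
orth-tag n t u k l k≤n l≤n (tu , ut) g = zero′ t u k l k≤n l≤n tu , zero′ u t l k l≤n k≤n ut
  where
  zero′ : ∀ t u k l → k ≤ n → l ≤ n → (∀ p s → (coef t ∗ coef u) p s ≡ 0ℚ) → prodₚ n (fun (t , k)) (fun (u , l)) g ≡ 0ℚ
  zero′ t u k l k≤n l≤n z = trans (comb-product n (coef t) (coef u) k l g k≤n l≤n)
    (trans (cong (δ l k ⊗_) (∑-zero (perms n) (λ σ → trans (cong (_⊗ g σ) (trans (L₄-congˡ (λ p s → el p s k σ) z) (L₄-0 (λ p s → el p s k σ)))) (0⊗ (g σ))))) (⊗0 (δ l k)))

all-lookup : ∀ {A : Set} {P : A → Set} {xs : List A} → All P xs → (i : Fin (length xs)) → P (lookup xs i)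
all-lookup (p ∷ ps) Fin.zero    = p
all-lookup (p ∷ ps) (Fin.suc i) = all-lookup ps i

allPairs-lookup : ∀ {A : Set} {R : A → A → Set} {xs : List A} → AllPairs (λ x y → R x y × R y x) xs →
                  (i j : Fin (length xs)) → i ≢ j → R (lookup xs i) (lookup xs j)
allPairs-lookup (p ∷ ps) Fin.zero    Fin.zero    neq = ⊥-elim (neq refl)
allPairs-lookup (p ∷ ps) Fin.zero    (Fin.suc j) neq = proj₁ (all-lookup p j)
allPairs-lookup (p ∷ ps) (Fin.suc i) Fin.zero    neq = proj₂ (all-lookup p i)
allPairs-lookup (p ∷ ps) (Fin.suc i) (Fin.suc j) neq = allPairs-lookup ps i j (neq ∘ cong Fin.suc)

lincF : {I : Set} → (I → Word → ℚ) → List ℚ → List I → Word → ℚ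
lincF hf []       ts       σ = 0ℚ
lincF hf (c ∷ cs) []       σ = 0ℚ
lincF hf (c ∷ cs) (t ∷ ts) σ = c ⊗ hf t σ ⊕ lincF hf cs ts σ

Rep-lincomb : ∀ {I : Set} n (h : I → GA) (hf : I → Word → ℚ) → (∀ t → Rep n (h t) (hf t)) →
              ∀ cs ts → Rep n (lincomb cs (map h ts)) (lincF hf cs ts)
Rep-lincomb n h hf r []       ts       g = sym (∑-zero (perms n) (λ σ → 0⊗ (g σ)))
Rep-lincomb n h hf r (c ∷ cs) []       g = sym (∑-zero (perms n) (λ σ → 0⊗ (g σ)))
Rep-lincomb n h hf r (c ∷ cs) (t ∷ ts) g = begin
  ⟪ scaleGA c (h t) ++ lincomb cs (map h ts) , g ⟫
    ≡⟨ pair-++ (scaleGA c (h t)) (lincomb cs (map h ts)) g ⟩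
  ⟪ scaleGA c (h t) , g ⟫ ⊕ ⟪ lincomb cs (map h ts) , g ⟫
    ≡⟨ cong₂ _⊕_ (trans (pair-scale c (h t) g) (cong (c ⊗_) (r t g))) (Rep-lincomb n h hf r cs ts g) ⟩
  c ⊗ ∑ₚ n (hf t) g ⊕ ∑ₚ n (lincF hf cs ts) g
    ≡⟨ cong (_⊕ ∑ₚ n (lincF hf cs ts) g) (sym (∑-*ˡ (perms n) c (λ σ → hf t σ ⊗ g σ))) ⟩
  ∑ (perms n) (λ σ → c ⊗ (hf t σ ⊗ g σ)) ⊕ ∑ₚ n (lincF hf cs ts) g
    ≡⟨ sym (∑-⊕ (perms n) (λ σ → c ⊗ (hf t σ ⊗ g σ)) (λ σ → lincF hf cs ts σ ⊗ g σ)) ⟩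
  ∑ (perms n) (λ σ → c ⊗ (hf t σ ⊗ g σ) ⊕ lincF hf cs ts σ ⊗ g σ)
    ≡⟨ ∑-cong (perms n) (λ σ → solve 4 (λ c f l g → c :* (f :* g) :+ l :* g := (c :* f :+ l) :* g) refl c (hf t σ) (lincF hf cs ts σ) (g σ)) ⟩
  ∑ₚ n (lincF hf (c ∷ cs) (t ∷ ts)) g ∎

prodₚ-lincF-orth : ∀ n e cs ts g → All (Orthogonal n e) ts → prodₚ n (fun e) (lincF fun cs ts) g ≡ 0ℚ
prodₚ-lincF-orth n e []       ts       g _        = ∑-zero (perms n) (λ α → trans (cong (fun e α ⊗_) (∑-zero (perms n) (λ β → 0⊗ (g (compose α β))))) (⊗0 (fun e α)))
prodₚ-lincF-orth n e (c ∷ cs) []       g _        = ∑-zero (perms n) (λ α → trans (cong (fun e α ⊗_) (∑-zero (perms n) (λ β → 0⊗ (g (compose α β))))) (⊗0 (fun e α)))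
prodₚ-lincF-orth n e (c ∷ cs) (t ∷ ts) g (o ∷ os) = trans (prodₚ-∷ n (fun e) c (fun t) (lincF fun cs ts) g)
  (trans (cong₂ (λ x y → c ⊗ x ⊕ y) (proj₁ (o g)) (prodₚ-lincF-orth n e cs ts g os)) (trans (cong (_⊕ 0ℚ) (⊗0 c)) refl))
  where
  prodₚ-∷ : ∀ n f c h l g → prodₚ n f (λ σ → c ⊗ h σ ⊕ l σ) g ≡ c ⊗ prodₚ n f h g ⊕ prodₚ n f l g
  prodₚ-∷ n f c h l g = begin
    ∑ (perms n) (λ α → f α ⊗ ∑ (perms n) (λ β → (c ⊗ h β ⊕ l β) ⊗ g (compose α β)))
      ≡⟨ ∑-cong (perms n) (λ α → cong (f α ⊗_) (trans (∑-cong (perms n) (λ β → solve 4 (λ c h l g → (c :* h :+ l) :* g := c :* (h :* g) :+ l :* g) refl c (h β) (l β) (g (compose α β))))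
           (trans (∑-⊕ (perms n) (λ β → c ⊗ (h β ⊗ g (compose α β))) (λ β → l β ⊗ g (compose α β)))
             (cong (_⊕ ∑ₚ n l (λ β → g (compose α β))) (∑-*ˡ (perms n) c (λ β → h β ⊗ g (compose α β))))))) ⟩
    ∑ (perms n) (λ α → f α ⊗ (c ⊗ ∑ₚ n h (λ β → g (compose α β)) ⊕ ∑ₚ n l (λ β → g (compose α β))))
      ≡⟨ ∑-cong (perms n) (λ α → solve 4 (λ f c x y → f :* (c :* x :+ y) := c :* (f :* x) :+ f :* y) refl (f α) c (∑ₚ n h (λ β → g (compose α β))) (∑ₚ n l (λ β → g (compose α β)))) ⟩
    ∑ (perms n) (λ α → c ⊗ (f α ⊗ ∑ₚ n h (λ β → g (compose α β))) ⊕ f α ⊗ ∑ₚ n l (λ β → g (compose α β)))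
      ≡⟨ trans (∑-⊕ (perms n) (λ α → c ⊗ (f α ⊗ ∑ₚ n h (λ β → g (compose α β)))) (λ α → f α ⊗ ∑ₚ n l (λ β → g (compose α β))))
           (cong (_⊕ prodₚ n f l g) (∑-*ˡ (perms n) c (λ α → f α ⊗ ∑ₚ n h (λ β → g (compose α β))))) ⟩
    c ⊗ prodₚ n f h g ⊕ prodₚ n f l g ∎

prodₚ-scale : ∀ n f c h g → prodₚ n f (λ σ → c ⊗ h σ) g ≡ c ⊗ prodₚ n f h g
prodₚ-scale n f c h g = trans (∑-cong (perms n) (λ α → trans (cong (f α ⊗_) (trans (∑-cong (perms n) (λ β → ℚ.*-assoc c (h β) (g (compose α β))))
    (∑-*ˡ (perms n) c (λ β → h β ⊗ g (compose α β))))) (⊗-swap (f α) c (∑ₚ n h (λ β → g (compose α β))))))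
  (∑-*ˡ (perms n) c (λ α → f α ⊗ ∑ₚ n h (λ β → g (compose α β))))

-- Multiplication by the first idempotent e reduces a linear relation to c e = 0. The coefficient of
-- the identity permutation, non-zero by hypothesis, then gives c = 0.
indep : ∀ n cs ts → length cs ≡ length ts → All (λ e → proj₂ e ≤ n) ts → AllPairs (Orthogonal n) ts →
        All (λ e → fun e (from1 n) ≢ 0ℚ) ts → All (λ σ → lincF fun cs ts σ ≡ 0ℚ) (perms n) → All (_≡ 0ℚ) cs
indep n []       []       len _          _          _          z = []
indep n (c ∷ cs) (e ∷ ts) len (k≤n ∷ ks) (os ∷ oss) (nz ∷ nzs) z = c≡0 ∷
  indep n cs ts (ℕ.suc-injective len) ks oss nzs (All.map (λ {σ} eq → trans (sym (trans (cong (λ x → x ⊗ fun e σ ⊕ lincF fun cs ts σ) c≡0)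
    (trans (cong (_⊕ lincF fun cs ts σ) (0⊗ (fun e σ))) (0⊕ (lincF fun cs ts σ))))) eq) z)
  where
  g : Word → ℚ
  g = at-perm (from1 n)
  opp : ∀ {x y : ℚ} → x ⊕ y ≡ 0ℚ → y ≡ ⊝ 1ℚ ⊗ x
  opp {x} {y} eq = trans (solve 2 (λ x y → y := (x :+ y) :+ :- (con 1ℚ) :* x) refl x y) (trans (cong (_⊕ ⊝ 1ℚ ⊗ x) eq) (0⊕ (⊝ 1ℚ ⊗ x)))
  -- The rest of the combination equals − c e on permutations, and e annihilates it.
  rest : prodₚ n (fun e) (lincF fun cs ts) g ≡ ⊝ 1ℚ ⊗ (c ⊗ fun e (from1 n))
  rest = begin
    prodₚ n (fun e) (lincF fun cs ts) g
      ≡⟨ ∑-cong (perms n) (λ α → cong (fun e α ⊗_) (∑ₚ-cong n (λ β → g (compose α β)) (All.map (λ {σ} eq → opp {c ⊗ fun e σ} {lincF fun cs ts σ} eq) z))) ⟩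
    prodₚ n (fun e) (λ σ → ⊝ 1ℚ ⊗ (c ⊗ fun e σ)) g
      ≡⟨ trans (prodₚ-scale n (fun e) (⊝ 1ℚ) (λ σ → c ⊗ fun e σ) g) (cong (⊝ 1ℚ ⊗_) (prodₚ-scale n (fun e) c (fun e) g)) ⟩
    ⊝ 1ℚ ⊗ (c ⊗ prodₚ n (fun e) (fun e) g)
      ≡⟨ cong (λ x → ⊝ 1ℚ ⊗ (c ⊗ x)) (trans (fun-idem n (proj₁ e) (proj₂ e) g k≤n) (∑ₚ-at n (fun e) (from1 n) (id-IsPerm n))) ⟩
    ⊝ 1ℚ ⊗ (c ⊗ fun e (from1 n)) ∎
  c≡0 : c ≡ 0ℚ
  c≡0 = ⊗-cancel-0 (fun e (from1 n)) c nz (trans (ℚ.*-comm (fun e (from1 n)) c)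
    (⊗-cancel-0 (⊝ 1ℚ) (c ⊗ fun e (from1 n)) (λ ()) (trans (sym rest) (prodₚ-lincF-orth n e cs ts g os))))

-- Closure under combinations is built in as constructors, and equality is asked only on
-- permutations; coefficient lists are extracted once and for all by `span-coeffs`.
data Span (n : ℕ) {I : Set} (ts : List I) (hf : I → Word → ℚ) : (Word → ℚ) → Set where
  span-0 : ∀ {f} → All (λ σ → f σ ≡ 0ℚ) (perms n) → Span n ts hf f
  span-g : ∀ {f} t → t ∈ ts → All (λ σ → f σ ≡ hf t σ) (perms n) → Span n ts hf f
  span-+ : ∀ {f} a g c h → Span n ts hf g → Span n ts hf h → All (λ σ → f σ ≡ a ⊗ g σ ⊕ c ⊗ h σ) (perms n) → Span n ts hf f

zeros : {I : Set} → List I → List ℚ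
zeros = map (λ _ → 0ℚ)

lincF-zeros : ∀ {I : Set} (hf : I → Word → ℚ) ts σ → lincF hf (zeros ts) ts σ ≡ 0ℚ
lincF-zeros hf []       σ = refl
lincF-zeros hf (t ∷ ts) σ = trans (cong₂ _⊕_ (0⊗ (hf t σ)) (lincF-zeros hf ts σ)) refl

lincF-unit : ∀ {I : Set} (hf : I → Word → ℚ) ts t → t ∈ ts →
             Σ (List ℚ) λ cs → length cs ≡ length ts × (∀ σ → lincF hf cs ts σ ≡ hf t σ)
lincF-unit hf (t ∷ ts) .t (here refl) = 1ℚ ∷ zeros ts , cong suc (L.length-map _ ts) ,
  λ σ → trans (cong₂ _⊕_ (1⊗ (hf t σ)) (lincF-zeros hf ts σ)) (⊕0 (hf t σ))
lincF-unit hf (u ∷ ts) t (there t∈) with lincF-unit hf ts t t∈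
... | cs , len , eq = 0ℚ ∷ cs , cong suc len , λ σ → trans (cong₂ _⊕_ (0⊗ (hf u σ)) (eq σ)) (0⊕ (hf t σ))

lincF-+ : ∀ {I : Set} (hf : I → Word → ℚ) a c xs ys ts → length xs ≡ length ts → length ys ≡ length ts →
          Σ (List ℚ) λ cs → length cs ≡ length ts × (∀ σ → lincF hf cs ts σ ≡ a ⊗ lincF hf xs ts σ ⊕ c ⊗ lincF hf ys ts σ)
lincF-+ hf a c []       []       []       _  _  = [] , refl , λ σ → sym (trans (cong₂ _⊕_ (⊗0 a) (⊗0 c)) refl)
lincF-+ hf a c (x ∷ xs) (y ∷ ys) (t ∷ ts) lx ly with lincF-+ hf a c xs ys ts (ℕ.suc-injective lx) (ℕ.suc-injective ly)
... | cs , len , eq = (a ⊗ x ⊕ c ⊗ y) ∷ cs , cong suc len , λ σ → trans (cong ((a ⊗ x ⊕ c ⊗ y) ⊗ hf t σ ⊕_) (eq σ))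
  (solve 7 (λ a c x y h l m → (a :* x :+ c :* y) :* h :+ (a :* l :+ c :* m) := a :* (x :* h :+ l) :+ c :* (y :* h :+ m)) refl
    a c x y (hf t σ) (lincF hf xs ts σ) (lincF hf ys ts σ))

span-coeffs : ∀ {n} {I : Set} {ts : List I} {hf f} → Span n ts hf f →
              Σ (List ℚ) λ cs → length cs ≡ length ts × All (λ σ → f σ ≡ lincF hf cs ts σ) (perms n)
span-coeffs {ts = ts} {hf} (span-0 z) = zeros ts , L.length-map _ ts , All.map (λ {σ} eq → trans eq (sym (lincF-zeros hf ts σ))) z
span-coeffs {ts = ts} {hf} (span-g t t∈ eqs) with lincF-unit hf ts t t∈
... | cs , len , eq = cs , len , All.map (λ {σ} e → trans e (sym (eq σ))) eqs
span-coeffs {n} {ts = ts} {hf} {f} (span-+ a g c h sg sh eqs) with span-coeffs sg | span-coeffs sh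
... | xs , lx , ex | ys , ly , ey with lincF-+ hf a c xs ys ts lx ly
... | cs , len , eq = cs , len , All.zipWith (λ {σ} (e , ex , ey) → trans e (trans (cong₂ (λ p q → a ⊗ p ⊕ c ⊗ q) ex ey) (sym (eq σ))))
  (eqs , All.zipWith id (ex , ey))

span⇒InSpan : ∀ n {I : Set} (ts : List I) (h : I → GA) (hf : I → Word → ℚ) → (∀ t → Rep n (h t) (hf t)) →
              ∀ x f → Rep n x f → Span n ts hf f → InSpan (map h ts) x
span⇒InSpan n ts h hf r x f rx sp with span-coeffs sp
... | cs , len , eqs = cs , trans len (sym (L.length-map h ts)) , Rep⇒≈ {n} {x} {lincomb cs (map h ts)} {lincF hf cs ts} (Rep-cong {n} {x} {f} {lincF hf cs ts} rx eqs) (Rep-lincomb n h hf r cs ts)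

coeff-mul : ∀ n e e′ σ → coeffGA (mulGA (elt n e) (elt n e′)) σ ≡ prodₚ n (fun e) (fun e′) (at-perm σ)
coeff-mul n e e′ σ = trans (coeffGA-pair (mulGA (elt n e) (elt n e′)) σ)
  (Rep-mulGA {n} {elt n e} {elt n e′} {fun e} {fun e′} (Rep-elt n e) (Rep-elt n e′) (at-perm σ))

orthIdemBasis : ∀ n {G : Set} (gens : List G) (h : G → GA) (hf : G → Word → ℚ) → (∀ t → Rep n (h t) (hf t)) →
  ∀ ts → All (λ e → proj₂ e ≤ n) ts → AllPairs (Orthogonal n) ts → All (λ e → fun e (from1 n) ≢ 0ℚ) ts →
  All (λ e → Span n gens hf (fun e)) ts → All (λ t → Span n ts fun (hf t)) gens →
  OrthIdemBasis (map h gens) (map (elt n) ts)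
orthIdemBasis n gens h hf r ts ks os nzs es gs =
    All.map⁺ (All.map (λ {e} sp → span⇒InSpan n gens h hf r (elt n e) (fun e) (Rep-elt n e) sp) es)
  , All.map⁺ (All.map (λ {t} sp → span⇒InSpan n ts (elt n) fun (Rep-elt n) (h t) (hf t) (r t) sp) gs)
  , (λ cs len z → indep n cs ts (trans len (L.length-map (elt n) ts)) ks os nzs
      (All.map (λ {σ} ip → trans (sym (∑ₚ-at n (lincF fun cs ts) σ ip)) (trans (sym (Rep-lincomb n (elt n) fun (Rep-elt n) cs ts (at-perm σ)))
        (trans (sym (coeffGA-pair (lincomb cs (map (elt n) ts)) σ)) (z σ)))) (perms-IsPerm n)))
  , all-lookup {P = λ x → mulGA x x ≈ x} (All.map⁺ (All.map (λ {e} k≤n σ → trans (coeff-mul n e e σ)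
      (trans (fun-idem n (proj₁ e) (proj₂ e) (at-perm σ) k≤n) (sym (trans (coeffGA-pair (elt n e) σ) (Rep-elt n e (at-perm σ)))))) ks))
  , allPairs-lookup {R = λ x y → mulGA x y ≈ []} (AllPairs.map⁺ (allPairs-map (λ {e} {e′} o →
      (λ σ → trans (coeff-mul n e e′ σ) (proj₁ (o (at-perm σ)))) , (λ σ → trans (coeff-mul n e′ e σ) (proj₂ (o (at-perm σ))))) os))
  where
  allPairs-map : ∀ {A : Set} {R S : A → A → Set} {xs : List A} → (∀ {x y} → R x y → S x y) → AllPairs R xs → AllPairs S xs
  allPairs-map f []       = []
  allPairs-map f (p ∷ ps) = All.map f p ∷ allPairs-map f ps

-- Coefficients of V_m

-- Multiplication of generating series by (1+x²)/(1-x²) and 2x/(1-x²).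
αo βo : (ℕ → ℚ) → ℕ → ℚ
αo g zero    = g 0
αo g (suc m) = βo g m ⊕ g (suc m)
βo g zero    = 0ℚ
βo g (suc m) = αo g m ⊕ g m

αo-cong : ∀ {g h : ℕ → ℚ} → (∀ m → g m ≡ h m) → ∀ m → αo g m ≡ αo h m
βo-cong : ∀ {g h : ℕ → ℚ} → (∀ m → g m ≡ h m) → ∀ m → βo g m ≡ βo h m
αo-cong eq zero    = eq 0
αo-cong eq (suc m) = cong₂ _⊕_ (βo-cong eq m) (eq (suc m))
βo-cong eq zero    = refl
βo-cong eq (suc m) = cong₂ _⊕_ (αo-cong eq m) (eq m)

αo-⊕ : ∀ (g h : ℕ → ℚ) m → αo (λ i → g i ⊕ h i) m ≡ αo g m ⊕ αo h m
βo-⊕ : ∀ (g h : ℕ → ℚ) m → βo (λ i → g i ⊕ h i) m ≡ βo g m ⊕ βo h m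
αo-⊕ g h zero    = refl
αo-⊕ g h (suc m) = trans (cong (_⊕ (g (suc m) ⊕ h (suc m))) (βo-⊕ g h m)) (⊕-interchange (βo g m) (βo h m) (g (suc m)) (h (suc m)))
βo-⊕ g h zero    = refl
βo-⊕ g h (suc m) = trans (cong (_⊕ (g m ⊕ h m)) (αo-⊕ g h m)) (⊕-interchange (αo g m) (αo h m) (g m) (h m))

-- α² = β² + 1 has to be carried along with αβ = βα.
αβ-comm : ∀ g m → αo (βo g) m ≡ βo (αo g) m
αα≡ββ+1 : ∀ g m → αo (αo g) m ≡ βo (βo g) m ⊕ g m
αβ-comm g zero    = refl
αβ-comm g (suc m) = begin
  βo (βo g) m ⊕ (αo g m ⊕ g m)   ≡⟨ solve 3 (λ b a g → b :+ (a :+ g) := (b :+ g) :+ a) refl (βo (βo g) m) (αo g m) (g m) ⟩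
  (βo (βo g) m ⊕ g m) ⊕ αo g m   ≡⟨ cong (_⊕ αo g m) (sym (αα≡ββ+1 g m)) ⟩
  αo (αo g) m ⊕ αo g m ∎
αα≡ββ+1 g zero    = sym (0⊕ (g 0))
αα≡ββ+1 g (suc m) = trans (cong (_⊕ (βo g m ⊕ g (suc m))) (sym (αβ-comm g m)))
  (sym (ℚ.+-assoc (αo (βo g) m) (βo g m) (g (suc m))))

iter : ((ℕ → ℚ) → ℕ → ℚ) → ℕ → (ℕ → ℚ) → ℕ → ℚ
iter f zero    g = g
iter f (suc k) g = f (iter f k g)

isOdd : ℕ → Bool
isOdd zero    = false
isOdd (suc m) = not (isOdd m)

oddseq : ℕ → ℚ
oddseq m = 𝟙 (isOdd m)

-- The coefficients of x/(1-x²) · ((1+x²)/(1-x²))^a · (2x/(1-x²))^c; `oddseq` is the first factor.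
Gs : ℕ → ℕ → ℕ → ℚ
Gs a c = iter αo a (iter βo c oddseq)

βo-iter-αo : ∀ a g m → βo (iter αo a g) m ≡ iter αo a (βo g) m
βo-iter-αo zero    g m = refl
βo-iter-αo (suc a) g m = trans (sym (αβ-comm (iter αo a g) m)) (αo-cong (βo-iter-αo a g) m)

βo-Gs : ∀ a c m → βo (Gs a c) m ≡ Gs a (suc c) m
βo-Gs a c m = βo-iter-αo a (iter βo c oddseq) m

-- In generating series, x/(1-x)² = x (1+x)²/(1-x²)² with (1+x)² = (1+x²) + 2x.
natseq : ∀ m → nat m ≡ αo oddseq m ⊕ βo oddseq m
natseq zero    = refl
natseq (suc m) = begin
  1ℚ ⊕ nat m
    ≡⟨ cong₂ _⊕_ (bit (isOdd m)) (natseq m) ⟩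
  (𝟙 (isOdd m) ⊕ 𝟙 (not (isOdd m))) ⊕ (αo oddseq m ⊕ βo oddseq m)
    ≡⟨ solve 4 (λ p q a b → (p :+ q) :+ (a :+ b) := (b :+ q) :+ (a :+ p)) refl (𝟙 (isOdd m)) (𝟙 (not (isOdd m))) (αo oddseq m) (βo oddseq m) ⟩
  (βo oddseq m ⊕ 𝟙 (not (isOdd m))) ⊕ (αo oddseq m ⊕ 𝟙 (isOdd m)) ∎
  where
  bit : ∀ b → 1ℚ ≡ 𝟙 b ⊕ 𝟙 (not b)
  bit true  = refl
  bit false = refl

VanishPar : Bool → (ℕ → ℚ) → Set
VanishPar π g = ∀ m → isOdd m ≡ π → g m ≡ 0ℚ

not-flip : ∀ {a b} → not a ≡ b → a ≡ not b
not-flip {true}  refl = refl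
not-flip {false} refl = refl

αo-par : ∀ {π g} → VanishPar π g → VanishPar π (αo g)
βo-par : ∀ {π g} → VanishPar π g → VanishPar (not π) (βo g)
αo-par z zero    e = z 0 e
αo-par z (suc m) e = trans (cong₂ _⊕_ (βo-par z m (not-flip e)) (z (suc m) e)) refl
βo-par z zero    e = refl
βo-par {π} z (suc m) e = trans (cong₂ _⊕_ (αo-par z m e′) (z m e′)) refl
  where
  e′ : isOdd m ≡ π
  e′ = Bool.not-injective e

-- The initial factor is odd in x, the factors counted by a are even, and those counted by c are
-- odd.
Gs-par : ∀ a c → VanishPar (isOdd c) (Gs a c)
Gs-par zero    zero    m e = cong 𝟙 e
Gs-par zero    (suc c) = βo-par (Gs-par zero c)
Gs-par (suc a) c       = αo-par (Gs-par a c)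

Below : ℕ → (ℕ → ℚ) → Set
Below c g = ∀ m → m < c → g m ≡ 0ℚ

αo-below : ∀ {c g} → Below c g → Below c (αo g)
βo-below : ∀ {c g} → Below c g → Below (suc c) (βo g)
αo-below z zero    lt = z 0 lt
αo-below z (suc m) lt = trans (cong₂ _⊕_ (βo-below z m (ℕ.m<n⇒m<1+n (ℕ.<-trans (ℕ.n<1+n m) lt))) (z (suc m) lt)) refl
βo-below z zero    lt = refl
βo-below z (suc m) (s≤s lt) = trans (cong₂ _⊕_ (αo-below z m lt) (z m lt)) refl

αo-lead : ∀ c {g} → Below c g → αo g c ≡ g c
αo-lead zero    z = refl
αo-lead (suc c) {g} z = trans (cong (_⊕ g (suc c)) (βo-below z c (ℕ.m<n⇒m<1+n (ℕ.n<1+n c)))) (0⊕ (g (suc c)))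

βo-lead : ∀ c {g} → Below c g → βo g (suc c) ≡ g c ⊕ g c
βo-lead c {g} z = cong (_⊕ g c) (αo-lead c z)

Gs-below : ∀ a c → Below (suc c) (Gs a c)
Gs-below zero    zero    zero (s≤s z≤n) = refl
Gs-below zero    (suc c) = βo-below (Gs-below zero c)
Gs-below (suc a) c       = αo-below (Gs-below a c)

2^ : ℕ → ℚ
2^ zero    = 1ℚ
2^ (suc c) = 2^ c ⊕ 2^ c

Gs-lead : ∀ a c → Gs a c (suc c) ≡ 2^ c
Gs-lead zero    zero    = refl
Gs-lead zero    (suc c) = trans (βo-lead (suc c) (Gs-below zero c)) (cong₂ _⊕_ (Gs-lead zero c) (Gs-lead zero c))
Gs-lead (suc a) c       = trans (αo-lead (suc c) (Gs-below a c)) (Gs-lead a c)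

2^≢0 : ∀ c → 2^ c ≢ 0ℚ
2^≢0 (suc c) eq = 2^≢0 c (trans (solve 1 (λ x → x := con ½ :* (x :+ x)) refl (2^ c)) (trans (cong (½ ⊗_) eq) (⊗0 ½)))

up : ℕ → ℕ → Bool
up x y = not (y <ᵇ x)

differ : Bool → Bool → ℕ
differ true  true  = 0
differ false false = 0
differ _     _     = 1

-- Counts changes in the sign sequence that begins with s and goes on with the directions of the
-- steps of x ∷ w. The closing sign of the alternating word is not yet taken into account.
chg : Bool → ℕ → Word → ℕ
chg s x []      = 0
chg s x (y ∷ w) = differ s (up x y) + chg (up x y) y w

same : Bool → ℕ → Word → ℕ
same s x []      = 0
same s x (y ∷ w) = 1 ∸ differ s (up x y) + same (up x y) y w

VA-[] : ∀ A → VA A [] ≡ 1ℚ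
VA-[] []      = refl
VA-[] (s ∷ A) = trans (⊕0 (1ℚ ⊗ VA A [])) (trans (1⊗ (VA A [])) (VA-[] A))

Qs : Bool → List Bool → ℕ → Word → ℚ
Qs s A x w = ΔL w (λ q r → fs s (x ∷ q) ⊗ VA A r)

VA-∷ : ∀ s A x w → VA (s ∷ A) (x ∷ w) ≡ VA A (x ∷ w) ⊕ Qs s A x w
VA-∷ s A x w = trans (ΔL-∷ x w (λ q r → fs s q ⊗ VA A r)) (cong (_⊕ Qs s A x w) (1⊗ (VA A (x ∷ w))))

Qs-∷ : ∀ s A x y w → Qs s A x (y ∷ w) ≡ VA A (y ∷ w) ⊕ 𝟙 (step s x y) ⊗ Qs s A y w
Qs-∷ s A x y w = trans (ΔL-∷ y w (λ q r → fs s (x ∷ q) ⊗ VA A r)) (cong₂ _⊕_ (1⊗ (VA A (y ∷ w)))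
  (trans (ΔL-cong w (λ q r → trans (cong (_⊗ VA A r) (𝟙-∧ (step s x y) (mono s (y ∷ q)))) (ℚ.*-assoc (𝟙 (step s x y)) (fs s (y ∷ q)) (VA A r))))
    (∑-*ˡ (splitsL w) (𝟙 (step s x y)) (λ p → fs s (y ∷ proj₁ p) ⊗ VA A (proj₂ p)))))

Vm : Bool → Word → ℕ → ℚ
Vm s w m = VA (alt s m) w

Vm-single : ∀ s x m → Vm s (x ∷ []) m ≡ nat m
Vm-single s x zero    = refl
Vm-single s x (suc m) = trans (VA-∷ s (alt (not s) m) x []) (trans (cong₂ _⊕_ (Vm-single (not s) x m)
  (trans (⊕0 (1ℚ ⊗ VA (alt (not s) m) [])) (trans (1⊗ (VA (alt (not s) m) [])) (VA-[] (alt (not s) m))))) (ℚ.+-comm (nat m) 1ℚ))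

-- Either the first block is empty or it contains x. In the second case remove x: the block remains
-- available for y exactly when the step from x to y has direction s.
Vm-rec : ∀ s x y w m → Vm s (x ∷ y ∷ w) (suc m) ≡
         Vm (not s) (x ∷ y ∷ w) m ⊕ (if step s x y then Vm s (y ∷ w) (suc m) else Vm (not s) (y ∷ w) m)
Vm-rec s x y w m = trans (VA-∷ s A x (y ∷ w)) (cong (VA A (x ∷ y ∷ w) ⊕_) (trans (Qs-∷ s A x y w) (pick (step s x y))))
  where
  A : List Bool
  A = alt (not s) m
  pick : ∀ b → VA A (y ∷ w) ⊕ 𝟙 b ⊗ Qs s A y w ≡ (if b then VA (s ∷ A) (y ∷ w) else VA A (y ∷ w))
  pick true  = trans (cong (VA A (y ∷ w) ⊕_) (1⊗ (Qs s A y w))) (sym (VA-∷ s A y w))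
  pick false = trans (cong (VA A (y ∷ w) ⊕_) (0⊗ (Qs s A y w))) (⊕0 (VA A (y ∷ w)))

-- The transfer matrix of a step has rank one, so only V^u(y ∷ w) is needed, u being the direction of the step.
Vm-same : ∀ x y w m → Vm (up x y) (x ∷ y ∷ w) m ≡ αo (Vm (up x y) (y ∷ w)) m
Vm-diff : ∀ x y w m → Vm (not (up x y)) (x ∷ y ∷ w) m ≡ βo (Vm (up x y) (y ∷ w)) m
Vm-same x y w zero    = refl
Vm-same x y w (suc m) = trans (Vm-rec (up x y) x y w m) (cong₂ _⊕_ (Vm-diff x y w m)
  (cong (λ b → if b then Vm (up x y) (y ∷ w) (suc m) else Vm (not (up x y)) (y ∷ w) m) (step-up (y <ᵇ x) refl)))
  where
  step-up : ∀ b → (y <ᵇ x) ≡ b → step (up x y) x y ≡ true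
  step-up b eq with y <ᵇ x in e
  ... | true  = e
  ... | false = cong not e
Vm-diff x y w zero    = refl
Vm-diff x y w (suc m) = trans (Vm-rec (not (up x y)) x y w m) (cong₂ _⊕_
  (trans (cong (λ b → Vm b (x ∷ y ∷ w) m) (Bool.not-involutive (up x y))) (Vm-same x y w m))
  (trans (cong (λ b → if b then Vm (not (up x y)) (y ∷ w) (suc m) else Vm (not (not (up x y))) (y ∷ w) m) step-down)
    (cong (λ b → Vm b (y ∷ w) m) (Bool.not-involutive (up x y)))))
  where
  step-down : step (not (up x y)) x y ≡ false
  step-down with y <ᵇ x in e
  ... | true  = cong not e
  ... | false = e

-- Each step repeating the previous direction multiplies the generating series in m by
-- (1+x²)/(1-x²), each change by 2x/(1-x²). The operators commute, so only the two counts matter; a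
-- single letter gives `natseq`.
Vm-formula : ∀ s x w m → Vm s (x ∷ w) m ≡ Gs (suc (same s x w)) (chg s x w) m ⊕ Gs (same s x w) (suc (chg s x w)) m
Vm-formula s x []      m = trans (Vm-single s x m) (natseq m)
Vm-formula s x (y ∷ w) m with up x y in eq | Vm-same x y w m | Vm-diff x y w m
Vm-formula true  x (y ∷ w) m | true  | e | _ = trans e (trans (αo-cong (Vm-formula true y w) m) (αo-⊕ _ _ m))
Vm-formula false x (y ∷ w) m | false | e | _ = trans e (trans (αo-cong (Vm-formula false y w) m) (αo-⊕ _ _ m))
Vm-formula true  x (y ∷ w) m | false | _ | e = trans e (trans (βo-cong (Vm-formula false y w) m) (trans (βo-⊕ _ _ m)
  (cong₂ _⊕_ (βo-Gs (suc (same false y w)) (chg false y w) m) (βo-Gs (same false y w) (suc (chg false y w)) m))))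
Vm-formula false x (y ∷ w) m | true  | _ | e = trans e (trans (βo-cong (Vm-formula true y w) m) (trans (βo-⊕ _ _ m)
  (cong₂ _⊕_ (βo-Gs (suc (same true y w)) (chg true y w) m) (βo-Gs (same true y w) (suc (chg true y w)) m))))

differ-sum : ∀ s u → 1 ∸ differ s u + differ s u ≡ 1
differ-sum true  true  = refl
differ-sum true  false = refl
differ-sum false true  = refl
differ-sum false false = refl

same+chg : ∀ s x w → same s x w + chg s x w ≡ length w
same+chg s x []      = refl
same+chg s x (y ∷ w) = trans (interch (1 ∸ differ s (up x y)) (same (up x y) y w) (differ s (up x y)) (chg (up x y) y w))
  (cong₂ _+_ (differ-sum s (up x y)) (same+chg (up x y) y w))
  where
  interch : ∀ a b c d → (a + b) + (c + d) ≡ (a + c) + (b + d)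
  interch a b c d = trans (ℕ.+-assoc a b (c + d)) (trans (cong (a +_) (trans (sym (ℕ.+-assoc b c d)) (trans (cong (_+ d) (ℕ.+-comm b c)) (ℕ.+-assoc c b d))))
    (sym (ℕ.+-assoc a c (b + d))))

-- Its generating series in m is x (2x)^c (1+x²)^(n-c) / (1-x²)^(n+1).
G : ℕ → ℕ → ℕ → ℚ
G n c = Gs (n ∸ c) c

-- By parity at most one of the two summands is non-zero for a given m. Which one it is accounts for
-- the last sign of the alternating word.
Vm-G : ∀ s x w m → Vm s (x ∷ w) m ≡ G (suc (length w)) (chg s x w) m ⊕ G (suc (length w)) (suc (chg s x w)) m
Vm-G s x w m = trans (Vm-formula s x w m) (cong₂ (λ a b → Gs a (chg s x w) m ⊕ Gs b (suc (chg s x w)) m)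
  (sym (trans (cong (λ z → suc z ∸ chg s x w) (sym (same+chg s x w))) (ℕ.m+n∸n≡m (suc (same s x w)) (chg s x w))))
  (sym (trans (cong (_∸ chg s x w) (sym (same+chg s x w))) (ℕ.m+n∸n≡m (same s x w) (chg s x w)))))

G-even : ∀ n c m → isOdd m ≡ isOdd c → G n c m ≡ 0ℚ
G-even n c m e = Gs-par (n ∸ c) c m e

G-below : ∀ n c m → m ≤ c → G n c m ≡ 0ℚ
G-below n c m le = Gs-below (n ∸ c) c m (s≤s le)

G-lead : ∀ n c → G n c (suc c) ≡ 2^ c
G-lead n c = Gs-lead (n ∸ c) c

-- All that the comparison of steps needs from a permutation: neighbours differ, so a step that is
-- not a descent is a strict ascent.
data Adj : Word → Set where
  adj₀ : Adj []
  adj₁ : ∀ {x} → Adj (x ∷ [])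
  adj₂ : ∀ {x y w} → x ≢ y → Adj (y ∷ w) → Adj (x ∷ y ∷ w)

distinct⇒Adj : ∀ w → distinct w ≡ true → Adj w
distinct⇒Adj []          d = adj₀
distinct⇒Adj (x ∷ [])    d = adj₁
distinct⇒Adj (x ∷ y ∷ w) d = adj₂ x≢y (distinct⇒Adj (y ∷ w) (∧-true (not (elemᵇ x (y ∷ w))) d))
  where
  repeated : ∀ x → distinct (x ∷ x ∷ w) ≡ true → ⊥
  repeated x d with x ≡ᵇ x | ℕ.≡⇒≡ᵇ x x refl
  repeated x () | true | _
  x≢y : x ≢ y
  x≢y refl = repeated x d

<ᵇ-up : ∀ x y → x ≢ y → (x <ᵇ y) ≡ up x y
<ᵇ-up x y neq with ℕ.<-cmp x y
... | tri< lt _ _ = trans (<ᵇ-true lt) (cong not (sym (<ᵇ-false (ℕ.<⇒≤ lt))))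
... | tri≈ _ eq _ = ⊥-elim (neq eq)
... | tri> _ _ gt = trans (<ᵇ-false (ℕ.<⇒≤ gt)) (cong not (sym (<ᵇ-true gt)))

changes-chg : ∀ x y w → Adj (x ∷ y ∷ w) → changes (x ∷ y ∷ w) ≡ chg (up x y) y w
changes-chg x y []      _ = refl
changes-chg x y (z ∷ w) (adj₂ x≢y a@(adj₂ y≢z _)) rewrite <ᵇ-up x y x≢y | <ᵇ-up y z y≢z = cong₂ _+_ (lem (y <ᵇ x) (z <ᵇ y)) (changes-chg y z w a)
  where
  lem : ∀ a b → (if (not a ∧ b) ∨ (a ∧ not b) then 1 else 0) ≡ differ (not a) (not b)
  lem true  true  = refl
  lem true  false = refl
  lem false true  = refl
  lem false false = refl

-- Peaks and valleys alternate. If the first step ascends there are as many valleys as peaks or one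
-- fewer, if it descends as many or one more, according to the last step.
PeakRel : Bool → ℕ → ℕ → Set
PeakRel true  c p = c ≡ double p ⊎ suc c ≡ double p
PeakRel false c p = c ≡ double p ⊎ c ≡ suc (double p)

peaks-chg : ∀ x y w → Adj (x ∷ y ∷ w) → PeakRel (up x y) (chg (up x y) y w) (peaks (x ∷ y ∷ w))
peaks-chg x y [] _ with up x y
... | true  = inj₁ refl
... | false = inj₁ refl
peaks-chg x y (z ∷ w) (adj₂ x≢y a@(adj₂ y≢z _)) rewrite <ᵇ-up x y x≢y with peaks-chg y z w a
... | ih with y <ᵇ x | z <ᵇ y
... | true  | true  = ih
peaks-chg x y (z ∷ w) _ | inj₁ e | true  | false = inj₂ (cong suc e)
peaks-chg x y (z ∷ w) _ | inj₂ e | true  | false = inj₁ e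
peaks-chg x y (z ∷ w) _ | inj₁ e | false | true  = inj₂ (cong (suc ∘ suc) e)
peaks-chg x y (z ∷ w) _ | inj₂ e | false | true  = inj₁ (cong suc e)
... | false | false = ih

peaks-chg⁻ : ∀ x y w → Adj (x ∷ y ∷ w) → PeakRel false (chg false x (y ∷ w)) (peaks (x ∷ y ∷ w))
peaks-chg⁻ x y w a with up x y | peaks-chg x y w a
... | false | r      = r
... | true  | inj₁ e = inj₂ (cong suc e)
... | true  | inj₂ e = inj₁ e

changes-≤ : ∀ x y w → changes (x ∷ y ∷ w) ≤ length w
changes-≤ x y []      = z≤n
changes-≤ x y (z ∷ w) = ℕ.+-mono-≤ (bit (((x <ᵇ y) ∧ (z <ᵇ y)) ∨ ((y <ᵇ x) ∧ (y <ᵇ z)))) (changes-≤ y z w)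
  where
  bit : ∀ b → (if b then 1 else 0) ≤ 1
  bit true  = ℕ.≤-refl
  bit false = z≤n

peaks-≤ : ∀ x y w → peaks (x ∷ y ∷ w) ≤ length w
peaks-≤ x y []      = z≤n
peaks-≤ x y (z ∷ w) = ℕ.+-mono-≤ (bit ((x <ᵇ y) ∧ (z <ᵇ y))) (peaks-≤ y z w)
  where
  bit : ∀ b → (if b then 1 else 0) ≤ 1
  bit true  = ℕ.≤-refl
  bit false = z≤n

-- Components of low degree and spans

NC-I₀ : ∀ s x w → NC.I s 0 (x ∷ w) ≡ 0ℚ
NC-I₀ true  x w = refl
NC-I₀ false x w = refl

VA-single : ∀ s w → VA (s ∷ []) w ≡ fs s w
VA-single s w = NC.⋆one (fs s) w

-- I₁ has no constant term and equals R₁ up to degree 2, hence I_k = R₁^k / k! in degree k.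
I₁ : Bool → Word → ℚ
I₁ s = NC.evS (scaleS ½ (logS (V₂ s)))

I≐pow : ∀ s k → NC.I s k NC.≐ recip (k !) NC.· NC.pow (I₁ s) k
I≐pow s k w = trans (NC.I≐ s k w) (trans (NC.evS-scaleS (recip (k !)) (powS (scaleS ½ (logS (V₂ s))) k) w)
  (cong (recip (k !) ⊗_) (NC.evS-powS (valid-scaleS ½ (valid-logS (valid-V₂ s))) k w)))

I₁≐ : ∀ s → NC.I s 1 NC.≐ I₁ s
I₁≐ s w = trans (I≐pow s 1 w) (trans (1⊗ ((I₁ s NC.⋆ NC.one) w)) (NC.⋆one (I₁ s) w))

I₁-vanish : ∀ s → NC.Vanish₀ (I₁ s)
I₁-vanish s w eq = trans (sym (I₁≐ s w)) (NC.I-deg s 1 w (subst (_< 1) (sym eq) (s≤s z≤n)))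

I₁-letter : ∀ s x → I₁ s (x ∷ []) ≡ 1ℚ
I₁-letter s x = trans (sym (I₁≐ s (x ∷ []))) (begin
  NC.I s 1 (x ∷ [])
    ≡⟨ solve 1 (λ z → z := con ½ :* (con 1ℚ :* con 0ℚ :+ (((con 1ℚ :+ (con 1ℚ :+ con 0ℚ)) :* con 1ℚ) :* z :+ con 0ℚ))) refl (NC.I s 1 (x ∷ [])) ⟩
  ½ ⊗ (1ℚ ⊗ 0ℚ ⊕ (pow₁ (nat 2) 1 ⊗ NC.I s 1 (x ∷ []) ⊕ 0ℚ))
    ≡⟨ cong (λ z → ½ ⊗ (1ℚ ⊗ z ⊕ (pow₁ (nat 2) 1 ⊗ NC.I s 1 (x ∷ []) ⊕ 0ℚ))) (sym (NC-I₀ s x [])) ⟩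
  ½ ⊗ Σ< 2 (λ k → pow₁ (nat 2) k ⊗ NC.I s k (x ∷ []))
    ≡⟨ cong (½ ⊗_) (trans (el-gen false s 1 (x ∷ [])) (Vm-single s x 2)) ⟩
  1ℚ ∎)

ΔL-at-[] : ∀ w (F : Word → Word → ℚ) → (∀ y q r → suc (length r) ≤ length w → F (y ∷ q) r ≡ 0ℚ) → ΔL w F ≡ F [] w
ΔL-at-[] []      F z = ⊕0 (F [] [])
ΔL-at-[] (x ∷ w) F z = trans (ΔL-∷ x w F) (trans (cong (F [] (x ∷ w) ⊕_) (∑-zero-All (All.map
  (λ {qr} e → z x (proj₁ qr) (proj₂ qr) (s≤s (ℕ.≤-trans (ℕ.m≤n+m (length (proj₂ qr)) (length (proj₁ qr))) (ℕ.≤-reflexive e)))) (deg-splitsL w)))) (⊕0 (F [] (x ∷ w))))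

pow-top : ∀ f → NC.Vanish₀ f → (∀ x → f (x ∷ []) ≡ 1ℚ) → ∀ w → NC.pow f (length w) w ≡ 1ℚ
pow-top f f₀ f1 []      = refl
pow-top f f₀ f1 (x ∷ w) = begin
  ΔL (x ∷ w) (λ q r → f q ⊗ NC.pow f (length w) r)
    ≡⟨ ΔL-∷ x w (λ q r → f q ⊗ NC.pow f (length w) r) ⟩
  f [] ⊗ NC.pow f (length w) (x ∷ w) ⊕ ΔL w (λ q r → f (x ∷ q) ⊗ NC.pow f (length w) r)
    ≡⟨ cong₂ _⊕_ (trans (cong (_⊗ NC.pow f (length w) (x ∷ w)) (f₀ [] refl)) (0⊗ (NC.pow f (length w) (x ∷ w))))
         (ΔL-at-[] w (λ q r → f (x ∷ q) ⊗ NC.pow f (length w) r)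
           (λ y q r lt → trans (cong (f (x ∷ y ∷ q) ⊗_) (NC.pow-vanish f₀ (length w) r lt)) (⊗0 (f (x ∷ y ∷ q))))) ⟩
  0ℚ ⊕ f (x ∷ []) ⊗ NC.pow f (length w) w
    ≡⟨ trans (0⊕ (f (x ∷ []) ⊗ NC.pow f (length w) w)) (cong₂ _⊗_ (f1 x) (pow-top f f₀ f1 w)) ⟩
  1ℚ ∎

I-top : ∀ s w → NC.I s (length w) w ≡ recip (length w !)
I-top s w = trans (I≐pow s (length w) w) (trans (cong (recip (length w !) ⊗_) (pow-top (I₁ s) (I₁-vanish s) (I₁-letter s) w)) (⊗1 (recip (length w !))))

J≐J₀⋆I : ∀ s k → NC.J s k NC.≐ NC.J s 0 NC.⋆ NC.I (not s) k
J≐J₀⋆I s k w = trans (split k w) (NC.⋆-congʳ (NC.I (not s) k) (λ q → sym (trans (split 0 q) (trans (NC.⋆-congˡ j₀ I0≐one q) (NC.⋆one j₀ q)))) w)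
  where
  J₀ : Ser
  J₀ = mulS (V₁ s) (powRat (V₂ (not s)) (⊝ ½))
  j₀ : Word → ℚ
  j₀ = NC.evS J₀
  split : ∀ k → NC.J s k NC.≐ j₀ NC.⋆ NC.I (not s) k
  split k q = trans (NC.J≐ s k q) (trans (NC.evS-mulS {J₀} {Iof (V₂ (not s)) k}
    (valid-mulS (valid-V₁ s) (valid-powRat (valid-V₂ (not s)) (⊝ ½))) (valid-Iof (valid-V₂ (not s)) k) q)
    (NC.⋆-congˡ j₀ (λ r → sym (NC.I≐ (not s) k r)) q))
  I0≐one : NC.I (not s) 0 NC.≐ NC.one
  I0≐one q = trans (I≐pow (not s) 0 q) (1⊗ (NC.one q))

J₀-[] : ∀ s → NC.J s 0 [] ≡ 1ℚ
J₀-[] s = trans (sym (trans (⊕0 (1ℚ ⊗ NC.J s 0 [])) (1⊗ (NC.J s 0 [])))) (trans (el-gen true s 0 []) (VA-single s []))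

-- J_0 has constant term 1 and I_k starts in degree k, so J_k and I_k agree in degree k.
J-top : ∀ s w → NC.J s (length w) w ≡ recip (length w !)
J-top s w = trans (J≐J₀⋆I s (length w) w) (trans (ΔL-at-[] w (λ q r → NC.J s 0 q ⊗ NC.I (not s) (length w) r)
  (λ y q r lt → trans (cong (NC.J s 0 (y ∷ q) ⊗_) (NC.I-deg (not s) (length w) r lt)) (⊗0 (NC.J s 0 (y ∷ q)))))
  (trans (cong₂ _⊗_ (J₀-[] s) (I-top (not s) w)) (1⊗ (recip (length w !)))))

-- At t = 1 the generating polynomial of the J_k is V₁^s. In degree 2 its terms are J_0, then J_1,
-- which vanishes by parity, and J_2 with value ½.
J₀-pair : ∀ s x y → NC.J s 0 (x ∷ y ∷ []) ≡ fs s (x ∷ y ∷ []) ⊕ ⊝ ½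
J₀-pair s x y = begin
  NC.J s 0 w
    ≡⟨ solve 1 (λ a → a := (con 1ℚ :* a :+ (con 1ℚ :* con 0ℚ :+ (con 1ℚ :* con ½ :+ con 0ℚ))) :+ :- con ½) refl (NC.J s 0 w) ⟩
  (1ℚ ⊗ NC.J s 0 w ⊕ (1ℚ ⊗ 0ℚ ⊕ (1ℚ ⊗ ½ ⊕ 0ℚ))) ⊕ ⊝ ½
    ≡⟨ cong₂ (λ a b → (1ℚ ⊗ NC.J s 0 w ⊕ (1ℚ ⊗ a ⊕ (1ℚ ⊗ b ⊕ 0ℚ))) ⊕ ⊝ ½) (sym (NC.J-parity s 1 w (s≤s z≤n) refl)) (sym (J-top s w)) ⟩
  Σ< 3 (λ k → pow₁ 1ℚ k ⊗ NC.J s k w) ⊕ ⊝ ½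
    ≡⟨ cong (_⊕ ⊝ ½) (trans (el-gen true s 0 w) (VA-single s w)) ⟩
  fs s w ⊕ ⊝ ½ ∎
  where
  w : Word
  w = x ∷ y ∷ []

-- In degree k + 2 only the components of degree at most 2 of J_0 meet I_k, and the one of degree 1
-- vanishes by parity.
J-second : ∀ s x y w → NC.J s (length w) (x ∷ y ∷ w) ≡
           NC.I (not s) (length w) (x ∷ y ∷ w) ⊕ (fs s (x ∷ y ∷ []) ⊕ ⊝ ½) ⊗ recip (length w !)
J-second s x y w = begin
  NC.J s k (x ∷ y ∷ w)
    ≡⟨ trans (J≐J₀⋆I s k (x ∷ y ∷ w)) (trans (ΔL-∷ x (y ∷ w) F) (cong (F [] (x ∷ y ∷ w) ⊕_) (ΔL-∷ y w (λ q r → F (x ∷ q) r)))) ⟩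
  F [] (x ∷ y ∷ w) ⊕ (F (x ∷ []) (y ∷ w) ⊕ ΔL w (λ q r → F (x ∷ y ∷ q) r))
    ≡⟨ cong₂ _⊕_ (trans (cong (_⊗ NC.I (not s) k (x ∷ y ∷ w)) (J₀-[] s)) (1⊗ (NC.I (not s) k (x ∷ y ∷ w))))
        (cong₂ _⊕_ (trans (cong (_⊗ NC.I (not s) k (y ∷ w)) (NC.J-parity s 0 (x ∷ []) z≤n refl)) (0⊗ (NC.I (not s) k (y ∷ w))))
          (trans (ΔL-at-[] w (λ q r → F (x ∷ y ∷ q) r) (λ z q r lt → trans (cong (NC.J s 0 (x ∷ y ∷ z ∷ q) ⊗_) (NC.I-deg (not s) k r lt)) (⊗0 (NC.J s 0 (x ∷ y ∷ z ∷ q)))))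
            (cong₂ _⊗_ (J₀-pair s x y) (I-top (not s) w)))) ⟩
  NC.I (not s) k (x ∷ y ∷ w) ⊕ (0ℚ ⊕ (fs s (x ∷ y ∷ []) ⊕ ⊝ ½) ⊗ recip (k !))
    ≡⟨ cong (NC.I (not s) k (x ∷ y ∷ w) ⊕_) (0⊕ ((fs s (x ∷ y ∷ []) ⊕ ⊝ ½) ⊗ recip (k !))) ⟩
  NC.I (not s) k (x ∷ y ∷ w) ⊕ (fs s (x ∷ y ∷ []) ⊕ ⊝ ½) ⊗ recip (k !) ∎
  where
  k : ℕ
  k = length w
  F : Word → Word → ℚ
  F q r = NC.J s 0 q ⊗ NC.I (not s) k r

-- J^+ and J^- have the same component in degree k. This is why the index of `tC` stops at n - 2;
-- `tD-top` does the same for `tD`.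
tC-top : ∀ w → fun (tC , length w) w ≡ 0ℚ
tC-top w = trans (cong₂ (λ x y → (0ℚ ⊗ NC.I true (length w) w ⊕ 0ℚ ⊗ NC.I false (length w) w) ⊕ (½ ⊗ x ⊕ ⊝ ½ ⊗ y)) (J-top true w) (J-top false w))
  (solve 3 (λ a b r → (con 0ℚ :* a :+ con 0ℚ :* b) :+ (con ½ :* r :+ :- con ½ :* r) := con 0ℚ) refl (NC.I true (length w) w) (NC.I false (length w) w) (recip (length w !)))

tD-top : ∀ w → fun (tD , length w) w ≡ 0ℚ
tD-top w = trans (cong₂ (λ x y → (⊝ 1ℚ ⊗ y ⊕ 0ℚ ⊗ NC.I false (length w) w) ⊕ (1ℚ ⊗ x ⊕ 0ℚ ⊗ NC.J false (length w) w)) (J-top true w) (I-top true w))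
  (solve 3 (λ a b r → (:- con 1ℚ :* r :+ con 0ℚ :* a) :+ (con 1ℚ :* r :+ con 0ℚ :* b) := con 0ℚ) refl (NC.I false (length w) w) (NC.J false (length w) w) (recip (length w !)))

tB-top : ∀ w → fun (tB , length w) w ≡ 0ℚ
tB-top w = trans (cong₂ _⊕_ (cong₂ (λ x y → ⊝ ½ ⊗ x ⊕ ⊝ ½ ⊗ y) (I-top true w) (I-top false w)) (cong₂ (λ x y → ½ ⊗ x ⊕ ½ ⊗ y) (J-top true w) (J-top false w)))
  (solve 1 (λ r → (:- con ½ :* r :+ :- con ½ :* r) :+ (con ½ :* r :+ con ½ :* r) := con 0ℚ) refl (recip (length w !)))

-- A pair of letters either ascends or descends, so the corrections in `J-second` for the two signs
-- add up to zero. With `tB-top` this moves the end of the range of `tB` down to n - 4.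
tB-second : ∀ x y w → fun (tB , length w) (x ∷ y ∷ w) ≡ 0ℚ
tB-second x y w = trans (cong ((⊝ ½ ⊗ a ⊕ ⊝ ½ ⊗ b) ⊕_) (cong₂ (λ x y → ½ ⊗ x ⊕ ½ ⊗ y) (J-second true x y w) (J-second false x y w)))
  (trans (solve 5 (λ a b r f g → (:- con ½ :* a :+ :- con ½ :* b) :+ (con ½ :* (b :+ (f :+ :- con ½) :* r) :+ con ½ :* (a :+ (g :+ :- con ½) :* r)) :=
       con ½ :* ((f :+ g) :+ :- con 1ℚ) :* r) refl a b (recip (length w !)) (fs true (x ∷ y ∷ [])) (fs false (x ∷ y ∷ [])))
    (trans (cong (λ z → (½ ⊗ (z ⊕ ⊝ 1ℚ)) ⊗ recip (length w !)) (both (y <ᵇ x))) (0⊗ (recip (length w !)))))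
  where
  a b : ℚ
  a = NC.I true (length w) (x ∷ y ∷ w)
  b = NC.I false (length w) (x ∷ y ∷ w)
  both : ∀ c → 𝟙 (not c ∧ true) ⊕ 𝟙 (c ∧ true) ≡ 1ℚ
  both true  = refl
  both false = refl

module _ {n : ℕ} {I : Set} {ts : List I} {hf : I → Word → ℚ} where

  span-ext : ∀ {f g} → Span n ts hf f → All (λ σ → g σ ≡ f σ) (perms n) → Span n ts hf g
  span-ext {f} sp eqs = span-+ 1ℚ f 0ℚ f sp sp (All.map (λ {σ} e → trans e (solve 1 (λ x → x := con 1ℚ :* x :+ con 0ℚ :* x) refl (f σ))) eqs)

  span-scale : ∀ c f → Span n ts hf f → Span n ts hf (λ σ → c ⊗ f σ)
  span-scale c f sp = span-+ c f 0ℚ f sp sp (All.universal (λ σ → solve 2 (λ c x → c :* x := c :* x :+ con 0ℚ :* x) refl c (f σ)) (perms n))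

  span-Σ : ∀ N (F : ℕ → Word → ℚ) → (∀ k → k < N → Span n ts hf (F k)) → Span n ts hf (λ σ → Σ< N (λ k → F k σ))
  span-Σ zero    F sp = span-0 (All.universal (λ σ → refl) (perms n))
  span-Σ (suc N) F sp = span-+ 1ℚ (F 0) 1ℚ (λ σ → Σ< N (λ k → F (suc k) σ)) (sp 0 (s≤s z≤n)) (span-Σ N (F ∘ suc) (λ k lt → sp (suc k) (s≤s lt)))
    (All.universal (λ σ → sym (cong₂ _⊕_ (1⊗ (F 0 σ)) (1⊗ (Σ< N (λ k → F (suc k) σ))))) (perms n))

  -- Forward substitution in a lower triangular system with invertible diagonal.
  span-tri : ∀ (g U : ℕ → Word → ℚ) (co : ℕ → ℕ → ℚ) →
    (∀ m → All (λ σ → U m σ ≡ Σ< (suc m) (λ r → co m r ⊗ g r σ)) (perms n)) →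
    (∀ m → co m m ≢ 0ℚ) → (∀ m → Span n ts hf (U m)) → ∀ m → Span n ts hf (g m)
  span-tri g U co eqs nz sp m = go (suc m) m (ℕ.n<1+n m)
    where
    go : ∀ N m → m < N → Span n ts hf (g m)
    go (suc N) m (s≤s m≤N) = span-+ inv (U m) (⊝ inv) S (sp m)
      (span-Σ m (λ r σ → co m r ⊗ g r σ) (λ r r<m → span-scale (co m r) (g r) (go N r (ℕ.<-≤-trans r<m m≤N))))
      (All.map (λ {σ} e → sym (begin
        inv ⊗ U m σ ⊕ ⊝ inv ⊗ S σ                   ≡⟨ cong (λ z → inv ⊗ z ⊕ ⊝ inv ⊗ S σ) (trans e (Σ<-last m (λ r → co m r ⊗ g r σ))) ⟩
        inv ⊗ (S σ ⊕ co m m ⊗ g m σ) ⊕ ⊝ inv ⊗ S σ  ≡⟨ solve 4 (λ i s c g → i :* (s :+ c :* g) :+ (:- i) :* s := (i :* c) :* g) refl inv (S σ) (co m m) (g m σ) ⟩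
        (inv ⊗ co m m) ⊗ g m σ                       ≡⟨ cong (_⊗ g m σ) (ℚ.*-inverseˡ (co m m) {{ℚ.≢-nonZero (nz m)}}) ⟩
        1ℚ ⊗ g m σ                                   ≡⟨ 1⊗ (g m σ) ⟩
        g m σ ∎)) (eqs m))
      where
      inv : ℚ
      inv = ℚ.1/_ (co m m) {{ℚ.≢-nonZero (nz m)}}
      S : Word → ℚ
      S σ = Σ< m (λ r → co m r ⊗ g r σ)

  -- If U m depends on a permutation through a statistic, up to a common weight, and vanishes when
  -- the statistic exceeds m, then sorting by the statistic is the triangular expansion required by
  -- `span-tri`.
  span-tri-stat : ∀ (wt : Word → ℚ) (stat : Word → ℕ) (H : ℕ → ℕ → ℚ) (U : ℕ → Word → ℚ) →
    (∀ m → All (λ σ → U m σ ≡ H (stat σ) m ⊗ wt σ) (perms n)) → (∀ p m → m < p → H p m ≡ 0ℚ) → (∀ m → H m m ≢ 0ℚ) →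
    (∀ m → Span n ts hf (U m)) → ∀ r → Span n ts hf (λ σ → δ (stat σ) r ⊗ wt σ)
  span-tri-stat wt stat H U eqs below lead = span-tri (λ r σ → δ (stat σ) r ⊗ wt σ) U (λ m r → H r m)
    (λ m → All.map (λ {σ} e → trans e (sym (expand m (stat σ) (wt σ)))) (eqs m)) lead
    where
    expand : ∀ m p w → Σ< (suc m) (λ r → H r m ⊗ (δ p r ⊗ w)) ≡ H p m ⊗ w
    expand m p w with p ℕ.≤? m
    ... | yes p≤m = trans (Σ<-single (suc m) p {λ r → H r m ⊗ (δ p r ⊗ w)} (s≤s p≤m)
            (λ i i≢p → trans (cong (λ z → H i m ⊗ (z ⊗ w)) (δ-≢ p i (i≢p ∘ sym))) (trans (cong (H i m ⊗_) (0⊗ w)) (⊗0 (H i m)))))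
          (cong (H p m ⊗_) (trans (cong (_⊗ w) (δ-refl p)) (1⊗ w)))
    ... | no  p≰m = trans (Σ<-zero< (suc m) (λ i i≤m → trans (cong (λ z → H i m ⊗ (z ⊗ w)) (δ-≢ p i (λ p≡i → p≰m (subst (_≤ m) (sym p≡i) (s≤s⁻¹ i≤m)))))
            (trans (cong (H i m ⊗_) (0⊗ w)) (⊗0 (H i m))))) (sym (trans (cong (_⊗ w) (below p m (ℕ.≰⇒> p≰m))) (0⊗ w)))

  -- A function that depends on a permutation only through the statistic is a combination of class
  -- functions; its value on a class is taken from the first permutation found there.
  span-stat : ∀ (wt : Word → ℚ) (stat : Word → ℕ) N (f h : Word → ℚ) →
    (∀ r → r < N → Span n ts hf (λ σ → δ (stat σ) r ⊗ wt σ)) → All (λ σ → stat σ < N) (perms n) →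
    All (λ σ → f σ ≡ h σ ⊗ wt σ) (perms n) → (∀ σ τ → IsPerm n σ → IsPerm n τ → stat σ ≡ stat τ → h σ ≡ h τ) → Span n ts hf f
  span-stat wt stat N f h sp bd eqs dep = span-ext (span-Σ N (λ r σ → value r ⊗ (δ (stat σ) r ⊗ wt σ)) (λ r lt → span-scale (value r) (λ σ → δ (stat σ) r ⊗ wt σ) (sp r lt)))
    (All.zipWith (λ {σ} (e , lt , ip , mem) → trans e (sym (trans (Σ<-single N (stat σ) {λ r → value r ⊗ (δ (stat σ) r ⊗ wt σ)} lt
        (λ i i≢ → trans (cong (λ z → value i ⊗ (z ⊗ wt σ)) (δ-≢ (stat σ) i (i≢ ∘ sym))) (trans (cong (value i ⊗_) (0⊗ (wt σ))) (⊗0 (value i)))))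
        (cong₂ _⊗_ (found (perms-IsPerm n) mem ip) (trans (cong (_⊗ wt σ) (δ-refl (stat σ))) (1⊗ (wt σ)))))))
      (eqs , All.zipWith id (bd , All.zipWith id (perms-IsPerm n , All.tabulate id))))
    where
    first : ℕ → List Word → ℚ
    -- A default for classes without permutations; for the class of a listed permutation the search
    -- succeeds.
    first r []       = 0ℚ
    first r (τ ∷ τs) = if stat τ ≡ᵇ r then h τ else first r τs
    value : ℕ → ℚ
    value r = first r (perms n)
    found : ∀ {τs σ} → All (IsPerm n) τs → σ ∈ τs → IsPerm n σ → first (stat σ) τs ≡ h σ
    found {τ ∷ τs} {σ} (ipτ ∷ ips) mem ip with stat τ ≡ᵇ stat σ in eq
    ... | true  = dep τ σ ipτ ip (ℕ.≡ᵇ⇒≡ (stat τ) (stat σ) (subst T (sym eq) tt))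
    found {τ ∷ τs} {σ} (ipτ ∷ ips) (here refl) ip | false = ⊥-elim (subst T eq (ℕ.≡⇒≡ᵇ (stat τ) (stat τ) refl))
    found {τ ∷ τs} {σ} (ipτ ∷ ips) (there m)   ip | false = found ips m ip

-- Parity and ranges of indices.

mod2 : ∀ k → k % 2 ≡ (if isOdd k then 1 else 0)
mod2 zero          = refl
mod2 (suc zero)    = refl
mod2 (suc (suc k)) = trans (trans (cong (_% 2) (ℕ.+-comm 2 k)) (ℕ.[m+n]%n≡m%n k 2)) (trans (mod2 k)
  (cong (λ b → if b then 1 else 0) (sym (Bool.not-involutive (isOdd k)))))

mod2-isOdd : ∀ k n → k % 2 ≡ n % 2 → isOdd k ≡ isOdd n
mod2-isOdd k n eq with isOdd k | isOdd n | trans (sym (mod2 k)) (trans eq (mod2 n))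
... | true  | true  | _ = refl
... | false | false | _ = refl

isOdd-mod2 : ∀ k n → isOdd k ≡ isOdd n → k % 2 ≡ n % 2
isOdd-mod2 k n eq = trans (mod2 k) (trans (cong (λ b → if b then 1 else 0) eq) (sym (mod2 n)))

negOnePow-isOdd : ∀ k → negOnePow k ≡ (if isOdd k then ⊝ 1ℚ else 1ℚ)
negOnePow-isOdd zero    = refl
negOnePow-isOdd (suc k) with isOdd k | negOnePow-isOdd k
... | true  | eq = cong ⊝_ eq
... | false | eq = cong ⊝_ eq

negOnePow-opp : ∀ k n → isOdd k ≢ isOdd n → negOnePow k ≡ ⊝ negOnePow n
negOnePow-opp k n neq with isOdd k | isOdd n | negOnePow-isOdd k | negOnePow-isOdd n
... | true  | true  | _ | _ = ⊥-elim (neq refl)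
... | false | false | _ | _ = ⊥-elim (neq refl)
... | true  | false | a | b = trans a (cong ⊝_ (sym b))
... | false | true  | a | b = trans a (cong ⊝_ (sym b))

isOdd-double : ∀ a → isOdd (double a) ≡ false
isOdd-double zero    = refl
isOdd-double (suc a) = trans (Bool.not-involutive (isOdd (double a))) (isOdd-double a)

half : ℕ → ℕ
half zero          = 0
half (suc zero)    = 0
half (suc (suc j)) = suc (half j)

half-split : ∀ j → j ≡ double (half j) ⊎ j ≡ suc (double (half j))
half-split zero          = inj₁ refl
half-split (suc zero)    = inj₂ refl
half-split (suc (suc j)) with half-split j
... | inj₁ e = inj₁ (cong (suc ∘ suc) e)
... | inj₂ e = inj₂ (cong (suc ∘ suc) e)

∧-T : ∀ {a b} → a ≡ true → b ≡ true → T (a ∧ b)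
∧-T refl refl = tt

T-∧ˡ : ∀ a {b} → T (a ∧ b) → T a
T-∧ˡ true _ = tt

T-∧ʳ : ∀ a {b} → T (a ∧ b) → T b
T-∧ʳ true t = t

T⇒≡true : ∀ {b} → T b → b ≡ true
T⇒≡true {true} _ = refl

upTo-∈ : ∀ {k n} → k ≤ n → k ∈ upTo (suc n)
upTo-∈ k≤n = Mem.∈-applyUpTo⁺ id (s≤s k≤n)

K? : ∀ n k → Dec (T ((1 ≤ᵇ k) ∧ par k n))
K? n k = Bool.T? ((1 ≤ᵇ k) ∧ par k n)

U? : ∀ d n k → Dec (T ((k + d ≤ᵇ n) ∧ par k n))
U? d n k = Bool.T? ((k + d ≤ᵇ n) ∧ par k n)

rngK-∈ : ∀ {k n} → 1 ≤ k → k ≤ n → k % 2 ≡ n % 2 → k ∈ rngK n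
rngK-∈ {k} {n} 1≤k k≤n eq = Mem.∈-filter⁺ (K? n) (upTo-∈ k≤n)
  (∧-T (T⇒≡true (ℕ.≤⇒≤ᵇ 1≤k)) (T⇒≡true (ℕ.≡⇒≡ᵇ (k % 2) (n % 2) eq)))

rngUpTo-∈ : ∀ d {k n} → k + d ≤ n → k % 2 ≡ n % 2 → k ∈ rngUpTo d n
rngUpTo-∈ d {k} {n} le eq = Mem.∈-filter⁺ (U? d n) (upTo-∈ (ℕ.≤-trans (ℕ.m≤m+n k d) le))
  (∧-T (T⇒≡true (ℕ.≤⇒≤ᵇ le)) (T⇒≡true (ℕ.≡⇒≡ᵇ (k % 2) (n % 2) eq)))

rngK-All : ∀ n → All (λ k → 1 ≤ k × k ≤ n × k % 2 ≡ n % 2) (rngK n)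
rngK-All n = All.zipWith (λ {k} (t , le) → ℕ.≤ᵇ⇒≤ 1 k (T-∧ˡ (1 ≤ᵇ k) t) , le , ℕ.≡ᵇ⇒≡ (k % 2) (n % 2) (T-∧ʳ (1 ≤ᵇ k) t))
  (All.all-filter (K? n) (upTo (suc n)) , All.filter⁺ (K? n) (All.applyUpTo⁺₁ id (suc n) s≤s⁻¹))

rngUpTo-All : ∀ d n → All (λ k → k + d ≤ n × k % 2 ≡ n % 2) (rngUpTo d n)
rngUpTo-All d n = All.map (λ {k} t → ℕ.≤ᵇ⇒≤ (k + d) n (T-∧ˡ (k + d ≤ᵇ n) t) , ℕ.≡ᵇ⇒≡ (k % 2) (n % 2) (T-∧ʳ (k + d ≤ᵇ n) t))
  (All.all-filter (U? d n) (upTo (suc n)))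

rngK-inc : ∀ n → AllPairs _<_ (rngK n)
rngK-inc n = AllPairs.filter⁺ (K? n) (AllPairs.applyUpTo⁺₁ id (suc n) (λ i<j _ → i<j))

rngUpTo-inc : ∀ d n → AllPairs _<_ (rngUpTo d n)
rngUpTo-inc d n = AllPairs.filter⁺ (U? d n) (AllPairs.applyUpTo⁺₁ id (suc n) (λ i<j _ → i<j))

tagged-orth : ∀ n t ks → All (_≤ n) ks → AllPairs _<_ ks → AllPairs (Orthogonal n) (map (t ,_) ks)
tagged-orth n t []       _          _          = []
tagged-orth n t (k ∷ ks) (k≤n ∷ le) (k< ∷ inc) =
  All.map⁺ (All.zipWith (λ {l} (k<l , l≤n) → orth-≢ n t t k l k≤n l≤n (ℕ.<⇒≢ k<l)) (k< , le)) ∷ tagged-orth n t ks le inc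

cross-orth : ∀ n t u ks ls → Annihilate t u → All (_≤ n) ks → All (_≤ n) ls →
             All (λ e → All (Orthogonal n e) (map (u ,_) ls)) (map (t ,_) ks)
cross-orth n t u ks ls ann le le′ = All.map⁺ (All.map (λ {k} k≤n → All.map⁺ (All.map (λ {l} l≤n → orth-tag n t u k l k≤n l≤n ann) le′)) le)

rngK-≤ : ∀ n → All (_≤ n) (rngK n)
rngK-≤ n = All.map (λ (_ , le , _) → le) (rngK-All n)

rngUpTo-≤ : ∀ d n → All (_≤ n) (rngUpTo d n)
rngUpTo-≤ d n = All.map (λ {k} (le , _) → ℕ.≤-trans (ℕ.m≤m+n k d) le) (rngUpTo-All d n)

tsW tsWc tsC tsP tsPc : ℕ → List Entry
tsW  n = map (tA ,_) (rngK n) ++ map (tB ,_) (rngUpTo 4 n)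
tsWc n = map (tP ,_) (rngK n) ++ map (tD ,_) (rngUpTo 2 n)
tsC  n = map (tA ,_) (rngK n) ++ map (tB ,_) (rngUpTo 4 n) ++ map (tC ,_) (rngUpTo 2 n)
tsP  n = map (tM ,_) (rngK n)
tsPc n = map (tE ,_) (rngUpTo 0 n)

tsW-orth : ∀ n → AllPairs (Orthogonal n) (tsW n)
tsW-orth n = AllPairs.++⁺ (tagged-orth n tA (rngK n) (rngK-≤ n) (rngK-inc n)) (tagged-orth n tB (rngUpTo 4 n) (rngUpTo-≤ 4 n) (rngUpTo-inc 4 n))
  (cross-orth n tA tB (rngK n) (rngUpTo 4 n) A⊥B (rngK-≤ n) (rngUpTo-≤ 4 n))

tsWc-orth : ∀ n → AllPairs (Orthogonal n) (tsWc n)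
tsWc-orth n = AllPairs.++⁺ (tagged-orth n tP (rngK n) (rngK-≤ n) (rngK-inc n)) (tagged-orth n tD (rngUpTo 2 n) (rngUpTo-≤ 2 n) (rngUpTo-inc 2 n))
  (cross-orth n tP tD (rngK n) (rngUpTo 2 n) P⊥D (rngK-≤ n) (rngUpTo-≤ 2 n))

tsC-orth : ∀ n → AllPairs (Orthogonal n) (tsC n)
tsC-orth n = AllPairs.++⁺ (tagged-orth n tA (rngK n) (rngK-≤ n) (rngK-inc n))
  (AllPairs.++⁺ (tagged-orth n tB (rngUpTo 4 n) (rngUpTo-≤ 4 n) (rngUpTo-inc 4 n)) (tagged-orth n tC (rngUpTo 2 n) (rngUpTo-≤ 2 n) (rngUpTo-inc 2 n))
    (cross-orth n tB tC (rngUpTo 4 n) (rngUpTo 2 n) B⊥C (rngUpTo-≤ 4 n) (rngUpTo-≤ 2 n)))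
  (All.zipWith (λ (p , q) → All.++⁺ p q) (cross-orth n tA tB (rngK n) (rngUpTo 4 n) A⊥B (rngK-≤ n) (rngUpTo-≤ 4 n)
    , cross-orth n tA tC (rngK n) (rngUpTo 2 n) A⊥C (rngK-≤ n) (rngUpTo-≤ 2 n)))

tag-≤ : ∀ {n t ks} → All (_≤ n) ks → All (λ (e : Entry) → proj₂ e ≤ n) (map (t ,_) ks)
tag-≤ le = All.map⁺ le

cases₂ : ∀ (Q : Word → Set) n → 2 ≤ n → (∀ x y w → length (x ∷ y ∷ w) ≡ n → Q (x ∷ y ∷ w)) → ∀ σ → length σ ≡ n → Q σ
cases₂ Q n le q []          refl with le
... | ()
cases₂ Q n le q (x ∷ [])    refl with le
... | s≤s ()
cases₂ Q n le q (x ∷ y ∷ w) len = q x y w len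

-- Components as functions of run and peak statistics.

module Families (n : ℕ) (2≤n : 2 ≤ n) where

  perms-∀ : ∀ {Q : Word → Set} → (∀ σ → IsPerm n σ → Q σ) → All Q (perms n)
  perms-∀ q = All.map (λ {σ} ip → q σ ip) (perms-IsPerm n)

  perms-len : ∀ {Q : Word → Set} → (∀ σ → length σ ≡ n → Q σ) → All Q (perms n)
  perms-len q = All.map (λ {σ} len → q σ len) (perms-length n)

  L₄-zero : ∀ c y → (∀ p s → y p s ≡ 0ℚ) → L₄ c y ≡ 0ℚ
  L₄-zero c y z = trans (L₄-cong c z) (trans (cong₂ _⊕_ (cong₂ _⊕_ (⊗0 (c false true)) (⊗0 (c false false))) (cong₂ _⊕_ (⊗0 (c true true)) (⊗0 (c true false)))) refl)

  el-parity : ∀ p s k σ → length σ ≡ n → k ≤ n → isOdd k ≢ isOdd n → el p s k σ ≡ 0ℚ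
  el-parity true  s k σ refl k≤n neq = NC.J-parity s k σ k≤n (negOnePow-opp k (length σ) neq)
  el-parity false s k σ refl k≤n neq = NC.I-parity s k σ k≤n (negOnePow-opp k (length σ) neq)

  -- Expansions of V_m involve all k up to n. The indices left out of a basis, of wrong parity or at
  -- an end of the range, are shown to give zero functions in degree n.
  Has : List Entry → Tag → Set
  Has ts t = ∀ k → k ≤ n → Span n ts fun (fun (t , k))

  has-parity : ∀ {ts} t k → k ≤ n → isOdd k ≢ isOdd n → Span n ts fun (fun (t , k))
  has-parity t k k≤n neq = span-0 (perms-len (λ σ len → L₄-zero (coef t) (λ p s → el p s k σ) (λ p s → el-parity p s k σ len k≤n neq)))

  is-member : ∀ {ts} t k → (t , k) ∈ ts → Span n ts fun (fun (t , k))
  is-member t k mem = span-g (t , k) mem (perms-len (λ σ _ → refl))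

  by-parity : ∀ {ts} t k → k ≤ n → (k % 2 ≡ n % 2 → Span n ts fun (fun (t , k))) → Span n ts fun (fun (t , k))
  by-parity t k k≤n sp with isOdd k Bool.≟ isOdd n
  ... | yes eq  = sp (isOdd-mod2 k n eq)
  ... | no  neq = has-parity t k k≤n neq

  zero-I : ∀ σ → length σ ≡ n → ∀ c → c true true ≡ 0ℚ → c true false ≡ 0ℚ → comb c 0 σ ≡ 0ℚ
  zero-I σ len c z z′ = cases₂ (λ σ → comb c 0 σ ≡ 0ℚ) n 2≤n (λ x y w _ → trans (cong₂ _⊕_
      (cong₂ (λ a b → c false true ⊗ a ⊕ c false false ⊗ b) (NC-I₀ true x (y ∷ w)) (NC-I₀ false x (y ∷ w)))
      (cong₂ (λ a b → a ⊗ NC.J true 0 (x ∷ y ∷ w) ⊕ b ⊗ NC.J false 0 (x ∷ y ∷ w)) z z′))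
    (solve 4 (λ a b c d → (a :* con 0ℚ :+ b :* con 0ℚ) :+ (con 0ℚ :* c :+ con 0ℚ :* d) := con 0ℚ) refl
      (c false true) (c false false) (NC.J true 0 (x ∷ y ∷ w)) (NC.J false 0 (x ∷ y ∷ w)))) σ len

  has-rngK : ∀ {ts} t → (∀ k → k ∈ rngK n → (t , k) ∈ ts) → coef t true true ≡ 0ℚ → coef t true false ≡ 0ℚ → Has ts t
  has-rngK t mem z z′ zero    k≤n = span-0 (perms-len (λ σ len → zero-I σ len (coef t) z z′))
  has-rngK t mem z z′ (suc k) k≤n = by-parity t (suc k) k≤n (λ eq → is-member t (suc k) (mem (suc k) (rngK-∈ (s≤s z≤n) k≤n eq)))

  has-E : Has (tsPc n) tE
  has-E k k≤n = by-parity tE k k≤n (λ eq → is-member tE k (Mem.∈-map⁺ (tE ,_) (rngUpTo-∈ 0 (subst (_≤ n) (sym (ℕ.+-identityʳ k)) k≤n) eq)))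

  top-zero : ∀ t → (∀ w → fun (t , length w) w ≡ 0ℚ) → ∀ {ts} → Span n ts fun (fun (t , n))
  top-zero t z = span-0 (perms-len (λ { σ refl → z σ }))

  has-rng2 : ∀ {ts} t → (∀ k → k ∈ rngUpTo 2 n → (t , k) ∈ ts) → (∀ w → fun (t , length w) w ≡ 0ℚ) → Has ts t
  has-rng2 {ts} t mem z k k≤n = by-parity t k k≤n (λ eq → go (n ∸ k) (ℕ.m+[n∸m]≡n k≤n) eq)
    where
    go : ∀ d → k + d ≡ n → k % 2 ≡ n % 2 → Span n ts fun (fun (t , k))
    go zero          e eq = subst (λ z → Span n ts fun (fun (t , z))) (sym (trans (sym (ℕ.+-identityʳ k)) e)) (top-zero t z)
    go (suc zero)    e eq = ⊥-elim (Bool.not-¬ {isOdd k} refl (trans (mod2-isOdd k n eq) (cong isOdd (trans (sym e) (ℕ.+-comm k 1)))))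
    go (suc (suc d)) e eq = is-member t k (mem k (rngUpTo-∈ 2 (subst (k + 2 ≤_) e (ℕ.+-monoʳ-≤ k (s≤s (s≤s z≤n)))) eq))

  -- For n - k equal to 0 or 2 the component vanishes by `tB-top` and `tB-second`, for 1 or 3 by
  -- parity, and from 4 on the index belongs to the range.
  has-B : ∀ {ts} → (∀ k → k ∈ rngUpTo 4 n → (tB , k) ∈ ts) → Has ts tB
  has-B {ts} mem k k≤n = by-parity tB k k≤n (λ eq → go (n ∸ k) (ℕ.m+[n∸m]≡n k≤n) eq)
    where
    odd-⊥ : ∀ c → k + suc (double c) ≡ n → k % 2 ≡ n % 2 → ⊥
    odd-⊥ c e eq = Bool.not-¬ {isOdd k} refl (trans (mod2-isOdd k n eq) (trans (cong isOdd (trans (sym e) (ℕ.+-suc k (double c)))) (cong not (even c))))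
      where
      even : ∀ c → isOdd (k + double c) ≡ isOdd k
      even zero    = cong isOdd (ℕ.+-identityʳ k)
      even (suc c) = trans (cong isOdd (trans (ℕ.+-suc k (suc (double c))) (cong suc (ℕ.+-suc k (double c))))) (trans (Bool.not-involutive _) (even c))
    go : ∀ d → k + d ≡ n → k % 2 ≡ n % 2 → Span n ts fun (fun (tB , k))
    go zero                      e eq = subst (λ z → Span n ts fun (fun (tB , z))) (sym (trans (sym (ℕ.+-identityʳ k)) e)) (top-zero tB tB-top)
    go (suc zero)                e eq = ⊥-elim (odd-⊥ 0 e eq)
    go (suc (suc zero))          e eq = span-0 (perms-len (cases₂ (λ σ → fun (tB , k) σ ≡ 0ℚ) n 2≤n (λ x y w len →
      subst (λ z → fun (tB , z) (x ∷ y ∷ w) ≡ 0ℚ) (ℕ.suc-injective (ℕ.suc-injective (trans len (trans (sym e) (ℕ.+-comm k 2))))) (tB-second x y w))))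
    go (suc (suc (suc zero)))    e eq = ⊥-elim (odd-⊥ 1 e eq)
    go (suc (suc (suc (suc d)))) e eq = is-member tB k (mem k (rngUpTo-∈ 4 (subst (k + 4 ≤_) e (ℕ.+-monoʳ-≤ k (s≤s (s≤s (s≤s (s≤s z≤n)))))) eq))

  Vac : ℚ → ℚ → ℕ → Word → ℚ
  Vac a c m σ = a ⊗ Vm true σ m ⊕ c ⊗ Vm false σ m

  elac : ℚ → ℚ → Bool → ℕ → Word → ℚ
  elac a c p k σ = a ⊗ el p true k σ ⊕ c ⊗ el p false k σ

  Vac-expand : ∀ a c p m σ → length σ ≡ n → Vac a c (num p m) σ ≡ Σ< (suc n) (λ k → pow₁ (nat (num p m)) k ⊗ elac a c p k σ)
  Vac-expand a c p m σ refl = begin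
    a ⊗ Vm true σ (num p m) ⊕ c ⊗ Vm false σ (num p m)
      ≡⟨ cong₂ (λ x y → a ⊗ x ⊕ c ⊗ y) (sym (el-gen p true m σ)) (sym (el-gen p false m σ)) ⟩
    a ⊗ Σ< (suc n) (λ k → q k ⊗ el p true k σ) ⊕ c ⊗ Σ< (suc n) (λ k → q k ⊗ el p false k σ)
      ≡⟨ cong₂ _⊕_ (sym (Σ<-*ˡ (suc n) a (λ k → q k ⊗ el p true k σ))) (sym (Σ<-*ˡ (suc n) c (λ k → q k ⊗ el p false k σ))) ⟩
    Σ< (suc n) (λ k → a ⊗ (q k ⊗ el p true k σ)) ⊕ Σ< (suc n) (λ k → c ⊗ (q k ⊗ el p false k σ))
      ≡⟨ sym (Σ<-⊕ (suc n) (λ k → a ⊗ (q k ⊗ el p true k σ)) (λ k → c ⊗ (q k ⊗ el p false k σ))) ⟩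
    Σ< (suc n) (λ k → a ⊗ (q k ⊗ el p true k σ) ⊕ c ⊗ (q k ⊗ el p false k σ))
      ≡⟨ Σ<-cong (suc n) (λ k → solve 5 (λ a c q x y → a :* (q :* x) :+ c :* (q :* y) := q :* (a :* x :+ c :* y)) refl a c (q k) (el p true k σ) (el p false k σ)) ⟩
    Σ< (suc n) (λ k → q k ⊗ elac a c p k σ) ∎
    where
    q : ℕ → ℚ
    q = pow₁ (nat (num p m))

  span-V : ∀ {ts} a c p → (∀ k → k ≤ n → Span n ts fun (elac a c p k)) → ∀ m → Span n ts fun (Vac a c (num p m))
  span-V a c p sp m = span-ext (span-Σ (suc n) (λ k σ → pow₁ (nat (num p m)) k ⊗ elac a c p k σ)
    (λ k lt → span-scale (pow₁ (nat (num p m)) k) (elac a c p k) (sp k (s≤s⁻¹ lt)))) (perms-len (λ σ len → Vac-expand a c p m σ len))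

  -- The converse use of interpolation: when V_m takes the same values at σ and τ for all m of one
  -- parity, so does every component.
  elac-dep : ∀ a c p σ τ → length σ ≡ n → length τ ≡ n → (∀ m → Vac a c (num p m) σ ≡ Vac a c (num p m) τ) → ∀ k → k ≤ n → elac a c p k σ ≡ elac a c p k τ
  elac-dep a c p σ τ lσ lτ eq k k≤n = interpolate (suc n) (λ k → elac a c p k σ) (λ k → elac a c p k τ) (λ m → nat (num p m)) (num-inj p)
    (λ m → trans (sym (Vac-expand a c p m σ lσ)) (trans (eq m) (Vac-expand a c p m τ lτ))) k (s≤s k≤n)

  adj : ∀ {σ} → IsPerm n σ → Adj σ
  adj {σ} (_ , _ , d) = distinct⇒Adj σ d

  first≢0 : ∀ {x w} → IsPerm n (x ∷ w) → 0 ≢ x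
  first≢0 (_ , mem ∷ _ , _) refl = lem n mem
    where
    lem : ∀ n → 0 ∈ from1 n → ⊥
    lem n m with Mem.∈-map⁻ suc m
    ... | _ , _ , ()

  Vm-cons : ∀ s x w m → length (x ∷ w) ≡ n → Vm s (x ∷ w) m ≡ G n (chg s x w) m ⊕ G n (suc (chg s x w)) m
  Vm-cons s x w m refl = Vm-G s x w m

  isPerm₂ : ∀ {Q : Word → Set} → (∀ x y w → IsPerm n (x ∷ y ∷ w) → Q (x ∷ y ∷ w)) → ∀ σ → IsPerm n σ → Q σ
  isPerm₂ {Q} q σ ip = cases₂ (λ σ → IsPerm n σ → Q σ) n 2≤n (λ x y w _ → q x y w) σ (proj₁ ip) ip

  pick : ∀ {x y z : ℚ} → y ≡ 0ℚ → x ≡ z → x ⊕ y ≡ z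
  pick {x} e e′ = trans (cong (x ⊕_) e) (trans (⊕0 x) e′)

  pickʳ : ∀ {x y z : ℚ} → x ≡ 0ℚ → y ≡ z → x ⊕ y ≡ z
  pickʳ {x} {y} e e′ = trans (cong (_⊕ y) e) (trans (0⊕ y) e′)

  -- With initial sign - there are 2p or 2p + 1 changes for p peaks. At an even number of blocks
  -- only odd indices of G survive, and 2p + 1 is the one that occurs in both cases.
  Vm-peaks : ∀ m σ → IsPerm n σ → Vm false σ (double m) ≡ G n (suc (double (peaks σ))) (double m)
  Vm-peaks m = isPerm₂ (λ x y w ip → trans (Vm-cons false x (y ∷ w) (double m) (proj₁ ip)) (go (chg false x (y ∷ w)) (peaks (x ∷ y ∷ w)) (peaks-chg⁻ x y w (adj ip))))
    where
    go : ∀ b p → PeakRel false b p → G n b (double m) ⊕ G n (suc b) (double m) ≡ G n (suc (double p)) (double m)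
    go .(double p)       p (inj₁ refl) = pickʳ (G-even n (double p) (double m) (trans (isOdd-double m) (sym (isOdd-double p)))) refl
    go .(suc (double p)) p (inj₂ refl) = pick (G-even n (double (suc p)) (double m) (trans (isOdd-double m) (sym (isOdd-double (suc p))))) refl

  -- The letter 0 in front supplies the initial ascent, giving 2p or 2p - 1 changes for p left
  -- peaks. At an odd number of blocks the surviving index is 2p.
  Vm-lpeaks : ∀ m σ → IsPerm n σ → Vm true σ (suc (double m)) ≡ G n (double (peaks (0 ∷ σ))) (suc (double m))
  Vm-lpeaks m = isPerm₂ (λ x y w ip → trans (Vm-cons true x (y ∷ w) (suc (double m)) (proj₁ ip))
    (go (chg true x (y ∷ w)) (peaks (0 ∷ x ∷ y ∷ w)) (peaks-chg 0 x (y ∷ w) (adj₂ (first≢0 ip) (adj ip)))))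
    where
    go : ∀ b p → PeakRel true b p → G n b (suc (double m)) ⊕ G n (suc b) (suc (double m)) ≡ G n (double p) (suc (double m))
    go .(double p) p (inj₁ refl) = pick (G-even n (suc (double p)) (suc (double m)) (cong not (trans (isOdd-double m) (sym (isOdd-double p))))) refl
    go b           p (inj₂ e)    = pickʳ (G-even n b (suc (double m)) (trans (cong not (isOdd-double m)) (sym (not-flip {isOdd b} (trans (cong isOdd e) (isOdd-double p))))))
      (cong (λ z → G n z (suc (double m))) e)

  Vm-lruns : ∀ m σ → IsPerm n σ → Vm true σ m ≡ G n (changes (0 ∷ σ)) m ⊕ G n (suc (changes (0 ∷ σ))) m
  Vm-lruns m = isPerm₂ (λ x y w ip → trans (Vm-cons true x (y ∷ w) m (proj₁ ip))
    (cong (λ z → G n z m ⊕ G n (suc z) m) (sym (changes-chg 0 x (y ∷ w) (adj₂ (first≢0 ip) (adj ip))))))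

  sg : Word → ℚ
  sg σ = if firstAsc σ then 1ℚ else ⊝ 1ℚ

  -- Half the sum of V_m^+ and V_m^-: one has j changes, the other j + 1, since exactly one initial
  -- sign agrees with the first step. `HC` is half the difference, whose sign depends on that step.
  HW : ℕ → ℕ → ℚ
  HW j m = ½ ⊗ ((G n j m ⊕ (G n (suc j) m ⊕ G n (suc j) m)) ⊕ G n (suc (suc j)) m)

  HC : ℕ → ℕ → ℚ
  HC j m = ½ ⊗ (G n j m ⊕ ⊝ G n (suc (suc j)) m)

  Vm-runs : ∀ m σ → IsPerm n σ → Vac ½ ½ m σ ≡ HW (changes σ) m × Vac ½ (⊝ ½) m σ ≡ HC (changes σ) m ⊗ sg σ
  Vm-runs m = isPerm₂ (λ x y w ip → go x y w ip (up x y) refl)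
    where
    go : ∀ x y w → IsPerm n (x ∷ y ∷ w) → ∀ u → up x y ≡ u → Vac ½ ½ m (x ∷ y ∷ w) ≡ HW (changes (x ∷ y ∷ w)) m × Vac ½ (⊝ ½) m (x ∷ y ∷ w) ≡ HC (changes (x ∷ y ∷ w)) m ⊗ sg (x ∷ y ∷ w)
    go x y w ip u eq = concl u (adj ip) refl (V true) (V false)
      where
      j : ℕ
      j = chg u y w
      V : ∀ s → Vm s (x ∷ y ∷ w) m ≡ G n (differ s u + j) m ⊕ G n (suc (differ s u + j)) m
      V s = trans (Vm-cons s x (y ∷ w) m (proj₁ ip)) (cong (λ z → G n (differ s z + chg z y w) m ⊕ G n (suc (differ s z + chg z y w)) m) eq)
      concl : ∀ u′ → Adj (x ∷ y ∷ w) → u ≡ u′ → Vm true (x ∷ y ∷ w) m ≡ G n (differ true u + j) m ⊕ G n (suc (differ true u + j)) m →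
        Vm false (x ∷ y ∷ w) m ≡ G n (differ false u + j) m ⊕ G n (suc (differ false u + j)) m →
        Vac ½ ½ m (x ∷ y ∷ w) ≡ HW (changes (x ∷ y ∷ w)) m × Vac ½ (⊝ ½) m (x ∷ y ∷ w) ≡ HC (changes (x ∷ y ∷ w)) m ⊗ sg (x ∷ y ∷ w)
      concl true a@(adj₂ x≢y _) refl e⁺ e⁻ =
          trans (cong₂ (λ x y → ½ ⊗ x ⊕ ½ ⊗ y) e⁺ e⁻) (trans (solve 3 (λ a b c → con ½ :* (a :+ b) :+ con ½ :* (b :+ c) := con ½ :* ((a :+ (b :+ b)) :+ c)) refl (G n j m) (G n (suc j) m) (G n (suc (suc j)) m)) (cong (λ z → HW z m) (sym ch)))
        , trans (cong₂ (λ x y → ½ ⊗ x ⊕ ⊝ ½ ⊗ y) e⁺ e⁻) (trans (solve 3 (λ a b c → con ½ :* (a :+ b) :+ (:- con ½) :* (b :+ c) := (con ½ :* (a :+ :- c)) :* con 1ℚ) refl (G n j m) (G n (suc j) m) (G n (suc (suc j)) m))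
            (cong₂ (λ z b → HC z m ⊗ (if b then 1ℚ else ⊝ 1ℚ)) (sym ch) (sym (trans (<ᵇ-up x y x≢y) eq))))
        where
        ch : changes (x ∷ y ∷ w) ≡ j
        ch = trans (changes-chg x y w a) (cong (λ z → chg z y w) eq)
      concl false a@(adj₂ x≢y _) refl e⁺ e⁻ =
          trans (cong₂ (λ x y → ½ ⊗ x ⊕ ½ ⊗ y) e⁺ e⁻) (trans (solve 3 (λ a b c → con ½ :* (b :+ c) :+ con ½ :* (a :+ b) := con ½ :* ((a :+ (b :+ b)) :+ c)) refl (G n j m) (G n (suc j) m) (G n (suc (suc j)) m)) (cong (λ z → HW z m) (sym ch)))
        , trans (cong₂ (λ x y → ½ ⊗ x ⊕ ⊝ ½ ⊗ y) e⁺ e⁻) (trans (solve 3 (λ a b c → con ½ :* (b :+ c) :+ (:- con ½) :* (a :+ b) := (con ½ :* (a :+ :- c)) :* (:- con 1ℚ)) refl (G n j m) (G n (suc j) m) (G n (suc (suc j)) m))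
            (cong₂ (λ z b → HC z m ⊗ (if b then 1ℚ else ⊝ 1ℚ)) (sym ch) (sym (trans (<ᵇ-up x y x≢y) eq))))
        where
        ch : changes (x ∷ y ∷ w) ≡ j
        ch = trans (changes-chg x y w a) (cong (λ z → chg z y w) eq)

-- The bases of the five algebras.

double-mono : ∀ {a b} → a ≤ b → double a ≤ double b
double-mono z≤n     = z≤n
double-mono (s≤s p) = s≤s (s≤s (double-mono p))

num-split : ∀ M → Σ Bool λ p → Σ ℕ λ m → M ≡ num p m
num-split M with half-split M
... | inj₁ e = false , half M , e
... | inj₂ e = true  , half M , e

δ-double : ∀ b a → δ (double b) (double a) ≡ δ b a
δ-double zero    zero    = refl
δ-double zero    (suc a) = refl
δ-double (suc b) zero    = refl
δ-double (suc b) (suc a) = δ-double b a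

δ-odd-even : ∀ b a → δ (suc (double b)) (double a) ≡ 0ℚ
δ-odd-even b zero          = refl
δ-odd-even zero (suc a)    = refl
δ-odd-even (suc b) (suc a) = δ-odd-even b a

𝟙-split : ∀ a b → 𝟙 (a ∧ b) ⊕ 𝟙 (a ∧ not b) ≡ 𝟙 a
𝟙-split true  true  = refl
𝟙-split true  false = refl
𝟙-split false b     = refl

½⊗≢0 : ∀ x → x ≢ 0ℚ → ½ ⊗ x ≢ 0ℚ
½⊗≢0 x x≢0 eq = x≢0 (⊗-cancel-0 ½ x (λ ()) eq)

GenC : Set
GenC = ℕ ⊎ (ℕ × Bool)

genC : ℕ → ℕ → List GenC
genC n j = if j % 2 ≡ᵇ 0 then inj₁ j ∷ [] else inj₂ (j , true) ∷ inj₂ (j , false) ∷ []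

indexC : ℕ → List GenC
indexC n = concatMap (genC n) (upTo (suc n))

eltC : ℕ → GenC → GA
eltC n (inj₁ j)           = W n j
eltC n (inj₂ (j , true))  = Wp n j
eltC n (inj₂ (j , false)) = Wm n j

indexC-gens : ∀ n → map (eltC n) (indexC n) ≡ gensC n
indexC-gens n = go (upTo (suc n))
  where
  go : ∀ js → map (eltC n) (concatMap (genC n) js) ≡ concatMap (λ j → if j % 2 ≡ᵇ 0 then W n j ∷ [] else Wp n j ∷ Wm n j ∷ []) js
  go []       = refl
  go (j ∷ js) = trans (L.map-++ (eltC n) (genC n j) (concatMap (genC n) js)) (cong₂ _++_ (one (j % 2 ≡ᵇ 0)) (go js))
    where
    one : ∀ b → map (eltC n) (if b then inj₁ j ∷ [] else inj₂ (j , true) ∷ inj₂ (j , false) ∷ []) ≡ (if b then W n j ∷ [] else Wp n j ∷ Wm n j ∷ [])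
    one true  = refl
    one false = refl

∈-concatMap : ∀ {A B : Set} (k : A → List B) {j js x} → j ∈ js → x ∈ k j → x ∈ concatMap k js
∈-concatMap k {js = j ∷ js} (here refl) x∈ = Mem.∈-++⁺ˡ x∈
∈-concatMap k {js = i ∷ js} (there j∈)  x∈ = Mem.∈-++⁺ʳ (k i) (∈-concatMap k j∈ x∈)

mod2≡ᵇ0 : ∀ j → (j % 2 ≡ᵇ 0) ≡ not (isOdd j)
mod2≡ᵇ0 j with isOdd j | mod2 j
... | true  | e = cong (_≡ᵇ 0) e
... | false | e = cong (_≡ᵇ 0) e

Rep-W : ∀ n r → Rep n (W n r) (λ σ → δ (suc (changes σ)) r)
Rep-W n r g = begin
  ⟪ Wp n r ++ Wm n r , g ⟫
    ≡⟨ pair-++ (Wp n r) (Wm n r) g ⟩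
  ⟪ Wp n r , g ⟫ ⊕ ⟪ Wm n r , g ⟫
    ≡⟨ cong₂ _⊕_ (Rep-sumPerms n (λ σ → (runs σ ≡ᵇ r) ∧ firstAsc σ) g) (Rep-sumPerms n (λ σ → (runs σ ≡ᵇ r) ∧ not (firstAsc σ)) g) ⟩
  ∑ₚ n (λ σ → 𝟙 ((runs σ ≡ᵇ r) ∧ firstAsc σ)) g ⊕ ∑ₚ n (λ σ → 𝟙 ((runs σ ≡ᵇ r) ∧ not (firstAsc σ))) g
    ≡⟨ sym (∑-⊕ (perms n) (λ σ → 𝟙 ((runs σ ≡ᵇ r) ∧ firstAsc σ) ⊗ g σ) (λ σ → 𝟙 ((runs σ ≡ᵇ r) ∧ not (firstAsc σ)) ⊗ g σ)) ⟩
  ∑ (perms n) (λ σ → 𝟙 ((runs σ ≡ᵇ r) ∧ firstAsc σ) ⊗ g σ ⊕ 𝟙 ((runs σ ≡ᵇ r) ∧ not (firstAsc σ)) ⊗ g σ)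
    ≡⟨ ∑-cong (perms n) (λ σ → trans (sym (ℚ.*-distribʳ-+ (g σ) (𝟙 ((runs σ ≡ᵇ r) ∧ firstAsc σ)) (𝟙 ((runs σ ≡ᵇ r) ∧ not (firstAsc σ)))))
         (cong (_⊗ g σ) (𝟙-split (runs σ ≡ᵇ r) (firstAsc σ)))) ⟩
  ∑ₚ n (λ σ → δ (suc (changes σ)) r) g ∎

funC : GenC → Word → ℚ
funC (inj₁ j)           σ = δ (suc (changes σ)) j
funC (inj₂ (j , true))  σ = 𝟙 ((runs σ ≡ᵇ j) ∧ firstAsc σ)
funC (inj₂ (j , false)) σ = 𝟙 ((runs σ ≡ᵇ j) ∧ not (firstAsc σ))

Rep-C : ∀ n t → Rep n (eltC n t) (funC t)
Rep-C n (inj₁ j)           = Rep-W n j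
Rep-C n (inj₂ (j , true))  = Rep-sumPerms n (λ σ → (runs σ ≡ᵇ j) ∧ firstAsc σ)
Rep-C n (inj₂ (j , false)) = Rep-sumPerms n (λ σ → (runs σ ≡ᵇ j) ∧ not (firstAsc σ))

module Bases (n : ℕ) (2≤n : 2 ≤ n) where
  open Families n 2≤n

  wt₁ : Word → ℚ
  wt₁ _ = 1ℚ

  NonZeroAt : List Entry → Set
  NonZeroAt ts = All (λ e → fun e (from1 n) ≢ 0ℚ) ts

  elac-M : ∀ k σ → elac 0ℚ 1ℚ false k σ ≡ fun (tM , k) σ
  elac-M k σ = solve 4 (λ a b c d → con 0ℚ :* a :+ con 1ℚ :* b := (con 0ℚ :* a :+ con 1ℚ :* b) :+ (con 0ℚ :* c :+ con 0ℚ :* d)) refl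
    (NC.I true k σ) (NC.I false k σ) (NC.J true k σ) (NC.J false k σ)

  elac-E : ∀ k σ → elac 1ℚ 0ℚ true k σ ≡ fun (tE , k) σ
  elac-E k σ = solve 4 (λ a b c d → con 1ℚ :* c :+ con 0ℚ :* d := (con 0ℚ :* a :+ con 0ℚ :* b) :+ (con 1ℚ :* c :+ con 0ℚ :* d)) refl
    (NC.I true k σ) (NC.I false k σ) (NC.J true k σ) (NC.J false k σ)

  elac-P : ∀ k σ → elac 1ℚ 0ℚ false k σ ≡ fun (tP , k) σ
  elac-P k σ = solve 4 (λ a b c d → con 1ℚ :* a :+ con 0ℚ :* b := (con 1ℚ :* a :+ con 0ℚ :* b) :+ (con 0ℚ :* c :+ con 0ℚ :* d)) refl
    (NC.I true k σ) (NC.I false k σ) (NC.J true k σ) (NC.J false k σ)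

  elac-DP : ∀ k σ → elac 1ℚ 0ℚ true k σ ≡ 1ℚ ⊗ fun (tD , k) σ ⊕ 1ℚ ⊗ fun (tP , k) σ
  elac-DP k σ = solve 4 (λ a b c d → con 1ℚ :* c :+ con 0ℚ :* d := con 1ℚ :* ((:- con 1ℚ :* a :+ con 0ℚ :* b) :+ (con 1ℚ :* c :+ con 0ℚ :* d))
      :+ con 1ℚ :* ((con 1ℚ :* a :+ con 0ℚ :* b) :+ (con 0ℚ :* c :+ con 0ℚ :* d))) refl
    (NC.I true k σ) (NC.I false k σ) (NC.J true k σ) (NC.J false k σ)

  D-elac : ∀ k σ → fun (tD , k) σ ≡ elac 1ℚ 0ℚ true k σ ⊕ ⊝ 1ℚ ⊗ elac 1ℚ 0ℚ false k σ
  D-elac k σ = solve 4 (λ a b c d → (:- con 1ℚ :* a :+ con 0ℚ :* b) :+ (con 1ℚ :* c :+ con 0ℚ :* d) :=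
      (con 1ℚ :* c :+ con 0ℚ :* d) :+ :- con 1ℚ :* (con 1ℚ :* a :+ con 0ℚ :* b)) refl
    (NC.I true k σ) (NC.I false k σ) (NC.J true k σ) (NC.J false k σ)

  elac-A : ∀ k σ → elac ½ ½ false k σ ≡ fun (tA , k) σ
  elac-A k σ = solve 4 (λ a b c d → con ½ :* a :+ con ½ :* b := (con ½ :* a :+ con ½ :* b) :+ (con 0ℚ :* c :+ con 0ℚ :* d)) refl
    (NC.I true k σ) (NC.I false k σ) (NC.J true k σ) (NC.J false k σ)

  elac-BA : ∀ k σ → elac ½ ½ true k σ ≡ 1ℚ ⊗ fun (tB , k) σ ⊕ 1ℚ ⊗ fun (tA , k) σ
  elac-BA k σ = solve 4 (λ a b c d → con ½ :* c :+ con ½ :* d := con 1ℚ :* ((:- con ½ :* a :+ :- con ½ :* b) :+ (con ½ :* c :+ con ½ :* d))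
      :+ con 1ℚ :* ((con ½ :* a :+ con ½ :* b) :+ (con 0ℚ :* c :+ con 0ℚ :* d))) refl
    (NC.I true k σ) (NC.I false k σ) (NC.J true k σ) (NC.J false k σ)

  B-elac : ∀ k σ → fun (tB , k) σ ≡ elac ½ ½ true k σ ⊕ ⊝ 1ℚ ⊗ elac ½ ½ false k σ
  B-elac k σ = solve 4 (λ a b c d → (:- con ½ :* a :+ :- con ½ :* b) :+ (con ½ :* c :+ con ½ :* d) :=
      (con ½ :* c :+ con ½ :* d) :+ :- con 1ℚ :* (con ½ :* a :+ con ½ :* b)) refl
    (NC.I true k σ) (NC.I false k σ) (NC.J true k σ) (NC.J false k σ)

  elac-C : ∀ k σ → elac ½ (⊝ ½) true k σ ≡ fun (tC , k) σ
  elac-C k σ = solve 4 (λ a b c d → con ½ :* c :+ (:- con ½) :* d := (con 0ℚ :* a :+ con 0ℚ :* b) :+ (con ½ :* c :+ (:- con ½) :* d)) refl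
    (NC.I true k σ) (NC.I false k σ) (NC.J true k σ) (NC.J false k σ)

  only⁺ : ∀ x y → 1ℚ ⊗ x ⊕ 0ℚ ⊗ y ≡ x
  only⁺ = solve 2 (λ x y → con 1ℚ :* x :+ con 0ℚ :* y := x) refl

  only⁻ : ∀ x y → 0ℚ ⊗ x ⊕ 1ℚ ⊗ y ≡ y
  only⁻ = solve 2 (λ x y → con 0ℚ :* x :+ con 1ℚ :* y := y) refl

  zero⁺ : ∀ x x′ {y y′} → y ≡ y′ → 0ℚ ⊗ x ⊕ 1ℚ ⊗ y ≡ 0ℚ ⊗ x′ ⊕ 1ℚ ⊗ y′
  zero⁺ x x′ {y} {y′} e = trans (only⁻ x y) (trans e (sym (only⁻ x′ y′)))

  zero⁻ : ∀ y y′ {x x′} → x ≡ x′ → 1ℚ ⊗ x ⊕ 0ℚ ⊗ y ≡ 1ℚ ⊗ x′ ⊕ 0ℚ ⊗ y′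
  zero⁻ y y′ {x} {x′} e = trans (only⁺ x y) (trans e (sym (only⁺ x′ y′)))

  span-dep : ∀ {I : Set} {ts : List I} {hf : I → Word → ℚ} (stat : Word → ℕ) N (f : Word → ℚ) →
    (∀ r → r < N → Span n ts hf (λ σ → δ (stat σ) r)) → (∀ σ → IsPerm n σ → stat σ < N) →
    (∀ σ τ → IsPerm n σ → IsPerm n τ → stat σ ≡ stat τ → f σ ≡ f τ) → Span n ts hf f
  span-dep stat N f sp bd dep = span-stat wt₁ stat N f f (λ r lt → span-ext (sp r lt) (perms-len (λ σ _ → ⊗1 (δ (stat σ) r))))
    (perms-∀ bd) (perms-len (λ σ _ → sym (⊗1 (f σ)))) dep

  span-classes : ∀ {I : Set} {ts : List I} {hf : I → Word → ℚ} (stat : Word → ℕ) (H : ℕ → ℕ → ℚ) (U : ℕ → Word → ℚ) →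
    (∀ m σ → IsPerm n σ → U m σ ≡ H (stat σ) m) → (∀ p m → m < p → H p m ≡ 0ℚ) → (∀ m → H m m ≢ 0ℚ) →
    (∀ m → Span n ts hf (U m)) → ∀ r → Span n ts hf (λ σ → δ (stat σ) r)
  span-classes stat H U eq below lead sp r = span-ext (span-tri-stat wt₁ stat H U (λ m → perms-∀ (λ σ ip → trans (eq m σ ip) (sym (⊗1 (H (stat σ) m))))) below lead sp r)
    (perms-len (λ σ _ → sym (⊗1 (δ (stat σ) r))))

  index-∈ : ∀ {r N} → r < N → r ∈ upTo N
  index-∈ lt = Mem.∈-applyUpTo⁺ id lt

  len-≤ : ∀ {x y w} → IsPerm n (x ∷ y ∷ w) → length w ≤ n
  len-≤ {w = w} (len , _) = subst (length w ≤_) len (ℕ.≤-trans (ℕ.n≤1+n _) (ℕ.n≤1+n _))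

  dep-M : ∀ k → k ≤ n → ∀ σ τ → IsPerm n σ → IsPerm n τ → peaks σ ≡ peaks τ → fun (tM , k) σ ≡ fun (tM , k) τ
  dep-M k k≤n σ τ ipσ ipτ e = trans (sym (elac-M k σ)) (trans (elac-dep 0ℚ 1ℚ false σ τ (proj₁ ipσ) (proj₁ ipτ)
    (λ m → zero⁺ (Vm true σ (double m)) (Vm true τ (double m)) (trans (Vm-peaks m σ ipσ) (trans (cong (λ p → G n (suc (double p)) (double m)) e) (sym (Vm-peaks m τ ipτ))))) k k≤n) (elac-M k τ))

  basis-P : NonZeroAt (tsP n) → OrthIdemBasis (map (Pk n) (upTo (suc n))) (map (elt n) (tsP n))
  basis-P nz = orthIdemBasis n (upTo (suc n)) (Pk n) (λ r σ → δ (peaks σ) r) (λ r → Rep-sumPerms n (λ σ → peaks σ ≡ᵇ r)) (tsP n)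
    (tag-≤ (rngK-≤ n)) (tagged-orth n tM (rngK n) (rngK-≤ n) (rngK-inc n)) nz
    (All.map⁺ (All.map (λ {k} k≤n → span-dep peaks (suc n) (fun (tM , k)) (λ r lt → span-g r (index-∈ lt) (perms-len (λ _ _ → refl)))
      (isPerm₂ (λ x y w ip → s≤s (ℕ.≤-trans (peaks-≤ x y w) (len-≤ ip)))) (dep-M k k≤n)) (rngK-≤ n)))
    -- The argument `suc m` puts the leading terms on the diagonal: with p peaks the first non-zero
    -- value occurs at 2p + 2 blocks.
    (All.universal (span-classes peaks (λ p m → G n (suc (double p)) (double (suc m))) (λ m → Vac 0ℚ 1ℚ (double (suc m)))
      (λ m σ ip → trans (only⁻ (Vm true σ (double (suc m))) (Vm false σ (double (suc m)))) (Vm-peaks (suc m) σ ip))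
      (λ p m m<p → G-below n (suc (double p)) (double (suc m)) (ℕ.m≤n⇒m≤1+n (double-mono m<p)))
      (λ m eq → 2^≢0 (suc (double m)) (trans (sym (G-lead n (suc (double m)))) eq))
      (λ m → span-V 0ℚ 1ℚ false (λ k k≤n → span-ext (has-rngK tM (λ k mem → Mem.∈-map⁺ (tM ,_) mem) refl refl k k≤n) (perms-len (λ σ _ → elac-M k σ))) (suc m))) (upTo (suc n)))

  lpeaks : Word → ℕ
  lpeaks σ = peaks (0 ∷ σ)

  dep-E : ∀ k → k ≤ n → ∀ σ τ → IsPerm n σ → IsPerm n τ → lpeaks σ ≡ lpeaks τ → fun (tE , k) σ ≡ fun (tE , k) τ
  dep-E k k≤n σ τ ipσ ipτ e = trans (sym (elac-E k σ)) (trans (elac-dep 1ℚ 0ℚ true σ τ (proj₁ ipσ) (proj₁ ipτ)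
    (λ m → zero⁻ (Vm false σ (suc (double m))) (Vm false τ (suc (double m))) (trans (Vm-lpeaks m σ ipσ) (trans (cong (λ p → G n (double p) (suc (double m))) e) (sym (Vm-lpeaks m τ ipτ))))) k k≤n) (elac-E k τ))

  basis-Pc : NonZeroAt (tsPc n) → OrthIdemBasis (map (Pc n) (upTo (suc n))) (map (elt n) (tsPc n))
  basis-Pc nz = orthIdemBasis n (upTo (suc n)) (Pc n) (λ r σ → δ (lpeaks σ) r) (λ r → Rep-sumPerms n (λ σ → peaks (0 ∷ σ) ≡ᵇ r)) (tsPc n)
    (tag-≤ (rngUpTo-≤ 0 n)) (tagged-orth n tE (rngUpTo 0 n) (rngUpTo-≤ 0 n) (rngUpTo-inc 0 n)) nz
    (All.map⁺ (All.map (λ {k} k≤n → span-dep lpeaks (suc n) (fun (tE , k)) (λ r lt → span-g r (index-∈ lt) (perms-len (λ _ _ → refl)))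
      (isPerm₂ (λ x y w ip → s≤s (ℕ.≤-trans (peaks-≤ 0 x (y ∷ w)) (subst (length (y ∷ w) ≤_) (proj₁ ip) (ℕ.n≤1+n _))))) (dep-E k k≤n)) (rngUpTo-≤ 0 n)))
    -- No shift here: with p left peaks the first non-zero value occurs at 2p + 1 blocks.
    (All.universal (span-classes lpeaks (λ p m → G n (double p) (suc (double m))) (λ m → Vac 1ℚ 0ℚ (suc (double m)))
      (λ m σ ip → trans (only⁺ (Vm true σ (suc (double m))) (Vm false σ (suc (double m)))) (Vm-lpeaks m σ ip))
      (λ p m m<p → G-below n (double p) (suc (double m)) (ℕ.≤-trans (ℕ.n≤1+n _) (double-mono m<p)))
      (λ m eq → 2^≢0 (double m) (trans (sym (G-lead n (double m))) eq))
      (λ m → span-V 1ℚ 0ℚ true (λ k k≤n → span-ext (has-E k k≤n) (perms-len (λ σ _ → elac-E k σ))) m)) (upTo (suc n)))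

  lchanges : Word → ℕ
  lchanges σ = changes (0 ∷ σ)

  dep-⁺ : ∀ p k → k ≤ n → ∀ σ τ → IsPerm n σ → IsPerm n τ → lchanges σ ≡ lchanges τ → elac 1ℚ 0ℚ p k σ ≡ elac 1ℚ 0ℚ p k τ
  dep-⁺ p k k≤n σ τ ipσ ipτ e = elac-dep 1ℚ 0ℚ p σ τ (proj₁ ipσ) (proj₁ ipτ)
    (λ m → zero⁻ (Vm false σ (num p m)) (Vm false τ (num p m)) (trans (Vm-lruns (num p m) σ ipσ) (trans (cong (λ j → G n j (num p m) ⊕ G n (suc j) (num p m)) e) (sym (Vm-lruns (num p m) τ ipτ))))) k k≤n

  span-anyV : ∀ {ts} a c → (∀ p k → k ≤ n → Span n ts fun (elac a c p k)) → ∀ M → Span n ts fun (Vac a c M)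
  span-anyV {ts} a c sp M with num-split M
  ... | p , m , eq = subst (λ z → Span n ts fun (Vac a c z)) (sym eq) (span-V a c p (sp p) m)

  -- Runs exceed changes by one; the generator with index 0 is the zero element.
  span-suc : ∀ {ts : List Entry} (stat : Word → ℕ) → (∀ r → Span n ts fun (λ σ → δ (stat σ) r)) → ∀ r → Span n ts fun (λ σ → δ (suc (stat σ)) r)
  span-suc stat sp zero    = span-0 (perms-len (λ _ _ → refl))
  span-suc stat sp (suc r) = sp r

  basis-Wc : NonZeroAt (tsWc n) → OrthIdemBasis (map (Wc n) (upTo (suc n))) (map (elt n) (tsWc n))
  basis-Wc nz = orthIdemBasis n (upTo (suc n)) (Wc n) (λ r σ → δ (suc (lchanges σ)) r) (λ r → Rep-sumPerms n (λ σ → runs (0 ∷ σ) ≡ᵇ r)) (tsWc n)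
    (All.++⁺ (tag-≤ (rngK-≤ n)) (tag-≤ (rngUpTo-≤ 2 n))) (tsWc-orth n) nz
    (All.++⁺
      (All.map⁺ (All.map (λ {k} k≤n → inGens (fun (tP , k)) (λ σ τ ipσ ipτ e → trans (sym (elac-P k σ)) (trans (dep-⁺ false k k≤n σ τ ipσ ipτ e) (elac-P k τ)))) (rngK-≤ n)))
      (All.map⁺ (All.map (λ {k} k≤n → inGens (fun (tD , k)) (λ σ τ ipσ ipτ e → trans (D-elac k σ) (trans
        (cong₂ (λ x y → x ⊕ ⊝ 1ℚ ⊗ y) (dep-⁺ true k k≤n σ τ ipσ ipτ e) (dep-⁺ false k k≤n σ τ ipσ ipτ e)) (sym (D-elac k τ))))) (rngUpTo-≤ 2 n))))
    (All.universal (span-suc lchanges (span-classes lchanges (λ j m → G n j (suc m) ⊕ G n (suc j) (suc m)) (λ m → Vac 1ℚ 0ℚ (suc m))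
      (λ m σ ip → trans (only⁺ (Vm true σ (suc m)) (Vm false σ (suc m))) (Vm-lruns (suc m) σ ip))
      (λ p m m<p → pick (G-below n (suc p) (suc m) (ℕ.m≤n⇒m≤1+n m<p)) (G-below n p (suc m) m<p))
      (λ m eq → 2^≢0 m (trans (sym (trans (pick (G-below n (suc m) (suc m) ℕ.≤-refl) refl) (G-lead n m))) eq))
      (λ m → span-anyV 1ℚ 0ℚ spans (suc m)))) (upTo (suc n)))
    where
    inGens : ∀ f → (∀ σ τ → IsPerm n σ → IsPerm n τ → lchanges σ ≡ lchanges τ → f σ ≡ f τ) → Span n (upTo (suc n)) (λ r σ → δ (suc (lchanges σ)) r) f
    inGens f = span-dep lchanges n f (λ r lt → span-g (suc r) (index-∈ (s≤s lt)) (perms-len (λ _ _ → refl)))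
      (isPerm₂ (λ x y w ip → subst (changes (0 ∷ x ∷ y ∷ w) <_) (proj₁ ip) (s≤s (changes-≤ 0 x (y ∷ w)))))
    hasP : Has (tsWc n) tP
    hasP = has-rngK tP (λ k mem → Mem.∈-++⁺ˡ (Mem.∈-map⁺ (tP ,_) mem)) refl refl
    hasD : Has (tsWc n) tD
    hasD = has-rng2 tD (λ k mem → Mem.∈-++⁺ʳ (map (tP ,_) (rngK n)) (Mem.∈-map⁺ (tD ,_) mem)) tD-top
    spans : ∀ p k → k ≤ n → Span n (tsWc n) fun (elac 1ℚ 0ℚ p k)
    spans false k k≤n = span-ext (hasP k k≤n) (perms-len (λ σ _ → elac-P k σ))
    spans true  k k≤n = span-+ 1ℚ (fun (tD , k)) 1ℚ (fun (tP , k)) (hasD k k≤n) (hasP k k≤n) (perms-len (λ σ _ → elac-DP k σ))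

  dep-½ : ∀ p k → k ≤ n → ∀ σ τ → IsPerm n σ → IsPerm n τ → changes σ ≡ changes τ → elac ½ ½ p k σ ≡ elac ½ ½ p k τ
  dep-½ p k k≤n σ τ ipσ ipτ e = elac-dep ½ ½ p σ τ (proj₁ ipσ) (proj₁ ipτ)
    (λ m → trans (proj₁ (Vm-runs (num p m) σ ipσ)) (trans (cong (λ j → HW j (num p m)) e) (sym (proj₁ (Vm-runs (num p m) τ ipτ))))) k k≤n

  dep-A : ∀ k → k ≤ n → ∀ σ τ → IsPerm n σ → IsPerm n τ → changes σ ≡ changes τ → fun (tA , k) σ ≡ fun (tA , k) τ
  dep-A k k≤n σ τ ipσ ipτ e = trans (sym (elac-A k σ)) (trans (dep-½ false k k≤n σ τ ipσ ipτ e) (elac-A k τ))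

  dep-B : ∀ k → k ≤ n → ∀ σ τ → IsPerm n σ → IsPerm n τ → changes σ ≡ changes τ → fun (tB , k) σ ≡ fun (tB , k) τ
  dep-B k k≤n σ τ ipσ ipτ e = trans (B-elac k σ) (trans (cong₂ (λ x y → x ⊕ ⊝ 1ℚ ⊗ y) (dep-½ true k k≤n σ τ ipσ ipτ e) (dep-½ false k k≤n σ τ ipσ ipτ e)) (sym (B-elac k τ)))

  changes-< : ∀ σ → IsPerm n σ → changes σ < n
  changes-< = isPerm₂ (λ x y w ip → subst (changes (x ∷ y ∷ w) <_) (proj₁ ip) (s≤s (ℕ.≤-trans (changes-≤ x y w) (ℕ.n≤1+n _))))

  -- The triangular system uses V_m for all m. Even m need ½(I^+ + I^-), which is `tA`; odd m need
  -- ½(J^+ + J^-), the sum of `tA` and `tB`.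
  span-runs : ∀ {ts} → Has ts tA → Has ts tB → ∀ r → Span n ts fun (λ σ → δ (changes σ) r)
  span-runs {ts} hasA hasB = span-classes changes (λ j m → HW j (suc m)) (λ m → Vac ½ ½ (suc m)) (λ m σ ip → proj₁ (Vm-runs (suc m) σ ip))
    (λ p m m<p → trans (cong (½ ⊗_) (trans (cong₂ _⊕_ (cong₂ _⊕_ (G-below n p (suc m) m<p) (cong₂ _⊕_ (G-below n (suc p) (suc m) (ℕ.m≤n⇒m≤1+n m<p)) (G-below n (suc p) (suc m) (ℕ.m≤n⇒m≤1+n m<p))))
      (G-below n (suc (suc p)) (suc m) (ℕ.m≤n⇒m≤1+n (ℕ.m≤n⇒m≤1+n m<p)))) refl)) (⊗0 ½))
    (λ m → ½⊗≢0 ((G n m (suc m) ⊕ (G n (suc m) (suc m) ⊕ G n (suc m) (suc m))) ⊕ G n (suc (suc m)) (suc m)) (λ eq → 2^≢0 m (trans (sym (trans (pick {G n m (suc m) ⊕ (G n (suc m) (suc m) ⊕ G n (suc m) (suc m))} (G-below n (suc (suc m)) (suc m) (ℕ.n≤1+n _))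
      (pick {G n m (suc m)} (trans (cong₂ _⊕_ (G-below n (suc m) (suc m) ℕ.≤-refl) (G-below n (suc m) (suc m) ℕ.≤-refl)) refl) refl)) (G-lead n m))) eq)))
    (λ m → span-anyV ½ ½ spans (suc m))
    where
    spans : ∀ p k → k ≤ n → Span n ts fun (elac ½ ½ p k)
    spans false k k≤n = span-ext (hasA k k≤n) (perms-len (λ σ _ → elac-A k σ))
    spans true  k k≤n = span-+ 1ℚ (fun (tB , k)) 1ℚ (fun (tA , k)) (hasB k k≤n) (hasA k k≤n) (perms-len (λ σ _ → elac-BA k σ))

  basis-W : NonZeroAt (tsW n) → OrthIdemBasis (map (W n) (upTo (suc n))) (map (elt n) (tsW n))
  basis-W nz = orthIdemBasis n (upTo (suc n)) (W n) (λ r σ → δ (suc (changes σ)) r) (Rep-W n) (tsW n)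
    (All.++⁺ (tag-≤ (rngK-≤ n)) (tag-≤ (rngUpTo-≤ 4 n))) (tsW-orth n) nz
    (All.++⁺ (All.map⁺ (All.map (λ {k} k≤n → inGens (fun (tA , k)) (dep-A k k≤n)) (rngK-≤ n)))
             (All.map⁺ (All.map (λ {k} k≤n → inGens (fun (tB , k)) (dep-B k k≤n)) (rngUpTo-≤ 4 n))))
    (All.universal (span-suc changes (span-runs (has-rngK tA (λ k mem → Mem.∈-++⁺ˡ (Mem.∈-map⁺ (tA ,_) mem)) refl refl)
      (has-B (λ k mem → Mem.∈-++⁺ʳ (map (tA ,_) (rngK n)) (Mem.∈-map⁺ (tB ,_) mem))))) (upTo (suc n)))
    where
    inGens : ∀ f → (∀ σ τ → IsPerm n σ → IsPerm n τ → changes σ ≡ changes τ → f σ ≡ f τ) → Span n (upTo (suc n)) (λ r σ → δ (suc (changes σ)) r) f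
    inGens f = span-dep changes n f (λ r lt → span-g (suc r) (index-∈ (s≤s lt)) (perms-len (λ _ _ → refl))) changes-<

  evenᵇ : Word → Bool
  evenᵇ σ = not (isOdd (changes σ))

  -- The signed weight of the differences W_j^+ - W_j^-: they belong to the algebra for odd j, that
  -- is for an even number of changes, and the weight is zero elsewhere.
  wtC : Word → ℚ
  wtC σ = sg σ ⊗ 𝟙 (evenᵇ σ)

  sg² : ∀ σ → sg σ ⊗ sg σ ≡ 1ℚ
  sg² σ with firstAsc σ
  ... | true  = refl
  ... | false = refl

  HC-odd : ∀ j i → isOdd j ≡ true → HC j (suc (double i)) ≡ 0ℚ
  HC-odd j i e = trans (cong₂ (λ x y → ½ ⊗ (x ⊕ ⊝ y)) (G-even n j (suc (double i)) (trans (cong not (isOdd-double i)) (sym e)))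
    (G-even n (suc (suc j)) (suc (double i)) (trans (cong not (isOdd-double i)) (sym (trans (Bool.not-involutive (isOdd j)) e))))) refl

  -- Only odd m occur for J^+ - J^-, and by parity V_m^+ - V_m^- vanishes there on permutations with
  -- an odd number of changes.
  C-odd-zero : ∀ k → k ≤ n → ∀ σ → IsPerm n σ → isOdd (changes σ) ≡ true → fun (tC , k) σ ≡ 0ℚ
  C-odd-zero k k≤n σ ip odd = trans (sym (elac-C k σ)) (interpolate (suc n) (λ k → elac ½ (⊝ ½) true k σ) (λ _ → 0ℚ) (λ m → nat (num true m)) (num-inj true)
    (λ m → trans (sym (Vac-expand ½ (⊝ ½) true m σ (proj₁ ip))) (trans (proj₂ (Vm-runs (suc (double m)) σ ip)) (trans (cong (_⊗ sg σ) (HC-odd (changes σ) m odd))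
      (trans (0⊗ (sg σ)) (sym (Σ<-zero< (suc n) (λ k _ → ⊗0 (pow₁ (nat (num true m)) k)))))))) k (s≤s k≤n))

  C-weighted : ∀ k → k ≤ n → ∀ σ → IsPerm n σ → fun (tC , k) σ ≡ (sg σ ⊗ fun (tC , k) σ) ⊗ wtC σ
  C-weighted k k≤n σ ip with isOdd (changes σ) in eq
  ... | true  = trans (C-odd-zero k k≤n σ ip eq) (sym (trans (cong ((sg σ ⊗ fun (tC , k) σ) ⊗_) (⊗0 (sg σ))) (⊗0 (sg σ ⊗ fun (tC , k) σ))))
  ... | false = sym (trans (solve 2 (λ s f → (s :* f) :* (s :* con 1ℚ) := (s :* s) :* f) refl (sg σ) (fun (tC , k) σ)) (trans (cong (_⊗ fun (tC , k) σ) (sg² σ)) (1⊗ (fun (tC , k) σ))))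

  dep-C : ∀ k → k ≤ n → ∀ σ τ → IsPerm n σ → IsPerm n τ → changes σ ≡ changes τ → sg σ ⊗ fun (tC , k) σ ≡ sg τ ⊗ fun (tC , k) τ
  dep-C k k≤n σ τ ipσ ipτ e = trans (cong (sg σ ⊗_) (sym (elac-C k σ))) (trans
    (interpolate (suc n) (λ k → sg σ ⊗ elac ½ (⊝ ½) true k σ) (λ k → sg τ ⊗ elac ½ (⊝ ½) true k τ) (λ m → nat (num true m)) (num-inj true)
      (λ m → trans (val σ ipσ m) (trans (cong (λ j → HC j (num true m)) e) (sym (val τ ipτ m)))) k (s≤s k≤n))
    (cong (sg τ ⊗_) (elac-C k τ)))
    where
    val : ∀ σ → IsPerm n σ → ∀ m → Σ< (suc n) (λ k → pow₁ (nat (num true m)) k ⊗ (sg σ ⊗ elac ½ (⊝ ½) true k σ)) ≡ HC (changes σ) (num true m)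
    val σ ip m = begin
      Σ< (suc n) (λ k → pow₁ (nat (num true m)) k ⊗ (sg σ ⊗ elac ½ (⊝ ½) true k σ))
        ≡⟨ trans (Σ<-cong (suc n) (λ k → ⊗-swap (pow₁ (nat (num true m)) k) (sg σ) (elac ½ (⊝ ½) true k σ))) (Σ<-*ˡ (suc n) (sg σ) (λ k → pow₁ (nat (num true m)) k ⊗ elac ½ (⊝ ½) true k σ)) ⟩
      sg σ ⊗ Σ< (suc n) (λ k → pow₁ (nat (num true m)) k ⊗ elac ½ (⊝ ½) true k σ)
        ≡⟨ cong (sg σ ⊗_) (trans (sym (Vac-expand ½ (⊝ ½) true m σ (proj₁ ip))) (proj₂ (Vm-runs (num true m) σ ip))) ⟩
      sg σ ⊗ (HC (changes σ) (num true m) ⊗ sg σ)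
        ≡⟨ trans (solve 2 (λ s h → s :* (h :* s) := (s :* s) :* h) refl (sg σ) (HC (changes σ) (num true m))) (trans (cong (_⊗ HC (changes σ) (num true m)) (sg² σ)) (1⊗ (HC (changes σ) (num true m)))) ⟩
      HC (changes σ) (num true m) ∎

  C-∈-even : ∀ j → j ≤ n → isOdd j ≡ false → inj₁ j ∈ indexC n
  C-∈-even j j≤n e = ∈-concatMap (genC n) (upTo-∈ j≤n) (subst (λ b → inj₁ j ∈ (if b then inj₁ j ∷ [] else inj₂ (j , true) ∷ inj₂ (j , false) ∷ [])) (sym (trans (mod2≡ᵇ0 j) (cong not e))) (here refl))

  C-∈-odd : ∀ j b → j ≤ n → isOdd j ≡ true → inj₂ (j , b) ∈ indexC n
  C-∈-odd j b j≤n e = ∈-concatMap (genC n) (upTo-∈ j≤n) (subst (λ c → inj₂ (j , b) ∈ (if c then inj₁ j ∷ [] else inj₂ (j , true) ∷ inj₂ (j , false) ∷ [])) (sym (trans (mod2≡ᵇ0 j) (cong not e))) (mem b))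
    where
    mem : ∀ b → inj₂ (j , b) ∈ (inj₂ (j , true) ∷ inj₂ (j , false) ∷ [])
    mem true  = here refl
    mem false = there (here refl)

  C-gen : ∀ j b → j ≤ n → isOdd j ≡ true → Span n (indexC n) funC (funC (inj₂ (j , b)))
  C-gen j b j≤n e = span-g (inj₂ (j , b)) (C-∈-odd j b j≤n e) (perms-len (λ _ _ → refl))

  C-class : ∀ r → r < n → Span n (indexC n) funC (λ σ → δ (changes σ) r)
  C-class r lt with isOdd (suc r) in eq
  ... | false = span-g (inj₁ (suc r)) (C-∈-even (suc r) lt eq) (perms-len (λ _ _ → refl))
  ... | true  = span-+ 1ℚ (funC (inj₂ (suc r , true))) 1ℚ (funC (inj₂ (suc r , false))) (C-gen (suc r) true lt eq) (C-gen (suc r) false lt eq)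
    (perms-len (λ σ _ → sym (trans (cong₂ _⊕_ (1⊗ (funC (inj₂ (suc r , true)) σ)) (1⊗ (funC (inj₂ (suc r , false)) σ))) (𝟙-split (changes σ ≡ᵇ r) (firstAsc σ)))))

  sg-split : ∀ σ r → 𝟙 ((changes σ ≡ᵇ r) ∧ firstAsc σ) ⊕ ⊝ 1ℚ ⊗ 𝟙 ((changes σ ≡ᵇ r) ∧ not (firstAsc σ)) ≡ δ (changes σ) r ⊗ sg σ
  sg-split σ r with changes σ ≡ᵇ r | firstAsc σ
  ... | true  | true  = refl
  ... | true  | false = refl
  ... | false | true  = refl
  ... | false | false = refl

  δ-≡ : ∀ j r (x : ℕ → ℚ) → δ j r ⊗ x j ≡ δ j r ⊗ x r
  δ-≡ j r x with j ℕ.≟ r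
  ... | yes refl = refl
  ... | no  neq  = trans (cong (_⊗ x j) (δ-≢ j r neq)) (trans (0⊗ (x j)) (sym (trans (cong (_⊗ x r) (δ-≢ j r neq)) (0⊗ (x r)))))

  C-wclass : ∀ r → r < n → Span n (indexC n) funC (λ σ → δ (changes σ) r ⊗ wtC σ)
  C-wclass r lt with isOdd r in eq
  ... | true  = span-0 (perms-len (λ σ _ → trans (δ-≡ (changes σ) r (λ j → sg σ ⊗ 𝟙 (not (isOdd j)))) (trans (cong (λ b → δ (changes σ) r ⊗ (sg σ ⊗ 𝟙 (not b))) eq)
    (trans (cong (δ (changes σ) r ⊗_) (⊗0 (sg σ))) (⊗0 (δ (changes σ) r))))))
  ... | false = span-+ 1ℚ (funC (inj₂ (suc r , true))) (⊝ 1ℚ) (funC (inj₂ (suc r , false))) (C-gen (suc r) true lt (cong not eq)) (C-gen (suc r) false lt (cong not eq))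
    (perms-len (λ σ _ → trans (δ-≡ (changes σ) r (λ j → sg σ ⊗ 𝟙 (not (isOdd j)))) (trans (cong (λ b → δ (changes σ) r ⊗ (sg σ ⊗ 𝟙 (not b))) eq)
      (trans (cong (δ (changes σ) r ⊗_) (⊗1 (sg σ))) (trans (sym (sg-split σ r)) (cong (_⊕ ⊝ 1ℚ ⊗ funC (inj₂ (suc r , false)) σ) (sym (1⊗ (funC (inj₂ (suc r , true)) σ)))))))))

  module _ {ts : List Entry} (hasA : Has ts tA) (hasB : Has ts tB) (hasC : Has ts tC) where

    hchanges : Word → ℕ
    hchanges σ = half (changes σ)

    -- The weight kills odd numbers of changes, so half the number of changes is a sufficient
    -- statistic; it makes the odd values m = 2i + 1 triangular.
    span-signed : ∀ a → Span n ts fun (λ σ → δ (hchanges σ) a ⊗ wtC σ)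
    span-signed = span-tri-stat wtC hchanges (λ a i → HC (double a) (suc (double i))) (λ i → Vac ½ (⊝ ½) (suc (double i)))
      (λ i → perms-∀ (λ σ ip → trans (proj₂ (Vm-runs (suc (double i)) σ ip)) (eqn i σ)))
      (λ p m m<p → trans (cong₂ (λ x y → ½ ⊗ (x ⊕ ⊝ y)) (G-below n (double p) (suc (double m)) (ℕ.≤-trans (ℕ.n≤1+n _) (double-mono m<p)))
        (G-below n (double (suc p)) (suc (double m)) (ℕ.≤-trans (ℕ.n≤1+n _) (double-mono (ℕ.m≤n⇒m≤1+n m<p))))) refl)
      (λ m → ½⊗≢0 (G n (double m) (suc (double m)) ⊕ ⊝ G n (suc (suc (double m))) (suc (double m))) (λ eq → 2^≢0 (double m) (trans (sym (trans (pick {G n (double m) (suc (double m))} (cong ⊝_ (G-below n (suc (suc (double m))) (suc (double m)) (ℕ.n≤1+n _))) refl) (G-lead n (double m)))) eq)))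
      (λ i → span-V ½ (⊝ ½) true (λ k k≤n → span-ext (hasC k k≤n) (perms-len (λ σ _ → elac-C k σ))) i)
      where
      eqn : ∀ i σ → HC (changes σ) (suc (double i)) ⊗ sg σ ≡ HC (double (hchanges σ)) (suc (double i)) ⊗ wtC σ
      eqn i σ with half-split (changes σ)
      ... | inj₁ e = cong₂ _⊗_ (cong (λ j → HC j (suc (double i))) e) (sym (trans (cong (λ b → sg σ ⊗ 𝟙 (not b)) (trans (cong isOdd e) (isOdd-double (hchanges σ)))) (⊗1 (sg σ))))
      ... | inj₂ e = trans (cong (_⊗ sg σ) (HC-odd (changes σ) i odd)) (trans (0⊗ (sg σ)) (sym (trans (cong (λ b → HC (double (hchanges σ)) (suc (double i)) ⊗ (sg σ ⊗ 𝟙 (not b))) odd)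
        (trans (cong (HC (double (hchanges σ)) (suc (double i)) ⊗_) (⊗0 (sg σ))) (⊗0 (HC (double (hchanges σ)) (suc (double i))))))))
        where
        odd : isOdd (changes σ) ≡ true
        odd = trans (cong isOdd e) (cong not (isOdd-double (hchanges σ)))

    signed-eq : ∀ σ a → δ (hchanges σ) a ⊗ wtC σ ≡ δ (changes σ) (double a) ⊗ sg σ
    signed-eq σ a with half-split (changes σ)
    ... | inj₁ e = cong₂ _⊗_ (trans (sym (δ-double (hchanges σ) a)) (cong (λ j → δ j (double a)) (sym e)))
                     (trans (cong (λ b → sg σ ⊗ 𝟙 (not b)) (trans (cong isOdd e) (isOdd-double (hchanges σ)))) (⊗1 (sg σ)))
    ... | inj₂ e = trans (cong (λ b → δ (hchanges σ) a ⊗ (sg σ ⊗ 𝟙 (not b))) (trans (cong isOdd e) (cong not (isOdd-double (hchanges σ)))))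
                     (trans (trans (cong (δ (hchanges σ) a ⊗_) (⊗0 (sg σ))) (⊗0 (δ (hchanges σ) a)))
                       (sym (trans (cong (_⊗ sg σ) (trans (cong (λ j → δ j (double a)) e) (δ-odd-even (hchanges σ) a))) (0⊗ (sg σ)))))

    asc-split : ∀ a b → 𝟙 (a ∧ b) ≡ ½ ⊗ 𝟙 a ⊕ ½ ⊗ (𝟙 a ⊗ (if b then 1ℚ else ⊝ 1ℚ))
    asc-split true  true  = refl
    asc-split true  false = refl
    asc-split false true  = refl
    asc-split false false = refl

    desc-split : ∀ a b → 𝟙 (a ∧ not b) ≡ ½ ⊗ 𝟙 a ⊕ ⊝ ½ ⊗ (𝟙 a ⊗ (if b then 1ℚ else ⊝ 1ℚ))
    desc-split true  true  = refl
    desc-split true  false = refl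
    desc-split false true  = refl
    desc-split false false = refl

    spanC-odd : ∀ a b → Span n ts fun (funC (inj₂ (suc (double a) , b)))
    spanC-odd a true  = span-+ ½ (λ σ → δ (changes σ) (double a)) ½ (λ σ → δ (hchanges σ) a ⊗ wtC σ) (span-runs hasA hasB (double a)) (span-signed a)
      (perms-len (λ σ _ → trans (asc-split (changes σ ≡ᵇ double a) (firstAsc σ)) (cong (λ z → ½ ⊗ δ (changes σ) (double a) ⊕ ½ ⊗ z) (sym (signed-eq σ a)))))
    spanC-odd a false = span-+ ½ (λ σ → δ (changes σ) (double a)) (⊝ ½) (λ σ → δ (hchanges σ) a ⊗ wtC σ) (span-runs hasA hasB (double a)) (span-signed a)
      (perms-len (λ σ _ → trans (desc-split (changes σ ≡ᵇ double a) (firstAsc σ)) (cong (λ z → ½ ⊗ δ (changes σ) (double a) ⊕ ⊝ ½ ⊗ z) (sym (signed-eq σ a)))))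

    spanC-gens : All (λ t → Span n ts fun (funC t)) (indexC n)
    spanC-gens = All.concat⁺ (All.map⁺ (All.universal one (upTo (suc n))))
      where
      one : ∀ j → All (λ t → Span n ts fun (funC t)) (genC n j)
      one j with j % 2 ≡ᵇ 0 in eq
      ... | true  = span-suc changes (span-runs hasA hasB) j ∷ []
      ... | false with half-split j
      ...   | inj₁ e = ⊥-elim (Bool.not-¬ {false} refl (trans (sym eq) (trans (mod2≡ᵇ0 j) (cong not (trans (cong isOdd e) (isOdd-double (half j)))))))
      ...   | inj₂ e = subst (λ z → Span n ts fun (funC (inj₂ (z , true)))) (sym e) (spanC-odd (half j) true)
                     ∷ subst (λ z → Span n ts fun (funC (inj₂ (z , false)))) (sym e) (spanC-odd (half j) false) ∷ []

  basis-C : NonZeroAt (tsC n) → OrthIdemBasis (gensC n) (map (elt n) (tsC n))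
  basis-C nz = subst (λ gs → OrthIdemBasis gs (map (elt n) (tsC n))) (indexC-gens n) (orthIdemBasis n (indexC n) (eltC n) funC (Rep-C n) (tsC n)
    (All.++⁺ (tag-≤ (rngK-≤ n)) (All.++⁺ (tag-≤ (rngUpTo-≤ 4 n)) (tag-≤ (rngUpTo-≤ 2 n)))) (tsC-orth n) nz
    (All.++⁺ (All.map⁺ (All.map (λ {k} k≤n → span-dep changes n (fun (tA , k)) C-class changes-< (dep-A k k≤n)) (rngK-≤ n)))
      (All.++⁺ (All.map⁺ (All.map (λ {k} k≤n → span-dep changes n (fun (tB , k)) C-class changes-< (dep-B k k≤n)) (rngUpTo-≤ 4 n)))
        (All.map⁺ (All.map (λ {k} k≤n → span-stat wtC changes n (fun (tC , k)) (λ σ → sg σ ⊗ fun (tC , k) σ) C-wclass (perms-∀ changes-<) (perms-∀ (C-weighted k k≤n)) (dep-C k k≤n)) (rngUpTo-≤ 2 n)))))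
    (spanC-gens
      (has-rngK tA (λ k mem → Mem.∈-++⁺ˡ (Mem.∈-map⁺ (tA ,_) mem)) refl refl)
      (has-B (λ k mem → Mem.∈-++⁺ʳ (map (tA ,_) (rngK n)) (Mem.∈-++⁺ˡ (Mem.∈-map⁺ (tB ,_) mem))))
      (has-rng2 tC (λ k mem → Mem.∈-++⁺ʳ (map (tA ,_) (rngK n)) (Mem.∈-++⁺ʳ (map (tB ,_) (rngUpTo 4 n)) (Mem.∈-map⁺ (tC ,_) mem))) tC-top)))

-- Symmetric functions

-- Dual to the multiplication of monomials, so that convolution is the product of formal power
-- series.
splitsV : ∀ {m} → Vec ℕ m → List (Vec ℕ m × Vec ℕ m)
splitsV []       = ([] , []) ∷ []
splitsV (a ∷ vs) = concatMap (λ bc → map (λ uw → (proj₁ bc ∷ proj₁ uw) , (proj₂ bc ∷ proj₂ uw)) (splitsV vs)) (splitsℕ a)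

ΔV : ∀ {m} → Vec ℕ m → (Vec ℕ m → Vec ℕ m → ℚ) → ℚ
ΔV v = ∑₂ (splitsV v)

ΔV-∷ : ∀ {m} a (vs : Vec ℕ m) G → ΔV (a ∷ vs) G ≡ Δℕ a (λ b c → ΔV vs (λ u w → G (b ∷ u) (c ∷ w)))
ΔV-∷ a vs G = trans (∑-concatMap (λ bc → map (λ uw → (proj₁ bc ∷ proj₁ uw) , (proj₂ bc ∷ proj₂ uw)) (splitsV vs)) (splitsℕ a) (λ p → G (proj₁ p) (proj₂ p)))
  (∑-cong (splitsℕ a) (λ bc → ∑-map (λ uw → (proj₁ bc ∷ proj₁ uw) , (proj₂ bc ∷ proj₂ uw)) (splitsV vs) (λ p → G (proj₁ p) (proj₂ p))))

ΔV-cong : ∀ {m} (v : Vec ℕ m) {G H : Vec ℕ m → Vec ℕ m → ℚ} → (∀ u w → G u w ≡ H u w) → ΔV v G ≡ ΔV v H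
ΔV-cong v = ∑₂-cong (splitsV v)

ΔV-coassoc : ∀ {m} (v : Vec ℕ m) (F : Vec ℕ m → Vec ℕ m → Vec ℕ m → ℚ) →
  ΔV v (λ q r → ΔV q (λ s t → F s t r)) ≡ ΔV v (λ q r → ΔV r (λ s t → F q s t))
ΔV-coassoc []       F = refl
ΔV-coassoc (a ∷ vs) F = begin
  ΔV (a ∷ vs) (λ q r → ΔV q (λ s t → F s t r))
    ≡⟨ trans (ΔV-∷ a vs (λ q r → ΔV q (λ s t → F s t r))) (Δℕ-cong a (λ b c → ΔV-cong vs (λ u w → ΔV-∷ b u (λ s t → F s t (c ∷ w))))) ⟩
  Δℕ a (λ b c → ΔV vs (λ u w → Δℕ b (λ b₁ b₂ → ΔV u (λ u₁ u₂ → F (b₁ ∷ u₁) (b₂ ∷ u₂) (c ∷ w)))))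
    ≡⟨ Δℕ-cong a (λ b c → ∑-swap (splitsV vs) (splitsℕ b) (λ uw bb → ΔV (proj₁ uw) (λ u₁ u₂ → F (proj₁ bb ∷ u₁) (proj₂ bb ∷ u₂) (c ∷ proj₂ uw)))) ⟩
  Δℕ a (λ b c → Δℕ b (λ b₁ b₂ → ΔV vs (λ u w → ΔV u (λ u₁ u₂ → F (b₁ ∷ u₁) (b₂ ∷ u₂) (c ∷ w)))))
    ≡⟨ Δℕ-cong a (λ b c → Δℕ-cong b (λ b₁ b₂ → ΔV-coassoc vs (λ u₁ u₂ w → F (b₁ ∷ u₁) (b₂ ∷ u₂) (c ∷ w)))) ⟩
  Δℕ a (λ b c → Δℕ b (λ b₁ b₂ → ΔV vs (λ u w → ΔV w (λ w₁ w₂ → F (b₁ ∷ u) (b₂ ∷ w₁) (c ∷ w₂)))))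
    ≡⟨ Δℕ-coassoc a (λ b₁ b₂ c → ΔV vs (λ u w → ΔV w (λ w₁ w₂ → F (b₁ ∷ u) (b₂ ∷ w₁) (c ∷ w₂)))) ⟩
  Δℕ a (λ b c → Δℕ c (λ c₁ c₂ → ΔV vs (λ u w → ΔV w (λ w₁ w₂ → F (b ∷ u) (c₁ ∷ w₁) (c₂ ∷ w₂)))))
    ≡⟨ Δℕ-cong a (λ b c → sym (∑-swap (splitsV vs) (splitsℕ c) (λ uw cc → ΔV (proj₂ uw) (λ w₁ w₂ → F (b ∷ proj₁ uw) (proj₁ cc ∷ w₁) (proj₂ cc ∷ w₂))))) ⟩
  Δℕ a (λ b c → ΔV vs (λ u w → Δℕ c (λ c₁ c₂ → ΔV w (λ w₁ w₂ → F (b ∷ u) (c₁ ∷ w₁) (c₂ ∷ w₂)))))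
    ≡⟨ sym (trans (ΔV-∷ a vs (λ q r → ΔV r (λ s t → F q s t))) (Δℕ-cong a (λ b c → ΔV-cong vs (λ u w → ΔV-∷ c w (λ s t → F (b ∷ u) s t))))) ⟩
  ΔV (a ∷ vs) (λ q r → ΔV r (λ s t → F q s t)) ∎

ΔV-comm : ∀ {m} (v : Vec ℕ m) G → ΔV v G ≡ ΔV v (λ u w → G w u)
ΔV-comm []       G = refl
ΔV-comm (a ∷ vs) G = begin
  ΔV (a ∷ vs) G                                                   ≡⟨ ΔV-∷ a vs G ⟩
  Δℕ a (λ b c → ΔV vs (λ u w → G (b ∷ u) (c ∷ w)))                ≡⟨ Δℕ-comm a (λ b c → ΔV vs (λ u w → G (b ∷ u) (c ∷ w))) ⟩
  Δℕ a (λ b c → ΔV vs (λ u w → G (c ∷ u) (b ∷ w)))                ≡⟨ Δℕ-cong a (λ b c → ΔV-comm vs (λ u w → G (c ∷ u) (b ∷ w))) ⟩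
  Δℕ a (λ b c → ΔV vs (λ u w → G (c ∷ w) (b ∷ u)))                ≡⟨ sym (ΔV-∷ a vs (λ u w → G w u)) ⟩
  ΔV (a ∷ vs) (λ u w → G w u) ∎

𝟙-+0 : ∀ b c → 𝟙 (b + c ≡ᵇ 0) ≡ 𝟙 (b ≡ᵇ 0) ⊗ 𝟙 (c ≡ᵇ 0)
𝟙-+0 zero    c = sym (1⊗ (𝟙 (c ≡ᵇ 0)))
𝟙-+0 (suc b) c = sym (0⊗ (𝟙 (c ≡ᵇ 0)))

ΔV-counitˡ : ∀ {m} (v : Vec ℕ m) (F : Vec ℕ m → ℚ) → ΔV v (λ q r → 𝟙 (vsum q ≡ᵇ 0) ⊗ F r) ≡ F v
ΔV-counitˡ []       F = trans (⊕0 (1ℚ ⊗ F [])) (1⊗ (F []))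
ΔV-counitˡ (a ∷ vs) F = begin
  ΔV (a ∷ vs) (λ q r → 𝟙 (vsum q ≡ᵇ 0) ⊗ F r)
    ≡⟨ ΔV-∷ a vs (λ q r → 𝟙 (vsum q ≡ᵇ 0) ⊗ F r) ⟩
  Δℕ a (λ b c → ΔV vs (λ u w → 𝟙 (b + vsum u ≡ᵇ 0) ⊗ F (c ∷ w)))
    ≡⟨ Δℕ-cong a (λ b c → trans (ΔV-cong vs (λ u w → trans (cong (_⊗ F (c ∷ w)) (𝟙-+0 b (vsum u))) (ℚ.*-assoc (𝟙 (b ≡ᵇ 0)) (𝟙 (vsum u ≡ᵇ 0)) (F (c ∷ w)))))
         (trans (∑-*ˡ (splitsV vs) (𝟙 (b ≡ᵇ 0)) (λ uw → 𝟙 (vsum (proj₁ uw) ≡ᵇ 0) ⊗ F (c ∷ proj₂ uw))) (cong (𝟙 (b ≡ᵇ 0) ⊗_) (ΔV-counitˡ vs (λ w → F (c ∷ w)))))) ⟩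
  Δℕ a (λ b c → 𝟙 (b ≡ᵇ 0) ⊗ F (c ∷ vs))
    ≡⟨ Δℕ-counitˡ a (λ c → F (c ∷ vs)) ⟩
  F (a ∷ vs) ∎

ΔV-counitʳ : ∀ {m} (v : Vec ℕ m) (F : Vec ℕ m → ℚ) → ΔV v (λ q r → F q ⊗ 𝟙 (vsum r ≡ᵇ 0)) ≡ F v
ΔV-counitʳ v F = trans (ΔV-comm v (λ q r → F q ⊗ 𝟙 (vsum r ≡ᵇ 0)))
  (trans (ΔV-cong v (λ u w → ℚ.*-comm (F w) (𝟙 (vsum u ≡ᵇ 0)))) (ΔV-counitˡ v F))

deg-splitsV : ∀ {m} (v : Vec ℕ m) → All (λ p → vsum (proj₁ p) + vsum (proj₂ p) ≡ vsum v) (splitsV v)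
deg-splitsV []       = refl ∷ []
deg-splitsV (a ∷ vs) = All.concat⁺ (All.map⁺ (All.map (λ {bc} e → All.map⁺ (All.map (λ {uw} e′ →
  trans (interch (proj₁ bc) (vsum (proj₁ uw)) (proj₂ bc) (vsum (proj₂ uw))) (cong₂ _+_ e e′)) (deg-splitsV vs))) (deg-splitsℕ a)))
  where
  interch : ∀ a b c d → (a + b) + (c + d) ≡ (a + c) + (b + d)
  interch a b c d = trans (ℕ.+-assoc a b (c + d)) (trans (cong (a +_) (trans (sym (ℕ.+-assoc b c d)) (trans (cong (_+ d) (ℕ.+-comm b c)) (ℕ.+-assoc c b d))))
    (sym (ℕ.+-assoc a c (b + d))))

polyC : ℕ → Coalg
polyC m = record
  { Pt = Vec ℕ m ; deg = vsum ; splits = splitsV ; deg-splits = deg-splitsV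
  ; coassoc = ΔV-coassoc ; counitˡ = ΔV-counitˡ ; counitʳ = ΔV-counitʳ }

below-ΔV : ∀ {m} (v : Vec ℕ m) (H : Vec ℕ m → Vec ℕ m → ℚ) → ∑ (below v) (λ u → H u (Vec.zipWith _∸_ v u)) ≡ ΔV v H
below-ΔV []       H = refl
below-ΔV (a ∷ vs) H = begin
  ∑ (concatMap (λ b → map (b ∷_) (below vs)) (upTo (suc a))) (λ u → H u (Vec.zipWith _∸_ (a ∷ vs) u))
    ≡⟨ trans (∑-concatMap (λ b → map (b ∷_) (below vs)) (upTo (suc a)) (λ u → H u (Vec.zipWith _∸_ (a ∷ vs) u)))
         (∑-cong (upTo (suc a)) (λ b → ∑-map (b ∷_) (below vs) (λ u → H u (Vec.zipWith _∸_ (a ∷ vs) u)))) ⟩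
  ∑ (upTo (suc a)) (λ b → ∑ (below vs) (λ u → H (b ∷ u) ((a ∸ b) ∷ Vec.zipWith _∸_ vs u)))
    ≡⟨ trans (∑-cong (upTo (suc a)) (λ b → below-ΔV vs (λ u w → H (b ∷ u) ((a ∸ b) ∷ w)))) (∑-upTo (suc a) (λ b → ΔV vs (λ u w → H (b ∷ u) ((a ∸ b) ∷ w)))) ⟩
  Σ< (suc a) (λ b → ΔV vs (λ u w → H (b ∷ u) ((a ∸ b) ∷ w)))
    ≡⟨ Δℕ-Σ< a (λ b c → ΔV vs (λ u w → H (b ∷ u) (c ∷ w))) ⟩
  Δℕ a (λ b c → ΔV vs (λ u w → H (b ∷ u) (c ∷ w)))
    ≡⟨ sym (ΔV-∷ a vs H) ⟩
  ΔV (a ∷ vs) H ∎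

ite≡𝟙 : ∀ b → (if b then 1ℚ else 0ℚ) ≡ 𝟙 b
ite≡𝟙 true  = refl
ite≡𝟙 false = refl

psum-∑ : ∀ {m} {A : Set} (f : A → Poly m) xs v → psum (map f xs) v ≡ ∑ xs (λ x → f x v)
psum-∑ f []       v = refl
psum-∑ f (x ∷ xs) v = cong (f x v ⊕_) (psum-∑ f xs v)

module PolyC (m : ℕ) where
  open Conv (polyC m) public

  pmul≐⋆ : ∀ f g → pmul f g ≐ f ⋆ g
  pmul≐⋆ f g v = trans (sumℚ-map (λ u → f u ⊗ g (Vec.zipWith _∸_ v u)) (below v)) (below-ΔV v (λ u w → f u ⊗ g w))

  pone≐one : pone ≐ one
  pone≐one v = ite≡𝟙 (vsum v ≡ᵇ 0)

  P-comm : ∀ f g → f ⋆ g ≐ g ⋆ f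
  P-comm f g v = trans (ΔV-comm v (λ u w → f u ⊗ g w)) (ΔV-cong v (λ u w → ℚ.*-comm (f w) (g u)))

  open Commutative P-comm public

  Σ⋆ : ∀ {A : Set} (xs : List A) f (g : A → Fun) → f ⋆ (λ w → ∑ xs (λ x → g x w)) ≐ (λ v → ∑ xs (λ x → (f ⋆ g x) v))
  Σ⋆ xs f g v = trans (∑₂-cong (splits v) (λ q r → sym (∑-*ˡ xs (f q) (λ x → g x r)))) (∑-swap (splits v) xs (λ qr x → f (proj₁ qr) ⊗ g x (proj₂ qr)))

  ΓS : Comp → Fun
  ΓS I v = ∑ (coarsen I) (λ J → negOnePow (length I ∸ length J) ⊗ hJ J v)

  ΓR≐ΓS : ∀ I → ΓR I ≐ ΓS I
  ΓR≐ΓS I v = psum-∑ (λ J → pscale (negOnePow (length I ∸ length J)) (hJ J)) (coarsen I) v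

  addHead : ℕ → Comp → Comp
  addHead i []       = []
  addHead i (c ∷ cs) = (i + c) ∷ cs

  -- Coarsenings are non-empty and not longer than the original; the second fact keeps the truncated
  -- subtraction in the sign exponent honest.
  data Shorter (L : ℕ) : Comp → Set where
    shorter : ∀ c cs → length (c ∷ cs) ≤ L → Shorter L (c ∷ cs)

  coarsen-shorter : ∀ j r → All (Shorter (length (j ∷ r))) (coarsen (j ∷ r))
  coarsen-shorter j []      = shorter j [] ℕ.≤-refl ∷ []
  coarsen-shorter j (k ∷ r) = All.concat⁺ (All.map⁺ (All.map (λ { (shorter c cs le) →
    shorter j (c ∷ cs) (s≤s le) ∷ shorter (j + c) cs (ℕ.m≤n⇒m≤1+n le) ∷ [] }) (coarsen-shorter k r)))

  coarsen-∷ : ∀ i j r (F : Comp → ℚ) → ∑ (coarsen (i ∷ j ∷ r)) F ≡ ∑ (coarsen (j ∷ r)) (λ J → F (i ∷ J) ⊕ F (addHead i J))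
  coarsen-∷ i j r F = trans (∑-concatMap _ (coarsen (j ∷ r)) F) (∑-cong-All (All.map (λ { (shorter c cs _) → cong (F (i ∷ c ∷ cs) ⊕_) (⊕0 (F ((i + c) ∷ cs))) }) (coarsen-shorter j r)))

  coarsen-addHead : ∀ i j r (F : Comp → ℚ) → ∑ (coarsen ((i + j) ∷ r)) F ≡ ∑ (coarsen (j ∷ r)) (λ J → F (addHead i J))
  coarsen-addHead i j []      F = refl
  coarsen-addHead i j (k ∷ r) F = trans (coarsen-∷ (i + j) k r F) (trans
    (∑-cong-All (All.map (λ { (shorter c cs _) → cong (λ z → F ((i + j) ∷ c ∷ cs) ⊕ F (z ∷ cs)) (ℕ.+-assoc i j c) }) (coarsen-shorter k r)))
    (sym (coarsen-∷ j k r (λ J → F (addHead i J)))))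

  -- A coarsening of (i, j, ...) keeps i separate or adds it to the next part. The coarsenings of
  -- the second kind also occur for (i + j, ...), with opposite sign, and cancel.
  ΓS-step : ∀ i j r → hk i ⋆ ΓS (j ∷ r) ≐ ΓS (i ∷ j ∷ r) ⊞ ΓS ((i + j) ∷ r)
  ΓS-step i j r v = sym (begin
    ΓS (i ∷ j ∷ r) v ⊕ ΓS ((i + j) ∷ r) v
      ≡⟨ cong₂ _⊕_ (coarsen-∷ i j r (λ J → negOnePow (suc L ∸ length J) ⊗ hJ J v)) (coarsen-addHead i j r (λ J → negOnePow (L ∸ length J) ⊗ hJ J v)) ⟩
    ∑ CO (λ J → negOnePow (L ∸ length J) ⊗ hJ (i ∷ J) v ⊕ negOnePow (suc L ∸ length (addHead i J)) ⊗ hJ (addHead i J) v)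
      ⊕ ∑ CO (λ J → negOnePow (L ∸ length (addHead i J)) ⊗ hJ (addHead i J) v)
      ≡⟨ sym (∑-⊕ CO (λ J → negOnePow (L ∸ length J) ⊗ hJ (i ∷ J) v ⊕ negOnePow (suc L ∸ length (addHead i J)) ⊗ hJ (addHead i J) v) (λ J → negOnePow (L ∸ length (addHead i J)) ⊗ hJ (addHead i J) v)) ⟩
    ∑ CO (λ J → (negOnePow (L ∸ length J) ⊗ hJ (i ∷ J) v ⊕ negOnePow (suc L ∸ length (addHead i J)) ⊗ hJ (addHead i J) v) ⊕ negOnePow (L ∸ length (addHead i J)) ⊗ hJ (addHead i J) v)
      ≡⟨ ∑-cong-All (All.map (λ { (shorter c cs le) → collapse c cs le }) (coarsen-shorter j r)) ⟩
    ∑ CO (λ J → (hk i ⋆ (λ w → negOnePow (L ∸ length J) ⊗ hJ J w)) v)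
      ≡⟨ sym (Σ⋆ CO (hk i) (λ J w → negOnePow (L ∸ length J) ⊗ hJ J w) v) ⟩
    (hk i ⋆ ΓS (j ∷ r)) v ∎)
    where
    L : ℕ
    L = length (j ∷ r)
    CO : List Comp
    CO = coarsen (j ∷ r)
    collapse : ∀ c cs → length (c ∷ cs) ≤ L →
      (negOnePow (L ∸ length (c ∷ cs)) ⊗ hJ (i ∷ c ∷ cs) v ⊕ negOnePow (suc L ∸ length (c ∷ cs)) ⊗ hJ ((i + c) ∷ cs) v) ⊕ negOnePow (L ∸ length (c ∷ cs)) ⊗ hJ ((i + c) ∷ cs) v
      ≡ (hk i ⋆ (λ w → negOnePow (L ∸ length (c ∷ cs)) ⊗ hJ (c ∷ cs) w)) v
    collapse c cs le = begin
      (ν ⊗ hJ (i ∷ c ∷ cs) v ⊕ negOnePow (suc L ∸ length (c ∷ cs)) ⊗ y) ⊕ ν ⊗ y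
        ≡⟨ cong (λ z → (ν ⊗ hJ (i ∷ c ∷ cs) v ⊕ negOnePow z ⊗ y) ⊕ ν ⊗ y) (ℕ.+-∸-assoc 1 le) ⟩
      (ν ⊗ hJ (i ∷ c ∷ cs) v ⊕ ⊝ ν ⊗ y) ⊕ ν ⊗ y
        ≡⟨ solve 3 (λ n x y → (n :* x :+ (:- n) :* y) :+ n :* y := n :* x) refl ν (hJ (i ∷ c ∷ cs) v) y ⟩
      ν ⊗ hJ (i ∷ c ∷ cs) v
        ≡⟨ cong (ν ⊗_) (pmul≐⋆ (hk i) (hJ (c ∷ cs)) v) ⟩
      ν ⊗ (hk i ⋆ hJ (c ∷ cs)) v
        ≡⟨ sym (⋆-·ˡ ν (hk i) (hJ (c ∷ cs)) v) ⟩
      (hk i ⋆ (λ w → ν ⊗ hJ (c ∷ cs) w)) v ∎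
      where
      ν y : ℚ
      ν = negOnePow (L ∸ length (c ∷ cs))
      y = hJ ((i + c) ∷ cs) v

  ΓR-single : ∀ i → ΓR (i ∷ []) ≐ hk i
  ΓR-single i v = trans (ΓR≐ΓS (i ∷ []) v) (trans (⊕0 (1ℚ ⊗ hJ (i ∷ []) v)) (trans (1⊗ (hJ (i ∷ []) v))
    (trans (pmul≐⋆ (hk i) pone v) (trans (⋆-congˡ (hk i) pone≐one v) (⋆one (hk i) v)))))

  ΓR-step : ∀ i j r → ΓR (suc i ∷ []) ⋆ ΓR (suc j ∷ r) ≐ ΓR (suc i ∷ suc j ∷ r) ⊞ ΓR ((suc i + suc j) ∷ r)
  ΓR-step i j r v = trans (⋆-cong (ΓR-single (suc i)) (ΓR≐ΓS (suc j ∷ r)) v) (trans (ΓS-step (suc i) (suc j) r v)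
    (cong₂ _⊕_ (sym (ΓR≐ΓS (suc i ∷ suc j ∷ r) v)) (sym (ΓR≐ΓS ((suc i + suc j) ∷ r) v))))

  ΓR-[] : ΓR [] ≐ one
  ΓR-[] v = trans (ΓR≐ΓS [] v) (trans (⊕0 (1ℚ ⊗ pone v)) (trans (1⊗ (pone v)) (pone≐one v)))

  Homog : ℕ → Fun → Set
  Homog d f = ∀ v → deg v ≢ d → f v ≡ 0ℚ

  homog-⋆ : ∀ {c d f g} → Homog c f → Homog d g → Homog (c + d) (f ⋆ g)
  homog-⋆ {c} {d} {f} {g} hf hg v neq = ∑-zero-All (All.map (λ {qr} e → term (proj₁ qr) (proj₂ qr) e) (deg-splits v))
    where
    term : ∀ q r → deg q + deg r ≡ deg v → f q ⊗ g r ≡ 0ℚ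
    term q r e with deg q ℕ.≟ c
    ... | no  q≢ = trans (cong (_⊗ g r) (hf q q≢)) (0⊗ (g r))
    ... | yes q≡ = trans (cong (f q ⊗_) (hg r (λ r≡ → neq (trans (sym e) (cong₂ _+_ q≡ r≡))))) (⊗0 (f q))

  homog-cong : ∀ {d f g} → f ≐ g → Homog d g → Homog d f
  homog-cong eq h v neq = trans (eq v) (h v neq)

  homog-one : Homog 0 one
  homog-one v neq with vsum v
  ... | zero  = ⊥-elim (neq refl)
  ... | suc _ = refl

  ite-≢ : ∀ {a c} (b : Bool) → a ≢ c → (if (a ≡ᵇ c) ∧ b then 1ℚ else 0ℚ) ≡ 0ℚ
  ite-≢ {a} {c} b neq with a ≡ᵇ c in eq
  ... | false = refl
  ... | true  = ⊥-elim (neq (ℕ.≡ᵇ⇒≡ a c (subst T (sym eq) tt)))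

  homog-hk : ∀ k → Homog k (hk k)
  homog-hk k v neq = trans (cong (λ b → if b then 1ℚ else 0ℚ) (sym (Bool.∧-identityʳ (vsum v ≡ᵇ k)))) (ite-≢ {vsum v} {k} true neq)

  homog-pk : ∀ k → Homog k (pk k)
  homog-pk k v neq = ite-≢ {vsum v} {k} (nonzeros v ≡ᵇ 1) neq

  homog-hJ : ∀ J → Homog (csum J) (hJ J)
  homog-hJ []      = homog-cong pone≐one homog-one
  homog-hJ (j ∷ J) = homog-cong (pmul≐⋆ (hk j) (hJ J)) (homog-⋆ {j} {csum J} {hk j} {hJ J} (homog-hk j) (homog-hJ J))

  homog-pλ : ∀ J → Homog (csum J) (pλ J)
  homog-pλ []      = homog-cong pone≐one homog-one
  homog-pλ (j ∷ J) = homog-cong (pmul≐⋆ (pk j) (pλ J)) (homog-⋆ {j} {csum J} {pk j} {pλ J} (homog-pk j) (homog-pλ J))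

  coarsen-csum : ∀ j r → All (λ J → csum J ≡ csum (j ∷ r)) (coarsen (j ∷ r))
  coarsen-csum j []      = refl ∷ []
  coarsen-csum j (k ∷ r) = All.concat⁺ (All.map⁺ (All.zipWith (λ { (shorter c cs _ , e) → cong (j +_) e ∷ trans (ℕ.+-assoc j c (csum cs)) (cong (j +_) e) ∷ [] })
    (coarsen-shorter k r , coarsen-csum k r)))

  ΓR-deg : ∀ {d} I → Valid d I → Homog d (ΓR I)
  ΓR-deg []      (_ , refl) = homog-cong ΓR-[] homog-one
  ΓR-deg (i ∷ I) (_ , refl) v neq = trans (ΓR≐ΓS (i ∷ I) v) (∑-zero-All (All.map (λ {J} e →
    trans (cong (negOnePow (length (i ∷ I) ∸ length J) ⊗_) (homog-hJ J v (λ eq → neq (trans eq e)))) (⊗0 (negOnePow (length (i ∷ I) ∸ length J)))) (coarsen-csum i I)))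

polyI : ℕ → Interp
polyI m = record
  { coalg = polyC m ; b = ΓR ; b-[] = PolyC.ΓR-[] m ; b-step = PolyC.ΓR-step m ; b-deg = PolyC.ΓR-deg m }

-- Sums over partitions

<ᵇ-suc : ∀ i r → 𝟙 (i <ᵇ suc r) ≡ 𝟙 (i <ᵇ r) ⊕ δ i r
<ᵇ-suc zero    zero    = refl
<ᵇ-suc zero    (suc r) = refl
<ᵇ-suc (suc i) zero    = refl
<ᵇ-suc (suc i) (suc r) = <ᵇ-suc i r

∑-from1 : ∀ N F → ∑ (from1 N) F ≡ Σ< N (F ∘ suc)
∑-from1 N F = trans (∑-map suc (upTo N) F) (∑-upTo N (F ∘ suc))

partsF-suc : ∀ f d M g → ∑ (partsF (suc f) (suc d) M) g ≡
             Σ< (suc d) (λ i → 𝟙 (i <ᵇ M) ⊗ ∑ (partsF f (d ∸ i) (suc i)) (λ μ → g (suc i ∷ μ)))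
partsF-suc f d M g = begin
  ∑ (partsF (suc f) (suc d) M) g
    ≡⟨ trans (∑-concatMap (λ k → map (k ∷_) (partsF f (suc d ∸ k) k)) (filterᵇ (λ k → (k ≤ᵇ M) ∧ (k ≤ᵇ suc d)) (from1 (suc d))) g)
         (∑-cong (filterᵇ (λ k → (k ≤ᵇ M) ∧ (k ≤ᵇ suc d)) (from1 (suc d))) (λ k → ∑-map (k ∷_) (partsF f (suc d ∸ k) k) g)) ⟩
  ∑ (filterᵇ (λ k → (k ≤ᵇ M) ∧ (k ≤ᵇ suc d)) (from1 (suc d))) (λ k → ∑ (partsF f (suc d ∸ k) k) (λ μ → g (k ∷ μ)))
    ≡⟨ trans (∑-filter (λ k → (k ≤ᵇ M) ∧ (k ≤ᵇ suc d)) (from1 (suc d)) (λ k → ∑ (partsF f (suc d ∸ k) k) (λ μ → g (k ∷ μ))))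
         (∑-from1 (suc d) (λ k → 𝟙 ((k ≤ᵇ M) ∧ (k ≤ᵇ suc d)) ⊗ ∑ (partsF f (suc d ∸ k) k) (λ μ → g (k ∷ μ)))) ⟩
  Σ< (suc d) (λ i → 𝟙 ((i <ᵇ M) ∧ (i <ᵇ suc d)) ⊗ ∑ (partsF f (d ∸ i) (suc i)) (λ μ → g (suc i ∷ μ)))
    ≡⟨ Σ<-cong< (suc d) (λ i lt → cong (λ b → 𝟙 b ⊗ ∑ (partsF f (d ∸ i) (suc i)) (λ μ → g (suc i ∷ μ)))
         (trans (cong ((i <ᵇ M) ∧_) (<ᵇ-true lt)) (Bool.∧-identityʳ (i <ᵇ M)))) ⟩
  Σ< (suc d) (λ i → 𝟙 (i <ᵇ M) ⊗ ∑ (partsF f (d ∸ i) (suc i)) (λ μ → g (suc i ∷ μ))) ∎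

partsF-fuel : ∀ f f′ d M g → d ≤ f → d ≤ f′ → ∑ (partsF f d M) g ≡ ∑ (partsF f′ d M) g
partsF-fuel f       f′       zero    M g _       _        = refl
partsF-fuel (suc f) (suc f′) (suc d) M g (s≤s p) (s≤s p′) = trans (partsF-suc f d M g) (trans
  (Σ<-cong (suc d) (λ i → cong (𝟙 (i <ᵇ M) ⊗_) (partsF-fuel f f′ (d ∸ i) (suc i) (λ μ → g (suc i ∷ μ)) (ℕ.≤-trans (ℕ.m∸n≤m d i) p) (ℕ.≤-trans (ℕ.m∸n≤m d i) p′))))
  (sym (partsF-suc f′ d M g)))

-- A partition with parts at most r + 1 either has no part r + 1 or loses one such part, the
-- largest, which leaves a partition of the same kind.
partsF-split : ∀ d r g → ∑ (partsF d d (suc r)) g ≡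
  ∑ (partsF d d r) g ⊕ 𝟙 (r <ᵇ d) ⊗ ∑ (partsF (d ∸ suc r) (d ∸ suc r) (suc r)) (λ μ → g (suc r ∷ μ))
partsF-split zero    r g = sym (trans (cong ((g [] ⊕ 0ℚ) ⊕_) (0⊗ (g (suc r ∷ []) ⊕ 0ℚ))) (⊕0 (g [] ⊕ 0ℚ)))
partsF-split (suc d) r g = begin
  ∑ (partsF (suc d) (suc d) (suc r)) g
    ≡⟨ partsF-suc d d (suc r) g ⟩
  Σ< (suc d) (λ i → 𝟙 (i <ᵇ suc r) ⊗ K i)
    ≡⟨ Σ<-cong (suc d) (λ i → trans (cong (_⊗ K i) (<ᵇ-suc i r)) (ℚ.*-distribʳ-+ (K i) (𝟙 (i <ᵇ r)) (δ i r))) ⟩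
  Σ< (suc d) (λ i → 𝟙 (i <ᵇ r) ⊗ K i ⊕ δ i r ⊗ K i)
    ≡⟨ Σ<-⊕ (suc d) (λ i → 𝟙 (i <ᵇ r) ⊗ K i) (λ i → δ i r ⊗ K i) ⟩
  Σ< (suc d) (λ i → 𝟙 (i <ᵇ r) ⊗ K i) ⊕ Σ< (suc d) (λ i → δ i r ⊗ K i)
    ≡⟨ cong₂ _⊕_ (sym (partsF-suc d d r g)) tail ⟩
  ∑ (partsF (suc d) (suc d) r) g ⊕ 𝟙 (r <ᵇ suc d) ⊗ ∑ (partsF (d ∸ r) (d ∸ r) (suc r)) (λ μ → g (suc r ∷ μ)) ∎
  where
  K : ℕ → ℚ
  K i = ∑ (partsF d (d ∸ i) (suc i)) (λ μ → g (suc i ∷ μ))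
  fuelK : K r ≡ ∑ (partsF (d ∸ r) (d ∸ r) (suc r)) (λ μ → g (suc r ∷ μ))
  fuelK = partsF-fuel d (d ∸ r) (d ∸ r) (suc r) (λ μ → g (suc r ∷ μ)) (ℕ.m∸n≤m d r) ℕ.≤-refl
  tail : Σ< (suc d) (λ i → δ i r ⊗ K i) ≡ 𝟙 (r <ᵇ suc d) ⊗ ∑ (partsF (d ∸ r) (d ∸ r) (suc r)) (λ μ → g (suc r ∷ μ))
  tail with r ℕ.<? suc d
  ... | yes lt = trans (Σ<-single (suc d) r {λ i → δ i r ⊗ K i} lt (λ i i≢r → trans (cong (_⊗ K i) (δ-≢ i r i≢r)) (0⊗ (K i))))
    (cong₂ _⊗_ (trans (δ-refl r) (sym (cong 𝟙 (<ᵇ-true lt)))) fuelK)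
  ... | no ¬lt = trans (Σ<-zero< (suc d) (λ i i<d → trans (cong (_⊗ K i) (δ-≢ i r (λ i≡r → ¬lt (subst (_< suc d) i≡r i<d)))) (0⊗ (K i))))
    (sym (trans (cong (λ b → 𝟙 b ⊗ ∑ (partsF (d ∸ r) (d ∸ r) (suc r)) (λ μ → g (suc r ∷ μ))) (<ᵇ-false (ℕ.≮⇒≥ ¬lt))) (0⊗ (∑ (partsF (d ∸ r) (d ∸ r) (suc r)) (λ μ → g (suc r ∷ μ))))))

IsPart : ℕ → ℕ → List ℕ → Set
IsPart d M μ = All (λ x → 1 ≤ x × x ≤ M) μ × csum μ ≡ d

partsF-IsPart : ∀ f d M → All (IsPart d M) (partsF f d M)
partsF-IsPart f       zero    M = ([] , refl) ∷ []
partsF-IsPart zero    (suc d) M = []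
partsF-IsPart (suc f) (suc d) M = All.concat⁺ (All.map⁺ (All.zipWith (λ {k} (t , 1≤k) →
    All.map⁺ (All.map (λ (pμ , sμ) →
        ((1≤k , ℕ.≤ᵇ⇒≤ k M (T-∧ˡ (k ≤ᵇ M) t)) ∷ All.map (λ (lo , hi) → lo , ℕ.≤-trans hi (ℕ.≤ᵇ⇒≤ k M (T-∧ˡ (k ≤ᵇ M) t))) pμ)
      , trans (cong (k +_) sμ) (ℕ.m+[n∸m]≡n (ℕ.≤ᵇ⇒≤ k (suc d) (T-∧ʳ (k ≤ᵇ M) t))))
      (partsF-IsPart f (suc d ∸ k) k)))
  (All.all-filter (λ k → Bool.T? ((k ≤ᵇ M) ∧ (k ≤ᵇ suc d))) (from1 (suc d))
  , All.filter⁺ (λ k → Bool.T? ((k ≤ᵇ M) ∧ (k ≤ᵇ suc d))) (All.map⁺ (All.universal (λ _ → s≤s z≤n) (upTo (suc d)))))))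

Πa : (ℕ → ℚ) → List ℕ → ℚ
Πa a = foldr (λ x r → a x ⊗ r) 1ℚ

uz : ℕ → ℕ → ℚ
uz r c = recip (r ℕ.^ c) ⊗ recip (c !)

-- The factors of 1/z_μ for part sizes up to N, with the largest size outermost, so that it grows
-- together with the bound in `Zle`.
rz : ℕ → List ℕ → ℚ
rz zero    μ = 1ℚ
rz (suc N) μ = uz (suc N) (count (suc N) μ) ⊗ rz N μ

rz-zλ : ∀ μ → recip (zλ μ) ≡ rz (csum μ) μ
rz-zλ μ = trans (cong (λ xs → recip (foldr F 1 xs)) (from1≡ (csum μ))) (trans (front (csum μ) suc) (sym (snoc (csum μ))))
  where
  F : ℕ → ℕ → ℕ
  F r acc = (r ℕ.^ count r μ) * (count r μ !) * acc
  u : ℕ → ℚ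
  u r = uz r (count r μ)
  Πf : ℕ → (ℕ → ℚ) → ℚ
  Πf zero    g = 1ℚ
  Πf (suc N) g = g 0 ⊗ Πf N (g ∘ suc)
  Πf-last : ∀ N g → Πf (suc N) g ≡ g N ⊗ Πf N g
  Πf-last zero    g = refl
  Πf-last (suc N) g = trans (cong (g 0 ⊗_) (Πf-last N (g ∘ suc))) (⊗-swap (g 0) (g (suc N)) (Πf N (g ∘ suc)))
  front : ∀ N (h : ℕ → ℕ) → recip (foldr F 1 (applyUpTo h N)) ≡ Πf N (u ∘ h)
  front zero    h = refl
  front (suc N) h = trans (recip-* ((h 0 ℕ.^ count (h 0) μ) * (count (h 0) μ !)) (foldr F 1 (applyUpTo (h ∘ suc) N)))
    (cong₂ _⊗_ (recip-* (h 0 ℕ.^ count (h 0) μ) (count (h 0) μ !)) (front N (h ∘ suc)))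
  snoc : ∀ N → rz N μ ≡ Πf N (u ∘ suc)
  snoc zero    = refl
  snoc (suc N) = trans (cong (u (suc N) ⊗_) (snoc N)) (sym (Πf-last N (u ∘ suc)))

count-0 : ∀ r {μ} → All (λ x → 1 ≤ x × x ≤ r) μ → count (suc r) μ ≡ 0
count-0 r []             = refl
count-0 r {x ∷ μ} ((_ , x≤r) ∷ p) with x ≡ᵇ suc r in eq
... | false = count-0 r p
... | true  = ⊥-elim (ℕ.<-irrefl (ℕ.≡ᵇ⇒≡ x (suc r) (subst T (sym eq) tt)) (s≤s x≤r))

count-same : ∀ r μ → count r (r ∷ μ) ≡ suc (count r μ)
count-same r μ with r ≡ᵇ r | ℕ.≡⇒≡ᵇ r r refl
... | true | _ = refl

count-diff : ∀ r x μ → x ≢ r → count r (x ∷ μ) ≡ count r μ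
count-diff r x μ neq with x ≡ᵇ r in eq
... | false = refl
... | true  = ⊥-elim (neq (ℕ.≡ᵇ⇒≡ x r (subst T (sym eq) tt)))

rz-∷ : ∀ N x μ → N < x → rz N (x ∷ μ) ≡ rz N μ
rz-∷ zero    x μ lt = refl
rz-∷ (suc N) x μ lt = cong₂ (λ c z → uz (suc N) c ⊗ z) (count-diff (suc N) x μ (ℕ.>⇒≢ lt)) (rz-∷ N x μ (ℕ.<-trans (ℕ.n<1+n N) lt))

module Partitions (m : ℕ) where
  open PolyC m public

  Ex : Fun → Fun
  Ex f v = Σ< (suc (deg v)) (λ j → recip (j !) ⊗ pow f j v)

  Ex-extend : ∀ {f} → Vanish₀ f → ∀ N v → deg v < N → Ex f v ≡ Σ< N (λ j → recip (j !) ⊗ pow f j v)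
  Ex-extend f₀ N v lt = Σ<-extend (suc (deg v)) N lt (λ j v<j → trans (cong (recip (j !) ⊗_) (pow-vanish f₀ j v v<j)) (⊗0 (recip (j !))))

  Ex-ode : ∀ f → Vanish₀ f → D (Ex f) ≐ D f ⋆ Ex f
  Ex-ode f f₀ v = begin
    nat n ⊗ Ex f v
      ≡⟨ sym (Σ<-*ˡ (suc n) (nat n) (λ j → recip (j !) ⊗ pow f j v)) ⟩
    nat n ⊗ (1ℚ ⊗ one v) ⊕ Σ< n (λ j → nat n ⊗ (recip (suc j !) ⊗ pow f (suc j) v))
      ≡⟨ cong₂ _⊕_ const (Σ<-cong n term) ⟩
    0ℚ ⊕ Σ< n (λ j → (D f ⋆ (recip (j !) · pow f j)) v)
      ≡⟨ trans (0⊕ _) (sym (⋆-Σˡ n (D f) (λ j → recip (j !) · pow f j) v)) ⟩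
    (D f ⋆ Σf n (λ j → recip (j !) · pow f j)) v
      ≡⟨ ⋆-local (D-Vanish₀ f) v (λ q q<v → sym (Ex-extend f₀ n q q<v)) ⟩
    (D f ⋆ Ex f) v ∎
    where
    n : ℕ
    n = deg v
    const : nat n ⊗ (1ℚ ⊗ one v) ≡ 0ℚ
    const with deg v
    ... | zero  = 0⊗ (1ℚ ⊗ 1ℚ)
    ... | suc d = ⊗0 (nat (suc d))
    term : ∀ j → nat n ⊗ (recip (suc j !) ⊗ pow f (suc j) v) ≡ (D f ⋆ (recip (j !) · pow f j)) v
    term j = begin
      nat n ⊗ (recip (suc j !) ⊗ pow f (suc j) v)                  ≡⟨ ⊗-swap (nat n) (recip (suc j !)) (pow f (suc j) v) ⟩
      recip (suc j !) ⊗ D (pow f (suc j)) v                        ≡⟨ cong (recip (suc j !) ⊗_) (D-pow f j v) ⟩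
      recip (suc j !) ⊗ (nat (suc j) ⊗ (D f ⋆ pow f j) v)          ≡⟨ sym (ℚ.*-assoc (recip (suc j !)) (nat (suc j)) ((D f ⋆ pow f j) v)) ⟩
      (recip (suc j !) ⊗ nat (suc j)) ⊗ (D f ⋆ pow f j) v          ≡⟨ cong (_⊗ (D f ⋆ pow f j) v) (recip-!-suc j) ⟩
      recip (j !) ⊗ (D f ⋆ pow f j) v                              ≡⟨ sym (⋆-·ˡ (recip (j !)) (D f) (pow f j) v) ⟩
      (D f ⋆ (recip (j !) · pow f j)) v ∎

  ⋆-homog-cong : ∀ {c f} (X Y : Fun) → Homog c f → ∀ v → (∀ w → c + deg w ≡ deg v → X w ≡ Y w) → (f ⋆ X) v ≡ (f ⋆ Y) v
  ⋆-homog-cong {c} {f} X Y hf v eq = ∑-cong-All (All.map (λ {qr} e → term (proj₁ qr) (proj₂ qr) e) (deg-splits v))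
    where
    term : ∀ q r → deg q + deg r ≡ deg v → f q ⊗ X r ≡ f q ⊗ Y r
    term q r e with deg q ℕ.≟ c
    ... | yes q≡ = cong (f q ⊗_) (eq r (trans (cong (_+ deg r) (sym q≡)) e))
    ... | no  q≢ = trans (cong (_⊗ X r) (hf q q≢)) (trans (0⊗ (X r)) (sym (trans (cong (_⊗ Y r) (hf q q≢)) (0⊗ (Y r)))))

  module _ (a : ℕ → ℚ) where

    weight : ℕ → List ℕ → Fun
    weight N μ v = Πa a μ ⊗ (rz N μ ⊗ pλ μ v)

    Zle : ℕ → Fun
    Zle M v = ∑ (partsF (deg v) (deg v) M) (λ μ → weight M μ v)

    -- Shifting 1 / c!, for the multiplicity c of the part suc r, to 1 / (j + c)! makes the removal of one such part
    -- a recursion in j (Tser-rec).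
    tw : ℕ → ℕ → List ℕ → Fun
    tw r j μ v = Πa a μ ⊗ (((recip (suc r ℕ.^ count (suc r) μ) ⊗ recip ((j + count (suc r) μ) !)) ⊗ rz r μ) ⊗ pλ μ v)

    Tser : ℕ → ℕ → Fun
    Tser r j v = ∑ (partsF (deg v) (deg v) (suc r)) (λ μ → tw r j μ v)

    -- The exponent a_r p_r / r of the factor that accounts for parts of size r, with index shifted
    -- by one.
    fr : ℕ → Fun
    fr r = (a (suc r) ⊗ recip (suc r)) · pk (suc r)

    fr-homog : ∀ r → Homog (suc r) (fr r)
    fr-homog r v neq = trans (cong ((a (suc r) ⊗ recip (suc r)) ⊗_) (homog-pk (suc r) v neq)) (⊗0 (a (suc r) ⊗ recip (suc r)))

    tw-∷ : ∀ r j μ → tw r j (suc r ∷ μ) ≐ fr r ⋆ tw r (suc j) μ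
    tw-∷ r j μ v = begin
      (a (suc r) ⊗ Πa a μ) ⊗ (((recip (suc r ℕ.^ count (suc r) (suc r ∷ μ)) ⊗ recip ((j + count (suc r) (suc r ∷ μ)) !)) ⊗ rz r (suc r ∷ μ)) ⊗ pmul (pk (suc r)) (pλ μ) v)
        ≡⟨ cong₂ (λ x y → (a (suc r) ⊗ Πa a μ) ⊗ (x ⊗ y))
             (cong₂ (λ k z → (recip (suc r ℕ.^ k) ⊗ recip ((j + k) !)) ⊗ z) (count-same (suc r) μ) (rz-∷ r (suc r) μ (ℕ.n<1+n r)))
             (pmul≐⋆ (pk (suc r)) (pλ μ) v) ⟩
      (a (suc r) ⊗ Πa a μ) ⊗ (((recip (suc r * suc r ℕ.^ c) ⊗ recip ((j + suc c) !)) ⊗ rz r μ) ⊗ (pk (suc r) ⋆ pλ μ) v)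
        ≡⟨ cong₂ (λ x y → (a (suc r) ⊗ Πa a μ) ⊗ (((x ⊗ recip (y !)) ⊗ rz r μ) ⊗ (pk (suc r) ⋆ pλ μ) v)) (recip-* (suc r) (suc r ℕ.^ c)) (ℕ.+-suc j c) ⟩
      (a (suc r) ⊗ Πa a μ) ⊗ ((((recip (suc r) ⊗ recip (suc r ℕ.^ c)) ⊗ recip ((suc j + c) !)) ⊗ rz r μ) ⊗ (pk (suc r) ⋆ pλ μ) v)
        ≡⟨ solve 7 (λ x p i q f z y → (x :* p) :* ((((i :* q) :* f) :* z) :* y) := (x :* i) :* ((p :* ((q :* f) :* z)) :* y)) refl
             (a (suc r)) (Πa a μ) (recip (suc r)) (recip (suc r ℕ.^ c)) (recip ((suc j + c) !)) (rz r μ) ((pk (suc r) ⋆ pλ μ) v) ⟩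
      (a (suc r) ⊗ recip (suc r)) ⊗ (k ⊗ (pk (suc r) ⋆ pλ μ) v)
        ≡⟨ cong ((a (suc r) ⊗ recip (suc r)) ⊗_) (sym (⋆-·ˡ k (pk (suc r)) (pλ μ) v)) ⟩
      (a (suc r) ⊗ recip (suc r)) ⊗ (pk (suc r) ⋆ (k · pλ μ)) v
        ≡⟨ sym (⋆-·ʳ (a (suc r) ⊗ recip (suc r)) (pk (suc r)) (k · pλ μ) v) ⟩
      (fr r ⋆ (k · pλ μ)) v
        ≡⟨ ⋆-congˡ (fr r) (λ w → ℚ.*-assoc (Πa a μ) ((recip (suc r ℕ.^ c) ⊗ recip ((suc j + c) !)) ⊗ rz r μ) (pλ μ w)) v ⟩
      (fr r ⋆ tw r (suc j) μ) v ∎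
      where
      c : ℕ
      c = count (suc r) μ
      k : ℚ
      k = Πa a μ ⊗ ((recip (suc r ℕ.^ c) ⊗ recip ((suc j + c) !)) ⊗ rz r μ)

    tw-small : ∀ r j μ v → count (suc r) μ ≡ 0 → tw r j μ v ≡ recip (j !) ⊗ weight r μ v
    tw-small r j μ v eq = trans (cong (λ k → Πa a μ ⊗ (((recip (suc r ℕ.^ k) ⊗ recip ((j + k) !)) ⊗ rz r μ) ⊗ pλ μ v)) eq)
      (trans (cong (λ k → Πa a μ ⊗ (((1ℚ ⊗ recip (k !)) ⊗ rz r μ) ⊗ pλ μ v)) (ℕ.+-identityʳ j))
        (solve 4 (λ p f z y → p :* (((con 1ℚ :* f) :* z) :* y) := f :* (p :* (z :* y))) refl (Πa a μ) (recip (j !)) (rz r μ) (pλ μ v)))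

    Tser-rec : ∀ r j → Tser r j ≐ recip (j !) · Zle r ⊞ fr r ⋆ Tser r (suc j)
    Tser-rec r j v = trans (partsF-split d r (λ μ → tw r j μ v)) (cong₂ _⊕_ small large)
      where
      d : ℕ
      d = deg v
      small : ∑ (partsF d d r) (λ μ → tw r j μ v) ≡ recip (j !) ⊗ Zle r v
      small = trans (∑-cong-All (All.map (λ {μ} ip → tw-small r j μ v (count-0 r (proj₁ ip))) (partsF-IsPart d d r))) (∑-*ˡ (partsF d d r) (recip (j !)) (λ μ → weight r μ v))
      Y : Fun
      Y w = ∑ (partsF (d ∸ suc r) (d ∸ suc r) (suc r)) (λ μ → tw r (suc j) μ w)
      large : 𝟙 (r <ᵇ d) ⊗ ∑ (partsF (d ∸ suc r) (d ∸ suc r) (suc r)) (λ μ → tw r j (suc r ∷ μ) v) ≡ (fr r ⋆ Tser r (suc j)) v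
      large with r ℕ.<? d
      ... | yes lt = trans (cong (λ b → 𝟙 b ⊗ ∑ (partsF (d ∸ suc r) (d ∸ suc r) (suc r)) (λ μ → tw r j (suc r ∷ μ) v)) (<ᵇ-true lt)) (trans (1⊗ (∑ (partsF (d ∸ suc r) (d ∸ suc r) (suc r)) (λ μ → tw r j (suc r ∷ μ) v)))
        (trans (∑-cong (partsF (d ∸ suc r) (d ∸ suc r) (suc r)) (λ μ → tw-∷ r j μ v))
          (trans (sym (Σ⋆ (partsF (d ∸ suc r) (d ∸ suc r) (suc r)) (fr r) (λ μ → tw r (suc j) μ) v))
            (⋆-homog-cong Y (Tser r (suc j)) (fr-homog r) v (λ w e → cong (λ z → ∑ (partsF z z (suc r)) (λ μ → tw r (suc j) μ w))
              (trans (cong (_∸ suc r) (sym e)) (ℕ.m+n∸m≡n (suc r) (deg w))))))))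
      ... | no ¬lt = trans (cong (λ b → 𝟙 b ⊗ ∑ (partsF (d ∸ suc r) (d ∸ suc r) (suc r)) (λ μ → tw r j (suc r ∷ μ) v)) (<ᵇ-false (ℕ.≮⇒≥ ¬lt)))
        (trans (0⊗ (∑ (partsF (d ∸ suc r) (d ∸ suc r) (suc r)) (λ μ → tw r j (suc r ∷ μ) v))) (sym (trans
          (⋆-homog-cong (Tser r (suc j)) (λ _ → 0ℚ) (fr-homog r) v (λ w e → ⊥-elim (¬lt (subst (suc r ≤_) e (ℕ.m≤m+n (suc r) (deg w))))))
          (∑-zero (splits v) (λ qr → ⊗0 (fr r (proj₁ qr)))))))

    fr₀ : ∀ r → Vanish₀ (fr r)
    fr₀ r v eq = fr-homog r v (λ e → ℕ.0≢1+n (trans (sym eq) e))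

    Tser-iter : ∀ r N → Tser r 0 ≐ Σf N (λ j → recip (j !) · (pow (fr r) j ⋆ Zle r)) ⊞ pow (fr r) N ⋆ Tser r N
    Tser-iter r zero    v = sym (trans (0⊕ _) (one⋆ (Tser r 0) v))
    Tser-iter r (suc N) v = begin
      Tser r 0 v
        ≡⟨ Tser-iter r N v ⟩
      S ⊕ (pow (fr r) N ⋆ Tser r N) v
        ≡⟨ cong (S ⊕_) (trans (⋆-congˡ (pow (fr r) N) (Tser-rec r N) v) (⋆-⊞ˡ (pow (fr r) N) (recip (N !) · Zle r) (fr r ⋆ Tser r (suc N)) v)) ⟩
      S ⊕ ((pow (fr r) N ⋆ (recip (N !) · Zle r)) v ⊕ (pow (fr r) N ⋆ (fr r ⋆ Tser r (suc N))) v)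
        ≡⟨ cong₂ (λ x y → S ⊕ (x ⊕ y)) (⋆-·ˡ (recip (N !)) (pow (fr r) N) (Zle r) v)
             (trans (sym (⋆-assoc (pow (fr r) N) (fr r) (Tser r (suc N)) v)) (⋆-congʳ (Tser r (suc N)) (P-comm (pow (fr r) N) (fr r)) v)) ⟩
      S ⊕ (recip (N !) ⊗ (pow (fr r) N ⋆ Zle r) v ⊕ (pow (fr r) (suc N) ⋆ Tser r (suc N)) v)
        ≡⟨ sym (ℚ.+-assoc S (recip (N !) ⊗ (pow (fr r) N ⋆ Zle r) v) _) ⟩
      (S ⊕ recip (N !) ⊗ (pow (fr r) N ⋆ Zle r) v) ⊕ (pow (fr r) (suc N) ⋆ Tser r (suc N)) v
        ≡⟨ cong (_⊕ (pow (fr r) (suc N) ⋆ Tser r (suc N)) v) (sym (Σ<-last N (λ j → recip (j !) ⊗ (pow (fr r) j ⋆ Zle r) v))) ⟩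
      Σ< (suc N) (λ j → recip (j !) ⊗ (pow (fr r) j ⋆ Zle r) v) ⊕ (pow (fr r) (suc N) ⋆ Tser r (suc N)) v ∎
      where
      S : ℚ
      S = Σ< N (λ j → recip (j !) ⊗ (pow (fr r) j ⋆ Zle r) v)

    -- Iterating the removal of parts r + 1 more often than the degree allows kills the remainder.
    -- What is left is the exponential series of `fr r` times the sum over partitions with smaller
    -- parts.
    Zle-suc : ∀ r → Zle (suc r) ≐ Ex (fr r) ⋆ Zle r
    Zle-suc r v = begin
      Zle (suc r) v
        ≡⟨ Tser-iter r N v ⟩
      Σ< N (λ j → recip (j !) ⊗ (pow (fr r) j ⋆ Zle r) v) ⊕ (pow (fr r) N ⋆ Tser r N) v
        ≡⟨ cong₂ _⊕_ (Σ<-cong N (λ j → sym (⋆-·ʳ (recip (j !)) (pow (fr r) j) (Zle r) v)))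
             (trans (⋆-cong-deg {pow (fr r) N} {λ _ → 0ℚ} {Tser r N} {Tser r N} v (λ q q≤v → pow-vanish (fr₀ r) N q (s≤s q≤v)) (λ _ _ → refl))
               (∑-zero (splits v) (λ qr → 0⊗ (Tser r N (proj₂ qr))))) ⟩
      Σ< N (λ j → ((recip (j !) · pow (fr r) j) ⋆ Zle r) v) ⊕ 0ℚ
        ≡⟨ trans (⊕0 _) (sym (⋆-Σʳ N (λ j → recip (j !) · pow (fr r) j) (Zle r) v)) ⟩
      (Σf N (λ j → recip (j !) · pow (fr r) j) ⋆ Zle r) v
        ≡⟨ ⋆-cong-deg {g = Zle r} {Zle r} v (λ q q≤v → sym (Ex-extend (fr₀ r) N q (s≤s q≤v))) (λ _ _ → refl) ⟩
      (Ex (fr r) ⋆ Zle r) v ∎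
      where
      N : ℕ
      N = suc (deg v)

    PM : ℕ → Fun
    PM zero    v = 0ℚ
    PM (suc r) v = a (suc r) ⊗ pk (suc r) v ⊕ PM r v

    D-fr : ∀ r → D (fr r) ≐ a (suc r) · pk (suc r)
    D-fr r v with deg v ℕ.≟ suc r
    ... | yes e = trans (cong (λ z → nat z ⊗ ((a (suc r) ⊗ recip (suc r)) ⊗ pk (suc r) v)) e)
      (trans (solve 4 (λ n x i p → n :* ((x :* i) :* p) := (i :* n) :* (x :* p)) refl (nat (suc r)) (a (suc r)) (recip (suc r)) (pk (suc r) v))
        (trans (cong (_⊗ (a (suc r) ⊗ pk (suc r) v)) (recip-nat r)) (1⊗ (a (suc r) ⊗ pk (suc r) v))))
    ... | no ne = trans (cong (nat (deg v) ⊗_) (fr-homog r v ne)) (trans (⊗0 (nat (deg v))) (sym (trans (cong (a (suc r) ⊗_) (homog-pk (suc r) v ne)) (⊗0 (a (suc r))))))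

    Zle-0 : Zle 0 ≐ one
    Zle-0 v with deg v in eq
    ... | zero  = trans (⊕0 (1ℚ ⊗ (1ℚ ⊗ pone v))) (trans (1⊗ (1ℚ ⊗ pone v)) (trans (1⊗ (pone v)) (trans (pone≐one v) (cong (λ z → 𝟙 (z ≡ᵇ 0)) eq))))
    ... | suc d = trans (partsF-suc d d 0 (λ μ → weight 0 μ v)) (Σ<-zero< (suc d) (λ i _ → 0⊗ (∑ (partsF d (d ∸ i) (suc i)) (λ μ → weight 0 (suc i ∷ μ) v))))

    Zle-ode : ∀ M → D (Zle M) ≐ PM M ⋆ Zle M
    Zle-ode zero    v = trans (cong (nat (deg v) ⊗_) (Zle-0 v)) (trans const (sym (∑-zero (splits v) (λ qr → 0⊗ (Zle 0 (proj₂ qr))))))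
      where
      const : nat (deg v) ⊗ one v ≡ 0ℚ
      const with deg v
      ... | zero  = refl
      ... | suc d = ⊗0 (nat (suc d))
    Zle-ode (suc r) v = begin
      D (Zle (suc r)) v                               ≡⟨ cong (nat (deg v) ⊗_) (Zle-suc r v) ⟩
      D (Ex (fr r) ⋆ Zle r) v                         ≡⟨ ode-⋆ {D (fr r)} {PM r} {Ex (fr r)} {Zle r} (Ex-ode (fr r) (fr₀ r)) (Zle-ode r) v ⟩
      ((D (fr r) ⊞ PM r) ⋆ (Ex (fr r) ⋆ Zle r)) v     ≡⟨ ⋆-cong (λ q → cong (_⊕ PM r q) (D-fr r q)) (≐-sym (Zle-suc r)) v ⟩
      (PM (suc r) ⋆ Zle (suc r)) v ∎

    -- The series Σ_r a_r p_r without truncation: p_r is supported on exponent vectors of degree r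
    -- with a single non-zero entry.
    P : Fun
    P v = 𝟙 (nonzeros v ≡ᵇ 1) ⊗ a (deg v)

    PM-hi : ∀ M v → M < deg v → PM M v ≡ 0ℚ
    PM-hi zero    v lt = refl
    PM-hi (suc r) v lt = trans (cong₂ _⊕_ (trans (cong (a (suc r) ⊗_) (homog-pk (suc r) v (ℕ.>⇒≢ lt))) (⊗0 (a (suc r)))) (PM-hi r v (ℕ.<-trans (ℕ.n<1+n r) lt))) refl

  nonzeros-0 : ∀ {k} (v : Vec ℕ k) → vsum v ≡ 0 → nonzeros v ≡ 0
  nonzeros-0 []          eq = refl
  nonzeros-0 (zero ∷ vs) eq = nonzeros-0 vs eq

  P₀ : ∀ a → Vanish₀ (P a)
  P₀ a v eq = trans (cong (λ z → 𝟙 (z ≡ᵇ 1) ⊗ a (deg v)) (nonzeros-0 v eq)) (0⊗ (a (deg v)))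

  PM-P : ∀ a M v → deg v ≤ M → PM a M v ≡ P a v
  PM-P a zero    v le = sym (P₀ a v (ℕ.n≤0⇒n≡0 le))
  PM-P a (suc r) v le with deg v ℕ.≟ suc r
  ... | yes e = trans (cong (a (suc r) ⊗ pk (suc r) v ⊕_) (PM-hi a r v (subst (r <_) (sym e) (ℕ.n<1+n r)))) (trans (⊕0 (a (suc r) ⊗ pk (suc r) v))
    (trans (cong₂ _⊗_ (cong a (sym e)) (trans (cong (λ b → if b ∧ (nonzeros v ≡ᵇ 1) then 1ℚ else 0ℚ) (T⇒≡true (ℕ.≡⇒≡ᵇ (deg v) (suc r) e))) (ite≡𝟙 (nonzeros v ≡ᵇ 1))))
      (ℚ.*-comm (a (deg v)) (𝟙 (nonzeros v ≡ᵇ 1)))))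
  ... | no ne = trans (cong (_⊕ PM a r v) (trans (cong (a (suc r) ⊗_) (homog-pk (suc r) v ne)) (⊗0 (a (suc r))))) (trans (0⊕ (PM a r v))
    (PM-P a r v (s≤s⁻¹ (ℕ.≤∧≢⇒< le ne))))

  -- The full sum of a_λ p_λ / z_λ. Bounding the parts by the degree loses nothing, by `Zle-stable`.
  Zs : (ℕ → ℚ) → Fun
  Zs a v = Zle a (deg v) v

  Zle-stable : ∀ a M v → deg v ≤ M → Zle a M v ≡ Zs a v
  Zle-stable a M v le = go (M ∸ deg v) M (ℕ.m∸n+n≡m le)
    where
    go : ∀ e M → e + deg v ≡ M → Zle a M v ≡ Zs a v
    go zero    .(deg v)           refl = refl
    go (suc e) .(suc (e + deg v)) refl = trans (Tser-rec a (e + deg v) 0 v) (trans (cong₂ _⊕_ (1⊗ (Zle a (e + deg v) v)) rest) (trans (⊕0 (Zle a (e + deg v) v)) (go e (e + deg v) refl)))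
      where
      rest : (fr a (e + deg v) ⋆ Tser a (e + deg v) 1) v ≡ 0ℚ
      rest = trans (⋆-homog-cong (Tser a (e + deg v) 1) (λ _ → 0ℚ) (fr-homog a (e + deg v)) v
          (λ w eq → ⊥-elim (ℕ.<-irrefl refl (ℕ.<-≤-trans (s≤s (ℕ.m≤n+m (deg v) e)) (subst (suc (e + deg v) ≤_) eq (ℕ.m≤m+n (suc (e + deg v)) (deg w)))))))
        (∑-zero (splits v) (λ qr → ⊗0 (fr a (e + deg v) (proj₁ qr))))

  Zs-ode : ∀ a → D (Zs a) ≐ P a ⋆ Zs a
  Zs-ode a v = trans (Zle-ode a (deg v) v) (⋆-cong-deg v (λ q q≤v → PM-P a (deg v) q q≤v) (λ q q≤v → Zle-stable a (deg v) q q≤v))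

  Zs-partitions : ∀ a v → Zs a v ≡ ∑ (partitions (deg v)) (λ μ → Πa a μ ⊗ (recip (zλ μ) ⊗ pλ μ v))
  Zs-partitions a v = ∑-cong-All (All.map (λ {μ} ip → cong (λ z → Πa a μ ⊗ (z ⊗ pλ μ v)) (sym (trans (rz-zλ μ) (cong (λ d → rz d μ) (proj₂ ip))))) (partsF-IsPart (deg v) (deg v) (deg v)))

  Zs-at-0 : ∀ a v → deg v ≡ 0 → Zs a v ≡ 1ℚ
  Zs-at-0 a v eq = trans (cong (λ z → Zle a z v) eq) (trans (Zle-0 a v) (cong (λ z → 𝟙 (z ≡ᵇ 0)) eq))

  ⋆-at-0-1 : ∀ f g → (∀ p → deg p ≡ 0 → f p ≡ 1ℚ) → (∀ p → deg p ≡ 0 → g p ≡ 1ℚ) → ∀ p → deg p ≡ 0 → (f ⋆ g) p ≡ 1ℚ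
  ⋆-at-0-1 = Realisation.⋆-at-0≡1 (polyI m)

  Zs-unique : ∀ a X → D X ≐ P a ⋆ X → (∀ v → deg v ≡ 0 → X v ≡ 1ℚ) → X ≐ Zs a
  Zs-unique a X DX X1 = ode-unique (P₀ a) DX (Zs-ode a) (λ v eq → trans (X1 v eq) (sym (Zs-at-0 a v eq)))

  Zs-cong : ∀ {a b : ℕ → ℚ} → (∀ r → a r ≡ b r) → Zs a ≐ Zs b
  Zs-cong {a} {b} eq = Zs-unique b (Zs a) (λ v → trans (Zs-ode a v) (⋆-congʳ (Zs a) (λ q → cong (𝟙 (nonzeros q ≡ᵇ 1) ⊗_) (eq (deg q))) v)) (Zs-at-0 a)

  Zs-⋆ : ∀ a b → Zs a ⋆ Zs b ≐ Zs (λ r → a r ⊕ b r)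
  Zs-⋆ a b = Zs-unique (λ r → a r ⊕ b r) (Zs a ⋆ Zs b)
    (λ v → trans (ode-⋆ {P a} {P b} {Zs a} {Zs b} (Zs-ode a) (Zs-ode b) v)
      (⋆-congʳ (Zs a ⋆ Zs b) (λ q → sym (ℚ.*-distribˡ-+ (𝟙 (nonzeros q ≡ᵇ 1)) (a (deg q)) (b (deg q)))) v))
    (⋆-at-0-1 (Zs a) (Zs b) (Zs-at-0 a) (Zs-at-0 b))

  Zs-θ : ∀ a → θ (Zs a) ≐ Zs (λ r → negOnePow r ⊗ a r)
  Zs-θ a = Zs-unique (λ r → negOnePow r ⊗ a r) (θ (Zs a))
    (λ v → begin
      nat (deg v) ⊗ (negOnePow (deg v) ⊗ Zs a v)   ≡⟨ ⊗-swap (nat (deg v)) (negOnePow (deg v)) (Zs a v) ⟩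
      negOnePow (deg v) ⊗ D (Zs a) v               ≡⟨ cong (negOnePow (deg v) ⊗_) (Zs-ode a v) ⟩
      θ (P a ⋆ Zs a) v                             ≡⟨ θ-⋆ (P a) (Zs a) v ⟩
      (θ (P a) ⋆ θ (Zs a)) v                       ≡⟨ ⋆-congʳ (θ (Zs a)) (λ q → ⊗-swap (negOnePow (deg q)) (𝟙 (nonzeros q ≡ᵇ 1)) (a (deg q))) v ⟩
      (P (λ r → negOnePow r ⊗ a r) ⋆ θ (Zs a)) v ∎)
    (λ v eq → cong₂ (λ x y → negOnePow x ⊗ y) eq (Zs-at-0 a v eq))

  Zs-0 : Zs (λ _ → 0ℚ) ≐ one
  Zs-0 = ≐-sym (Zs-unique (λ _ → 0ℚ) one
    (λ v → trans (const v) (sym (trans (⋆one (P (λ _ → 0ℚ)) v) (⊗0 (𝟙 (nonzeros v ≡ᵇ 1)))))) (λ v eq → cong (λ z → 𝟙 (z ≡ᵇ 0)) eq))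
    where
    const : ∀ v → nat (deg v) ⊗ one v ≡ 0ℚ
    const v with deg v
    ... | zero  = refl
    ... | suc d = ⊗0 (nat (suc d))

-- Newton's identity and weights of odd and even parts.

ΔV-count₀ : ∀ {m} (v : Vec ℕ m) → ΔV v (λ u w → 𝟙 (nonzeros u ≡ᵇ 0)) ≡ 1ℚ
ΔV-count₀ []       = refl
ΔV-count₀ (a ∷ vs) = trans (ΔV-∷ a vs (λ u w → 𝟙 (nonzeros u ≡ᵇ 0))) (trans (Δℕ-cong a inner) (Δℕ-counitˡ a (λ _ → 1ℚ)))
  where
  inner : ∀ b c → ΔV vs (λ u w → 𝟙 (nonzeros (b ∷ u) ≡ᵇ 0)) ≡ 𝟙 (b ≡ᵇ 0) ⊗ 1ℚ
  inner zero    c = ΔV-count₀ vs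
  inner (suc b) c = ∑-0 (splitsV vs)

Δℕ-const : ∀ a y → Δℕ a (λ _ _ → y) ≡ nat (suc a) ⊗ y
Δℕ-const zero    y = trans (⊕0 y) (sym (1⊗ y))
Δℕ-const (suc a) y = trans (Δℕ-suc a (λ _ _ → y)) (trans (cong (y ⊕_) (Δℕ-const a y))
  (solve 2 (λ y n → y :+ n :* y := (con 1ℚ :+ n) :* y) refl y (nat (suc a))))

-- A factor x_i^r with 1 ≤ r ≤ v_i can be split off in v_i ways for every i. This is the coefficient
-- form of n h_n = Σ_r p_r h_{n-r}.
ΔV-count₁ : ∀ {m} (v : Vec ℕ m) → ΔV v (λ u w → 𝟙 (nonzeros u ≡ᵇ 1)) ≡ nat (vsum v)
ΔV-count₁ []       = refl
ΔV-count₁ (zero ∷ vs)  = trans (ΔV-∷ 0 vs (λ u w → 𝟙 (nonzeros u ≡ᵇ 1))) (trans (⊕0 (ΔV vs (λ u w → 𝟙 (nonzeros u ≡ᵇ 1)))) (ΔV-count₁ vs))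
ΔV-count₁ (suc a ∷ vs) = begin
  ΔV (suc a ∷ vs) (λ u w → 𝟙 (nonzeros u ≡ᵇ 1))
    ≡⟨ trans (ΔV-∷ (suc a) vs (λ u w → 𝟙 (nonzeros u ≡ᵇ 1))) (Δℕ-suc a (λ b c → ΔV vs (λ u w → 𝟙 (nonzeros (b ∷ u) ≡ᵇ 1)))) ⟩
  ΔV vs (λ u w → 𝟙 (nonzeros u ≡ᵇ 1)) ⊕ Δℕ a (λ b c → ΔV vs (λ u w → 𝟙 (nonzeros u ≡ᵇ 0)))
    ≡⟨ cong₂ _⊕_ (ΔV-count₁ vs) (trans (Δℕ-cong a (λ b c → ΔV-count₀ vs)) (trans (Δℕ-const a 1ℚ) (⊗1 (nat (suc a))))) ⟩
  nat (vsum vs) ⊕ nat (suc a)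
    ≡⟨ trans (ℚ.+-comm (nat (vsum vs)) (nat (suc a))) (sym (nat-+ (suc a) (vsum vs))) ⟩
  nat (suc a + vsum vs) ∎

-- The weight a_r at even r: in an even alternating word the signs ± cancel, in an odd one the first
-- sign remains. At odd r every block contributes 1, giving the number of blocks.
evenWeight : Bool → Bool → ℚ
evenWeight false _     = 0ℚ
evenWeight true  true  = 1ℚ
evenWeight true  false = ⊝ 1ℚ

partWeight : ℚ → ℚ → ℕ → ℚ
partWeight t e r = if isOdd r then t else e

mod2≡ᵇ1 : ∀ j → (j % 2 ≡ᵇ 1) ≡ isOdd j
mod2≡ᵇ1 j with isOdd j | mod2 j
... | true  | e = cong (_≡ᵇ 1) e
... | false | e = cong (_≡ᵇ 1) e

Πa-weight : ∀ t e μ → Πa (partWeight t e) μ ≡ pow₁ t (ℓo μ) ⊗ pow₁ e (ℓe μ)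
Πa-weight t e []      = refl
Πa-weight t e (x ∷ μ) rewrite mod2≡ᵇ1 x | mod2≡ᵇ0 x with isOdd x
... | true  = trans (cong (t ⊗_) (Πa-weight t e μ)) (sym (ℚ.*-assoc t (pow₁ t (ℓo μ)) (pow₁ e (ℓe μ))))
... | false = trans (cong (e ⊗_) (Πa-weight t e μ)) (⊗-swap e (pow₁ t (ℓo μ)) (pow₁ e (ℓe μ)))

ℓo-≤ : ∀ {M} μ → All (λ x → 1 ≤ x × x ≤ M) μ → ℓo μ ≤ csum μ
ℓo-≤ []      _              = z≤n
ℓo-≤ (x ∷ μ) ((1≤x , _) ∷ p) with x % 2 ≡ᵇ 1
... | true  = ℕ.+-mono-≤ 1≤x (ℓo-≤ μ p)
... | false = ℕ.≤-trans (ℓo-≤ μ p) (ℕ.m≤n+m (csum μ) x)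

condE : Tag → ℕ → Bool
condE tA e = e ≡ᵇ 0
condE tB e = (0 <ᵇ e) ∧ (e % 2 ≡ᵇ 0)
condE tC e = (0 <ᵇ e) ∧ (e % 2 ≡ᵇ 1)
condE tD e = 0 <ᵇ e
condE tE e = true
condE tP e = e ≡ᵇ 0
condE tM e = e ≡ᵇ 0

-- With e even parts, I^± contributes 0^e, J^+ contributes 1 and J^- contributes (-1)^e, where 0^0 =
-- 1. The coordinates of each family combine these into the indicator of its condition on e.
coef-condE : ∀ t e → L₄ (coef t) (λ p s → pow₁ (evenWeight p s) e) ≡ 𝟙 (condE t e)
coef-condE t zero    = zero-case t
  where
  zero-case : ∀ t → L₄ (coef t) (λ _ _ → 1ℚ) ≡ 𝟙 (condE t 0)
  zero-case tA = refl
  zero-case tB = refl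
  zero-case tC = refl
  zero-case tD = refl
  zero-case tE = refl
  zero-case tP = refl
  zero-case tM = refl
coef-condE t (suc e) = trans (L₄-cong (coef t) {λ p s → pow₁ (evenWeight p s) (suc e)} {vals (isOdd (suc e))} (bool² (0⊗ (pow₁ 0ℚ e)) (0⊗ (pow₁ 0ℚ e)) (ones (suc e)) (signs (suc e)))) (suc-case t)
  where
  vals : Bool → Bool → Bool → ℚ
  vals o false _     = 0ℚ
  vals o true  true  = 1ℚ
  vals o true  false = if o then ⊝ 1ℚ else 1ℚ
  ones : ∀ e → pow₁ 1ℚ e ≡ 1ℚ
  ones zero    = refl
  ones (suc e) = trans (1⊗ (pow₁ 1ℚ e)) (ones e)
  signs : ∀ e → pow₁ (⊝ 1ℚ) e ≡ (if isOdd e then ⊝ 1ℚ else 1ℚ)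
  signs e = trans (pow₁-neg 1ℚ e) (trans (cong (negOnePow e ⊗_) (ones e)) (trans (⊗1 (negOnePow e)) (negOnePow-isOdd e)))
  suc-case : ∀ t → L₄ (coef t) (vals (isOdd (suc e))) ≡ 𝟙 (condE t (suc e))
  suc-case tA with isOdd e
  ... | true  = refl
  ... | false = refl
  suc-case tB rewrite mod2≡ᵇ0 (suc e) with isOdd e
  ... | true  = refl
  ... | false = refl
  suc-case tC rewrite mod2≡ᵇ1 (suc e) with isOdd e
  ... | true  = refl
  ... | false = refl
  suc-case tD with isOdd e
  ... | true  = refl
  ... | false = refl
  suc-case tE with isOdd e
  ... | true  = refl
  ... | false = refl
  suc-case tP with isOdd e
  ... | true  = refl
  ... | false = refl
  suc-case tM with isOdd e
  ... | true  = refl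
  ... | false = refl

-- Images under Γ.

module Images (n : ℕ) where
  open Partitions n
  module PI = Signed (polyI n)
  module PE = EvComb (polyI n)

  v⁺≡1 : ∀ v → PI.v true v ≡ 1ℚ
  v⁺≡1 v with deg v in eq
  ... | zero  = trans (PI.ev-single [] v) (trans (ΓR-[] v) (cong (λ z → 𝟙 (z ≡ᵇ 0)) eq))
  ... | suc d = trans (PI.ev-single (suc d ∷ []) v) (trans (ΓR-single (suc d) v)
    (cong (λ b → if b then 1ℚ else 0ℚ) (T⇒≡true (ℕ.≡⇒≡ᵇ (vsum v) (suc d) eq))))

  sw : Bool → ℕ → ℚ
  sw true  r = 1ℚ
  sw false r = negOnePow r ⊗ ⊝ 1ℚ

  -- The image Σ_i h_i has all coefficients 1, so its differential equation is the count of
  -- `ΔV-count₁`.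
  v⁺≐Zs : PI.v true ≐ Zs (sw true)
  v⁺≐Zs = Zs-unique (sw true) (PI.v true) (λ v → begin
    nat (deg v) ⊗ PI.v true v                         ≡⟨ trans (cong (nat (deg v) ⊗_) (v⁺≡1 v)) (⊗1 (nat (deg v))) ⟩
    nat (deg v)                                       ≡⟨ sym (ΔV-count₁ v) ⟩
    ΔV v (λ u w → 𝟙 (nonzeros u ≡ᵇ 1))                ≡⟨ ΔV-cong v (λ u w → sym (trans (cong ((𝟙 (nonzeros u ≡ᵇ 1) ⊗ 1ℚ) ⊗_) (v⁺≡1 w)) (trans (⊗1 (𝟙 (nonzeros u ≡ᵇ 1) ⊗ 1ℚ)) (⊗1 (𝟙 (nonzeros u ≡ᵇ 1)))))) ⟩
    (P (sw true) ⋆ PI.v true) v ∎) (PI.v-at-0 true)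

  Z⁻ : Fun
  Z⁻ = Zs (λ _ → ⊝ 1ℚ)

  -- Elementary functions need not be computed: up to the degree sign, the image of V₁^- is the
  -- inverse of that of V₁^+, whose weights are the negatives.
  θv⁻ : PI.θ (PI.v false) ≐ Z⁻
  θv⁻ v = begin
    PI.θ (PI.v false) v                          ≡⟨ sym (one⋆ (PI.θ (PI.v false)) v) ⟩
    (one ⋆ PI.θ (PI.v false)) v                  ≡⟨ ⋆-congʳ (PI.θ (PI.v false)) (≐-sym left) v ⟩
    ((Z⁻ ⋆ PI.v true) ⋆ PI.θ (PI.v false)) v     ≡⟨ ⋆-assoc Z⁻ (PI.v true) (PI.θ (PI.v false)) v ⟩
    (Z⁻ ⋆ (PI.v true ⋆ PI.θ (PI.v false))) v     ≡⟨ ⋆-congˡ Z⁻ PI.inv⁺ v ⟩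
    (Z⁻ ⋆ one) v                                 ≡⟨ ⋆one Z⁻ v ⟩
    Z⁻ v ∎
    where
    left : Z⁻ ⋆ PI.v true ≐ one
    left q = trans (⋆-congˡ Z⁻ v⁺≐Zs q) (trans (Zs-⋆ (λ _ → ⊝ 1ℚ) (sw true) q) (trans (Zs-cong {λ _ → ⊝ 1ℚ ⊕ 1ℚ} {λ _ → 0ℚ} (λ _ → refl) q) (Zs-0 q)))

  v≐Zs : ∀ s → PI.v s ≐ Zs (sw s)
  v≐Zs true  = v⁺≐Zs
  v≐Zs false v = trans (sym (PI.θθ (PI.v false) v)) (trans (PI.θ-cong θv⁻ v) (Zs-θ (λ _ → ⊝ 1ℚ) v))

  V≐Zs : ∀ s → PI.V s ≐ Zs (λ r → sw s r ⊕ sw (not s) r)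
  V≐Zs s v = trans (⋆-cong (v≐Zs s) (v≐Zs (not s)) v) (Zs-⋆ (sw s) (sw (not s)) v)

  pow≐Zs : ∀ (a : ℕ → ℚ) X → X ≐ Zs a → ∀ k → pow X k ≐ Zs (λ r → nat k ⊗ a r)
  pow≐Zs a X eq zero    v = trans (sym (Zs-0 v)) (Zs-cong (λ r → sym (0⊗ (a r))) v)
  pow≐Zs a X eq (suc k) v = trans (⋆-cong eq (pow≐Zs a X eq k) v) (trans (Zs-⋆ a (λ r → nat k ⊗ a r) v)
    (Zs-cong (λ r → solve 2 (λ x n → x :+ n :* x := (con 1ℚ :+ n) :* x) refl (a r) (nat k)) v))

  sw-odd : ∀ s r → isOdd r ≡ true → sw s r ≡ 1ℚ
  sw-odd true  r e = refl
  sw-odd false r e = trans (cong (_⊗ ⊝ 1ℚ) (trans (negOnePow-isOdd r) (cong (λ b → if b then ⊝ 1ℚ else 1ℚ) e))) refl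

  sw-even : ∀ s r → isOdd r ≡ false → sw s r ≡ evenWeight true s
  sw-even true  r e = refl
  sw-even false r e = trans (cong (_⊗ ⊝ 1ℚ) (trans (negOnePow-isOdd r) (cong (λ b → if b then ⊝ 1ℚ else 1ℚ) e))) refl

  two-nat : ∀ j → nat j ⊗ (1ℚ ⊕ 1ℚ) ≡ nat (double j)
  two-nat j = trans (cong (_⊗ (1ℚ ⊕ 1ℚ)) (sym (nat-double-½ j))) (solve 1 (λ x → (x :* con ½) :* (con 1ℚ :+ con 1ℚ) := x) refl (nat (double j)))

  cancel-signs : ∀ s → evenWeight true s ⊕ evenWeight true (not s) ≡ 0ℚ
  cancel-signs true  = refl
  cancel-signs false = refl

  weight-even : ∀ s j r → nat j ⊗ (sw s r ⊕ sw (not s) r) ≡ partWeight (nat (double j)) 0ℚ r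
  weight-even s j r with isOdd r in eq
  ... | true  = trans (cong₂ (λ x y → nat j ⊗ (x ⊕ y)) (sw-odd s r eq) (sw-odd (not s) r eq)) (two-nat j)
  ... | false = trans (cong₂ (λ x y → nat j ⊗ (x ⊕ y)) (sw-even s r eq) (sw-even (not s) r eq)) (trans (cong (nat j ⊗_) (cancel-signs s)) (⊗0 (nat j)))

  weight-odd : ∀ s j r → sw s r ⊕ nat j ⊗ (sw (not s) r ⊕ sw s r) ≡ partWeight (nat (suc (double j))) (evenWeight true s) r
  weight-odd s j r with isOdd r in eq
  ... | true  = trans (cong₂ (λ x y → x ⊕ nat j ⊗ (y ⊕ x)) (sw-odd s r eq) (sw-odd (not s) r eq)) (cong (1ℚ ⊕_) (two-nat j))
  ... | false = trans (cong₂ (λ x y → x ⊕ nat j ⊗ (y ⊕ x)) (sw-even s r eq) (sw-even (not s) r eq))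
    (trans (cong (λ z → evenWeight true s ⊕ nat j ⊗ z) (trans (ℚ.+-comm (evenWeight true (not s)) (evenWeight true s)) (cancel-signs s))) (trans (cong (evenWeight true s ⊕_) (⊗0 (nat j))) (⊕0 (evenWeight true s))))

  el-Zs : ∀ p s j v → Σ< (suc (deg v)) (λ k → pow₁ (nat (num p j)) k ⊗ PE.elK p s k v) ≡ Zs (partWeight (nat (num p j)) (evenWeight p s)) v
  el-Zs false s j v = trans (PI.I-even s j v) (trans (pow≐Zs (λ r → sw s r ⊕ sw (not s) r) (PI.V s) (V≐Zs s) j v) (Zs-cong (weight-even s j) v))
  el-Zs true  s j v = trans (PI.J-odd s j v) (trans (⋆-cong (v≐Zs s) (pow≐Zs (λ r → sw (not s) r ⊕ sw s r) (PI.v (not s) ⋆ PI.v s)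
      (λ q → trans (⋆-cong (v≐Zs (not s)) (v≐Zs s) q) (Zs-⋆ (sw (not s)) (sw s) q)) j) v)
    (trans (Zs-⋆ (sw s) (λ r → nat j ⊗ (sw (not s) r ⊕ sw s r)) v) (Zs-cong (weight-odd s j) v)))

  term : List ℕ → Fun
  term μ v = recip (zλ μ) ⊗ pλ μ v

  -- For m blocks the weights give m^{ℓ_o} times a factor depending only on ℓ_e, so the coefficient
  -- of m^k selects the partitions with k odd parts.
  el-image : ∀ p s k v → k ≤ deg v → PE.elK p s k v ≡ ∑ (partitions (deg v)) (λ μ → (δ (ℓo μ) k ⊗ pow₁ (evenWeight p s) (ℓe μ)) ⊗ term μ v)
  el-image p s k v k≤ = interpolate N (λ k → PE.elK p s k v) (λ k → ∑ PP (λ μ → (δ (ℓo μ) k ⊗ pow₁ e (ℓe μ)) ⊗ term μ v)) (λ j → nat (num p j)) (num-inj p)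
    (λ j → trans (el-Zs p s j v) (expand (nat (num p j)))) k (s≤s k≤)
    where
    N : ℕ
    N = suc (deg v)
    PP : List (List ℕ)
    PP = partitions (deg v)
    e : ℚ
    e = evenWeight p s
    expand : ∀ t → Zs (partWeight t e) v ≡ Σ< N (λ k → pow₁ t k ⊗ ∑ PP (λ μ → (δ (ℓo μ) k ⊗ pow₁ e (ℓe μ)) ⊗ term μ v))
    expand t = begin
      Zs (partWeight t e) v
        ≡⟨ Zs-partitions (partWeight t e) v ⟩
      ∑ PP (λ μ → Πa (partWeight t e) μ ⊗ term μ v)
        ≡⟨ ∑-cong-All (All.map (λ {μ} ip → trans (cong (_⊗ term μ v) (Πa-weight t e μ)) (sym (single μ (ℕ.≤-trans (ℓo-≤ μ (proj₁ ip)) (ℕ.≤-reflexive (proj₂ ip)))))) (partsF-IsPart (deg v) (deg v) (deg v))) ⟩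
      ∑ PP (λ μ → Σ< N (λ k → pow₁ t k ⊗ ((δ (ℓo μ) k ⊗ pow₁ e (ℓe μ)) ⊗ term μ v)))
        ≡⟨ sym (Σ<-∑ N PP (λ k μ → pow₁ t k ⊗ ((δ (ℓo μ) k ⊗ pow₁ e (ℓe μ)) ⊗ term μ v))) ⟩
      Σ< N (λ k → ∑ PP (λ μ → pow₁ t k ⊗ ((δ (ℓo μ) k ⊗ pow₁ e (ℓe μ)) ⊗ term μ v)))
        ≡⟨ Σ<-cong N (λ k → ∑-*ˡ PP (pow₁ t k) (λ μ → (δ (ℓo μ) k ⊗ pow₁ e (ℓe μ)) ⊗ term μ v)) ⟩
      Σ< N (λ k → pow₁ t k ⊗ ∑ PP (λ μ → (δ (ℓo μ) k ⊗ pow₁ e (ℓe μ)) ⊗ term μ v)) ∎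
      where
      single : ∀ μ → ℓo μ ≤ deg v → Σ< N (λ k → pow₁ t k ⊗ ((δ (ℓo μ) k ⊗ pow₁ e (ℓe μ)) ⊗ term μ v)) ≡ (pow₁ t (ℓo μ) ⊗ pow₁ e (ℓe μ)) ⊗ term μ v
      single μ le = trans (Σ<-single N (ℓo μ) {λ k → pow₁ t k ⊗ ((δ (ℓo μ) k ⊗ pow₁ e (ℓe μ)) ⊗ term μ v)} (s≤s le)
          (λ i i≢ → trans (cong (λ z → pow₁ t i ⊗ ((z ⊗ pow₁ e (ℓe μ)) ⊗ term μ v)) (δ-≢ (ℓo μ) i (i≢ ∘ sym)))
            (solve 3 (λ a b c → a :* ((con 0ℚ :* b) :* c) := con 0ℚ) refl (pow₁ t i) (pow₁ e (ℓe μ)) (term μ v))))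
        (trans (cong (λ z → pow₁ t (ℓo μ) ⊗ ((z ⊗ pow₁ e (ℓe μ)) ⊗ term μ v)) (δ-refl (ℓo μ)))
          (solve 3 (λ a b c → a :* ((con 1ℚ :* b) :* c) := (a :* b) :* c) refl (pow₁ t (ℓo μ)) (pow₁ e (ℓe μ)) (term μ v)))

  ev-image : ∀ t k v → k ≤ deg v → PI.ev (elF t (deg v) k) v ≡ ∑ (partitions (deg v)) (λ μ → 𝟙 ((ℓo μ ≡ᵇ k) ∧ condE t (ℓe μ)) ⊗ term μ v)
  ev-image t k v k≤ = begin
    PI.ev (elF t (deg v) k) v
      ≡⟨ PE.ev-elF t k v ⟩
    L₄ (coef t) (λ p s → PE.elK p s k v)
      ≡⟨ L₄-cong (coef t) (λ p s → el-image p s k v k≤) ⟩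
    L₄ (coef t) (λ p s → ∑ (partitions (deg v)) (λ μ → (δ (ℓo μ) k ⊗ pow₁ (evenWeight p s) (ℓe μ)) ⊗ term μ v))
      ≡⟨ sym (∑-L₄ (partitions (deg v)) (coef t) (λ μ p s → (δ (ℓo μ) k ⊗ pow₁ (evenWeight p s) (ℓe μ)) ⊗ term μ v)) ⟩
    ∑ (partitions (deg v)) (λ μ → L₄ (coef t) (λ p s → (δ (ℓo μ) k ⊗ pow₁ (evenWeight p s) (ℓe μ)) ⊗ term μ v))
      ≡⟨ ∑-cong (partitions (deg v)) (λ μ → trans (sym (L₄-*ʳ (coef t) (λ p s → δ (ℓo μ) k ⊗ pow₁ (evenWeight p s) (ℓe μ)) (term μ v)))
           (cong (_⊗ term μ v) (trans (sym (L₄-*ˡ (coef t) (λ p s → pow₁ (evenWeight p s) (ℓe μ)) (δ (ℓo μ) k)))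
             (trans (cong (δ (ℓo μ) k ⊗_) (coef-condE t (ℓe μ))) (sym (𝟙-∧ (ℓo μ ≡ᵇ k) (condE t (ℓe μ)))))))) ⟩
    ∑ (partitions (deg v)) (λ μ → 𝟙 ((ℓo μ ≡ᵇ k) ∧ condE t (ℓe μ)) ⊗ term μ v) ∎

  Γ≡ev : ∀ x v → Γ n x v ≡ PI.ev x v
  Γ≡ev x v = psum-∑ _ x v

  target≡∑ : ∀ cond v → target n cond v ≡ ∑ (partitions n) (λ μ → 𝟙 (cond μ) ⊗ term μ v)
  target≡∑ cond v = trans (psum-∑ (λ μ → pscale (recip (zλ μ)) (pλ μ)) (filterᵇ cond (partitions n)) v) (∑-filter cond (partitions n) (λ μ → term μ v))

  Γ-image : ∀ t k cond → k ≤ n → (∀ μ → cond μ ≡ (ℓo μ ≡ᵇ k) ∧ condE t (ℓe μ)) → Γ n (elF t n k) ≈P target n cond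
  Γ-image t k cond k≤n ceq v with vsum v ℕ.≟ n
  ... | yes e = trans (Γ≡ev (elF t n k) v) (trans (cong (λ d → PI.ev (elF t d k) v) (sym e)) (trans (ev-image t k v (subst (k ≤_) (sym e) k≤n))
    (trans (cong (λ d → ∑ (partitions d) (λ μ → 𝟙 ((ℓo μ ≡ᵇ k) ∧ condE t (ℓe μ)) ⊗ term μ v)) e)
      (trans (∑-cong (partitions n) (λ μ → cong (λ b → 𝟙 b ⊗ term μ v) (sym (ceq μ)))) (sym (target≡∑ cond v))))))
  ... | no ne = trans (Γ≡ev (elF t n k) v) (trans (PI.ev-deg (elF t n k) (valid-elF t n k) v ne)
    (sym (trans (target≡∑ cond v) (∑-zero-All (All.map (λ {μ} ip → trans (cong (λ z → 𝟙 (cond μ) ⊗ (recip (zλ μ) ⊗ z)) (homog-pλ μ v (λ e → ne (trans e (proj₂ ip)))))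
      (trans (cong (𝟙 (cond μ) ⊗_) (⊗0 (recip (zλ μ)))) (⊗0 (𝟙 (cond μ))))) (partsF-IsPart n n n))))))

-- Positivity and the coefficient of the identity permutation.

recip-≥0 : ∀ k → 0ℚ ℚ.≤ recip k
recip-≥0 zero    = ℚ.≤-refl
recip-≥0 (suc k) = ℚ.nonNegative⁻¹ (recip (suc k)) {{ℚ.normalize-nonNeg 1 (suc k)}}

recip->0 : ∀ k → 1 ≤ k → 0ℚ ℚ.< recip k
recip->0 (suc k) _ = ℚ.positive⁻¹ (recip (suc k)) {{ℚ.normalize-pos 1 (suc k)}}

∑-≥0 : ∀ {A : Set} {xs : List A} {f : A → ℚ} → All (λ x → 0ℚ ℚ.≤ f x) xs → 0ℚ ℚ.≤ ∑ xs f
∑-≥0 []       = ℚ.≤-refl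
∑-≥0 (p ∷ ps) = ℚ.+-mono-≤ p (∑-≥0 ps)

∑->0 : ∀ {A : Set} {xs : List A} {f : A → ℚ} {y} → All (λ x → 0ℚ ℚ.≤ f x) xs → y ∈ xs → 0ℚ ℚ.< f y → 0ℚ ℚ.< ∑ xs f
∑->0 (p ∷ ps) (here refl) pos = ℚ.+-mono-<-≤ pos (∑-≥0 ps)
∑->0 (p ∷ ps) (there y∈)  pos = ℚ.+-mono-≤-< p (∑->0 ps y∈ pos)

zλ-pos : ∀ μ → 1 ≤ zλ μ
zλ-pos μ = subst (λ xs → 1 ≤ foldr F 1 xs) (sym (from1≡ (csum μ))) (go (csum μ) suc (λ _ → s≤s z≤n))
  where
  F : ℕ → ℕ → ℕ
  F r acc = (r ℕ.^ count r μ) * (count r μ !) * acc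
  ^-pos : ∀ r c → 1 ≤ r → 1 ≤ r ℕ.^ c
  ^-pos r zero    p = ℕ.≤-refl
  ^-pos r (suc c) p = ℕ.*-mono-≤ p (^-pos r c p)
  go : ∀ N (h : ℕ → ℕ) → (∀ i → 1 ≤ h i) → 1 ≤ foldr F 1 (applyUpTo h N)
  go zero    h p = ℕ.≤-refl
  go (suc N) h p = ℕ.*-mono-≤ (ℕ.*-mono-≤ (^-pos (h 0) (count (h 0) μ) (p 0)) (ℕ.1≤n! (count (h 0) μ))) (go N (h ∘ suc) (p ∘ suc))

Sorted : ℕ → List ℕ → Set
Sorted M []      = ⊤
Sorted M (k ∷ μ) = 1 ≤ k × k ≤ M × Sorted k μ

partsF-∈ : ∀ f M μ → Sorted M μ → csum μ ≤ f → μ ∈ partsF f (csum μ) M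
partsF-∈ f       M []          _               _        = here refl
partsF-∈ (suc f) M (suc i ∷ μ) (1≤k , k≤M , s) (s≤s le) =
  ∈-concatMap (λ k → map (k ∷_) (partsF f (suc (i + csum μ) ∸ k) k))
    (Mem.∈-filter⁺ (λ k → Bool.T? ((k ≤ᵇ M) ∧ (k ≤ᵇ suc (i + csum μ)))) (Mem.∈-map⁺ suc (Mem.∈-applyUpTo⁺ id (s≤s (ℕ.m≤m+n i (csum μ)))))
      (∧-T (T⇒≡true (ℕ.≤⇒≤ᵇ k≤M)) (T⇒≡true (ℕ.≤⇒≤ᵇ (s≤s (ℕ.m≤m+n i (csum μ)))))))
    (Mem.∈-map⁺ (suc i ∷_) (subst (λ z → μ ∈ partsF f z (suc i)) (sym (ℕ.m+n∸m≡n i (csum μ)))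
      (partsF-∈ f (suc i) μ s (ℕ.≤-trans (ℕ.m≤n+m (csum μ) i) le))))

ones-sorted : ∀ M k → 1 ≤ M → Sorted M (replicate k 1)
ones-sorted M zero    p = tt
ones-sorted M (suc k) p = ℕ.≤-refl , p , ones-sorted 1 k ℕ.≤-refl

ℓo-odd : ∀ x μ → isOdd x ≡ true → ℓo (x ∷ μ) ≡ suc (ℓo μ)
ℓo-odd x μ e rewrite mod2≡ᵇ1 x | e = refl

ℓo-even : ∀ x μ → isOdd x ≡ false → ℓo (x ∷ μ) ≡ ℓo μ
ℓo-even x μ e rewrite mod2≡ᵇ1 x | e = refl

ℓe-odd : ∀ x μ → isOdd x ≡ true → ℓe (x ∷ μ) ≡ ℓe μ
ℓe-odd x μ e rewrite mod2≡ᵇ0 x | e = refl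

ℓe-even : ∀ x μ → isOdd x ≡ false → ℓe (x ∷ μ) ≡ suc (ℓe μ)
ℓe-even x μ e rewrite mod2≡ᵇ0 x | e = refl

ℓo-ones : ∀ k → ℓo (replicate k 1) ≡ k
ℓo-ones zero    = refl
ℓo-ones (suc k) = cong suc (ℓo-ones k)

ℓe-ones : ∀ k → ℓe (replicate k 1) ≡ 0
ℓe-ones zero    = refl
ℓe-ones (suc k) = ℓe-ones k

record Witness (n k : ℕ) (t : Tag) : Set where
  constructor witness
  field
    part   : List ℕ
    sorted : Sorted n part
    sum≡   : csum part ≡ n
    odds   : ℓo part ≡ k
    evens  : condE t (ℓe part) ≡ true

parity-diff : ∀ k n → k ≤ n → k % 2 ≡ n % 2 → Σ ℕ λ e → n ≡ double e + k
parity-diff k n k≤n eq with half-split (n ∸ k)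
... | inj₁ e = half (n ∸ k) , trans (sym (ℕ.m∸n+n≡m k≤n)) (cong (_+ k) e)
... | inj₂ e = ⊥-elim (Bool.not-¬ {isOdd k} refl (trans (mod2-isOdd k n eq) (trans (cong isOdd (trans (sym (ℕ.m∸n+n≡m k≤n)) (cong (_+ k) e))) (cong not (even (half (n ∸ k)))))))
  where
  even : ∀ c → isOdd (double c + k) ≡ isOdd k
  even zero    = refl
  even (suc c) = trans (Bool.not-involutive _) (even c)

-- The partition (n - k + 1, 1^{k-1}): the even excess n - k is put on one of k parts equal to 1,
-- which stays odd.
odd-witness : ∀ n k t → 1 ≤ k → k ≤ n → k % 2 ≡ n % 2 → condE t 0 ≡ true → Witness n k t
odd-witness n (suc k) t _ k≤n eq c with parity-diff (suc k) n k≤n eq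
... | e , refl = witness (suc (double e) ∷ replicate k 1) (s≤s z≤n , ℕ.≤-trans (s≤s (ℕ.m≤m+n (double e) k)) (ℕ.≤-reflexive (sym (ℕ.+-suc (double e) k))) , ones-sorted (suc (double e)) k (s≤s z≤n))
  (trans (cong (suc (double e) +_) (csum-ones k)) (sym (ℕ.+-suc (double e) k)))
  (trans (ℓo-odd (suc (double e)) (replicate k 1) (cong not (isOdd-double e))) (cong suc (ℓo-ones k)))
  (trans (cong (condE t) (trans (ℓe-odd (suc (double e)) (replicate k 1) (cong not (isOdd-double e))) (ℓe-ones k))) c)

-- The partition (n - k, 1^k), with the whole even excess as its only even part.
even-witness : ∀ n k t e → n ≡ double (suc e) + k → condE t 1 ≡ true → Witness n k t
even-witness n k t e refl c = witness (double (suc e) ∷ replicate k 1) (s≤s z≤n , ℕ.m≤m+n (double (suc e)) k , ones-sorted (double (suc e)) k (s≤s z≤n))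
  (cong (double (suc e) +_) (csum-ones k))
  (trans (ℓo-even (double (suc e)) (replicate k 1) (isOdd-double (suc e))) (ℓo-ones k))
  (trans (cong (condE t) (trans (ℓe-even (double (suc e)) (replicate k 1) (isOdd-double (suc e))) (cong suc (ℓe-ones k)))) c)

even₁-witness : ∀ n k t → k + 2 ≤ n → k % 2 ≡ n % 2 → condE t 1 ≡ true → Witness n k t
even₁-witness n k t le eq c with parity-diff k n (ℕ.≤-trans (ℕ.m≤m+n k 2) le) eq
... | zero  , e = ⊥-elim (ℕ.m+1+n≰m k (subst (k + 2 ≤_) e le))
... | suc d , e = even-witness n k t d e c

-- The partition (n - k - 2, 2, 1^k); an excess of at least 4 allows two even parts.
even₂-witness : ∀ n k → k + 4 ≤ n → k % 2 ≡ n % 2 → Witness n k tB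
even₂-witness n k le eq with parity-diff k n (ℕ.≤-trans (ℕ.m≤m+n k 4) le) eq
... | zero  , e = ⊥-elim (ℕ.m+1+n≰m k (subst (k + 4 ≤_) e le))
... | suc zero , e = ⊥-elim (ℕ.<-irrefl refl (ℕ.≤-trans (ℕ.m≤m+n (3 + k) 1) (ℕ.≤-trans (ℕ.≤-reflexive (trans (ℕ.+-comm (3 + k) 1) (ℕ.+-comm 4 k))) (subst (k + 4 ≤_) e le))))
... | suc (suc d) , refl = witness (double (suc d) ∷ 2 ∷ replicate k 1)
  (s≤s z≤n , ℕ.≤-trans (ℕ.n≤1+n _) (ℕ.≤-trans (ℕ.n≤1+n _) (ℕ.m≤m+n (double (suc (suc d))) k)) , s≤s z≤n , s≤s (s≤s z≤n) , ones-sorted 2 k (s≤s z≤n))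
  (trans (cong (λ z → double (suc d) + (2 + z)) (csum-ones k)) (trans (sym (ℕ.+-assoc (double (suc d)) 2 k)) (cong (_+ k) (ℕ.+-comm (double (suc d)) 2))))
  (trans (ℓo-even (double (suc d)) (2 ∷ replicate k 1) (isOdd-double (suc d))) (ℓo-ones k))
  (cong (condE tB) (trans (ℓe-even (double (suc d)) (2 ∷ replicate k 1) (isOdd-double (suc d))) (cong (suc ∘ suc) (ℓe-ones k))))

any-witness : ∀ n k → k ≤ n → k % 2 ≡ n % 2 → 1 ≤ n → Witness n k tE
any-witness n k k≤n eq 1≤n with parity-diff k n k≤n eq
... | zero  , refl = witness (replicate k 1) (ones-sorted k k 1≤n) (csum-ones k) (ℓo-ones k) refl
... | suc d , e    = even-witness n k tE d e refl

module AtIdentity (n′ : ℕ) where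
  n : ℕ
  n = suc n′
  open Images n
  open Partitions n

  zeroV : ∀ k → Vec ℕ k
  zeroV k = Vec.replicate k 0

  v₀ : ℕ → Vec ℕ n
  v₀ d = d ∷ zeroV n′

  vsum-zero : ∀ k → vsum (zeroV k) ≡ 0
  vsum-zero zero    = refl
  vsum-zero (suc k) = vsum-zero k

  nonzeros-zero : ∀ k → nonzeros (zeroV k) ≡ 0
  nonzeros-zero zero    = refl
  nonzeros-zero (suc k) = nonzeros-zero k

  deg-v₀ : ∀ d → vsum (v₀ d) ≡ d
  deg-v₀ d = trans (cong (d +_) (vsum-zero n′)) (ℕ.+-identityʳ d)

  ΔV-zero : ∀ k G → ΔV (zeroV k) G ≡ G (zeroV k) (zeroV k)
  ΔV-zero zero    G = ⊕0 (G [] [])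
  ΔV-zero (suc k) G = trans (ΔV-∷ 0 (zeroV k) G) (trans (⊕0 (ΔV (zeroV k) (λ u w → G (0 ∷ u) (0 ∷ w)))) (ΔV-zero k (λ u w → G (0 ∷ u) (0 ∷ w))))

  ⋆-v₀ : ∀ f g d → (f ⋆ g) (v₀ d) ≡ Δℕ d (λ b c → f (v₀ b) ⊗ g (v₀ c))
  ⋆-v₀ f g d = trans (ΔV-∷ d (zeroV n′) (λ u w → f u ⊗ g w)) (Δℕ-cong d (λ b c → ΔV-zero n′ (λ u w → f (b ∷ u) ⊗ g (c ∷ w))))

  ⋆-v₀-homog : ∀ {i} f g j → Homog i f → (f ⋆ g) (v₀ (i + j)) ≡ f (v₀ i) ⊗ g (v₀ j)
  ⋆-v₀-homog {i} f g j hf = trans (⋆-v₀ f g (i + j)) (Δℕ-single i j (λ b c → f (v₀ b) ⊗ g (v₀ c))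
    (λ b c b≢i → trans (cong (_⊗ g (v₀ c)) (hf (v₀ b) (λ e → b≢i (trans (sym (deg-v₀ b)) e)))) (0⊗ (g (v₀ c)))))

  ≡ᵇ-v₀ : ∀ d → (vsum (v₀ d) ≡ᵇ d) ≡ true
  ≡ᵇ-v₀ d = T⇒≡true (ℕ.≡⇒≡ᵇ (vsum (v₀ d)) d (deg-v₀ d))

  pk-v₀ : ∀ i → pk (suc i) (v₀ (suc i)) ≡ 1ℚ
  pk-v₀ i = cong₂ (λ b c → if b ∧ (suc c ≡ᵇ 1) then 1ℚ else 0ℚ) (≡ᵇ-v₀ (suc i)) (nonzeros-zero n′)

  pλ-v₀ : ∀ {M} μ → All (λ x → 1 ≤ x × x ≤ M) μ → pλ μ (v₀ (csum μ)) ≡ 1ℚ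
  pλ-v₀ []          _       = trans (pone≐one (v₀ 0)) (cong (λ z → 𝟙 (z ≡ᵇ 0)) (deg-v₀ 0))
  pλ-v₀ (zero ∷ μ)  ((() , _) ∷ _)
  pλ-v₀ (suc i ∷ μ) (_ ∷ p) = trans (pmul≐⋆ (pk (suc i)) (pλ μ) (v₀ (suc i + csum μ)))
    (trans (⋆-v₀-homog (pk (suc i)) (pλ μ) (csum μ) (homog-pk (suc i))) (cong₂ _⊗_ (pk-v₀ i) (pλ-v₀ μ p)))

  ΓR₁-v₀ : ∀ i → ΓR (i ∷ []) (v₀ i) ≡ 1ℚ
  ΓR₁-v₀ i = trans (ΓR-single i (v₀ i)) (cong (λ b → if b then 1ℚ else 0ℚ) (≡ᵇ-v₀ i))

  -- A ribbon Schur function with more than one row vanishes in a single variable. By the product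
  -- rule its value is that of the ribbon without first row minus that of the fused ribbon: both are
  -- 1 for single rows and both 0 otherwise.
  ΓR-v₀ : ∀ i j r → All (1 ≤_) (i ∷ j ∷ r) → ΓR (i ∷ j ∷ r) (v₀ (csum (i ∷ j ∷ r))) ≡ 0ℚ
  ΓR-v₀ (suc i) (suc j) r (pi ∷ pj ∷ pr) = begin
    ΓR (suc i ∷ suc j ∷ r) v
      ≡⟨ solve 2 (λ x y → x := (x :+ y) :+ :- y) refl (ΓR (suc i ∷ suc j ∷ r) v) (ΓR ((suc i + suc j) ∷ r) v) ⟩
    (ΓR (suc i ∷ suc j ∷ r) v ⊕ ΓR ((suc i + suc j) ∷ r) v) ⊕ ⊝ ΓR ((suc i + suc j) ∷ r) v
      ≡⟨ cong (_⊕ ⊝ ΓR ((suc i + suc j) ∷ r) v) (sym (ΓR-step i j r v)) ⟩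
    (ΓR (suc i ∷ []) ⋆ ΓR (suc j ∷ r)) v ⊕ ⊝ ΓR ((suc i + suc j) ∷ r) v
      ≡⟨ cong (_⊕ ⊝ ΓR ((suc i + suc j) ∷ r) v) (trans (⋆-v₀-homog (ΓR (suc i ∷ [])) (ΓR (suc j ∷ r)) (csum (suc j ∷ r)) hom)
           (trans (cong (_⊗ ΓR (suc j ∷ r) (v₀ (csum (suc j ∷ r)))) (ΓR₁-v₀ (suc i))) (1⊗ (ΓR (suc j ∷ r) (v₀ (csum (suc j ∷ r))))))) ⟩
    ΓR (suc j ∷ r) (v₀ (csum (suc j ∷ r))) ⊕ ⊝ ΓR ((suc i + suc j) ∷ r) v
      ≡⟨ rest r pr ⟩
    0ℚ ∎
    where
    v : Vec ℕ n
    v = v₀ (csum (suc i ∷ suc j ∷ r))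
    hom : Homog (suc i) (ΓR (suc i ∷ []))
    hom = ΓR-deg (suc i ∷ []) ((s≤s z≤n ∷ []) , ℕ.+-identityʳ (suc i))
    rest : ∀ r → All (1 ≤_) r → ΓR (suc j ∷ r) (v₀ (csum (suc j ∷ r))) ⊕ ⊝ ΓR ((suc i + suc j) ∷ r) (v₀ (csum (suc i ∷ suc j ∷ r))) ≡ 0ℚ
    rest []      _         = cong₂ (λ x y → x ⊕ ⊝ y) (trans (cong (λ z → ΓR (suc j ∷ []) (v₀ z)) (ℕ.+-identityʳ (suc j))) (ΓR₁-v₀ (suc j)))
      (trans (cong (λ z → ΓR ((suc i + suc j) ∷ []) (v₀ z)) (cong (suc i +_) (ℕ.+-identityʳ (suc j)))) (ΓR₁-v₀ (suc i + suc j)))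
    rest (k ∷ r) (pk ∷ pr) = cong₂ (λ x y → x ⊕ ⊝ y) (ΓR-v₀ (suc j) k r (pj ∷ pk ∷ pr))
      (trans (cong (λ z → ΓR ((suc i + suc j) ∷ k ∷ r) (v₀ z)) (sym (ℕ.+-assoc (suc i) (suc j) (csum (k ∷ r))))) (ΓR-v₀ (suc i + suc j) k r (s≤s z≤n ∷ pk ∷ pr)))

  shape-inc₁ : ∀ x w → Increasing (x ∷ w) → hasShape x (length w) [] w ≡ true
  shape-inc₁ x []      _                   = refl
  shape-inc₁ x (y ∷ w) ((x<y ∷ _) ∷ inc) = trans (cong (λ b → not b ∧ hasShape y (length w) [] w) (<ᵇ-false (ℕ.<⇒≤ x<y))) (shape-inc₁ y w inc)

  shape-inc₂ : ∀ x i j r w → Increasing (x ∷ w) → hasShape x i (j ∷ r) w ≡ false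
  shape-inc₂ x zero    j       r []      _                 = refl
  shape-inc₂ x zero    zero    r (y ∷ w) _                 = refl
  shape-inc₂ x zero    (suc j) r (y ∷ w) ((x<y ∷ _) ∷ inc) = cong (_∧ hasShape y j r w) (<ᵇ-false (ℕ.<⇒≤ x<y))
  shape-inc₂ x (suc i) j       r []      _                 = refl
  shape-inc₂ x (suc i) j       r (y ∷ w) ((x<y ∷ _) ∷ inc) = trans (cong (λ b → not b ∧ hasShape y i (j ∷ r) w) (<ᵇ-false (ℕ.<⇒≤ x<y))) (shape-inc₂ y i j r w inc)

  -- The identity occurs in R_I only for I = (n), and only then does x_1^n occur in the image of
  -- R_I. Hence the coefficient of the identity can be read off the image under Γ.
  ribbon-id : ∀ I w → Increasing w → length w ≡ n → Valid n I → 𝟙 (isRibbon I w) ≡ ΓR I (v₀ n)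
  ribbon-id (i ∷ [])        (x ∷ w) inc len (pi ∷ _ , s) = begin
    𝟙 (isRibbon (i ∷ []) (x ∷ w))                  ≡⟨ cong (λ z → 𝟙 (isRibbon (z ∷ []) (x ∷ w))) i≡ ⟩
    𝟙 (hasShape x (length w) [] w)                 ≡⟨ cong 𝟙 (shape-inc₁ x w inc) ⟩
    1ℚ                                             ≡⟨ sym (ΓR₁-v₀ n) ⟩
    ΓR (n ∷ []) (v₀ n)                             ≡⟨ cong (λ z → ΓR (z ∷ []) (v₀ n)) (sym (trans (sym (ℕ.+-identityʳ i)) s)) ⟩
    ΓR (i ∷ []) (v₀ n) ∎
    where
    i≡ : i ≡ suc (length w)
    i≡ = trans (sym (ℕ.+-identityʳ i)) (trans s (sym len))
  ribbon-id (suc i ∷ j ∷ r) (x ∷ w) inc len (pI , s) = trans (cong 𝟙 (shape-inc₂ x i j r w inc)) (sym (trans (cong (λ z → ΓR (suc i ∷ j ∷ r) (v₀ z)) (sym s)) (ΓR-v₀ (suc i) j r pI)))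
  ribbon-id (zero ∷ j ∷ r)  (x ∷ w) inc len (() ∷ _ , s)

  -- At x_1^n every p_λ with λ a partition of n is 1, so the coefficient is a sum of 1/z_λ over the
  -- partitions allowed by the tag; the witness shows that the sum is not empty.
  nonzero : ∀ t k → k ≤ n → Witness n k t → fun (t , k) (from1 n) ≢ 0ℚ
  nonzero t k k≤n (witness μ so su od ev′) eq = ℚ.<-irrefl (sym (trans (sym value) eq)) positive
    where
    value : fun (t , k) (from1 n) ≡ ∑ (partitions n) (λ μ → 𝟙 ((ℓo μ ≡ᵇ k) ∧ condE t (ℓe μ)) ⊗ term μ (v₀ n))
    value = begin
      fun (t , k) (from1 n)
        ≡⟨ trans (sym (ev-fun t k (from1 n))) (cong (λ d → NC.ev (elF t d k) (from1 n)) (from1-length n)) ⟩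
      NC.ev (elF t n k) (from1 n)
        ≡⟨ ∑-cong-All (All.map (λ {cI} vI → cong (proj₁ cI ⊗_) (ribbon-id (proj₂ cI) (from1 n) (from1-inc n) (from1-length n) vI)) (valid-elF t n k)) ⟩
      PI.ev (elF t n k) (v₀ n)
        ≡⟨ trans (cong (λ d → PI.ev (elF t d k) (v₀ n)) (sym (deg-v₀ n))) (ev-image t k (v₀ n) (subst (k ≤_) (sym (deg-v₀ n)) k≤n)) ⟩
      ∑ (partitions (vsum (v₀ n))) (λ μ → 𝟙 ((ℓo μ ≡ᵇ k) ∧ condE t (ℓe μ)) ⊗ term μ (v₀ n))
        ≡⟨ cong (λ d → ∑ (partitions d) (λ μ → 𝟙 ((ℓo μ ≡ᵇ k) ∧ condE t (ℓe μ)) ⊗ term μ (v₀ n))) (deg-v₀ n) ⟩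
      ∑ (partitions n) (λ μ → 𝟙 ((ℓo μ ≡ᵇ k) ∧ condE t (ℓe μ)) ⊗ term μ (v₀ n)) ∎
    term-v₀ : ∀ μ → IsPart n n μ → term μ (v₀ n) ≡ recip (zλ μ)
    term-v₀ μ (p , s) = trans (cong (recip (zλ μ) ⊗_) (trans (cong (λ d → pλ μ (v₀ d)) (sym s)) (pλ-v₀ μ p))) (⊗1 (recip (zλ μ)))
    nonneg : ∀ b x → 0ℚ ℚ.≤ x → 0ℚ ℚ.≤ 𝟙 b ⊗ x
    nonneg true  x p = subst (0ℚ ℚ.≤_) (sym (1⊗ x)) p
    nonneg false x p = ℚ.≤-reflexive (sym (0⊗ x))
    μ∈ : μ ∈ partitions n
    μ∈ = subst (λ d → μ ∈ partsF n d n) su (partsF-∈ n n μ so (ℕ.≤-reflexive su))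
    cond-μ : ((ℓo μ ≡ᵇ k) ∧ condE t (ℓe μ)) ≡ true
    cond-μ = cong₂ _∧_ (T⇒≡true (ℕ.≡⇒≡ᵇ (ℓo μ) k od)) ev′
    positive : 0ℚ ℚ.< ∑ (partitions n) (λ μ → 𝟙 ((ℓo μ ≡ᵇ k) ∧ condE t (ℓe μ)) ⊗ term μ (v₀ n))
    positive = ∑->0 {y = μ} (All.map (λ {μ} ip → nonneg ((ℓo μ ≡ᵇ k) ∧ condE t (ℓe μ)) (term μ (v₀ n)) (subst (0ℚ ℚ.≤_) (sym (term-v₀ μ ip)) (recip-≥0 (zλ μ)))) (partsF-IsPart n n n))
      μ∈ (subst (0ℚ ℚ.<_) (sym (trans (cong₂ (λ b x → 𝟙 b ⊗ x) cond-μ (term-v₀ μ (All.lookup (partsF-IsPart n n n) μ∈))) (1⊗ (recip (zλ μ))))) (recip->0 (zλ μ) (zλ-pos μ)))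

-- Assembly of bases and images for the five algebras.

fam-tag : ∀ n t ks → fam n (elF t) ks ≡ map (elt n) (map (t ,_) ks)
fam-tag n t ks = L.map-∘ ks

fam-tag² : ∀ n t u ks ls → fam n (elF t) ks ++ fam n (elF u) ls ≡ map (elt n) (map (t ,_) ks ++ map (u ,_) ls)
fam-tag² n t u ks ls = trans (cong₂ _++_ (fam-tag n t ks) (fam-tag n u ls)) (sym (L.map-++ (elt n) (map (t ,_) ks) (map (u ,_) ls)))

theorem5p3 : (n : ℕ) → 2 ≤ n →
    ( OrthIdemBasis (gensW n) (fam n eA (rngK n) ++ᴸ fam n eB (rngUpTo 4 n))
    × (∀ k → 1 ≤ k → k ≤ n → k % 2 ≡ n % 2 →
    Γ n (eA n k) ≈P target n (λ λs → (ℓo λs ≡ᵇ k) ∧ (ℓe λs ≡ᵇ 0)))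
    × (∀ l → l + 4 ≤ n → l % 2 ≡ n % 2 →
    Γ n (eB n l) ≈P target n (λ λs → (ℓo λs ≡ᵇ l) ∧ (0 <ᵇ ℓe λs) ∧ (ℓe λs % 2 ≡ᵇ 0))) )
    ×
    ( OrthIdemBasis (gensWc n) (fam n (λ n k → Ip k n) (rngK n) ++ᴸ fam n eD (rngUpTo 2 n))
    × (∀ k → 1 ≤ k → k ≤ n → k % 2 ≡ n % 2 →
    Γ n (Ip k n) ≈P target n (λ λs → (ℓo λs ≡ᵇ k) ∧ (ℓe λs ≡ᵇ 0)))
    × (∀ l → l + 2 ≤ n → l % 2 ≡ n % 2 →
    Γ n (eD n l) ≈P target n (λ λs → (ℓo λs ≡ᵇ l) ∧ (0 <ᵇ ℓe λs))) )
    ×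
    ( OrthIdemBasis (gensC n)
    (fam n eA (rngK n) ++ᴸ fam n eB (rngUpTo 4 n) ++ᴸ fam n eC (rngUpTo 2 n))
    × (∀ k → 1 ≤ k → k ≤ n → k % 2 ≡ n % 2 →
    Γ n (eA n k) ≈P target n (λ λs → (ℓo λs ≡ᵇ k) ∧ (ℓe λs ≡ᵇ 0)))
    × (∀ l → l + 4 ≤ n → l % 2 ≡ n % 2 →
    Γ n (eB n l) ≈P target n (λ λs → (ℓo λs ≡ᵇ l) ∧ (0 <ᵇ ℓe λs) ∧ (ℓe λs % 2 ≡ᵇ 0)))
    × (∀ m → m + 2 ≤ n → m % 2 ≡ n % 2 →
    Γ n (eC n m) ≈P target n (λ λs → (ℓo λs ≡ᵇ m) ∧ (0 <ᵇ ℓe λs) ∧ (ℓe λs % 2 ≡ᵇ 1))) )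
    ×
    ( OrthIdemBasis (gensP n) (fam n (λ n k → Im k n) (rngK n))
    × (∀ k → 1 ≤ k → k ≤ n → k % 2 ≡ n % 2 →
    Γ n (Im k n) ≈P target n (λ λs → (ℓo λs ≡ᵇ k) ∧ (ℓe λs ≡ᵇ 0))) )
    ×
    ( OrthIdemBasis (gensPc n) (fam n eE (rngUpTo 0 n))
    × (∀ k → k ≤ n → k % 2 ≡ n % 2 →
    Γ n (eE n k) ≈P target n (λ λs → ℓo λs ≡ᵇ k)) )
-- The successor form provides the variable x_1 at which the coefficient of the identity is
-- computed.
theorem5p3 n@(suc n′) 2≤n =
    ( subst (OrthIdemBasis (gensW n)) (sym (fam-tag² n tA tB (rngK n) (rngUpTo 4 n))) (basis-W (All.++⁺ nzA nzB))
    , imageA , imageB )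
  , ( subst (OrthIdemBasis (gensWc n)) (sym (fam-tag² n tP tD (rngK n) (rngUpTo 2 n))) (basis-Wc (All.++⁺ (nzK tP refl) (nz2 tD refl)))
    , (λ k _ k≤n _ → Γ-image tP k (λ μ → (ℓo μ ≡ᵇ k) ∧ (ℓe μ ≡ᵇ 0)) k≤n (λ _ → refl))
    , (λ l le _ → Γ-image tD l (λ μ → (ℓo μ ≡ᵇ l) ∧ (0 <ᵇ ℓe μ)) (below-≤ l 2 le) (λ _ → refl)) )
  , ( subst (OrthIdemBasis (gensC n)) (sym (trans (cong₂ _++_ (fam-tag n tA (rngK n)) (fam-tag² n tB tC (rngUpTo 4 n) (rngUpTo 2 n)))
        (sym (L.map-++ (elt n) (map (tA ,_) (rngK n)) (map (tB ,_) (rngUpTo 4 n) ++ map (tC ,_) (rngUpTo 2 n))))))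
        (basis-C (All.++⁺ nzA (All.++⁺ nzB (nz2 tC refl))))
    , imageA , imageB
    , (λ l le _ → Γ-image tC l (λ μ → (ℓo μ ≡ᵇ l) ∧ (0 <ᵇ ℓe μ) ∧ (ℓe μ % 2 ≡ᵇ 1)) (below-≤ l 2 le) (λ _ → refl)) )
  , ( subst (OrthIdemBasis (gensP n)) (sym (fam-tag n tM (rngK n))) (basis-P (nzK tM refl))
    , (λ k _ k≤n _ → Γ-image tM k (λ μ → (ℓo μ ≡ᵇ k) ∧ (ℓe μ ≡ᵇ 0)) k≤n (λ _ → refl)) )
  , ( subst (OrthIdemBasis (gensPc n)) (sym (fam-tag n tE (rngUpTo 0 n))) (basis-Pc nzE)
    , (λ k k≤n _ → Γ-image tE k (λ μ → ℓo μ ≡ᵇ k) k≤n (λ μ → sym (Bool.∧-identityʳ (ℓo μ ≡ᵇ k)))) )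
  where
  open Bases n 2≤n
  open Images n
  open AtIdentity n′ hiding (n)
  below-≤ : ∀ l d → l + d ≤ n → l ≤ n
  below-≤ l d le = ℕ.≤-trans (ℕ.m≤m+n l d) le
  imageA : ∀ k → 1 ≤ k → k ≤ n → k % 2 ≡ n % 2 → Γ n (eA n k) ≈P target n (λ μ → (ℓo μ ≡ᵇ k) ∧ (ℓe μ ≡ᵇ 0))
  imageA k _ k≤n _ = Γ-image tA k (λ μ → (ℓo μ ≡ᵇ k) ∧ (ℓe μ ≡ᵇ 0)) k≤n (λ _ → refl)
  imageB : ∀ l → l + 4 ≤ n → l % 2 ≡ n % 2 → Γ n (eB n l) ≈P target n (λ μ → (ℓo μ ≡ᵇ l) ∧ (0 <ᵇ ℓe μ) ∧ (ℓe μ % 2 ≡ᵇ 0))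
  imageB l le _ = Γ-image tB l (λ μ → (ℓo μ ≡ᵇ l) ∧ (0 <ᵇ ℓe μ) ∧ (ℓe μ % 2 ≡ᵇ 0)) (below-≤ l 4 le) (λ _ → refl)
  nzK : ∀ t → condE t 0 ≡ true → NonZeroAt (map (t ,_) (rngK n))
  nzK t c = All.map⁺ (All.map (λ {k} (1≤k , k≤n , par≡) → nonzero t k k≤n (odd-witness n k t 1≤k k≤n par≡ c)) (rngK-All n))
  nz2 : ∀ t → condE t 1 ≡ true → NonZeroAt (map (t ,_) (rngUpTo 2 n))
  nz2 t c = All.map⁺ (All.map (λ {l} (le , par≡) → nonzero t l (below-≤ l 2 le) (even₁-witness n l t le par≡ c)) (rngUpTo-All 2 n))
  nzA : NonZeroAt (map (tA ,_) (rngK n))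
  nzA = nzK tA refl
  nzB : NonZeroAt (map (tB ,_) (rngUpTo 4 n))
  nzB = All.map⁺ (All.map (λ {l} (le , par≡) → nonzero tB l (below-≤ l 4 le) (even₂-witness n l le par≡)) (rngUpTo-All 4 n))
  nzE : NonZeroAt (map (tE ,_) (rngUpTo 0 n))
  nzE = All.map⁺ (All.map (λ {k} (le , par≡) → nonzero tE k (below-≤ k 0 le) (any-witness n k (below-≤ k 0 le) par≡ (s≤s z≤n))) (rngUpTo-All 0 n))
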